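{- Let $U\subseteq\mathbb{R}$ be an open interval and let $f:U\to\mathbb{R}$ be real-analytic. If $$f(\mathscr{L}\cap U)\subseteq\mathscr{L},$$ where $\mathscr{L}$ is the set of Liouville numbers, then there exists a rational function $R\in\mathbb{R}(x)$, with no pole in $U$, such that $f(x)=R(x)$ for every $x\in U$.
   Context: A real number $\xi$ is a Liouville number if for every integer $N\ge 1$ there exist infinitely many pairs $(p,q)\in\mathbb{Z}\times\mathbb{Z}_{>0}$ with $q\ge 2$ such that $0<|\xi-p/q|<q^{ -N}$. The set of Liouville numbers is denoted $\mathscr{L}$. -}

module Defs where

open import Level using (0ℓ; suc)
open import Algebra.Bundles using (CommutativeRing)
open import Data.Integer.Base using (ℤ; +_; -[1+_])
open import Data.List.Base using (List; []; _∷_; map; foldr)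
open import Data.List.Membership.Propositional using (_∈_)
open import Data.Nat.Base as ℕ using (ℕ)
open import Data.Fin.Base using (toℕ)
open import Data.Product.Base using (Σ; ∃; _×_; _,_; proj₁)
open import Function.Bundles using (Func)
open import Relation.Binary.Bundles using (Setoid)
open import Relation.Binary.Core using (Rel)
open import Relation.Binary.Definitions using (tri<; tri≈; tri>)
open import Relation.Binary.Structures using (IsStrictTotalOrder)
open import Relation.Nullary using (¬_)
open import Relation.Nullary.Construct.Add.Extrema using (_±; [_])
open import Relation.Unary using (Pred; _⊆_)
import Algebra.Properties.Semiring.Exp
import Algebra.Properties.Semiring.Mult
import Algebra.Properties.Semiring.Sum
import Relation.Binary.Construct.Add.Extrema.Strict
import Relation.Binary.Construct.On as On
import Relation.Binary.Construct.StrictToNonStrict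

Finite : {A : Set} → Pred A 0ℓ → Set
Finite {A} P = Σ (List A) λ xs → P ⊆ (_∈ xs)

Infinite : {A : Set} → Pred A 0ℓ → Set
Infinite P = ¬ Finite P

-- The real numbers are, up to unique isomorphism, the complete ordered field,
-- and that is how they are specified here.
-- The inverse is a total function; its value at 0# is unconstrained.
record CompleteOrderedField : Set (suc 0ℓ) where
  field
    commutativeRing : CommutativeRing 0ℓ 0ℓ

  open CommutativeRing commutativeRing public

  infix  4 _<_
  infix  8 _⁻¹

  field
    _<_                : Rel Carrier 0ℓ
    isStrictTotalOrder : IsStrictTotalOrder _≈_ _<_
    _⁻¹                : Carrier → Carrier

  open IsStrictTotalOrder isStrictTotalOrder public using (compare)
  open Relation.Binary.Construct.StrictToNonStrict _≈_ _<_ public using (_≤_)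

  UpperBound : Pred Carrier 0ℓ → Pred Carrier 0ℓ
  UpperBound P u = ∀ x → P x → x ≤ u

  field
    1≉0         : 1# ≉ 0#
    ⁻¹-cong     : ∀ {x y} → x ≈ y → x ⁻¹ ≈ y ⁻¹
    ⁻¹-inverseʳ : ∀ x → x ≉ 0# → x * x ⁻¹ ≈ 1#
    +-monoʳ-<   : ∀ x {y z} → y < z → x + y < x + z
    *-pos       : ∀ {x y} → 0# < x → 0# < y → 0# < x * y
    complete    : (P : Pred Carrier 0ℓ) → ∃ P → ∃ (UpperBound P) →
                  ∃ λ s → UpperBound P s × (∀ u → UpperBound P u → s ≤ u)

module RealAnalysis (ℝ : CompleteOrderedField) where

  open CompleteOrderedField ℝ
  open Algebra.Properties.Semiring.Exp semiring public using (_^_)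
  open Algebra.Properties.Semiring.Mult semiring public using () renaming (_×_ to _·_)
  open Algebra.Properties.Semiring.Sum semiring public using (sum)
  open Relation.Binary.Construct.Add.Extrema.Strict _<_ public using (_<±_)

  ∣_∣ : Carrier → Carrier
  ∣ x ∣ with compare x 0#
  ... | tri< _ _ _ = - x
  ... | tri≈ _ _ _ = x
  ... | tri> _ _ _ = x

  fromℕ : ℕ → Carrier
  fromℕ n = n · 1#

  fromℤ : ℤ → Carrier
  fromℤ (+ n)    = fromℕ n
  fromℤ -[1+ n ] = - fromℕ (ℕ.suc n)

  -- The denominators range over ℕ; the condition 2 ≤ q makes them positive.
  Approximates : Carrier → ℕ → Pred (ℤ × ℕ) 0ℓ
  Approximates ξ N (p , q) =
    2 ℕ.≤ q × 0# < distance × distance < (fromℕ q ^ N) ⁻¹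
    where
    distance : Carrier
    distance = ∣ ξ - fromℤ p * fromℕ q ⁻¹ ∣

  Liouville : Pred Carrier 0ℓ
  Liouville ξ = ∀ N → 1 ℕ.≤ N → Infinite (Approximates ξ N)

  -- Endpoints lie in ℝ ∪ {-∞, +∞}, so half-lines and ℝ itself are included.
  record OpenInterval : Set where
    constructor ⟨_,_⟩
    field
      lower upper : Carrier ±

  infix 4 _∈ᴵ_
  _∈ᴵ_ : Carrier → OpenInterval → Set
  x ∈ᴵ ⟨ a , b ⟩ = a <± [ x ] × [ x ] <± b

  Points : OpenInterval → Setoid 0ℓ 0ℓ
  Points U = On.setoid {B = Σ Carrier (_∈ᴵ U)} setoid proj₁

  _⟶ℝ : OpenInterval → Set
  U ⟶ℝ = Func (Points U) setoid

  ConvergesTo : (ℕ → Carrier) → Carrier → Set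
  ConvergesTo s l =
    ∀ ε → 0# < ε → ∃ λ N → ∀ n → N ℕ.≤ n → ∣ s n - l ∣ < ε

  powerSeries : (ℕ → Carrier) → Carrier → ℕ → Carrier
  powerSeries a h n = sum {n} λ i → a (toℕ i) * h ^ toℕ i

  Analytic : ∀ {U} → U ⟶ℝ → Set
  Analytic {U} f =
    ∀ c → c ∈ᴵ U →
    Σ (ℕ → Carrier) λ a → ∃ λ r → 0# < r ×
    (∀ x (x∈U : x ∈ᴵ U) → ∣ x - c ∣ < r →
     ConvergesTo (powerSeries a (x - c)) (Func.to f (x , x∈U)))

  -- Coefficient lists, constant term first; trailing zeros are allowed.
  Polynomial : Set
  Polynomial = List Carrier

  coeff : Polynomial → ℕ → Carrier
  coeff []      _         = 0#
  coeff (a ∷ _) ℕ.zero    = a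
  coeff (_ ∷ p) (ℕ.suc n) = coeff p n

  infix  4 _≈ᴾ_
  infixl 6 _+ᴾ_
  infixl 7 _*ᴾ_

  _≈ᴾ_ : Rel Polynomial 0ℓ
  p ≈ᴾ q = ∀ n → coeff p n ≈ coeff q n

  _+ᴾ_ : Polynomial → Polynomial → Polynomial
  []      +ᴾ q       = q
  (a ∷ p) +ᴾ []      = a ∷ p
  (a ∷ p) +ᴾ (b ∷ q) = a + b ∷ p +ᴾ q

  _*ᴾ_ : Polynomial → Polynomial → Polynomial
  []      *ᴾ q = []
  (a ∷ p) *ᴾ q = map (a *_) q +ᴾ (0# ∷ p *ᴾ q)

  eval : Polynomial → Carrier → Carrier
  eval p x = foldr (λ a y → a + x * y) 0# p

  -- The field ℝ(x) is the setoid of these fractions under _≃_.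
  record RationalFunction : Set where
    field
      num den : Polynomial
      den≉0   : ¬ den ≈ᴾ []

  open RationalFunction

  infix 4 _≃_
  _≃_ : Rel RationalFunction 0ℓ
  R ≃ S = num R *ᴾ den S ≈ᴾ num S *ᴾ den R

  -- Fractions need not be in lowest terms, so poles and values are defined
  -- through all fractions representing R: x/x has no pole at 0 and value 1.
  PoleAt : RationalFunction → Carrier → Set
  PoleAt R x = ∀ S → S ≃ R → eval (den S) x ≈ 0#

  infix 4 _⟨_⟩≈_
  _⟨_⟩≈_ : RationalFunction → Carrier → Carrier → Set
  R ⟨ x ⟩≈ y = ∃ λ S → S ≃ R × eval (den S) x ≉ 0# ×
               y ≈ eval (num S) x * eval (den S) x ⁻¹

{-# OPTIONS --safe #-}
module Submission where

-- Suppose f is not rational on any subinterval.  We build nested intervals whose limit ξ is a Liouville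
-- number while |f(ξ) - a/b| ≥ b⁻⁴¹ for all large b.  The only obstruction is that every rational p/q in an
-- interval might have f(p/q) within b⁻⁴⁰ of some a/b with b at most a fixed power of q.  Split these b into
-- dyadic classes [X, X²) and look at a window of boundedly many points p/q, (p+1)/q, …: some class serves
-- many of them.  Siegel's lemma then gives polynomials P, Q with small integer coefficients such that
-- Q(u) a = P(u) b at those points, so that Q f - P nearly vanishes to an order exceeding the number of its
-- coefficients.  This contradicts the nonsingularity of the Hankel-type matrix (c_{k-i}) of Taylor
-- coefficients of f near the window.  That matrix is singular on a whole interval only if f is rational
-- there: the Padé approximants P_s/Q_s at nearby centres s differ by O(|s - s'|²), so they are constant in s.

open import Defs
open import Algebra.Bundles using (CommutativeRing)
import Algebra.Properties.Ring
import Algebra.Properties.Semiring.Exp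
import Algebra.Properties.Semiring.Mult
import Algebra.Properties.Semiring.Mult.TCOptimised
import Algebra.Solver.Ring
import Algebra.Solver.Ring.AlmostCommutativeRing as ACR
open import Axiom.ExcludedMiddle using (ExcludedMiddle)
open import Data.Empty using (⊥; ⊥-elim)
open import Data.Fin.Base as Fin using (Fin)
import Data.Fin.Properties as Finₚ
open import Data.Integer.Base as ℤ using (ℤ; +_; -[1+_]; _⊖_)
open import Data.Integer.Base using (+_; ℤ; -[1+_])
import Data.Integer.Properties as ℤₚ
open import Data.List.Base using (List; []; _∷_; length; map; take; _++_; upTo; cartesianProduct)
open import Data.List.Membership.Propositional using (_∈_)
open import Data.List.Membership.Propositional.Properties using (∈-map⁺; ∈-++⁺ˡ; ∈-++⁺ʳ; ∈-upTo⁺; ∈-cartesianProduct⁺)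
import Data.List.Properties as Listₚ
open import Data.List.Relation.Unary.All as All using (All; []; _∷_)
import Data.List.Relation.Unary.All.Properties as Allₚ
open import Data.List.Relation.Unary.AllPairs using (AllPairs; []; _∷_)
import Data.List.Relation.Unary.AllPairs.Properties as AllPairsₚ
open import Data.List.Relation.Unary.Any using (here; there)
open import Data.Maybe.Base using (Maybe; just; nothing)
open import Data.Nat.Base as ℕ using (ℕ; zero; suc)
open import Data.Nat.DivMod using (_/_; _%_; m%n<n; m≡m%n+[m/n]*n; m<n*o⇒m/o<n; [m+kn]%n≡m%n; m<n⇒m%n≡m)
import Data.Nat.Properties as ℕₚ
open import Data.Nat.Solver using (module +-*-Solver)
open import Data.Product.Base using (Σ; ∃; _×_; _,_; proj₁; proj₂)
import Data.Sign.Base as Sign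
open import Data.Sum.Base using (_⊎_; inj₁; inj₂; [_,_]′)
open import Function.Bundles using (Func)
open import Level using (0ℓ)
import Relation.Binary.Construct.Add.Extrema.Strict
import Relation.Binary.Construct.StrictToNonStrict as NonStrict
open import Relation.Binary.Definitions using (tri<; tri≈; tri>)
open import Relation.Binary.PropositionalEquality.Core as ≡ using (_≡_)
import Relation.Binary.Reasoning.Base.Triple as Triple
import Relation.Binary.Reasoning.Setoid as SetoidReasoning
open import Relation.Binary.Structures using (IsStrictTotalOrder; IsTotalOrder)
open import Relation.Nullary using (¬_; Dec; yes; no)
open import Relation.Nullary.Construct.Add.Extrema using ([_])

-- The constants are forced as follows. In the class `[X, X²)` with `X = Y ^ m`, neighbouring window
-- points differ by `h = Y⁻¹⁰`. `Q` has `m` coefficients below `X⁹`, so there are `X ^ (9 m)`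
-- candidates against `3 m + 1` residues of size `O(X²)`, and `9 m ≥ 2 (3 m + 1) + 1`. Since 10
-- exceeds 9, the Taylor error `X⁹ h ^ (1 - m) h ^ (2 m)` of `Q f` stays bounded. Recovering Taylor
-- coefficients up to index `3 m` costs `h ^ (- 3 m) = X³⁰`; an error `X⁻⁴⁰` multiplied by
-- `Q = O(X⁹)` still leaves `X⁻¹`, whence 40. One more power pays for the variation of `f` between
-- `p/q` and the points near it, whence 41. Fractions with denominators below `X²` are at least
-- `X⁻⁴` apart, so at most one of them disturbs a short interval, and a quarter of the interval
-- escapes it; this handles the large denominators without any window. The remaining obstacle is
-- uniformity: determinants and derivatives may vanish at isolated points. Taylor coefficients are
-- therefore treated as germs in the centre, bounded below by `c |s| ^ k`, and centres are chosen
-- off the bad point.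

-- Ring solver with integer coefficients.

module IntegerSolver (R : CommutativeRing 0ℓ 0ℓ) where

  open CommutativeRing R hiding (zero)
  open Algebra.Properties.Ring ring
  open Algebra.Properties.Semiring.Mult.TCOptimised semiring
    using (×-homo-+; ×1-homo-*; 1+×) renaming (_×_ to _·′_)
  open SetoidReasoning setoid

  -- The optimised multiple makes `num 1` reduce to `1#`, so that `:0` and `:1` denote `0#` and `1#`
  -- definitionally.
  num : ℕ → Carrier
  num n = n ·′ 1#

  ⟦_⟧ℤ : ℤ → Carrier
  ⟦ + n ⟧ℤ      = num n
  ⟦ -[1+ n ] ⟧ℤ = - num (suc n)

  private
    cancel-1 : ∀ x y → x - y ≈ (1# + x) - (1# + y)
    cancel-1 x y = begin
      x - y                     ≈⟨ +-identityˡ _ ⟨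
      0# + (x - y)              ≈⟨ +-congʳ (-‿inverseʳ 1#) ⟨
      (1# - 1#) + (x - y)       ≈⟨ +-assoc 1# (- 1#) _ ⟩
      1# + (- 1# + (x - y))     ≈⟨ +-congˡ (+-assoc _ _ _) ⟨
      1# + ((- 1# + x) - y)     ≈⟨ +-congˡ (+-congʳ (+-comm _ _)) ⟩
      1# + ((x - 1#) - y)       ≈⟨ +-congˡ (+-assoc _ _ _) ⟩
      1# + (x + (- 1# - y))     ≈⟨ +-assoc _ _ _ ⟨
      (1# + x) + (- 1# - y)     ≈⟨ +-congˡ (-‿+-comm 1# y) ⟩
      (1# + x) - (1# + y)       ∎

    ⊖-homo : ∀ m n → ⟦ m ⊖ n ⟧ℤ ≈ num m - num n
    ⊖-homo zero zero = sym (-‿inverseʳ 0#)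
    ⊖-homo zero (suc n) = sym (+-identityˡ _)
    ⊖-homo (suc m) zero = sym (trans (+-congˡ -0#≈0#) (+-identityʳ _))
    ⊖-homo (suc m) (suc n) = begin
      ⟦ suc m ⊖ suc n ⟧ℤ          ≡⟨ ≡.cong ⟦_⟧ℤ (ℤₚ.[1+m]⊖[1+n]≡m⊖n m n) ⟩
      ⟦ m ⊖ n ⟧ℤ                  ≈⟨ ⊖-homo m n ⟩
      num m - num n               ≈⟨ cancel-1 _ _ ⟩
      (1# + num m) - (1# + num n) ≈⟨ +-cong (1+× m 1#) (-‿cong (1+× n 1#)) ⟨
      num (suc m) - num (suc n)   ∎

    +-homoℤ : ∀ i j → ⟦ i ℤ.+ j ⟧ℤ ≈ ⟦ i ⟧ℤ + ⟦ j ⟧ℤ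
    +-homoℤ (+ m) (+ n) = ×-homo-+ 1# m n
    +-homoℤ (+ m) -[1+ n ] = ⊖-homo m (suc n)
    +-homoℤ -[1+ m ] (+ n) = trans (⊖-homo n (suc m)) (+-comm _ _)
    +-homoℤ -[1+ m ] -[1+ n ] = begin
      - num (suc (suc (m ℕ.+ n)))    ≡⟨ ≡.cong (λ k → - num (suc k)) (ℕₚ.+-suc m n) ⟨
      - num (suc m ℕ.+ suc n)        ≈⟨ -‿cong (×-homo-+ 1# (suc m) (suc n)) ⟩
      - (num (suc m) + num (suc n))  ≈⟨ -‿+-comm _ _ ⟨
      - num (suc m) - num (suc n)    ∎

    neg-homoℤ : ∀ i → ⟦ ℤ.- i ⟧ℤ ≈ - ⟦ i ⟧ℤ
    neg-homoℤ (+ zero)  = sym -0#≈0#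
    neg-homoℤ (+ suc n) = refl
    neg-homoℤ -[1+ n ]  = sym (-‿involutive _)

    ◃-homo⁺ : ∀ n → ⟦ Sign.+ ℤ.◃ n ⟧ℤ ≈ num n
    ◃-homo⁺ n = reflexive (≡.cong ⟦_⟧ℤ (ℤₚ.+◃n≡+n n))

    ◃-homo⁻ : ∀ n → ⟦ Sign.- ℤ.◃ n ⟧ℤ ≈ - num n
    ◃-homo⁻ n = trans (reflexive (≡.cong ⟦_⟧ℤ (ℤₚ.-◃n≡-n n))) (neg-homoℤ (+ n))

    *-homoℤ : ∀ i j → ⟦ i ℤ.* j ⟧ℤ ≈ ⟦ i ⟧ℤ * ⟦ j ⟧ℤ
    *-homoℤ (+ m) (+ n) = trans (◃-homo⁺ (m ℕ.* n)) (×1-homo-* m n)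
    *-homoℤ (+ m) -[1+ n ] = begin
      _                        ≈⟨ ◃-homo⁻ (m ℕ.* suc n) ⟩
      - num (m ℕ.* suc n)      ≈⟨ -‿cong (×1-homo-* m (suc n)) ⟩
      - (num m * num (suc n))  ≈⟨ -‿distribʳ-* _ _ ⟩
      num m * - num (suc n)    ∎
    *-homoℤ -[1+ m ] (+ n) = begin
      _                        ≈⟨ ◃-homo⁻ (suc m ℕ.* n) ⟩
      - num (suc m ℕ.* n)      ≈⟨ -‿cong (×1-homo-* (suc m) n) ⟩
      - (num (suc m) * num n)  ≈⟨ -‿distribˡ-* _ _ ⟩
      - num (suc m) * num n    ∎
    *-homoℤ -[1+ m ] -[1+ n ] = begin
      _                              ≈⟨ ◃-homo⁺ (suc m ℕ.* suc n) ⟩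
      num (suc m ℕ.* suc n)          ≈⟨ ×1-homo-* (suc m) (suc n) ⟩
      num (suc m) * num (suc n)      ≈⟨ -‿involutive _ ⟨
      - - (num (suc m) * num (suc n)) ≈⟨ -‿cong (-‿distribˡ-* _ _) ⟩
      - (- num (suc m) * num (suc n)) ≈⟨ -‿distribʳ-* _ _ ⟩
      - num (suc m) * - num (suc n)  ∎

  ℤ-homomorphism : ℤ.+-*-rawRing ACR.-Raw-AlmostCommutative⟶ ACR.fromCommutativeRing R
  ℤ-homomorphism = record
    { ⟦_⟧    = ⟦_⟧ℤ
    ; +-homo = +-homoℤ
    ; *-homo = *-homoℤ
    ; -‿homo = neg-homoℤ
    ; 0-homo = refl
    ; 1-homo = refl
    }

  private
    decide : ∀ i j → Maybe (⟦ i ⟧ℤ ≈ ⟦ j ⟧ℤ)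
    decide i j with i ℤₚ.≟ j
    ... | yes i≡j = just (reflexive (≡.cong ⟦_⟧ℤ i≡j))
    ... | no  _   = nothing

  open Algebra.Solver.Ring ℤ.+-*-rawRing (ACR.fromCommutativeRing R) ℤ-homomorphism decide
    public using (solve; _:+_; _:*_; _:-_; :-_; _:=_)
  open Algebra.Solver.Ring ℤ.+-*-rawRing (ACR.fromCommutativeRing R) ℤ-homomorphism decide
    using (Polynomial; con)

  :0 :1 : ∀ {n} → Polynomial n
  :0 = con (+ 0)
  :1 = con (+ 1)

-- Ordered field arithmetic, absolute values and powers.

module Ordered (ℝ : CompleteOrderedField) where

  open CompleteOrderedField ℝ hiding (zero)
  open RealAnalysis ℝ
  open IntegerSolver commutativeRing
  open Algebra.Properties.Ring ring using (-0#≈0#; -‿involutive)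
  open Algebra.Properties.Semiring.Exp semiring using (^-congˡ)
  private
    module O = IsStrictTotalOrder isStrictTotalOrder
    module N = NonStrict _≈_ _<_
    module T = IsTotalOrder (N.isTotalOrder isStrictTotalOrder)

  <-trans : ∀ {x y z} → x < y → y < z → x < z
  <-trans = O.trans

  <-irrefl : ∀ {x} → ¬ x < x
  <-irrefl = O.irrefl refl

  <⇒≤ : ∀ {x y} → x < y → x ≤ y
  <⇒≤ = inj₁

  ≈⇒≤ : ∀ {x y} → x ≈ y → x ≤ y
  ≈⇒≤ = inj₂

  ≤-refl : ∀ {x} → x ≤ x
  ≤-refl = inj₂ refl

  ≤-trans : ∀ {x y z} → x ≤ y → y ≤ z → x ≤ z
  ≤-trans = T.trans

  ≤-antisym : ∀ {x y} → x ≤ y → y ≤ x → x ≈ y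
  ≤-antisym = T.antisym

  ≤-total : ∀ x y → x ≤ y ⊎ y ≤ x
  ≤-total = T.total

  <-≤-trans : ∀ {x y z} → x < y → y ≤ z → x < z
  <-≤-trans = N.<-≤-trans O.trans O.<-respʳ-≈

  ≤-<-trans : ∀ {x y z} → x ≤ y → y < z → x < z
  ≤-<-trans = N.≤-<-trans sym O.trans O.<-respˡ-≈

  <-resp : ∀ {x y u v} → x ≈ u → y ≈ v → x < y → u < v
  <-resp p q x<y = O.<-respʳ-≈ q (O.<-respˡ-≈ p x<y)

  ≤-resp : ∀ {x y u v} → x ≈ u → y ≈ v → x ≤ y → u ≤ v
  ≤-resp p q x≤y = ≤-trans (≈⇒≤ (sym p)) (≤-trans x≤y (≈⇒≤ q))

  module ≤-Reasoning = Triple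
    (N.isPreorder₂ O.isStrictPartialOrder) O.asym O.trans O.<-resp-≈ <⇒≤ <-≤-trans ≤-<-trans

  ≤⇒≯ : ∀ {x y} → x ≤ y → ¬ y < x
  ≤⇒≯ x≤y y<x = <-irrefl (≤-<-trans x≤y y<x)

  ≰⇒> : ∀ {x y} → ¬ x ≤ y → y < x
  ≰⇒> {x} {y} x≰y with compare x y
  ... | tri< x<y _ _ = ⊥-elim (x≰y (<⇒≤ x<y))
  ... | tri≈ _ x≈y _ = ⊥-elim (x≰y (≈⇒≤ x≈y))
  ... | tri> _ _ y<x = y<x

  ≮⇒≥ : ∀ {x y} → ¬ x < y → y ≤ x
  ≮⇒≥ {x} {y} x≮y with compare x y
  ... | tri< x<y _ _ = ⊥-elim (x≮y x<y)
  ... | tri≈ _ x≈y _ = ≈⇒≤ (sym x≈y)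
  ... | tri> _ _ y<x = <⇒≤ y<x

  >⇒≉ : ∀ {x} → 0# < x → x ≉ 0#
  >⇒≉ 0<x x≈0 = <-irrefl (O.<-respʳ-≈ x≈0 0<x)

  sub-pos : ∀ {x y} → x < y → 0# < y - x
  sub-pos {x} {y} x<y = <-resp (-‿inverseˡ x) (+-comm _ _) (+-monoʳ-< (- x) x<y)

  sub-nonneg : ∀ {x y} → x ≤ y → 0# ≤ y - x
  sub-nonneg (inj₁ x<y) = <⇒≤ (sub-pos x<y)
  sub-nonneg {x} (inj₂ x≈y) = ≈⇒≤ (trans (sym (-‿inverseʳ x)) (+-congʳ x≈y))

  pos-sub : ∀ {x y} → 0# < y - x → x < y
  pos-sub {x} {y} 0<d = <-resp (+-identityʳ x) (solve 2 (λ x y → x :+ (y :- x) := y) refl x y) (+-monoʳ-< x 0<d)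

  nonneg-sub : ∀ {x y} → 0# ≤ y - x → x ≤ y
  nonneg-sub (inj₁ 0<d) = <⇒≤ (pos-sub 0<d)
  nonneg-sub {x} {y} (inj₂ 0≈d) = ≈⇒≤ (trans (sym (+-identityʳ x)) (trans (+-congˡ 0≈d)
    (solve 2 (λ x y → x :+ (y :- x) := y) refl x y)))

  ≤-by : ∀ {x y e} → 0# ≤ e → e ≈ y - x → x ≤ y
  ≤-by 0≤e e≈ = nonneg-sub (≤-trans 0≤e (≈⇒≤ e≈))

  <-by : ∀ {x y e} → 0# < e → e ≈ y - x → x < y
  <-by 0<e e≈ = pos-sub (<-≤-trans 0<e (≈⇒≤ e≈))

  +-monoˡ-≤ : ∀ z {x y} → x ≤ y → x + z ≤ y + z
  +-monoˡ-≤ z {x} {y} x≤y = ≤-by (sub-nonneg x≤y) (solve 3 (λ x y z → y :- x := (y :+ z) :- (x :+ z)) refl x y z)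

  +-monoʳ-≤ : ∀ z {x y} → x ≤ y → z + x ≤ z + y
  +-monoʳ-≤ z {x} {y} x≤y = ≤-by (sub-nonneg x≤y) (solve 3 (λ x y z → y :- x := (z :+ y) :- (z :+ x)) refl x y z)

  +-mono-≤ : ∀ {x y u v} → x ≤ y → u ≤ v → x + u ≤ y + v
  +-mono-≤ {y = y} {u} x≤y u≤v = ≤-trans (+-monoˡ-≤ u x≤y) (+-monoʳ-≤ y u≤v)

  +-monoˡ-< : ∀ z {x y} → x < y → x + z < y + z
  +-monoˡ-< z {x} {y} x<y = <-by (sub-pos x<y) (solve 3 (λ x y z → y :- x := (y :+ z) :- (x :+ z)) refl x y z)

  +-mono-<-≤ : ∀ {x y u v} → x < y → u ≤ v → x + u < y + v
  +-mono-<-≤ {y = y} {u} x<y u≤v = <-≤-trans (+-monoˡ-< u x<y) (+-monoʳ-≤ y u≤v)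

  +-mono-≤-< : ∀ {x y u v} → x ≤ y → u < v → x + u < y + v
  +-mono-≤-< {y = y} {u} x≤y u<v = ≤-<-trans (+-monoˡ-≤ u x≤y) (+-monoʳ-< y u<v)

  +-nonneg : ∀ {x y} → 0# ≤ x → 0# ≤ y → 0# ≤ x + y
  +-nonneg 0≤x 0≤y = ≤-trans (≈⇒≤ (sym (+-identityʳ 0#))) (+-mono-≤ 0≤x 0≤y)

  +-pos : ∀ {x y} → 0# < x → 0# ≤ y → 0# < x + y
  +-pos 0<x 0≤y = ≤-<-trans (≈⇒≤ (sym (+-identityʳ 0#))) (+-mono-<-≤ 0<x 0≤y)

  *-nonneg : ∀ {x y} → 0# ≤ x → 0# ≤ y → 0# ≤ x * y
  *-nonneg (inj₁ 0<x) (inj₁ 0<y) = <⇒≤ (*-pos 0<x 0<y)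
  *-nonneg {x} {y} (inj₁ _) (inj₂ 0≈y) = ≈⇒≤ (trans (sym (zeroʳ x)) (*-congˡ 0≈y))
  *-nonneg {x} {y} (inj₂ 0≈x) _ = ≈⇒≤ (trans (sym (zeroˡ y)) (*-congʳ 0≈x))

  *-monoˡ-≤ : ∀ {z x y} → 0# ≤ z → x ≤ y → z * x ≤ z * y
  *-monoˡ-≤ {z} {x} {y} 0≤z x≤y =
    ≤-by (*-nonneg 0≤z (sub-nonneg x≤y)) (solve 3 (λ x y z → z :* (y :- x) := z :* y :- z :* x) refl x y z)

  *-monoʳ-≤ : ∀ {z x y} → 0# ≤ z → x ≤ y → x * z ≤ y * z
  *-monoʳ-≤ 0≤z x≤y = ≤-resp (*-comm _ _) (*-comm _ _) (*-monoˡ-≤ 0≤z x≤y)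

  *-mono-≤ : ∀ {x y u v} → 0# ≤ x → 0# ≤ u → x ≤ y → u ≤ v → x * u ≤ y * v
  *-mono-≤ 0≤x 0≤u x≤y u≤v = ≤-trans (*-monoʳ-≤ 0≤u x≤y) (*-monoˡ-≤ (≤-trans 0≤x x≤y) u≤v)

  *-monoˡ-< : ∀ {z x y} → 0# < z → x < y → z * x < z * y
  *-monoˡ-< {z} {x} {y} 0<z x<y =
    <-by (*-pos 0<z (sub-pos x<y)) (solve 3 (λ x y z → z :* (y :- x) := z :* y :- z :* x) refl x y z)

  *-monoʳ-< : ∀ {z x y} → 0# < z → x < y → x * z < y * z
  *-monoʳ-< 0<z x<y = <-resp (*-comm _ _) (*-comm _ _) (*-monoˡ-< 0<z x<y)

  neg-mono-≤ : ∀ {x y} → x ≤ y → - y ≤ - x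
  neg-mono-≤ {x} {y} x≤y = ≤-by (sub-nonneg x≤y) (solve 2 (λ x y → y :- x := :- x :- :- y) refl x y)

  neg-pos : ∀ {x} → x < 0# → 0# < - x
  neg-pos {x} x<0 = <-by (sub-pos x<0) (solve 1 (λ x → :0 :- x := :- x :- :0) refl x)

  *-cancelˡ-≤ : ∀ {z x y} → 0# < z → z * x ≤ z * y → x ≤ y
  *-cancelˡ-≤ 0<z p = ≮⇒≥ λ y<x → ≤⇒≯ p (*-monoˡ-< 0<z y<x)

  *-cancelˡ-< : ∀ {z x y} → 0# ≤ z → z * x < z * y → x < y
  *-cancelˡ-< 0≤z p = ≰⇒> λ y≤x → ≤⇒≯ (*-monoˡ-≤ 0≤z y≤x) p

  0<1 : 0# < 1#
  0<1 with compare 0# 1#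
  ... | tri< p _ _ = p
  ... | tri≈ _ p _ = ⊥-elim (1≉0 (sym p))
  -- If `1#` were negative, `- 1#` would be positive, and so would its square `1#`.
  ... | tri> _ _ p = ⊥-elim (<-irrefl (<-trans p (<-≤-trans (*-pos (neg-pos p) (neg-pos p))
    (≈⇒≤ (solve 0 (:- :1 :* :- :1 := :1) refl)))))

  0≤1 : 0# ≤ 1#
  0≤1 = <⇒≤ 0<1

  fromℕ-nonneg : ∀ n → 0# ≤ fromℕ n
  fromℕ-nonneg zero = ≤-refl
  fromℕ-nonneg (suc n) = +-nonneg 0≤1 (fromℕ-nonneg n)

  fromℕ-pos : ∀ n → 0# < fromℕ (suc n)
  fromℕ-pos n = +-pos 0<1 (fromℕ-nonneg n)

  0<2 : 0# < 1# + 1#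
  0<2 = +-pos 0<1 0≤1

  ⁻¹-inverseˡ : ∀ x → x ≉ 0# → x ⁻¹ * x ≈ 1#
  ⁻¹-inverseˡ x x≉0 = trans (*-comm _ _) (⁻¹-inverseʳ x x≉0)

  ⁻¹-pos : ∀ {x} → 0# < x → 0# < x ⁻¹
  ⁻¹-pos {x} 0<x = *-cancelˡ-< (<⇒≤ 0<x) (<-resp (sym (zeroʳ x)) (sym (⁻¹-inverseʳ x (>⇒≉ 0<x))) 0<1)

  *-inv : ∀ {x} → 0# < x → x * x ⁻¹ ≈ 1#
  *-inv {x} 0<x = ⁻¹-inverseʳ x (>⇒≉ 0<x)

  ⁻¹-unique : ∀ {x y} → 0# < x → x * y ≈ 1# → y ≈ x ⁻¹
  ⁻¹-unique {x} {y} 0<x p = begin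
    y                ≈⟨ *-identityʳ y ⟨
    y * 1#           ≈⟨ *-congˡ (*-inv 0<x) ⟨
    y * (x * x ⁻¹)   ≈⟨ (solve 3 (λ a b c → c :* (a :* b) := a :* c :* b) refl) x (x ⁻¹) y ⟩
    x * y * x ⁻¹     ≈⟨ *-congʳ p ⟩
    1# * x ⁻¹        ≈⟨ *-identityˡ _ ⟩
    x ⁻¹             ∎
    where open SetoidReasoning setoid

  *-cancelˡ-≈ : ∀ {z x y} → z ≉ 0# → z * x ≈ z * y → x ≈ y
  *-cancelˡ-≈ {z} {x} {y} z≉0 p = begin
    x               ≈⟨ *-identityˡ x ⟨
    1# * x          ≈⟨ *-congʳ (⁻¹-inverseˡ z z≉0) ⟨
    z ⁻¹ * z * x    ≈⟨ *-assoc _ _ _ ⟩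
    z ⁻¹ * (z * x)  ≈⟨ *-congˡ p ⟩
    z ⁻¹ * (z * y)  ≈⟨ *-assoc _ _ _ ⟨
    z ⁻¹ * z * y    ≈⟨ *-congʳ (⁻¹-inverseˡ z z≉0) ⟩
    1# * y          ≈⟨ *-identityˡ y ⟩
    y               ∎
    where open SetoidReasoning setoid

  zero-product : ∀ {x y} → x ≉ 0# → x * y ≈ 0# → y ≈ 0#
  zero-product {x} x≉0 p = *-cancelˡ-≈ x≉0 (trans p (sym (zeroʳ x)))

  ⁻¹-anti-≤ : ∀ {x y} → 0# < x → x ≤ y → y ⁻¹ ≤ x ⁻¹
  ⁻¹-anti-≤ {x} {y} 0<x x≤y = begin
    y ⁻¹               ≈⟨ *-identityʳ _ ⟨
    y ⁻¹ * 1#          ≈⟨ *-congˡ (*-inv 0<x) ⟨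
    y ⁻¹ * (x * x ⁻¹)  ≤⟨ *-monoˡ-≤ 0≤y⁻¹ (*-monoʳ-≤ (<⇒≤ (⁻¹-pos 0<x)) x≤y) ⟩
    y ⁻¹ * (y * x ⁻¹)  ≈⟨ *-assoc _ _ _ ⟨
    y ⁻¹ * y * x ⁻¹    ≈⟨ *-congʳ (⁻¹-inverseˡ y (>⇒≉ 0<y)) ⟩
    1# * x ⁻¹          ≈⟨ *-identityˡ _ ⟩
    x ⁻¹               ∎
    where
    open ≤-Reasoning
    0<y = <-≤-trans 0<x x≤y
    0≤y⁻¹ = <⇒≤ (⁻¹-pos 0<y)

  ½ : Carrier
  ½ = (1# + 1#) ⁻¹

  ½+½ : ∀ x → ½ * x + ½ * x ≈ x
  ½+½ x = trans (solve 2 (λ h x → h :* x :+ h :* x := (:1 :+ :1) :* h :* x) refl ½ x) (trans (*-congʳ (*-inv 0<2))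
    (*-identityˡ x))

  0<½ : 0# < ½
  0<½ = ⁻¹-pos 0<2

  half-pos : ∀ {x} → 0# < x → 0# < ½ * x
  half-pos = *-pos 0<½

  ½<1 : ½ < 1#
  ½<1 = <-by 0<½ (trans (solve 1 (λ h → h := (h :+ h) :- h) refl ½)
    (+-congʳ (trans (sym (+-cong (*-identityʳ ½) (*-identityʳ ½))) (½+½ 1#))))

  half-≤ : ∀ {x} → 0# ≤ x → ½ * x ≤ x
  half-≤ 0≤x = ≤-trans (*-monoʳ-≤ 0≤x (<⇒≤ ½<1)) (≈⇒≤ (*-identityˡ _))

  half-< : ∀ {x} → 0# < x → ½ * x < x
  half-< 0<x = <-≤-trans (*-monoʳ-< 0<x ½<1) (≈⇒≤ (*-identityˡ _))

  -- Absolute value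

  abs-split : ∀ x → (0# ≤ x × ∣ x ∣ ≈ x) ⊎ (x ≤ 0# × ∣ x ∣ ≈ - x)
  abs-split x with compare x 0#
  ... | tri< x<0 _ _ = inj₂ (<⇒≤ x<0 , refl)
  ... | tri≈ _ x≈0 _ = inj₁ (≈⇒≤ (sym x≈0) , refl)
  ... | tri> _ _ 0<x = inj₁ (<⇒≤ 0<x , refl)

  abs-least : ∀ {x y} → x ≤ y → - x ≤ y → ∣ x ∣ ≤ y
  abs-least {x} p q with abs-split x
  ... | inj₁ (_ , e) = ≤-trans (≈⇒≤ e) p
  ... | inj₂ (_ , e) = ≤-trans (≈⇒≤ e) q

  abs-nonneg : ∀ x → 0# ≤ ∣ x ∣
  abs-nonneg x with abs-split x
  ... | inj₁ (p , e) = ≤-trans p (≈⇒≤ (sym e))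
  ... | inj₂ (p , e) = ≤-resp -0#≈0# (sym e) (neg-mono-≤ p)

  x≤∣x∣ : ∀ x → x ≤ ∣ x ∣
  x≤∣x∣ x with abs-split x
  ... | inj₁ (p , e) = ≈⇒≤ (sym e)
  ... | inj₂ (p , e) = ≤-trans p (abs-nonneg x)

  -x≤∣x∣ : ∀ x → - x ≤ ∣ x ∣
  -x≤∣x∣ x with abs-split x
  ... | inj₂ (p , e) = ≈⇒≤ (sym e)
  ... | inj₁ (p , e) = ≤-trans (neg-mono-≤ p) (≤-trans (≈⇒≤ -0#≈0#) (abs-nonneg x))

  abs-of-nonneg : ∀ {x} → 0# ≤ x → ∣ x ∣ ≈ x
  abs-of-nonneg {x} 0≤x = ≤-antisym (abs-least ≤-refl (≤-trans (neg-mono-≤ 0≤x) (≤-trans (≈⇒≤ -0#≈0#) 0≤x)))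
    (x≤∣x∣ x)

  abs-cong : ∀ {x y} → x ≈ y → ∣ x ∣ ≈ ∣ y ∣
  abs-cong {x} {y} x≈y = ≤-antisym (le x≈y) (le (sym x≈y))
    where
    le : ∀ {x y} → x ≈ y → ∣ x ∣ ≤ ∣ y ∣
    le {x} {y} e = abs-least (≤-trans (≈⇒≤ e) (x≤∣x∣ y)) (≤-trans (≈⇒≤ (-‿cong e)) (-x≤∣x∣ y))

  abs-neg : ∀ x → ∣ - x ∣ ≈ ∣ x ∣
  abs-neg x = ≤-antisym (abs-least (-x≤∣x∣ x) (≤-trans (≈⇒≤ (-‿involutive x)) (x≤∣x∣ x)))
    (abs-least (≤-trans (≈⇒≤ (sym (-‿involutive x))) (-x≤∣x∣ (- x))) (x≤∣x∣ (- x)))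

  abs-minus-comm : ∀ x y → ∣ x - y ∣ ≈ ∣ y - x ∣
  abs-minus-comm x y = trans (abs-cong (solve 2 (λ x y → x :- y := :- (y :- x)) refl x y)) (abs-neg (y - x))

  abs-triangle : ∀ x y → ∣ x + y ∣ ≤ ∣ x ∣ + ∣ y ∣
  abs-triangle x y = abs-least (+-mono-≤ (x≤∣x∣ x) (x≤∣x∣ y))
    (≤-trans (≈⇒≤ (solve 2 (λ x y → :- (x :+ y) := :- x :+ :- y) refl x y)) (+-mono-≤ (-x≤∣x∣ x) (-x≤∣x∣ y)))

  abs-* : ∀ x y → ∣ x * y ∣ ≈ ∣ x ∣ * ∣ y ∣
  abs-* x y with abs-split x | abs-split y
  ... | inj₁ (p , e) | inj₁ (q , f) = trans (abs-of-nonneg (*-nonneg p q)) (sym (*-cong e f))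
  ... | inj₁ (p , e) | inj₂ (q , f) = begin
    ∣ x * y ∣      ≈⟨ abs-neg _ ⟨
    ∣ - (x * y) ∣  ≈⟨ abs-cong (solve 2 (λ x y → :- (x :* y) := x :* :- y) refl x y) ⟩
    ∣ x * - y ∣    ≈⟨ abs-of-nonneg (*-nonneg p (≤-trans (≈⇒≤ (sym -0#≈0#)) (neg-mono-≤ q))) ⟩
    x * - y        ≈⟨ *-cong e f ⟨
    ∣ x ∣ * ∣ y ∣  ∎
    where open SetoidReasoning setoid
  ... | inj₂ (p , e) | inj₁ (q , f) = begin
    ∣ x * y ∣      ≈⟨ abs-neg _ ⟨
    ∣ - (x * y) ∣  ≈⟨ abs-cong (solve 2 (λ x y → :- (x :* y) := :- x :* y) refl x y) ⟩
    ∣ - x * y ∣    ≈⟨ abs-of-nonneg (*-nonneg (≤-trans (≈⇒≤ (sym -0#≈0#)) (neg-mono-≤ p)) q) ⟩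
    - x * y        ≈⟨ *-cong e f ⟨
    ∣ x ∣ * ∣ y ∣  ∎
    where open SetoidReasoning setoid
  ... | inj₂ (p , e) | inj₂ (q , f) = begin
    ∣ x * y ∣      ≈⟨ abs-cong (solve 2 (λ x y → x :* y := :- x :* :- y) refl x y) ⟩
    ∣ - x * - y ∣  ≈⟨ abs-of-nonneg (*-nonneg (≤-trans (≈⇒≤ (sym -0#≈0#)) (neg-mono-≤ p))
      (≤-trans (≈⇒≤ (sym -0#≈0#)) (neg-mono-≤ q))) ⟩
    - x * - y      ≈⟨ *-cong e f ⟨
    ∣ x ∣ * ∣ y ∣  ∎
    where open SetoidReasoning setoid

  abs-0 : ∣ 0# ∣ ≈ 0#
  abs-0 = abs-of-nonneg ≤-refl

  abs≤0⇒≈0 : ∀ {x} → ∣ x ∣ ≤ 0# → x ≈ 0#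
  abs≤0⇒≈0 {x} p = ≤-antisym (≤-trans (x≤∣x∣ x) p)
    (≤-resp (-0#≈0#) (-‿involutive x) (neg-mono-≤ (≤-trans (-x≤∣x∣ x) p)))

  abs-pos : ∀ {x} → x ≉ 0# → 0# < ∣ x ∣
  abs-pos x≉0 = ≰⇒> λ p → x≉0 (abs≤0⇒≈0 p)

  abs-sub-triangle : ∀ x y z → ∣ x - z ∣ ≤ ∣ x - y ∣ + ∣ y - z ∣
  abs-sub-triangle x y z = ≤-trans (≈⇒≤ (abs-cong (solve 3 (λ x y z → x :- z := (x :- y) :+ (y :- z)) refl x y z)))
    (abs-triangle _ _)

  abs-triangle⁻ : ∀ x y → ∣ x - y ∣ ≤ ∣ x ∣ + ∣ y ∣
  abs-triangle⁻ x y = ≤-trans (abs-triangle x (- y)) (+-monoʳ-≤ ∣ x ∣ (≈⇒≤ (abs-neg y)))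

  abs-*-≤ : ∀ {x y u v} → ∣ x ∣ ≤ u → ∣ y ∣ ≤ v → ∣ x * y ∣ ≤ u * v
  abs-*-≤ {x} {y} p q = ≤-trans (≈⇒≤ (abs-* x y)) (*-mono-≤ (abs-nonneg x) (abs-nonneg y) p q)

  abs-+-≤ : ∀ {x y u v} → ∣ x ∣ ≤ u → ∣ y ∣ ≤ v → ∣ x + y ∣ ≤ u + v
  abs-+-≤ {x} {y} p q = ≤-trans (abs-triangle x y) (+-mono-≤ p q)

  -- Powers

  ^-nonneg : ∀ {x} n → 0# ≤ x → 0# ≤ x ^ n
  ^-nonneg zero _ = 0≤1
  ^-nonneg (suc n) 0≤x = *-nonneg 0≤x (^-nonneg n 0≤x)

  ^-pos : ∀ {x} n → 0# < x → 0# < x ^ n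
  ^-pos zero _ = 0<1
  ^-pos (suc n) 0<x = *-pos 0<x (^-pos n 0<x)

  ^-mono-≤ : ∀ {x y} n → 0# ≤ x → x ≤ y → x ^ n ≤ y ^ n
  ^-mono-≤ zero _ _ = ≤-refl
  ^-mono-≤ (suc n) 0≤x x≤y = *-mono-≤ 0≤x (^-nonneg n 0≤x) x≤y (^-mono-≤ n 0≤x x≤y)

  1≤^ : ∀ {x} n → 1# ≤ x → 1# ≤ x ^ n
  1≤^ zero _ = ≤-refl
  1≤^ (suc n) 1≤x = ≤-trans (≈⇒≤ (sym (*-identityʳ 1#))) (*-mono-≤ 0≤1 0≤1 1≤x (1≤^ n 1≤x))

  ^-≤1 : ∀ {x} n → 0# ≤ x → x ≤ 1# → x ^ n ≤ 1#
  ^-≤1 zero _ _ = ≤-refl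
  ^-≤1 (suc n) 0≤x x≤1 = ≤-trans (*-mono-≤ 0≤x (^-nonneg n 0≤x) x≤1 (^-≤1 n 0≤x x≤1)) (≈⇒≤ (*-identityʳ 1#))

  1^ : ∀ n → 1# ^ n ≈ 1#
  1^ zero = refl
  1^ (suc n) = trans (*-identityˡ _) (1^ n)

  ^-* : ∀ x y n → (x * y) ^ n ≈ x ^ n * y ^ n
  ^-* x y zero = sym (*-identityʳ 1#)
  ^-* x y (suc n) = trans (*-congˡ (^-* x y n)) (solve 4 (λ x y u v → x :* y :* (u :* v) := x :* u :* (y :* v))
    refl x y (x ^ n) (y ^ n))

  ^-inv : ∀ {x} n → 0# < x → x ^ n * (x ⁻¹) ^ n ≈ 1#
  ^-inv {x} n 0<x = trans (sym (^-* x (x ⁻¹) n)) (trans (^-congˡ n (*-inv 0<x)) (1^ n))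

  abs-^ : ∀ x n → ∣ x ^ n ∣ ≈ ∣ x ∣ ^ n
  abs-^ x zero = abs-of-nonneg 0≤1
  abs-^ x (suc n) = trans (abs-* _ _) (*-congˡ (abs-^ x n))

  ^-monoʳ-≤ : ∀ {x} {m n} → 1# ≤ x → m ℕ.≤ n → x ^ m ≤ x ^ n
  ^-monoʳ-≤ {n = n} 1≤x ℕ.z≤n = 1≤^ n 1≤x
  ^-monoʳ-≤ 1≤x (ℕ.s≤s p) = *-monoˡ-≤ (≤-trans 0≤1 1≤x) (^-monoʳ-≤ 1≤x p)

  ^-antiʳ-≤ : ∀ {x} {m n} → 0# ≤ x → x ≤ 1# → m ℕ.≤ n → x ^ n ≤ x ^ m
  ^-antiʳ-≤ {n = n} 0≤x x≤1 ℕ.z≤n = ^-≤1 n 0≤x x≤1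
  ^-antiʳ-≤ 0≤x x≤1 (ℕ.s≤s p) = *-monoˡ-≤ 0≤x (^-antiʳ-≤ 0≤x x≤1 p)

  -- Maxima and minima

  infixl 6 _⊔_
  _⊔_ : Carrier → Carrier → Carrier
  x ⊔ y with ≤-total x y
  ... | inj₁ _ = y
  ... | inj₂ _ = x

  x≤x⊔y : ∀ x y → x ≤ x ⊔ y
  x≤x⊔y x y with ≤-total x y
  ... | inj₁ p = p
  ... | inj₂ _ = ≤-refl

  y≤x⊔y : ∀ x y → y ≤ x ⊔ y
  y≤x⊔y x y with ≤-total x y
  ... | inj₁ _ = ≤-refl
  ... | inj₂ p = p

  common-lower-bound : ∀ {x y} → 0# < x → 0# < y → ∃ λ z → 0# < z × z ≤ x × z ≤ y
  common-lower-bound {x} {y} 0<x 0<y with ≤-total x y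
  ... | inj₁ p = x , 0<x , ≤-refl , p
  ... | inj₂ p = y , 0<y , p , ≤-refl

-- Archimedean property, nested intervals and integers inside the field.

module Archimedean (em : ExcludedMiddle 0ℓ) (ℝ : CompleteOrderedField) where

  open CompleteOrderedField ℝ hiding (zero)
  open RealAnalysis ℝ
  open IntegerSolver commutativeRing
  open Ordered ℝ
  open Algebra.Properties.Semiring.Mult semiring using (×1-homo-*; ×-homo-+)
  open Algebra.Properties.Ring ring using (-0#≈0#; -‿involutive)

  -- Otherwise the naturals have a supremum `s`; since `n + 1 ≤ s` for every `n`, the smaller
  -- `s - 1#` is an upper bound as well.
  archimedean : ∀ x → ∃ λ n → x < fromℕ n
  archimedean x with em {∃ λ n → x < fromℕ n}
  ... | yes p = p
  ... | no ¬p = ⊥-elim (≤⇒≯ s≤s-1 s-1<s)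
    where
    bound : ∀ n → fromℕ n ≤ x
    bound n = ≮⇒≥ λ q → ¬p (n , q)
    sup = complete (λ y → ∃ λ n → y ≈ fromℕ n) (0# , 0 , refl)
      (x , λ y (n , e) → ≤-trans (≈⇒≤ e) (bound n))
    s = proj₁ sup
    s≤s-1 : s ≤ s - 1#
    s≤s-1 = proj₂ (proj₂ sup) (s - 1#) λ y (n , e) →
      ≤-by (sub-nonneg (proj₁ (proj₂ sup) (fromℕ (suc n)) (suc n , refl)))
        (trans (solve 2 (λ s n → s :- (:1 :+ n) := s :- :1 :- n) refl s (fromℕ n)) (+-congˡ (-‿cong (sym e))))
    s-1<s : s - 1# < s
    s-1<s = <-by 0<1 (solve 1 (λ s → :1 := s :- (s :- :1)) refl s)

  fromℕ-+ : ∀ m n → fromℕ (m ℕ.+ n) ≈ fromℕ m + fromℕ n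
  fromℕ-+ m n = ×-homo-+ 1# m n

  fromℕ-* : ∀ m n → fromℕ (m ℕ.* n) ≈ fromℕ m * fromℕ n
  fromℕ-* = ×1-homo-*

  fromℕ-1 : fromℕ 1 ≈ 1#
  fromℕ-1 = +-identityʳ 1#

  fromℕ-^ : ∀ m n → fromℕ (m ℕ.^ n) ≈ fromℕ m ^ n
  fromℕ-^ m zero = fromℕ-1
  fromℕ-^ m (suc n) = trans (fromℕ-* m (m ℕ.^ n)) (*-congˡ (fromℕ-^ m n))

  fromℕ-mono-≤ : ∀ {m n} → m ℕ.≤ n → fromℕ m ≤ fromℕ n
  fromℕ-mono-≤ {n = n} ℕ.z≤n = fromℕ-nonneg n
  fromℕ-mono-≤ (ℕ.s≤s p) = +-monoʳ-≤ 1# (fromℕ-mono-≤ p)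

  fromℕ-mono-< : ∀ {m n} → m ℕ.< n → fromℕ m < fromℕ n
  fromℕ-mono-< {m} {suc n} (ℕ.s≤s p) =
    <-≤-trans (<-by 0<1 (solve 1 (λ m → :1 := :1 :+ m :- m) refl (fromℕ m))) (+-monoʳ-≤ 1# (fromℕ-mono-≤ p))

  fromℕ-cancel-≤ : ∀ {m n} → fromℕ m ≤ fromℕ n → m ℕ.≤ n
  fromℕ-cancel-≤ {m} {n} p with m ℕₚ.≤? n
  ... | yes q = q
  ... | no q = ⊥-elim (≤⇒≯ p (fromℕ-mono-< (ℕₚ.≰⇒> q)))

  fromℕ-cancel-< : ∀ {m n} → fromℕ m < fromℕ n → m ℕ.< n
  fromℕ-cancel-< {m} {n} p with n ℕₚ.≤? m
  ... | no q = ℕₚ.≰⇒> q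
  ... | yes q = ⊥-elim (≤⇒≯ (fromℕ-mono-≤ q) p)

  fromℕ-pos′ : ∀ {n} → 1 ℕ.≤ n → 0# < fromℕ n
  fromℕ-pos′ {suc n} _ = fromℕ-pos n

  1≤fromℕ : ∀ {n} → 1 ℕ.≤ n → 1# ≤ fromℕ n
  1≤fromℕ p = ≤-trans (≈⇒≤ (sym fromℕ-1)) (fromℕ-mono-≤ p)

  fromℕ≤2^ : ∀ n → fromℕ n ≤ (1# + 1#) ^ n
  fromℕ≤2^ zero = 0≤1
  fromℕ≤2^ (suc n) = ≤-trans (+-mono-≤ (1≤^ n (≤-by 0≤1 (solve 1 (λ x → x := :1 :+ x :- :1) refl 1#))) (fromℕ≤2^ n))
    (≈⇒≤ (solve 1 (λ y → y :+ y := (:1 :+ :1) :* y) refl ((1# + 1#) ^ n)))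

  0≤½ : 0# ≤ ½
  0≤½ = <⇒≤ 0<½

  geometric-small : ∀ C {ε} → 0# < ε → ∃ λ n → C * ½ ^ n < ε
  geometric-small C {ε} 0<ε = n , (begin-strict
    C * ½ ^ n                          ≈⟨ *-identityˡ _ ⟨
    1# * (C * ½ ^ n)                   ≈⟨ *-congʳ (*-inv 0<ε) ⟨
    ε * ε ⁻¹ * (C * ½ ^ n)             ≈⟨ (solve 4 (λ e i c h → e :* i :* (c :* h) := e :* (c :* i) :* h) refl) ε
      (ε ⁻¹) C (½ ^ n) ⟩
    ε * (C * ε ⁻¹) * ½ ^ n             <⟨ *-monoʳ-< (^-pos n 0<½) (*-monoˡ-< 0<ε (proj₂ N)) ⟩
    ε * fromℕ n * ½ ^ n                ≤⟨ *-monoʳ-≤ (^-nonneg n 0≤½) (*-monoˡ-≤ (<⇒≤ 0<ε) (fromℕ≤2^ n)) ⟩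
    ε * (1# + 1#) ^ n * ½ ^ n          ≈⟨ *-assoc _ _ _ ⟩
    ε * ((1# + 1#) ^ n * ½ ^ n)        ≈⟨ *-congˡ (^-inv n 0<2) ⟩
    ε * 1#                             ≈⟨ *-identityʳ ε ⟩
    ε                                  ∎)
    where
    open ≤-Reasoning
    N = archimedean (C * ε ⁻¹)
    n = proj₁ N

  -- Replaces passages to the limit: estimates are proved with an error that is halved at every
  -- round of an iteration, and the error is then dropped.
  ≤-geometric-limit : ∀ {x y} C → (∀ n → x ≤ y + C * ½ ^ n) → x ≤ y
  ≤-geometric-limit {x} {y} C p = ≮⇒≥ λ y<x →
    let n , q = geometric-small C (sub-pos y<x) in
    ≤⇒≯ (p n) (<-≤-trans (+-monoʳ-< y q) (≈⇒≤ (solve 2 (λ x y → y :+ (x :- y) := x) refl x y)))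

  ≤-archimedean : ∀ {x y} C → (∀ ε → 0# < ε → x ≤ y + C * ε) → x ≤ y
  ≤-archimedean C p = ≤-geometric-limit C λ n → p (½ ^ n) (^-pos n 0<½)

  -- The point is the supremum of the left ends. Comparing `l m` with `u n` across different indices
  -- is what makes every `u n` an upper bound of them.
  nested-intervals : (l u : ℕ → Carrier) → (∀ m n → l m ≤ u n) → ∃ λ x → ∀ n → l n ≤ x × x ≤ u n
  nested-intervals l u p = x , λ n → proj₁ (proj₂ sup) (l n) (n , refl) ,
                                     proj₂ (proj₂ sup) (u n) λ y (m , e) → ≤-trans (≈⇒≤ e) (p m n)
    where
    sup = complete (λ y → ∃ λ n → y ≈ l n) (l 0 , 0 , refl) (u 0 , λ y (n , e) → ≤-trans (≈⇒≤ e) (p n 0))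
    x = proj₁ sup

  -- Integers inside the field

  -- A difference of two naturals, so that closure under the ring operations is a polynomial
  -- identity without cases on signs.
  IsInteger : Carrier → Set
  IsInteger x = ∃ λ m → ∃ λ n → x ≈ fromℕ m - fromℕ n

  isInteger-cong : ∀ {x y} → x ≈ y → IsInteger x → IsInteger y
  isInteger-cong x≈y (m , n , e) = m , n , trans (sym x≈y) e

  isInteger-fromℕ : ∀ n → IsInteger (fromℕ n)
  isInteger-fromℕ n = n , 0 , (solve 1 (λ x → x := x :- :0) refl) (fromℕ n)

  isInteger-neg : ∀ {x} → IsInteger x → IsInteger (- x)
  isInteger-neg (m , n , e) = n , m , trans (-‿cong e) (solve 2 (λ m n → :- (m :- n) := n :- m) refl (fromℕ m)
    (fromℕ n))

  isInteger-+ : ∀ {x y} → IsInteger x → IsInteger y → IsInteger (x + y)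
  isInteger-+ (m , n , e) (k , l , f) = m ℕ.+ k , n ℕ.+ l , trans (+-cong e f)
    (trans (solve 4 (λ m n k l → (m :- n) :+ (k :- l) := (m :+ k) :- (n :+ l)) refl (fromℕ m) (fromℕ n) (fromℕ k)
      (fromℕ l))
      (sym (+-cong (fromℕ-+ m k) (-‿cong (fromℕ-+ n l)))))

  isInteger-* : ∀ {x y} → IsInteger x → IsInteger y → IsInteger (x * y)
  isInteger-* (m , n , e) (k , l , f) = m ℕ.* k ℕ.+ n ℕ.* l , m ℕ.* l ℕ.+ n ℕ.* k , trans (*-cong e f)
    (trans (solve 4 (λ m n k l → (m :- n) :* (k :- l) := (m :* k :+ n :* l) :- (m :* l :+ n :* k)) refl (fromℕ m)
      (fromℕ n) (fromℕ k) (fromℕ l))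
      (sym (+-cong (h m k n l) (-‿cong (h m l n k)))))
    where
    h : ∀ a b c d → fromℕ (a ℕ.* b ℕ.+ c ℕ.* d) ≈ fromℕ a * fromℕ b + fromℕ c * fromℕ d
    h a b c d = trans (fromℕ-+ (a ℕ.* b) (c ℕ.* d)) (+-cong (fromℕ-* a b) (fromℕ-* c d))

  isInteger-sub : ∀ {x y} → IsInteger x → IsInteger y → IsInteger (x - y)
  isInteger-sub p q = isInteger-+ p (isInteger-neg q)

  isInteger-fromℤ : ∀ z → IsInteger (fromℤ z)
  isInteger-fromℤ (+ n) = isInteger-fromℕ n
  isInteger-fromℤ -[1+ n ] = isInteger-neg (isInteger-fromℕ (suc n))

  nonneg-integer : ∀ {x} → IsInteger x → 0# ≤ x → ∃ λ n → x ≈ fromℕ n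
  nonneg-integer {x} (m , n , e) 0≤x = k , trans e (trans (+-congʳ m≈) (solve 2 (λ n k → n :+ k :- n := k) refl
    (fromℕ n) (fromℕ k)))
    where
    n≤m : n ℕ.≤ m
    n≤m = fromℕ-cancel-≤ (nonneg-sub (≤-trans 0≤x (≈⇒≤ e)))
    k = m ℕ.∸ n
    m≈ : fromℕ m ≈ fromℕ n + fromℕ k
    m≈ = trans (reflexive (≡.cong fromℕ (≡.sym (ℕₚ.m+[n∸m]≡n n≤m)))) (fromℕ-+ n k)

  integer-fromℤ : ∀ {x} → IsInteger x → ∃ λ z → x ≈ fromℤ z
  integer-fromℤ {x} i = [ (λ 0≤x → positive (nonneg-integer i 0≤x)) ,
      (λ x≤0 → negative (nonneg-integer (isInteger-neg i) (≤-resp -0#≈0# refl (neg-mono-≤ x≤0)))) ]′ (≤-total 0# x)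
    where
    positive : (∃ λ n → x ≈ fromℕ n) → ∃ λ z → x ≈ fromℤ z
    positive (n , e) = + n , e
    negative : (∃ λ n → - x ≈ fromℕ n) → ∃ λ z → x ≈ fromℤ z
    negative (zero , e) = + 0 , trans (sym (-‿involutive x)) (trans (-‿cong e) -0#≈0#)
    negative (suc n , e) = -[1+ n ] , trans (sym (-‿involutive x)) (-‿cong e)

  integer-abs≥1 : ∀ {x} → IsInteger x → x ≉ 0# → 1# ≤ ∣ x ∣
  integer-abs≥1 {x} i x≉0 with ≤-total 0# x
  ... | inj₁ 0≤x = h (nonneg-integer i 0≤x)
    where
    h : (∃ λ n → x ≈ fromℕ n) → 1# ≤ ∣ x ∣
    h (zero , e) = ⊥-elim (x≉0 e)
    h (suc n , e) = ≤-trans (1≤fromℕ {suc n} (ℕ.s≤s ℕ.z≤n)) (≤-trans (≈⇒≤ (sym e)) (x≤∣x∣ x))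
  ... | inj₂ x≤0 = h (nonneg-integer (isInteger-neg i) (≤-resp -0#≈0# refl (neg-mono-≤ x≤0)))
    where
    h : (∃ λ n → - x ≈ fromℕ n) → 1# ≤ ∣ x ∣
    h (zero , e) = ⊥-elim (x≉0 (trans (sym (-‿involutive x)) (trans (-‿cong e) -0#≈0#)))
    h (suc n , e) = ≤-trans (1≤fromℕ {suc n} (ℕ.s≤s ℕ.z≤n)) (≤-trans (≈⇒≤ (sym e)) (-x≤∣x∣ x))

  integer-small⇒0 : ∀ {x} → IsInteger x → ∣ x ∣ < 1# → x ≈ 0#
  integer-small⇒0 {x} i p with em {x ≈ 0#}
  ... | yes e = e
  ... | no ne = ⊥-elim (≤⇒≯ (integer-abs≥1 i ne) p)

  private
    locate : ∀ y M → 0# ≤ y → y < fromℕ M → ∃ λ k → fromℕ k ≤ y × y < fromℕ (suc k)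
    locate y zero p q = ⊥-elim (≤⇒≯ p q)
    locate y (suc M) p q with ≤-total (fromℕ M) y
    ... | inj₁ r = M , r , q
    ... | inj₂ (inj₁ r) = locate y M p r
    ... | inj₂ (inj₂ r) = M , ≈⇒≤ (sym r) , q

    -- Adding a natural number above `- x` makes the argument positive, where `locate` finds the
    -- integer part by descending from an upper bound.
    floor-shifted : ∀ x N → - x < fromℕ N → ∃ λ y → IsInteger y × y ≤ x × x < y + 1#
    floor-shifted x N -x<N = from (archimedean (x + fromℕ N))
      where
      from : (∃ λ M → x + fromℕ N < fromℕ M) → ∃ λ y → IsInteger y × y ≤ x × x < y + 1#
      from (M , r) = conclude (locate (x + fromℕ N) M (≤-by (sub-nonneg (<⇒≤ -x<N)) (solve 2 (λ x n → n :- :- x :=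
        x :+ n :- :0) refl x (fromℕ N))) r)
        where
        conclude : (∃ λ k → fromℕ k ≤ x + fromℕ N × x + fromℕ N < fromℕ (suc k)) → ∃ λ y → IsInteger y × y ≤ x × x
          < y + 1#
        conclude (k , p , q) = fromℕ k - fromℕ N , (k , N , refl) ,
          ≤-by (sub-nonneg p) (solve 3 (λ x n k → x :+ n :- k := x :- (k :- n)) refl x (fromℕ N) (fromℕ k)) ,
          <-by (sub-pos q) (solve 3 (λ x n k → (:1 :+ k) :- (x :+ n) := k :- n :+ :1 :- x) refl x (fromℕ N)
            (fromℕ k))

  floor : ∀ x → ∃ λ y → IsInteger y × y ≤ x × x < y + 1#
  floor x = floor-shifted x (proj₁ (archimedean (- x))) (proj₂ (archimedean (- x)))

-- Horner evaluation of truncated power series.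

module Horner (ℝ : CompleteOrderedField) where

  open CompleteOrderedField ℝ hiding (zero)
  open RealAnalysis ℝ
  open IntegerSolver commutativeRing
  open Ordered ℝ

  Sequence : Set
  Sequence = ℕ → Carrier

  tail : Sequence → Sequence
  tail a n = a (suc n)

  -- pe a s n has n terms, hence degree at most n - 1.
  pe : Sequence → Carrier → ℕ → Carrier
  pe a s zero    = 0#
  pe a s (suc n) = a 0 + s * pe (tail a) s n

  pe-cong : ∀ {a b s t} n → (∀ k → k ℕ.< n → a k ≈ b k) → s ≈ t → pe a s n ≈ pe b t n
  pe-cong zero p e = refl
  pe-cong (suc n) p e = +-cong (p 0 (ℕ.s≤s ℕ.z≤n)) (*-cong e (pe-cong n (λ k q → p (suc k) (ℕ.s≤s q)) e))

  pe-congˡ : ∀ {a b s} n → (∀ k → a k ≈ b k) → pe a s n ≈ pe b s n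
  pe-congˡ n p = pe-cong n (λ k _ → p k) refl

  pe-+ : ∀ a b s n → pe (λ k → a k + b k) s n ≈ pe a s n + pe b s n
  pe-+ a b s zero = sym (+-identityʳ 0#)
  pe-+ a b s (suc n) = trans (+-congˡ (*-congˡ (pe-+ (tail a) (tail b) s n)))
    (solve 5 (λ x y s u v → x :+ y :+ s :* (u :+ v) := x :+ s :* u :+ (y :+ s :* v)) refl (a 0) (b 0) s
      (pe (tail a) s n) (pe (tail b) s n))

  pe-scale : ∀ c a s n → pe (λ k → c * a k) s n ≈ c * pe a s n
  pe-scale c a s zero = sym (zeroʳ c)
  pe-scale c a s (suc n) = trans (+-congˡ (*-congˡ (pe-scale c (tail a) s n)))
    (solve 4 (λ c x s u → c :* x :+ s :* (c :* u) := c :* (x :+ s :* u)) refl c (a 0) s (pe (tail a) s n))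

  pe-sub : ∀ a b s n → pe (λ k → a k - b k) s n ≈ pe a s n - pe b s n
  pe-sub a b s zero = solve 1 (λ x → :0 := :0 :- :0) refl 0#
  pe-sub a b s (suc n) = trans (+-congˡ (*-congˡ (pe-sub (tail a) (tail b) s n)))
    (solve 5 (λ x y s u v → x :- y :+ s :* (u :- v) := x :+ s :* u :- (y :+ s :* v)) refl (a 0) (b 0) s
      (pe (tail a) s n) (pe (tail b) s n))

  pe-snoc : ∀ a s n → pe a s (suc n) ≈ pe a s n + a n * s ^ n
  pe-snoc a s zero = solve 2 (λ x s → x :+ s :* :0 := :0 :+ x :* :1) refl (a 0) s
  pe-snoc a s (suc n) = trans (+-congˡ (*-congˡ (pe-snoc (tail a) s n)))
    (solve 5 (λ x s u v w → x :+ s :* (u :+ v :* w) := x :+ s :* u :+ v :* (s :* w)) refl (a 0) s (pe (tail a) s n)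
      (a (suc n)) (s ^ n))

  pe-zero : ∀ a s n → (∀ k → k ℕ.< n → a k ≈ 0#) → pe a s n ≈ 0#
  pe-zero a s zero p = refl
  pe-zero a s (suc n) p = trans (+-cong (p 0 (ℕ.s≤s ℕ.z≤n)) (*-congˡ (pe-zero (tail a) s n λ k q → p (suc k)
    (ℕ.s≤s q))))
    (solve 1 (λ s → :0 :+ s :* :0 := :0) refl s)

  pe-extend : ∀ a s n j → (∀ k → n ℕ.≤ k → k ℕ.< n ℕ.+ j → a k ≈ 0#) → pe a s (n ℕ.+ j) ≈ pe a s n
  pe-extend a s zero j p = pe-zero a s j (λ k → p k ℕ.z≤n)
  pe-extend a s (suc n) j p =
    +-congˡ (*-congˡ (pe-extend (tail a) s n j λ k q r → p (suc k) (ℕ.s≤s q) (ℕ.s≤s r)))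

  pe-substitute : ∀ a y s n → pe (λ k → a k * y ^ k) s n ≈ pe a (y * s) n
  pe-substitute a y s zero = refl
  pe-substitute a y s (suc n) = trans
    (+-congˡ (*-congˡ (trans (pe-congˡ n (λ k → solve 3 (λ u y v → u :* (y :* v) := y :* (u :* v)) refl (a (suc k))
      y (y ^ k)))
      (trans (pe-scale y (λ k → tail a k * y ^ k) s n) (*-congˡ (pe-substitute (tail a) y s n))))))
    (solve 4 (λ x y s u → x :* :1 :+ s :* (y :* u) := x :+ y :* s :* u) refl (a 0) y s (pe (tail a) (y * s) n))

  pe-nonneg : ∀ {a s} n → (∀ k → 0# ≤ a k) → 0# ≤ s → 0# ≤ pe a s n
  pe-nonneg zero p q = ≤-refl
  pe-nonneg (suc n) p q = +-nonneg (p 0) (*-nonneg q (pe-nonneg n (λ k → p (suc k)) q))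

  pe-abs : ∀ {a b s t} n → (∀ k → k ℕ.< n → ∣ a k ∣ ≤ b k) → ∣ s ∣ ≤ t → ∣ pe a s n ∣ ≤ pe b t n
  pe-abs zero p q = ≈⇒≤ abs-0
  pe-abs (suc n) p q = abs-+-≤ (p 0 (ℕ.s≤s ℕ.z≤n)) (abs-*-≤ q (pe-abs n (λ k r → p (suc k) (ℕ.s≤s r)) q))

-- Germs of analytic functions at 0, with explicit bounds.

module Germs (em : ExcludedMiddle 0ℓ) (ℝ : CompleteOrderedField) where

  open CompleteOrderedField ℝ hiding (zero)
  open RealAnalysis ℝ
  open IntegerSolver commutativeRing
  open Ordered ℝ
  open Archimedean em ℝ
  open Horner ℝ
  open Algebra.Properties.Semiring.Exp semiring using (^-congˡ; ^-homo-*)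

  Bounded : Sequence → Carrier → Carrier → Set
  Bounded a A R = ∀ n → ∣ a n ∣ ≤ A * R ^ n

  -- Analyticity in quantitative form: one geometric bound for the coefficients and for all
  -- remainders on `R * ∣ s ∣ ≤ 1#`, so that sums and products need no limits. With `1# ≤ R`, a
  -- uniform bound on the coefficients of a polynomial is also a bound of this geometric kind.
  record Expansion (g : Carrier → Carrier) (a : Sequence) (A R : Carrier) : Set where
    field
      0≤A    : 0# ≤ A
      1≤R    : 1# ≤ R
      coeffs : Bounded a A R
      approx : ∀ s → R * ∣ s ∣ ≤ 1# → ∀ n → ∣ g s - pe a s n ∣ ≤ A * (R * ∣ s ∣) ^ n

    0≤R : 0# ≤ R
    0≤R = ≤-trans 0≤1 1≤R

    bounded-by-A : ∀ s → R * ∣ s ∣ ≤ 1# → ∣ g s ∣ ≤ A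
    bounded-by-A s p = ≤-trans (≈⇒≤ (abs-cong (solve 1 (λ x → x := x :- :0) refl (g s)))) (≤-trans (approx s p 0)
      (≈⇒≤ (*-identityʳ A)))

    value-at-0 : g 0# ≈ a 0
    value-at-0 = begin-equality
      g 0#                            ≈⟨ (solve 2 (λ x y → x := (x :- (y :+ :0 :* :0)) :+ y) refl) (g 0#) (a 0) ⟩
      (g 0# - pe a 0# 1) + a 0        ≈⟨ +-congʳ (abs≤0⇒≈0 (≤-trans (approx 0# small 1) (≈⇒≤ zero-bound))) ⟩
      0# + a 0                        ≈⟨ +-identityˡ _ ⟩
      a 0                             ∎
      where
      open ≤-Reasoning
      R0 = trans (*-congˡ abs-0) (zeroʳ R)
      small = ≤-trans (≈⇒≤ R0) 0≤1
      zero-bound : A * (R * ∣ 0# ∣) ^ 1 ≈ 0#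
      zero-bound = trans (*-congˡ (trans (*-identityʳ _) R0)) (zeroʳ A)

  IsGerm : (Carrier → Carrier) → Set
  IsGerm g = ∃ λ a → ∃ λ A → ∃ λ R → Expansion g a A R

  bounded-weaken : ∀ {a A A′ R R′} → 0# ≤ A → 0# ≤ R → A ≤ A′ → R ≤ R′ → Bounded a A R → Bounded a A′ R′
  bounded-weaken 0≤A 0≤R p q b n = ≤-trans (b n) (*-mono-≤ 0≤A (^-nonneg n 0≤R) p (^-mono-≤ n 0≤R q))

  bounded-tail : ∀ {a A R} → Bounded a A R → Bounded (tail a) (A * R) R
  bounded-tail {A = A} {R} b n = ≤-trans (b (suc n)) (≈⇒≤ (solve 3 (λ a r s → a :* (r :* s) := a :* r :* s) refl A
    R (R ^ n)))

  expansion-weaken : ∀ {g a A A′ R R′} → A ≤ A′ → R ≤ R′ → Expansion g a A R → Expansion g a A′ R′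
  expansion-weaken p q E = record
    { 0≤A = ≤-trans 0≤A p
    ; 1≤R = ≤-trans 1≤R q
    ; coeffs = bounded-weaken 0≤A 0≤R p q coeffs
    ; approx = λ s r n →
        let 0≤∣s∣ = abs-nonneg s
            Rs≤ = *-monoʳ-≤ 0≤∣s∣ q
            0≤Rs = *-nonneg 0≤R 0≤∣s∣ in
        ≤-trans (approx s (≤-trans Rs≤ r) n) (*-mono-≤ 0≤A (^-nonneg n 0≤Rs) p (^-mono-≤ n 0≤Rs Rs≤))
    }
    where open Expansion E

  expansion-cong : ∀ {g h a A R} → (∀ s → g s ≈ h s) → Expansion g a A R → Expansion h a A R
  expansion-cong e E = record
    { 0≤A = 0≤A ; 1≤R = 1≤R ; coeffs = coeffs
    ; approx = λ s r n → ≤-trans (≈⇒≤ (abs-cong (+-congʳ (sym (e s))))) (approx s r n) }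
    where open Expansion E

  isGerm-cong : ∀ {g h} → (∀ s → g s ≈ h s) → IsGerm g → IsGerm h
  isGerm-cong e (a , A , R , E) = a , A , R , expansion-cong e E

  constant : Carrier → Sequence
  constant c zero    = c
  constant c (suc n) = 0#

  isGerm-const : ∀ c → IsGerm (λ _ → c)
  isGerm-const c = constant c , ∣ c ∣ , 1# , record
    { 0≤A = abs-nonneg c ; 1≤R = ≤-refl
    ; coeffs = λ { zero → ≈⇒≤ (sym (*-identityʳ _))
                 ; (suc n) → ≤-trans (≈⇒≤ abs-0) (*-nonneg (abs-nonneg c) (^-nonneg (suc n) 0≤1)) }
    ; approx = λ { s r zero → ≈⇒≤ (trans (abs-cong (solve 1 (λ c → c :- :0 := c) refl c)) (sym (*-identityʳ _)))
                 ; s r (suc n) → ≤-trans (≈⇒≤ (trans (abs-cong (trans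
                      (+-congˡ (-‿cong (+-congˡ (*-congˡ (pe-zero (λ _ → 0#) s n λ _ _ → refl)))))
                      (solve 2 (λ c s → c :- (c :+ s :* :0) := :0) refl c s))) abs-0))
                      (*-nonneg (abs-nonneg c) (^-nonneg (suc n) (*-nonneg 0≤1 (abs-nonneg s)))) }
    }

  identity-sequence : Sequence
  identity-sequence zero = 0#
  identity-sequence (suc n) = constant 1# n

  isGerm-id : IsGerm (λ s → s)
  isGerm-id = identity-sequence , 1# , 1# , record
    { 0≤A = 0≤1 ; 1≤R = ≤-refl
    ; coeffs = λ n → ≤-trans (c n) (≈⇒≤ (sym (trans (*-identityˡ _) (1^ n))))
    ; approx = λ { s r zero → ≤-trans (≈⇒≤ (trans (abs-cong (solve 1 (λ s → s :- :0 := s) refl s))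
      (sym (*-identityˡ _)))) (≤-trans r (≈⇒≤ (sym (*-identityˡ _))))
                 ; s r (suc zero) → ≤-trans (≈⇒≤ (trans (abs-cong (solve 1 (λ s → s :- (:0 :+ s :* :0) := s) refl
                   s)) (solve 1 (λ x → x := :1 :* (:1 :* x :* :1)) refl ∣ s ∣))) ≤-refl
                 ; s r (suc (suc n)) → ≤-trans (≈⇒≤ (trans (abs-cong (trans
                      (+-congˡ (-‿cong (+-congˡ (*-congˡ (+-congˡ (*-congˡ (pe-zero (λ _ → 0#) s n λ _ _ →
                        refl)))))))
                      (solve 1 (λ s → s :- (:0 :+ s :* (:1 :+ s :* :0)) := :0) refl s))) abs-0))
                      (*-nonneg 0≤1 (^-nonneg (suc (suc n)) (*-nonneg 0≤1 (abs-nonneg s)))) }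
    }
    where
    c : ∀ n → ∣ identity-sequence n ∣ ≤ 1#
    c zero = ≤-trans (≈⇒≤ abs-0) 0≤1
    c (suc zero) = ≈⇒≤ (abs-of-nonneg 0≤1)
    c (suc (suc n)) = ≤-trans (≈⇒≤ abs-0) 0≤1

  isGerm-+ : ∀ {g h} → IsGerm g → IsGerm h → IsGerm (λ s → g s + h s)
  isGerm-+ {g} {h} (a , A , R , E) (b , B , Q , F) = (λ k → a k + b k) , A + B , R ⊔ Q , record
    { 0≤A = +-nonneg E.0≤A F.0≤A ; 1≤R = E.1≤R
    ; coeffs = λ n → ≤-trans (abs-+-≤ (E.coeffs n) (F.coeffs n)) (≈⇒≤ (sym (distribʳ _ A B)))
    ; approx = λ s r n → ≤-trans (≈⇒≤ (abs-cong (trans (+-congˡ (-‿cong (pe-+ a b s n)))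
          (solve 4 (λ x y u v → x :+ y :- (u :+ v) := (x :- u) :+ (y :- v)) refl (g s) (h s) (pe a s n)
            (pe b s n)))))
        (≤-trans (abs-+-≤ (E.approx s r n) (F.approx s r n)) (≈⇒≤ (sym (distribʳ _ A B))))
    }
    where
    module E = Expansion (expansion-weaken ≤-refl (x≤x⊔y R Q) E)
    module F = Expansion (expansion-weaken ≤-refl (y≤x⊔y R Q) F)

  conv : Sequence → Sequence → Sequence
  conv a b zero    = a 0 * b 0
  conv a b (suc n) = a 0 * b (suc n) + conv (tail a) b n

  pe-conv : ∀ a b s n → pe (conv a b) s (suc n) ≈ a 0 * pe b s (suc n) + s * pe (conv (tail a) b) s n
  pe-conv a b s n = trans
    (+-congˡ (*-congˡ (trans (pe-+ (λ k → a 0 * b (suc k)) (conv (tail a) b) s n) (+-congʳ (pe-scale (a 0) (tail b)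
      s n)))))
    (solve 5 (λ x y s u v → x :* y :+ s :* (x :* u :+ v) := x :* (y :+ s :* u) :+ s :* v) refl (a 0) (b 0) s
      (pe (tail b) s n) (pe (conv (tail a) b) s n))

  conv-bound : ∀ {a b A B R} n → 0# ≤ R → Bounded a A R → Bounded b B R →
               ∣ conv a b n ∣ ≤ fromℕ (suc n) * (A * B * R ^ n)
  conv-bound {A = A} {B} {R} zero 0≤R p q = ≤-trans (abs-*-≤ (p 0) (q 0))
    (≈⇒≤ (solve 2 (λ a b → a :* :1 :* (b :* :1) := (:1 :+ :0) :* (a :* b :* :1)) refl A B))
  conv-bound {A = A} {B} {R} (suc n) 0≤R p q = ≤-trans
    (abs-+-≤ (abs-*-≤ (p 0) (q (suc n))) (conv-bound n 0≤R (bounded-tail p) q))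
    (≈⇒≤ (solve 5 (λ a b r u n → a :* :1 :* (b :* (r :* u)) :+ (:1 :+ n) :* (a :* r :* b :* u) := (:1 :+ (:1 :+ n))
      :* (a :* b :* (r :* u))) refl A B R (R ^ n) (fromℕ n)))

  -- Each of the `n` terms `a i * s ^ i` leaves the remainder of `h` of order `n - i`, and all these
  -- products have the same size. Only the first factor is truncated, so the estimate applies
  -- directly to a polynomial times `f`, which is how the Padé relations and the Siegel forms are
  -- bounded.
  product-remainder : ∀ {a b A B R s h} n → 0# ≤ R → Bounded a A R →
    (∀ k → ∣ h - pe b s k ∣ ≤ B * (R * ∣ s ∣) ^ k) →
    ∣ pe a s n * h - pe (conv a b) s n ∣ ≤ fromℕ n * (A * B * (R * ∣ s ∣) ^ n)
  product-remainder {h = h} zero 0≤R p q =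
    ≈⇒≤ (trans (abs-cong (solve 1 (λ h → :0 :* h :- :0 := :0) refl h)) (trans abs-0 (sym (zeroˡ _))))
  product-remainder {a} {b} {A} {B} {R} {s} {h} (suc n) 0≤R p q = ≤-trans
    (≈⇒≤ (abs-cong (trans (+-congˡ (-‿cong (pe-conv a b s n)))
      (solve 6 (λ x s u h v w → (x :+ s :* u) :* h :- (x :* v :+ s :* w) := x :* (h :- v) :+ s :* (u :* h :- w))
        refl
        (a 0) s (pe (tail a) s n) h (pe b s (suc n)) (pe (conv (tail a) b) s n)))))
    (≤-trans (abs-+-≤ (abs-*-≤ (p 0) (q (suc n))) (abs-*-≤ ≤-refl (product-remainder n 0≤R (bounded-tail p) q)))
      (≈⇒≤ (solve 6 (λ a b r s t n → a :* :1 :* (b :* (r :* s :* t)) :+ s :* (n :* (a :* r :* b :* t)) := (:1 :+ n)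
        :* (a :* b :* (r :* s :* t))) refl
        A B R ∣ s ∣ ((R * ∣ s ∣) ^ n) (fromℕ n))))

  1+n≤2^n : ∀ n → fromℕ (suc n) ≤ (1# + 1#) ^ n
  1+n≤2^n zero = ≈⇒≤ fromℕ-1
  1+n≤2^n (suc n) = ≤-trans (+-mono-≤ (1≤^ n (≤-by 0≤1 (solve 1 (λ x → x := :1 :+ x :- :1) refl 1#))) (1+n≤2^n n))
    (≈⇒≤ (solve 1 (λ y → y :+ y := (:1 :+ :1) :* y) refl ((1# + 1#) ^ n)))

  -- A coefficient of the Cauchy product has `n + 1` terms; the factor `n + 1 ≤ 2 ^ n` is absorbed
  -- by doubling `R`.
  isGerm-* : ∀ {g h} → IsGerm g → IsGerm h → IsGerm (λ s → g s * h s)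
  isGerm-* {g} {h} (a , A , R , E) (b , B , Q , F) = conv a b , A * B , (1# + 1#) * P , record
    { 0≤A = *-nonneg E.0≤A F.0≤A
    ; 1≤R = ≤-trans E.1≤R P≤2P
    ; coeffs = λ n → ≤-trans (conv-bound n E.0≤R E.coeffs F.coeffs) (double n P E.0≤R)
    ; approx = λ s r n → let r′ = ≤-trans (*-monoʳ-≤ (abs-nonneg s) P≤2P) r in ≤-trans
        (≈⇒≤ (abs-cong (solve 4 (λ g h u w → g :* h :- w := (g :- u) :* h :+ (u :* h :- w)) refl (g s) (h s)
          (pe a s n) (pe (conv a b) s n))))
        (≤-trans (abs-+-≤ (abs-*-≤ (E.approx s r′ n) (F.bounded-by-A s r′)) (product-remainder n E.0≤R E.coeffs
          (F.approx s r′)))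
        (≤-trans (≈⇒≤ (solve 4 (λ a b t n → a :* t :* b :+ n :* (a :* b :* t) := (:1 :+ n) :* (a :* b :* t)) refl A
          B ((P * ∣ s ∣) ^ n) (fromℕ n)))
        (≤-trans (double n (P * ∣ s ∣) (*-nonneg E.0≤R (abs-nonneg s)))
          (≈⇒≤ (*-congˡ (^-congˡ n (sym (*-assoc _ _ _)))))))) }
    where
    P = R ⊔ Q
    module E = Expansion (expansion-weaken ≤-refl (x≤x⊔y R Q) E)
    module F = Expansion (expansion-weaken ≤-refl (y≤x⊔y R Q) F)
    P≤2P : P ≤ (1# + 1#) * P
    P≤2P = ≤-by E.0≤R (solve 1 (λ p → p := (:1 :+ :1) :* p :- p) refl P)
    double : ∀ n X → 0# ≤ X → fromℕ (suc n) * (A * B * X ^ n) ≤ A * B * ((1# + 1#) * X) ^ n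
    double n X 0≤X = ≤-trans (*-monoʳ-≤ (*-nonneg (*-nonneg E.0≤A F.0≤A) (^-nonneg n 0≤X)) (1+n≤2^n n))
      (≈⇒≤ (trans (solve 3 (λ u c x → u :* (c :* x) := c :* (u :* x)) refl ((1# + 1#) ^ n) (A * B) (X ^ n))
        (*-congˡ (sym (^-* (1# + 1#) X n)))))

  isGerm-neg : ∀ {g} → IsGerm g → IsGerm (λ s → - g s)
  isGerm-neg {g} G = isGerm-cong (λ s → solve 1 (λ x → :- :1 :* x := :- x) refl (g s))
    (isGerm-* (isGerm-const (- 1#)) G)

  isGerm-sub : ∀ {g h} → IsGerm g → IsGerm h → IsGerm (λ s → g s - h s)
  isGerm-sub G H = isGerm-+ G (isGerm-neg H)

  -- Properties that hold near 0

  Near : (Carrier → Set) → Set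
  Near P = ∃ λ ρ → 0# < ρ × (∀ s → ∣ s ∣ < ρ → P s)

  near-∧ : ∀ {P Q : Carrier → Set} → Near P → Near Q → Near (λ s → P s × Q s)
  near-∧ (ρ , 0<ρ , p) (σ , 0<σ , q) with common-lower-bound 0<ρ 0<σ
  ... | τ , 0<τ , τ≤ρ , τ≤σ = τ , 0<τ , λ s r → p s (<-≤-trans r τ≤ρ) , q s (<-≤-trans r τ≤σ)

  near-map : ∀ {P Q : Carrier → Set} → (∀ s → P s → Q s) → Near P → Near Q
  near-map f (ρ , 0<ρ , p) = ρ , 0<ρ , λ s r → f s (p s r)

  near-all : ∀ {P : ℕ → Carrier → Set} n → (∀ k → k ℕ.< n → Near (P k)) → Near (λ s → ∀ k → k ℕ.< n → P k s)
  near-all zero p = 1# , 0<1 , λ s _ k ()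
  near-all {P} (suc n) p = near-map merge (near-∧ (p n ℕₚ.≤-refl) (near-all n λ k q → p k (ℕₚ.m≤n⇒m≤1+n q)))
    where
    merge : ∀ s → P n s × (∀ k → k ℕ.< n → P k s) → ∀ k → k ℕ.< suc n → P k s
    merge s (u , v) k q with ℕₚ.m<1+n⇒m<n∨m≡n q
    ... | inj₁ k<n = v k k<n
    ... | inj₂ ≡.refl = u

  near-small : ∀ R → Near (λ s → R * ∣ s ∣ ≤ 1#)
  near-small R = Q ⁻¹ , ⁻¹-pos 0<Q , λ s r → ≤-trans (*-monoʳ-≤ (abs-nonneg s) (≤-trans (x≤∣x∣ R)
    (≤-by 0≤1 (solve 1 (λ r → :1 := :1 :+ r :- r) refl ∣ R ∣))))
    (≤-trans (*-monoˡ-≤ (<⇒≤ 0<Q) (<⇒≤ r)) (≈⇒≤ (*-inv 0<Q)))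
    where
    Q = 1# + ∣ R ∣
    0<Q = +-pos 0<1 (abs-nonneg R)

  germ-bounded : ∀ {g} → IsGerm g → ∃ λ A → 0# ≤ A × Near (λ s → ∣ g s ∣ ≤ A)
  germ-bounded (a , A , R , E) = A , Expansion.0≤A E , near-map (Expansion.bounded-by-A E) (near-small R)

  least : (P : ℕ → Set) → ∀ n → P n → ∃ λ k → P k × (∀ j → j ℕ.< k → ¬ P j)
  least P n p with search n
    where
    search : ∀ n → (∃ λ k → P k × (∀ j → j ℕ.< k → ¬ P j)) ⊎ (∀ j → j ℕ.< n → ¬ P j)
    search zero = inj₂ λ j ()
    search (suc n) with search n
    ... | inj₁ q = inj₁ q
    ... | inj₂ q with em {P n}
    ...   | yes r = inj₁ (n , r , q)
    ...   | no r = inj₂ λ j j<1+n → [ q j , (λ { ≡.refl → r }) ]′ (ℕₚ.m<1+n⇒m<n∨m≡n j<1+n)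
  ... | inj₁ q = q
  ... | inj₂ q = n , p , q

  Vanishing : (Carrier → Carrier) → Set
  Vanishing g = Near (λ s → g s ≈ 0#)

  -- A lower bound c |s| ^ k, rather than mere nonvanishing for s ≉ 0, makes such germs
  -- uniformly bounded below away from 0 without any continuity argument.
  Nonvanishing : (Carrier → Carrier) → Set
  Nonvanishing g = ∃ λ c → ∃ λ k → 0# < c × Near (λ s → c * ∣ s ∣ ^ k ≤ ∣ g s ∣)

  -- If all coefficients vanish, the remainder bounds force `g s` below every `A * ½ ^ n` near 0.
  -- Otherwise the first nonzero coefficient dominates the rest of the series near 0.
  germ-dichotomy : ∀ {g} → IsGerm g → Vanishing g ⊎ Nonvanishing g
  germ-dichotomy {g} (a , A , R , E) with em {∃ λ k → a k ≉ 0#}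
  ... | no ¬p = inj₁ (near-map vanish (near-small ((1# + 1#) * R)))
    where
    open Expansion E
    a≈0 : ∀ k → a k ≈ 0#
    a≈0 k with em {a k ≈ 0#}
    ... | yes e = e
    ... | no e = ⊥-elim (¬p (k , e))
    vanish : ∀ s → (1# + 1#) * R * ∣ s ∣ ≤ 1# → g s ≈ 0#
    vanish s r = abs≤0⇒≈0 (≤-geometric-limit A λ n → ≤-trans
      (≈⇒≤ (abs-cong (trans (solve 1 (λ x → x := x :- :0) refl (g s))
        (+-congˡ (-‿cong (sym (pe-zero a s n λ k _ → a≈0 k)))))))
      (≤-trans (approx s (≤-trans Rs≤½ (<⇒≤ ½<1)) n)
        (≤-trans (*-monoˡ-≤ 0≤A (^-mono-≤ n (*-nonneg 0≤R (abs-nonneg s)) Rs≤½)) (≈⇒≤ (sym (+-identityˡ _))))))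
      where
      Rs≤½ : R * ∣ s ∣ ≤ ½
      Rs≤½ = *-cancelˡ-≤ 0<2 (≤-trans (≈⇒≤ (sym (*-assoc _ _ _))) (≤-trans r (≈⇒≤ (sym (*-inv 0<2)))))
  ... | yes (m , am≉0) with least (λ k → a k ≉ 0#) m am≉0
  ...   | k , ak≉0 , below = inj₂ (½ * ∣ a k ∣ , k , half-pos 0<∣ak∣ , near-map lower (near-∧ (near-small R)
    (near-small Q)))
    where
    open Expansion E
    open ≤-Reasoning
    0<∣ak∣ = abs-pos ak≉0
    -- The remainder after the leading term is at most `D * ∣ s ∣ ^ (k + 1)`; the condition
    -- `Q * ∣ s ∣ ≤ 1#` makes this at most half of the leading term.
    D = A * R ^ suc k
    Q = (½ * ∣ a k ∣) ⁻¹ * D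
    lower : ∀ s → R * ∣ s ∣ ≤ 1# × Q * ∣ s ∣ ≤ 1# → ½ * ∣ a k ∣ * ∣ s ∣ ^ k ≤ ∣ g s ∣
    lower s (r , q) = ≤-by (sub-nonneg main)
      (solve 3 (λ h t g → g :+ h :* t :- (h :+ h) :* t := g :- h :* t) refl (½ * ∣ a k ∣) (∣ s ∣ ^ k) ∣ g s ∣)
      where
      leading : pe a s (suc k) ≈ a k * s ^ k
      leading = trans (pe-snoc a s k) (trans (+-congʳ (pe-zero a s k a≈0)) (+-identityˡ _))
        where
        a≈0 : ∀ j → j ℕ.< k → a j ≈ 0#
        a≈0 j j<k with em {a j ≈ 0#}
        ... | yes e = e
        ... | no e = ⊥-elim (below j j<k e)
      D∣s∣≤ : D * ∣ s ∣ ≤ ½ * ∣ a k ∣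
      D∣s∣≤ = begin
        D * ∣ s ∣                                         ≈⟨ *-identityˡ _ ⟨
        1# * (D * ∣ s ∣)                                  ≈⟨ *-congʳ (*-inv (half-pos 0<∣ak∣)) ⟨
        ½ * ∣ a k ∣ * (½ * ∣ a k ∣) ⁻¹ * (D * ∣ s ∣)      ≈⟨ (solve 4 (λ h i d s → h :* i :* (d :* s) := h :*
          (i :* d :* s)) refl) (½ * ∣ a k ∣) ((½ * ∣ a k ∣) ⁻¹) D ∣ s ∣ ⟩
        ½ * ∣ a k ∣ * (Q * ∣ s ∣)                         ≤⟨ *-monoˡ-≤ (<⇒≤ (half-pos 0<∣ak∣)) q ⟩
        ½ * ∣ a k ∣ * 1#                                  ≈⟨ *-identityʳ _ ⟩
        ½ * ∣ a k ∣                                       ∎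
      main : (½ * ∣ a k ∣ + ½ * ∣ a k ∣) * ∣ s ∣ ^ k ≤ ∣ g s ∣ + ½ * ∣ a k ∣ * ∣ s ∣ ^ k
      main = begin
        (½ * ∣ a k ∣ + ½ * ∣ a k ∣) * ∣ s ∣ ^ k            ≈⟨ *-cong (½+½ _) (sym (abs-^ s k)) ⟩
        ∣ a k ∣ * ∣ s ^ k ∣                                ≈⟨ abs-* _ _ ⟨
        ∣ a k * s ^ k ∣                                    ≈⟨ abs-cong leading ⟨
        ∣ pe a s (suc k) ∣                                 ≈⟨ abs-cong (solve 2 (λ p g → p := g :- (g :- p)) refl
          (pe a s (suc k)) (g s)) ⟩
        ∣ g s - (g s - pe a s (suc k)) ∣                   ≤⟨ abs-triangle⁻ _ _ ⟩
        ∣ g s ∣ + ∣ g s - pe a s (suc k) ∣                 ≤⟨ +-monoʳ-≤ _ (approx s r (suc k)) ⟩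
        ∣ g s ∣ + A * (R * ∣ s ∣) ^ suc k                  ≈⟨ +-congˡ (*-congˡ (^-* R ∣ s ∣ (suc k))) ⟩
        ∣ g s ∣ + A * (R ^ suc k * ∣ s ∣ ^ suc k)          ≈⟨ +-congˡ (solve 4 (λ a r s t → a :* (r :* (s :* t)) :=
          a :* r :* s :* t) refl A (R ^ suc k) ∣ s ∣ (∣ s ∣ ^ k)) ⟩
        ∣ g s ∣ + D * ∣ s ∣ * ∣ s ∣ ^ k                    ≤⟨ +-monoʳ-≤ _ (*-monoʳ-≤ (^-nonneg k (abs-nonneg s))
          D∣s∣≤) ⟩
        ∣ g s ∣ + ½ * ∣ a k ∣ * ∣ s ∣ ^ k                  ∎

  nonvanishing-* : ∀ {g h} → Nonvanishing g → Nonvanishing h → Nonvanishing (λ s → g s * h s)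
  nonvanishing-* {g} {h} (c , k , 0<c , p) (d , l , 0<d , q) = c * d , k ℕ.+ l , *-pos 0<c 0<d , near-map
    (λ s (u , v) → ≤-trans (≈⇒≤ (trans (*-congˡ (^-homo-* ∣ s ∣ k l)) (solve 4 (λ c d x y → c :* d :* (x :* y) := c
      :* x :* (d :* y)) refl c d (∣ s ∣ ^ k) (∣ s ∣ ^ l))))
      (≤-trans (*-mono-≤ (*-nonneg (<⇒≤ 0<c) (^-nonneg k (abs-nonneg s))) (*-nonneg (<⇒≤ 0<d)
        (^-nonneg l (abs-nonneg s))) u v) (≈⇒≤ (sym (abs-* _ _)))))
    (near-∧ p q)

-- Sums of power series and their re-expansion at nearby centres.

module Series (em : ExcludedMiddle 0ℓ) (ℝ : CompleteOrderedField) where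
  open CompleteOrderedField ℝ hiding (zero)
  open RealAnalysis ℝ
  open IntegerSolver commutativeRing
  open Ordered ℝ
  open Archimedean em ℝ
  open Horner ℝ
  open Algebra.Properties.Ring ring using (-‿involutive)
  open Germs em ℝ

  converges-unique : ∀ {u x y} → ConvergesTo u x → ConvergesTo u y → x ≈ y
  converges-unique {u} {x} {y} p q = close (≤-archimedean (1# + 1#) λ ε 0<ε →
    let M , p′ = p ε 0<ε
        N , q′ = q ε 0<ε
        k = M ℕ.⊔ N in
    ≤-trans (abs-sub-triangle x (u k) y)
      (≤-trans (+-mono-≤ (≤-trans (≈⇒≤ (abs-minus-comm x (u k))) (<⇒≤ (p′ k (ℕₚ.m≤m⊔n M N))))
        (<⇒≤ (q′ k (ℕₚ.m≤n⊔m M N))))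
      (≈⇒≤ (solve 1 (λ e → e :+ e := :0 :+ (:1 :+ :1) :* e) refl ε))))
    where
    close : ∣ x - y ∣ ≤ 0# → x ≈ y
    close r = trans (solve 2 (λ x y → x := (x :- y) :+ y) refl x y) (trans (+-congʳ (abs≤0⇒≈0 r)) (+-identityˡ y))

  geometric-converges : ∀ {u x} C → (∀ n → ∣ u (suc n) - x ∣ ≤ C * ½ ^ n) → ConvergesTo u x
  geometric-converges {u} {x} C p ε 0<ε = suc N , close
    where
    C⁺ = ∣ C ∣
    N = proj₁ (geometric-small C⁺ 0<ε)
    close : ∀ n → suc N ℕ.≤ n → ∣ u n - x ∣ < ε
    close (suc n) (ℕ.s≤s q) = ≤-<-trans (p n) (≤-<-trans (*-monoʳ-≤ (^-nonneg n 0≤½) (x≤∣x∣ C))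
      (≤-<-trans (*-monoˡ-≤ (abs-nonneg C) (^-antiʳ-≤ 0≤½ (<⇒≤ ½<1) q)) (proj₂ (geometric-small C⁺ 0<ε))))

  monotone : ∀ {u : ℕ → Carrier} → (∀ n → u n ≤ u (suc n)) → ∀ {m n} → m ℕ.≤ n → u m ≤ u n
  monotone {u} p {n = zero} ℕ.z≤n = ≤-refl
  monotone {u} p {m} {suc n} q with ℕₚ.m≤n⇒m<n∨m≡n q
  ... | inj₁ (ℕ.s≤s r) = ≤-trans (monotone p r) (p n)
  ... | inj₂ ≡.refl = ≤-refl

  -- For `θ ≤ ½` the tail from index `n` is at most `w n = 2 A θ ^ n`, so the intervals of radius
  -- `w n` around the partial sums are nested and share a point.
  series-limit : ∀ {a A R s} → 0# ≤ A → 0# ≤ R → Bounded a A R → R * ∣ s ∣ ≤ ½ →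
    ∃ λ y → ∀ n → ∣ y - pe a s n ∣ ≤ (1# + 1#) * A * (R * ∣ s ∣) ^ n
  series-limit {a} {A} {R} {s} 0≤A 0≤R b Rs≤½ = y , λ n → abs-least
      (≤-by (sub-nonneg (proj₂ (proj₂ lim n))) (solve 3 (λ y p w → p :+ w :- y := w :- (y :- p)) refl y (pe a s n)
        (w n)))
      (≤-by (sub-nonneg (proj₁ (proj₂ lim n))) (solve 3 (λ y p w → y :- (p :- w) := w :- :- (y :- p)) refl y
        (pe a s n) (w n)))
    where
    θ = R * ∣ s ∣
    0≤θ = *-nonneg 0≤R (abs-nonneg s)
    w l u : ℕ → Carrier
    w n = (1# + 1#) * A * θ ^ n
    l n = pe a s n - w n
    u n = pe a s n + w n
    term : ∀ n → ∣ a n * s ^ n ∣ ≤ A * θ ^ n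
    term n = ≤-trans (abs-*-≤ (b n) (≈⇒≤ (abs-^ s n))) (≈⇒≤ (trans (*-assoc _ _ _) (*-congˡ (sym (^-* R ∣ s ∣ n)))))
    shrink : ∀ n → A * θ ^ n ≤ w n - w (suc n)
    shrink n = ≤-by (*-nonneg (*-nonneg 0≤A (^-nonneg n 0≤θ))
        (+-nonneg (sub-nonneg Rs≤½) (sub-nonneg Rs≤½)))
      (trans (solve 4 (λ a t h q → a :* t :* ((h :- q) :+ (h :- q)) := (:1 :+ :1) :* a :* t :* (h :* :1) :-
        (:1 :+ :1) :* a :* (q :* t)) refl A (θ ^ n) ½ θ)
        (trans (+-congʳ (trans (solve 3 (λ a t h → (:1 :+ :1) :* a :* t :* (h :* :1) := a :* t :* (h :* :1 :+ h :*
          :1)) refl A (θ ^ n) ½) (*-congˡ (½+½ 1#))))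
        (solve 3 (λ a t q → a :* t :* :1 :- (:1 :+ :1) :* a :* (q :* t) := (:1 :+ :1) :* a :* t :- (:1 :+ :1) :* a
          :* (q :* t) :- a :* t) refl A (θ ^ n) θ)))
    l-step : ∀ n → l n ≤ l (suc n)
    l-step n = ≤-trans (≤-by (+-nonneg (sub-nonneg (≤-trans (≤-trans (-x≤∣x∣ (a n * s ^ n)) (term n)) (shrink n)))
      ≤-refl)
        (solve 4 (λ p t w v → w :- v :- :- t :+ :0 := (p :+ t :- v) :- (p :- w)) refl (pe a s n) (a n * s ^ n)
          (w n) (w (suc n))))
      (≈⇒≤ (+-congʳ (sym (pe-snoc a s n))))
    u-step : ∀ n → u (suc n) ≤ u n
    u-step n = ≤-trans (≈⇒≤ (+-congʳ (pe-snoc a s n)))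
      (≤-by (sub-nonneg (≤-trans (≤-trans (x≤∣x∣ (a n * s ^ n)) (term n)) (shrink n)))
        (solve 4 (λ p t w v → w :- v :- t := (p :+ w) :- (p :+ t :+ v)) refl (pe a s n) (a n * s ^ n) (w n)
          (w (suc n))))
    l≤u : ∀ n → l n ≤ u n
    l≤u n = ≤-by (+-nonneg 0≤w 0≤w) (solve 2 (λ p w → w :+ w := (p :+ w) :- (p :- w)) refl (pe a s n) (w n))
      where 0≤w = *-nonneg (*-nonneg (<⇒≤ 0<2) 0≤A) (^-nonneg n 0≤θ)
    lim = nested-intervals l u λ m n → ≤-trans (monotone l-step (ℕₚ.m≤m⊔n m n)) (≤-trans (l≤u (m ℕ.⊔ n))
      (≤-resp (-‿involutive _) (-‿involutive _) (neg-mono-≤ (monotone {u = λ k → - u k} (λ k → neg-mono-≤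
        (u-step k)) (ℕₚ.m≤n⊔m m n)))))
    y = proj₁ lim

  -- Made total by excluded middle, with value `0#` where the series diverges, so that it is a
  -- function of `s` to which germ statements apply.
  sum-of : Sequence → Carrier → Carrier
  sum-of a s with em {∃ (ConvergesTo (pe a s))}
  ... | yes (y , _) = y
  ... | no _ = 0#

  sum-of-converges : ∀ {a s y} → ConvergesTo (pe a s) y → y ≈ sum-of a s
  sum-of-converges {a} {s} {y} p with em {∃ (ConvergesTo (pe a s))}
  ... | yes (z , q) = converges-unique p q
  ... | no q = ⊥-elim (q (y , p))

  sum-of-unique : ∀ {a s y} C → (∀ n → ∣ pe a s (suc n) - y ∣ ≤ C * ½ ^ n) → y ≈ sum-of a s
  sum-of-unique C p = sum-of-converges (geometric-converges C p)

  sum-of-approx : ∀ {a A R s} → 0# ≤ A → 0# ≤ R → Bounded a A R → R * ∣ s ∣ ≤ ½ →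
    ∀ n → ∣ sum-of a s - pe a s n ∣ ≤ (1# + 1#) * A * (R * ∣ s ∣) ^ n
  sum-of-approx {a} {A} {R} {s} 0≤A 0≤R b Rs≤½ n = ≤-trans
    (≈⇒≤ (abs-cong (+-congʳ (sym (sum-of-unique _ λ k → ≤-trans (≈⇒≤ (abs-minus-comm _ _))
      (≤-trans (p (suc k)) (*-monoˡ-≤ 0≤2A (≤-trans (^-mono-≤ (suc k) 0≤Rs Rs≤½) (half-≤ (^-nonneg k 0≤½))))))))))
      (p n)
    where
    lim = series-limit {a} {A} {R} {s} 0≤A 0≤R b Rs≤½
    p = proj₂ lim
    0≤2A = *-nonneg (<⇒≤ 0<2) 0≤A
    0≤Rs = *-nonneg 0≤R (abs-nonneg s)

  sum-of-bound : ∀ {a A R s} → 0# ≤ A → 0# ≤ R → Bounded a A R → R * ∣ s ∣ ≤ ½ → ∣ sum-of a s ∣ ≤ (1# + 1#) * A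
  sum-of-bound {a} {A} {R} {s} 0≤A 0≤R b p = ≤-trans (≈⇒≤ (abs-cong (solve 1 (λ x → x := x :- :0) refl
    (sum-of a s))))
    (≤-trans (sum-of-approx 0≤A 0≤R b p 0) (≈⇒≤ (*-identityʳ _)))

  sum-of-step : ∀ {a A R s} → 0# ≤ A → 0# ≤ R → Bounded a A R → R * ∣ s ∣ ≤ ½ →
    sum-of a s ≈ a 0 + s * sum-of (tail a) s
  sum-of-step {a} {A} {R} {s} 0≤A 0≤R b p = sym (sum-of-unique (∣ s ∣ * ((1# + 1#) * (A * R))) λ n →
    ≤-trans (≈⇒≤ (abs-cong (solve 4 (λ x s u v → x :+ s :* u :- (x :+ s :* v) := s :* :- (v :- u)) refl (a 0) s
      (pe (tail a) s n) (sum-of (tail a) s))))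
    (≤-trans (abs-*-≤ ≤-refl (≤-trans (≈⇒≤ (abs-neg _)) (≤-trans (sum-of-approx 0≤AR 0≤R (bounded-tail b) p n)
      (*-monoˡ-≤ (*-nonneg (<⇒≤ 0<2) 0≤AR) (^-mono-≤ n (*-nonneg 0≤R (abs-nonneg s)) p)))))
    (≈⇒≤ (sym (*-assoc _ _ _)))))
    where 0≤AR = *-nonneg 0≤A 0≤R

  -- Hasse derivatives: hasse k a n = C(n + k, k) a (n + k), by Pascal's rule.
  hasse : ℕ → Sequence → Sequence
  hasse zero a n = a n
  hasse (suc k) a zero = hasse k (tail a) zero
  hasse (suc k) a (suc n) = hasse (suc k) (tail a) n + hasse k (tail a) (suc n)

  -- The binomial coefficient `C(n + k, k)` is at most `2 ^ (n + k)`, which turns `R` into `2 R`;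
  -- the induction follows Pascal's rule.
  hasse-bound : ∀ k n {a A R} → 0# ≤ A → 0# ≤ R → Bounded a A R →
    ∣ hasse k a n ∣ ≤ A * ((1# + 1#) * R) ^ k * ((1# + 1#) * R) ^ n
  hasse-bound zero n {A = A} 0≤A 0≤R b = ≤-trans (b n) (*-mono-≤ 0≤A (^-nonneg n 0≤R) (≈⇒≤ (sym (*-identityʳ A)))
    (^-mono-≤ n 0≤R (≤-by 0≤R (solve 1 (λ r → r := (:1 :+ :1) :* r :- r) refl _))))
  hasse-bound (suc k) zero {A = A} {R} 0≤A 0≤R b = ≤-trans (hasse-bound k zero (*-nonneg 0≤A 0≤R) 0≤R (bounded-tail
    b))
    (≤-by (*-nonneg 0≤A (*-nonneg 0≤R (^-nonneg k (*-nonneg (<⇒≤ 0<2) 0≤R))))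
      (solve 3 (λ a r u → a :* (r :* u) := a :* ((:1 :+ :1) :* r :* u) :* :1 :- a :* r :* u :* :1) refl A R
        (((1# + 1#) * R) ^ k)))
  hasse-bound (suc k) (suc n) {A = A} {R} 0≤A 0≤R b = ≤-trans
    (abs-+-≤ (hasse-bound (suc k) n (*-nonneg 0≤A 0≤R) 0≤R (bounded-tail b)) (hasse-bound k (suc n) (*-nonneg 0≤A
      0≤R) 0≤R (bounded-tail b)))
    (≈⇒≤ (solve 4 (λ a r u v → a :* r :* ((:1 :+ :1) :* r :* u) :* v :+ a :* r :* u :* ((:1 :+ :1) :* r :* v) := a
      :* ((:1 :+ :1) :* r :* u) :* ((:1 :+ :1) :* r :* v)) refl
      A R (((1# + 1#) * R) ^ k) (((1# + 1#) * R) ^ n)))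

  module Taylor {R : Carrier} (1≤R : 1# ≤ R) where

    private
      0≤R = ≤-trans 0≤1 1≤R
      2R = (1# + 1#) * R
      0≤2R = *-nonneg (<⇒≤ 0<2) 0≤R
      4R = (1# + 1#) * 2R
      0≤4R = *-nonneg (<⇒≤ 0<2) 0≤2R
      double-≥ : ∀ {x} → 0# ≤ x → x ≤ (1# + 1#) * x
      double-≥ {x} 0≤x = ≤-by 0≤x (solve 1 (λ x → x := (:1 :+ :1) :* x :- x) refl x)

      halve : ∀ {x s} → (1# + 1#) * x * ∣ s ∣ ≤ 1# → x * ∣ s ∣ ≤ ½
      halve {x} {s} p = *-cancelˡ-≤ 0<2 (≤-trans (≈⇒≤ (sym (*-assoc _ _ _))) (≤-trans p (≈⇒≤ (sym (*-inv 0<2)))))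

      2R≤½ : ∀ {s} → 4R * ∣ s ∣ ≤ 1# → 2R * ∣ s ∣ ≤ ½
      2R≤½ {s} = halve {2R} {s}

      R≤½ : ∀ {s} → 4R * ∣ s ∣ ≤ 1# → R * ∣ s ∣ ≤ ½
      R≤½ {s} p = ≤-trans (*-monoʳ-≤ (abs-nonneg s) (double-≥ 0≤R)) (2R≤½ p)

    sum-small : ∀ {s t} → 4R * ∣ s ∣ ≤ 1# → 4R * ∣ t ∣ ≤ 1# → R * ∣ s + t ∣ ≤ ½
    sum-small {s} {t} p q = *-cancelˡ-≤ 0<2 (≤-trans (*-monoˡ-≤ (<⇒≤ 0<2) (*-monoˡ-≤ 0≤R (abs-triangle s t)))
      (≤-trans (≈⇒≤ (solve 3 (λ r s t → (:1 :+ :1) :* (r :* (s :+ t)) := (:1 :+ :1) :* r :* s :+ (:1 :+ :1) :* r :*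
        t) refl R ∣ s ∣ ∣ t ∣))
      (≤-trans (+-mono-≤ (2R≤½ p) (2R≤½ q)) (≈⇒≤ (solve 1 (λ h → h :+ h := (:1 :+ :1) :* h) refl ½)))))

    hasse-expansion : ∀ k {a A} → 0# ≤ A → Bounded a A R →
      Expansion (sum-of (hasse k a)) (hasse k a) ((1# + 1#) * (A * 2R ^ k)) 4R
    hasse-expansion k {a} {A} 0≤A b = record
      { 0≤A = *-nonneg (<⇒≤ 0<2) 0≤B
      ; 1≤R = ≤-trans 1≤R (≤-trans (double-≥ 0≤R) (double-≥ 0≤2R))
      ; coeffs = bounded-weaken 0≤B 0≤2R (double-≥ 0≤B) (double-≥ 0≤2R) (λ n → hasse-bound k n 0≤A 0≤R b)
      ; approx = λ s p n → ≤-trans (sum-of-approx 0≤B 0≤2R (λ n → hasse-bound k n 0≤A 0≤R b) (2R≤½ p) n)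
          (*-monoˡ-≤ (*-nonneg (<⇒≤ 0<2) 0≤B) (^-mono-≤ n (*-nonneg 0≤2R (abs-nonneg s)) (*-monoʳ-≤ (abs-nonneg s)
            (double-≥ 0≤2R))))
      }
      where 0≤B = *-nonneg 0≤A (^-nonneg k 0≤2R)

    hasse-sum-bound : ∀ k {a A s} → 0# ≤ A → Bounded a A R → 4R * ∣ s ∣ ≤ 1# →
      ∣ sum-of (hasse k a) s ∣ ≤ (1# + 1#) * (A * 2R ^ k)
    hasse-sum-bound k {s = s} 0≤A b p = Expansion.bounded-by-A (hasse-expansion k 0≤A b) s p

    private
      -- The Leibniz rule for the Hasse derivative of order `k + 1`, applied to `x ↦ a 0 + x * g x`
      -- with `g` the sum of the tail.
      hasse-sum-step : ∀ k {a A s} → 0# ≤ A → Bounded a A R → 4R * ∣ s ∣ ≤ 1# →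
        sum-of (hasse (suc k) a) s ≈ s * sum-of (hasse (suc k) (tail a)) s + sum-of (hasse k (tail a)) s
      hasse-sum-step k {a} {A} {s} 0≤A b p = sym (sum-of-unique (∣ s ∣ * C + D) λ n → ≤-trans
        (≈⇒≤ (abs-cong (trans (+-congʳ (pe-split n))
          (solve 5 (λ s u v x y → s :* u :+ v :- (s :* x :+ y) := s :* :- (x :- u) :+ :- (y :- v)) refl s
            (pe (hasse (suc k) (tail a)) s n) (pe (hasse k (tail a)) s (suc n)) (sum-of (hasse (suc k) (tail a)) s)
              (sum-of (hasse k (tail a)) s)))))
        (≤-trans (abs-+-≤ (abs-*-≤ ≤-refl (≤-trans (≈⇒≤ (abs-neg _)) (≤-trans (approx′ (suc k) n)
          (*-monoˡ-≤ (0≤C (suc k)) (pow n)))))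
            (≤-trans (≈⇒≤ (abs-neg _)) (≤-trans (approx′ k (suc n)) (*-monoˡ-≤ (0≤C k) (≤-trans (pow (suc n))
              (half-≤ (^-nonneg n 0≤½)))))))
          (≈⇒≤ (solve 4 (λ s c d h → s :* (c :* h) :+ d :* h := (s :* c :+ d) :* h) refl ∣ s ∣ C D (½ ^ n)))))
        where
        C = (1# + 1#) * (A * R * 2R ^ suc k)
        D = (1# + 1#) * (A * R * 2R ^ k)
        0≤C : ∀ k → 0# ≤ (1# + 1#) * (A * R * 2R ^ k)
        0≤C k = *-nonneg (<⇒≤ 0<2) (*-nonneg (*-nonneg 0≤A 0≤R) (^-nonneg k 0≤2R))
        approx′ : ∀ k n → ∣ sum-of (hasse k (tail a)) s - pe (hasse k (tail a)) s n ∣ ≤ (1# + 1#) * (A * R * 2R ^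
          k) * (2R * ∣ s ∣) ^ n
        approx′ k = sum-of-approx (*-nonneg (*-nonneg 0≤A 0≤R) (^-nonneg k 0≤2R)) 0≤2R
          (λ n → hasse-bound k n (*-nonneg 0≤A 0≤R) 0≤R (bounded-tail b)) (2R≤½ p)
        pow : ∀ n → (2R * ∣ s ∣) ^ n ≤ ½ ^ n
        pow n = ^-mono-≤ n (*-nonneg 0≤2R (abs-nonneg s)) (2R≤½ p)
        pe-split : ∀ n → pe (hasse (suc k) a) s (suc n) ≈ s * pe (hasse (suc k) (tail a)) s n + pe
          (hasse k (tail a)) s (suc n)
        pe-split n = trans (+-congˡ (*-congˡ (pe-+ (hasse (suc k) (tail a)) (tail (hasse k (tail a))) s n)))
          (solve 4 (λ x s u v → x :+ s :* (u :+ v) := s :* u :+ (x :+ s :* v)) refl (hasse k (tail a) zero) s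
            (pe (hasse (suc k) (tail a)) s n) (pe (tail (hasse k (tail a))) s n))

      module _ {s t : Carrier} (p : 4R * ∣ s ∣ ≤ 1#) (q : 4R * ∣ t ∣ ≤ 1#) where

        remainder : ℕ → Sequence → Carrier
        remainder n a = sum-of a (s + t) - pe (λ k → sum-of (hasse k a) s) t n

        -- Writing the sum as `a 0 + x * g x`, the Leibniz recursion passes to the remainders; the
        -- order drops only in the term that carries a factor `t`.
        remainder-step : ∀ n {a A} → 0# ≤ A → Bounded a A R →
          remainder (suc n) a ≈ s * remainder (suc n) (tail a) + t * remainder n (tail a)
        remainder-step n {a} {A} 0≤A b = trans
          (+-cong (sum-of-step 0≤A 0≤R b (sum-small p q))
            (-‿cong (+-cong (sum-of-step 0≤A 0≤R b (R≤½ p))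
              (*-congˡ (trans (pe-congˡ n (λ k → hasse-sum-step k 0≤A b p))
                (trans (pe-+ (λ k → s * sum-of (hasse (suc k) (tail a)) s) (λ k → sum-of (hasse k (tail a)) s) t n)
                  (+-congʳ (pe-scale s (λ k → sum-of (hasse (suc k) (tail a)) s) t n))))))))
          (solve 7 (λ x s t z y u v → x :+ (s :+ t) :* z :- (x :+ s :* y :+ t :* (s :* u :+ v)) := s :*
            (z :- (y :+ t :* u)) :+ t :* (z :- v)) refl
            (a 0) s t (sum-of (tail a) (s + t)) (sum-of (tail a) s)
            (pe (λ k → sum-of (hasse (suc k) (tail a)) s) t n) (pe (λ k → sum-of (hasse k (tail a)) s) t n))

        K : ℕ → Carrier
        K n = (1# + 1#) + pe (λ k → (1# + 1#) * 2R ^ k) ∣ t ∣ n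

        0≤K : ∀ n → 0# ≤ K n
        0≤K n = +-nonneg (<⇒≤ 0<2) (pe-nonneg n (λ k → *-nonneg (<⇒≤ 0<2) (^-nonneg k 0≤2R)) (abs-nonneg t))

        remainder-crude : ∀ n {a A} → 0# ≤ A → Bounded a A R → ∣ remainder n a ∣ ≤ A * K n
        remainder-crude n {a} {A} 0≤A b = ≤-trans (abs-triangle⁻ _ _)
          (≤-trans (+-mono-≤ (sum-of-bound 0≤A 0≤R b (sum-small p q))
             (pe-abs {b = λ k → A * ((1# + 1#) * 2R ^ k)} n
               (λ k _ → ≤-trans (hasse-sum-bound k 0≤A b p) (≈⇒≤ (solve 2 (λ x y → (:1 :+ :1) :* (x :* y) := x :*
                 ((:1 :+ :1) :* y)) refl A (2R ^ k)))) ≤-refl))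
            (≈⇒≤ (trans (+-congˡ (pe-scale A (λ k → (1# + 1#) * 2R ^ k) ∣ t ∣ n))
              (solve 2 (λ a x → (:1 :+ :1) :* a :+ a :* x := a :* ((:1 :+ :1) :+ x)) refl A
                (pe (λ k → (1# + 1#) * 2R ^ k) ∣ t ∣ n)))))

        -- The recursion loses a factor R |s| ≤ ½ on the unknown remainder, so iterating it
        -- removes the crude bound.
        remainder-bound : ∀ n {a A} → 0# ≤ A → Bounded a A R → ∣ remainder n a ∣ ≤ (1# + 1#) * A * (2R * ∣ t ∣) ^ n
        remainder-bound zero {a} {A} 0≤A b = ≤-trans (≈⇒≤ (abs-cong (solve 1 (λ x → x :- :0 := x) refl
          (sum-of a (s + t)))))
          (≤-trans (sum-of-bound 0≤A 0≤R b (sum-small p q)) (≈⇒≤ (sym (*-identityʳ _))))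
        remainder-bound (suc n) {a} {A} 0≤A b = ≤-geometric-limit (A * K (suc n)) λ j → iterate j 0≤A b
          where
          W = (2R * ∣ t ∣) ^ n
          iterate : ∀ j {a A} → 0# ≤ A → Bounded a A R →
            ∣ remainder (suc n) a ∣ ≤ (1# + 1#) * A * (2R * ∣ t ∣ * W) + A * K (suc n) * ½ ^ j
          iterate zero {a} {A} 0≤A b = ≤-trans (remainder-crude (suc n) 0≤A b)
            (≤-by (*-nonneg (*-nonneg (<⇒≤ 0<2) 0≤A) (^-nonneg (suc n) (*-nonneg 0≤2R (abs-nonneg t))))
              (solve 2 (λ x y → x := x :+ y :* :1 :- y) refl ((1# + 1#) * A * (2R * ∣ t ∣ * W)) (A * K (suc n))))
          iterate (suc j) {a} {A} 0≤A b = ≤-trans (≈⇒≤ (abs-cong (remainder-step n 0≤A b)))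
            (≤-trans (abs-+-≤ (abs-*-≤ ≤-refl (iterate j 0≤AR (bounded-tail b))) (abs-*-≤ ≤-refl (remainder-bound n
              0≤AR (bounded-tail b))))
            (≤-trans (≈⇒≤ (solve 7 (λ s r a t w k h → s :* ((:1 :+ :1) :* (a :* r) :* ((:1 :+ :1) :* r :* t :* w)
              :+ a :* r :* k :* h) :+ t :* ((:1 :+ :1) :* (a :* r) :* w) := r :* s :* ((:1 :+ :1) :* a :*
              ((:1 :+ :1) :* r :* t :* w) :+ a :* k :* h) :+ a :* ((:1 :+ :1) :* r :* t :* w)) refl
                (∣ s ∣) R A (∣ t ∣) W (K (suc n)) (½ ^ j)))
            (≤-trans (+-monoˡ-≤ _ (*-monoʳ-≤ (+-nonneg (*-nonneg (*-nonneg (<⇒≤ 0<2) 0≤A) 0≤T)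
              (*-nonneg (*-nonneg 0≤A (0≤K (suc n))) (^-nonneg j 0≤½))) (R≤½ p)))
            (≈⇒≤ (trans (solve 5 (λ h a t u v → h :* ((:1 :+ :1) :* a :* t :+ u :* v) :+ a :* t := (h :* (a :* t)
              :+ h :* (a :* t)) :+ a :* t :+ u :* (h :* v)) refl ½ A (2R * ∣ t ∣ * W) (A * K (suc n)) (½ ^ j))
              (+-congʳ (trans (+-congʳ (½+½ _)) (solve 2 (λ a t → a :* t :+ a :* t := (:1 :+ :1) :* a :* t) refl A
                (2R * ∣ t ∣ * W)))))))))
            where
            0≤AR = *-nonneg 0≤A 0≤R
            0≤T = ^-nonneg (suc n) (*-nonneg 0≤2R (abs-nonneg t))

    -- The constants do not depend on the centre `s`. This uniformity is what allows Padé
    -- approximants at different centres to be compared.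
    taylor : ∀ {a A s} → 0# ≤ A → Bounded a A R → 4R * ∣ s ∣ ≤ 1# →
      Expansion (λ t → sum-of a (s + t)) (λ k → sum-of (hasse k a) s) ((1# + 1#) * A) 4R
    taylor {a} {A} {s} 0≤A b p = record
      { 0≤A = *-nonneg (<⇒≤ 0<2) 0≤A
      ; 1≤R = ≤-trans 1≤R (≤-trans (double-≥ 0≤R) (double-≥ 0≤2R))
      ; coeffs = λ k → ≤-trans (hasse-sum-bound k 0≤A b p) (≤-trans (≈⇒≤ (sym (*-assoc _ _ _)))
          (*-monoˡ-≤ (*-nonneg (<⇒≤ 0<2) 0≤A) (^-mono-≤ k 0≤2R (double-≥ 0≤2R))))
      ; approx = λ t q n → ≤-trans (remainder-bound p q n 0≤A b)
          (*-monoˡ-≤ (*-nonneg (<⇒≤ 0<2) 0≤A) (^-mono-≤ n (*-nonneg 0≤2R (abs-nonneg t)) (*-monoʳ-≤ (abs-nonneg t)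
            (double-≥ 0≤2R))))
      }

-- Elimination over the ring of germs.

module LinearAlgebra (em : ExcludedMiddle 0ℓ) (ℝ : CompleteOrderedField) where
  open CompleteOrderedField ℝ hiding (zero)
  open RealAnalysis ℝ
  open IntegerSolver commutativeRing
  open Ordered ℝ
  open Archimedean em ℝ
  open Horner ℝ
  open Germs em ℝ

  dot : Sequence → Sequence → ℕ → Carrier
  dot x w zero    = 0#
  dot x w (suc n) = x 0 * w 0 + dot (tail x) (tail w) n

  dot-cong : ∀ {x y v w} n → (∀ k → k ℕ.< n → x k * v k ≈ y k * w k) → dot x v n ≈ dot y w n
  dot-cong zero p = refl
  dot-cong (suc n) p = +-cong (p 0 (ℕ.s≤s ℕ.z≤n)) (dot-cong n λ k q → p (suc k) (ℕ.s≤s q))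

  dot-zero : ∀ {x w} n → (∀ k → k ℕ.< n → x k * w k ≈ 0#) → dot x w n ≈ 0#
  dot-zero zero p = refl
  dot-zero (suc n) p = trans (+-cong (p 0 (ℕ.s≤s ℕ.z≤n)) (dot-zero n λ k q → p (suc k) (ℕ.s≤s q))) (+-identityˡ 0#)

  dot-combine : ∀ π α x y w n → dot (λ j → π * x j - α * y j) w n ≈ π * dot x w n - α * dot y w n
  dot-combine π α x y w zero = solve 2 (λ π α → :0 := π :* :0 :- α :* :0) refl π α
  dot-combine π α x y w (suc n) = trans (+-congˡ (dot-combine π α (tail x) (tail y) (tail w) n))
    (solve 7 (λ p a x y w u v → (p :* x :- a :* y) :* w :+ (p :* u :- a :* v) := p :* (x :* w :+ u) :- a :*
      (y :* w :+ v)) refl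
      π α (x 0) (y 0) (w 0) (dot (tail x) (tail w) n) (dot (tail y) (tail w) n))

  dot-scale : ∀ π x w n → dot x (λ j → π * w j) n ≈ π * dot x w n
  dot-scale π x w zero = sym (zeroʳ π)
  dot-scale π x w (suc n) = trans (+-congˡ (dot-scale π (tail x) (tail w) n))
    (solve 4 (λ p x w u → x :* (p :* w) :+ p :* u := p :* (x :* w :+ u)) refl π (x 0) (w 0) (dot (tail x) (tail w)
      n))

  dot-bound : ∀ {x w δ b c} n → (∀ k → k ℕ.< n → ∣ x k ∣ ≤ b) → (∀ k → k ℕ.< n → ∣ δ * w k ∣ ≤ c) →
    ∣ δ * dot x w n ∣ ≤ fromℕ n * (b * c)
  dot-bound {δ = δ} zero p q = ≈⇒≤ (trans (abs-cong (zeroʳ δ)) (trans abs-0 (sym (zeroˡ _))))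
  dot-bound {x} {w} {δ} {b} {c} (suc n) p q = ≤-trans
    (≈⇒≤ (abs-cong (solve 4 (λ d x w u → d :* (x :* w :+ u) := x :* (d :* w) :+ d :* u) refl δ (x 0) (w 0)
      (dot (tail x) (tail w) n))))
    (≤-trans (abs-+-≤ (abs-*-≤ (p 0 (ℕ.s≤s ℕ.z≤n)) (q 0 (ℕ.s≤s ℕ.z≤n)))
        (dot-bound n (λ k r → p (suc k) (ℕ.s≤s r)) (λ k r → q (suc k) (ℕ.s≤s r))))
      (≈⇒≤ (solve 2 (λ x n → x :+ n :* x := (:1 :+ n) :* x) refl (b * c) (fromℕ n))))

  isGerm-dot : ∀ {x w : ℕ → Carrier → Carrier} n → (∀ k → IsGerm (x k)) → (∀ k → IsGerm (w k)) →
    IsGerm (λ s → dot (λ k → x k s) (λ k → w k s) n)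
  isGerm-dot zero p q = isGerm-const 0#
  isGerm-dot (suc n) p q = isGerm-+ (isGerm-* (p 0) (q 0)) (isGerm-dot n (λ k → p (suc k)) (λ k → q (suc k)))

  germs-bounded : ∀ {g : ℕ → Carrier → Carrier} n → (∀ k → IsGerm (g k)) →
    ∃ λ A → 0# ≤ A × Near (λ s → ∀ k → k ℕ.< n → ∣ g k s ∣ ≤ A)
  germs-bounded zero p = 0# , ≤-refl , 1# , 0<1 , λ s _ k ()
  germs-bounded {g} (suc n) p = combine (germ-bounded (p n)) (germs-bounded n p)
    where
    combine : (∃ λ A → 0# ≤ A × Near (λ s → ∣ g n s ∣ ≤ A)) →
      (∃ λ A → 0# ≤ A × Near (λ s → ∀ k → k ℕ.< n → ∣ g k s ∣ ≤ A)) →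
      ∃ λ A → 0# ≤ A × Near (λ s → ∀ k → k ℕ.< suc n → ∣ g k s ∣ ≤ A)
    combine (A , 0≤A , u) (B , 0≤B , v) = A ⊔ B , ≤-trans 0≤A (x≤x⊔y A B) , near-map merge (near-∧ u v)
     where
     merge : ∀ s → ∣ g n s ∣ ≤ A × (∀ k → k ℕ.< n → ∣ g k s ∣ ≤ B) → ∀ k → k ℕ.< suc n → ∣ g k s ∣ ≤ A ⊔ B
     merge s (x , y) k q with ℕₚ.m<1+n⇒m<n∨m≡n q
     ... | inj₁ k<n = ≤-trans (y k k<n) (y≤x⊔y A B)
     ... | inj₂ ≡.refl = ≤-trans x (x≤x⊔y A B)

  Matrix : Set
  Matrix = ℕ → ℕ → Carrier → Carrier

  Degenerate : Matrix → ℕ → ℕ → Set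
  Degenerate M m n = Σ (ℕ → Carrier → Carrier) λ v →
    (∀ i → IsGerm (v i)) × (∃ λ i → i ℕ.< n × Nonvanishing (v i)) ×
    Near (λ s → ∀ r → r ℕ.< m → dot (λ i → M r i s) (λ i → v i s) n ≈ 0#)

  -- Quantitative injectivity: up to the factor `δ`, which arises as a product of pivots, a vector
  -- is controlled by its image. The germ `δ` may vanish at 0, so `w` itself is bounded only away
  -- from 0.
  Nondegenerate : Matrix → ℕ → ℕ → Set
  Nondegenerate M m n = Σ (Carrier → Carrier) λ δ → ∃ λ C →
    IsGerm δ × Nonvanishing δ × 0# ≤ C ×
    Near (λ s → ∀ w η → (∀ r → r ℕ.< m → ∣ dot (λ i → M r i s) w n ∣ ≤ η) →
                 ∀ i → i ℕ.< n → ∣ δ s * w i ∣ ≤ C * η)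

  private
    search : ∀ {P Q : ℕ → Set} m → (∀ r → P r ⊎ Q r) → (∀ r → r ℕ.< m → P r) ⊎ (∃ λ r → r ℕ.< m × Q r)
    search zero d = inj₁ λ r ()
    search {P} (suc m) d with d m | search m d
    ... | inj₂ q | _ = inj₂ (m , ℕₚ.≤-refl , q)
    ... | inj₁ p | inj₂ (r , r<m , q) = inj₂ (r , ℕₚ.m≤n⇒m≤1+n r<m , q)
    ... | inj₁ p | inj₁ ps = inj₁ λ r r<1+m → [ ps r , (λ { ≡.refl → p }) ]′ (ℕₚ.m<1+n⇒m<n∨m≡n r<1+m)

    nonvanishing-one : Nonvanishing (λ _ → 1#)
    nonvanishing-one = 1# , 0 , 0<1 , 1# , 0<1 , λ s _ → ≤-trans (≈⇒≤ (*-identityʳ 1#)) (x≤∣x∣ 1#)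

  -- Fraction-free Gaussian elimination over the ring of germs.
  degenerate-or-not : ∀ n m (M : Matrix) → (∀ r i → IsGerm (M r i)) → Degenerate M m n ⊎ Nondegenerate M m n
  degenerate-or-not zero m M G = inj₂ ((λ _ → 1#) , 0# , isGerm-const 1# , nonvanishing-one , ≤-refl , 1# , 0<1 , λ
    s _ w η _ i ())
  degenerate-or-not (suc n) m M G with search m (λ r → germ-dichotomy (G r 0))
  -- No entry of the first column can serve as pivot, so the first unit vector lies in the kernel
  -- near 0.
  ... | inj₁ all-vanish = inj₁ (v , germ , (0 , ℕ.s≤s ℕ.z≤n , nonvanishing-one) , near-map kernel
    (near-all m all-vanish))
    where
    v : ℕ → Carrier → Carrier
    v i s = constant 1# i
    germ : ∀ i → IsGerm (v i)
    germ i = isGerm-const (constant 1# i)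
    kernel : ∀ s → (∀ r → r ℕ.< m → M r 0 s ≈ 0#) → ∀ r → r ℕ.< m → dot (λ i → M r i s) (λ i → v i s) (suc n) ≈ 0#
    kernel s p r r<m = dot-zero {λ i → M r i s} {λ i → v i s} (suc n)
      λ { zero _ → trans (*-congʳ (p r r<m)) (zeroˡ _) ; (suc k) _ → zeroʳ _ }
  ... | inj₂ (p , p<m , π≢0) = eliminate (degenerate-or-not n m M′ G′)
    where
    π : Carrier → Carrier
    π = M p 0
    M′ : Matrix
    -- Cross-multiplication instead of division: the pivot may vanish at 0, and its inverse need not
    -- be a germ.
    M′ r j s = π s * M r (suc j) s - M r 0 s * M p (suc j) s
    G′ : ∀ r j → IsGerm (M′ r j)
    G′ r j = isGerm-sub (isGerm-* (G p 0) (G r (suc j))) (isGerm-* (G r 0) (G p (suc j)))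
    row : ℕ → Carrier → Sequence
    row r s j = M r (suc j) s
    eliminate : Degenerate M′ m n ⊎ Nondegenerate M′ m n → Degenerate M m (suc n) ⊎ Nondegenerate M m (suc n)
    eliminate (inj₁ (v′ , germ′ , (i , i<n , vi≢0) , ker)) = inj₁
      (v , germ , (suc i , ℕ.s≤s i<n , nonvanishing-* π≢0 vi≢0) , near-map kernel ker)
      where
      v : ℕ → Carrier → Carrier
      -- Back substitution in the pivot row, multiplied through by `π`; row `r` of `M` on `v` then
      -- equals row `r` of `M′` on `v′`.
      v zero s = - dot (row p s) (λ j → v′ j s) n
      v (suc j) s = π s * v′ j s
      germ : ∀ i → IsGerm (v i)
      germ zero = isGerm-neg (isGerm-dot n (λ j → G p (suc j)) germ′)
      germ (suc j) = isGerm-* (G p 0) (germ′ j)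
      kernel : ∀ s → (∀ r → r ℕ.< m → dot (λ i → M′ r i s) (λ i → v′ i s) n ≈ 0#) →
        ∀ r → r ℕ.< m → dot (λ i → M r i s) (λ i → v i s) (suc n) ≈ 0#
      kernel s q r r<m = trans
        (trans (+-congˡ (dot-scale (π s) (row r s) (λ j → v′ j s) n))
          (solve 4 (λ a p x y → a :* :- y :+ p :* x := p :* x :- a :* y) refl (M r 0 s) (π s) (dot (row r s)
            (λ j → v′ j s) n) (dot (row p s) (λ j → v′ j s) n)))
        (trans (sym (dot-combine (π s) (M r 0 s) (row r s) (row p s) (λ j → v′ j s) n)) (q r r<m))
    eliminate (inj₂ (δ , C , germδ , δ≢0 , 0≤C , bound)) = inj₂
      ((λ s → π s * δ s) , C₁ , isGerm-* (G p 0) germδ , nonvanishing-* π≢0 δ≢0 , 0≤C₁ ,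
       near-map solution (near-∧ bound (near-∧ near-a (near-∧ near-b near-d))))
      where
      bound-a = germs-bounded m (λ r → G r 0)
      bound-b = germs-bounded n (λ j → G p (suc j))
      bound-d = germ-bounded germδ
      a = proj₁ bound-a
      b = proj₁ bound-b
      d = proj₁ bound-d
      0≤a = proj₁ (proj₂ bound-a)
      0≤b = proj₁ (proj₂ bound-b)
      0≤d = proj₁ (proj₂ bound-d)
      near-a = proj₂ (proj₂ bound-a)
      near-b = proj₂ (proj₂ bound-b)
      near-d = proj₂ (proj₂ bound-d)
      -- A row of `M′` combines two rows of `M` with coefficients at most `a`, so a residual `η` of
      -- `M` becomes `2 a η` for `M′`.
      C₂ = C * (a + a)
      0≤C₂ = *-nonneg 0≤C (+-nonneg 0≤a 0≤a)
      nb = fromℕ n * (b * C₂)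
      0≤nb = *-nonneg (fromℕ-nonneg n) (*-nonneg 0≤b 0≤C₂)
      C₁ = a * C₂ + (d + nb)
      0≤C₁ = +-nonneg (*-nonneg 0≤a 0≤C₂) (+-nonneg 0≤d 0≤nb)
      solution : ∀ s → (∀ w η → (∀ r → r ℕ.< m → ∣ dot (λ i → M′ r i s) w n ∣ ≤ η) → ∀ i → i ℕ.< n → ∣ δ s * w i ∣
        ≤ C * η) ×
          (∀ r → r ℕ.< m → ∣ M r 0 s ∣ ≤ a) × (∀ j → j ℕ.< n → ∣ M p (suc j) s ∣ ≤ b) × ∣ δ s ∣ ≤ d →
        ∀ w η → (∀ r → r ℕ.< m → ∣ dot (λ i → M r i s) w (suc n) ∣ ≤ η) → ∀ i → i ℕ.< suc n → ∣ π s * δ s * w i ∣ ≤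
          C₁ * η
      solution s (inj , Ma , Mb , δd) w η h = λ
        { zero _ → ≤-trans (≈⇒≤ (abs-cong (solve 4 (λ p d w u → p :* d :* w := d :* (p :* w :+ u) :- d :* u) refl
          (π s) (δ s) (w 0) (dot (row p s) (tail w) n))))
            (≤-trans (abs-triangle⁻ _ _) (≤-trans (+-mono-≤ (abs-*-≤ δd (h p p<m)) (dot-bound n Mb δw′))
              (≤-by (*-nonneg (*-nonneg 0≤a 0≤C₂) 0≤η)
                (solve 6 (λ d e n b c x → x :* e := (x :+ (d :+ n :* (b :* c))) :* e :- (d :* e :+ n :*
                  (b :* (c :* e)))) refl d η (fromℕ n) b C₂ (a * C₂)))))
        ; (suc j) (ℕ.s≤s j<n) → ≤-trans (≈⇒≤ (abs-cong (*-assoc _ _ _)))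
            (≤-trans (abs-*-≤ (Ma p p<m) (δw′ j j<n)) (≤-by (*-nonneg (+-nonneg 0≤d 0≤nb) 0≤η)
              (solve 4 (λ x e a c → x :* e := (a :* c :+ x) :* e :- a :* (c :* e)) refl (d + nb) η a C₂))) }
        where
        0≤η : 0# ≤ η
        0≤η = ≤-trans (abs-nonneg _) (h p p<m)
        δw′ : ∀ j → j ℕ.< n → ∣ δ s * w (suc j) ∣ ≤ C₂ * η
        δw′ j j<n = ≤-trans (inj (tail w) ((a + a) * η) (λ r r<m → ≤-trans
            (≈⇒≤ (abs-cong (trans (dot-combine (π s) (M r 0 s) (row r s) (row p s) (tail w) n)
              (solve 5 (λ p a x y w → p :* x :- a :* y := p :* (a :* w :+ x) :- a :* (p :* w :+ y)) refl (π s)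
                (M r 0 s) (dot (row r s) (tail w) n) (dot (row p s) (tail w) n) (w 0)))))
            (≤-trans (abs-triangle⁻ _ _) (≤-trans (+-mono-≤ (abs-*-≤ (Ma p p<m) (h r r<m)) (abs-*-≤ (Ma r r<m)
              (h p p<m)))
              (≈⇒≤ (sym (distribʳ η a a)))))) j j<n) (≈⇒≤ (sym (*-assoc _ _ _)))

-- Interpolation at integer nodes.

module Interpolation (em : ExcludedMiddle 0ℓ) (ℝ : CompleteOrderedField) where
  open CompleteOrderedField ℝ hiding (zero)
  open RealAnalysis ℝ
  open IntegerSolver commutativeRing
  open Ordered ℝ
  open Archimedean em ℝ
  open Horner ℝ

  -- Synthetic division: the coefficients of the divided difference `(g u - g y) / (u - y)`.
  quotient : Sequence → Carrier → ℕ → Sequence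
  quotient g y zero _ = 0#
  quotient g y (suc n) zero = pe (tail g) y (suc n)
  quotient g y (suc n) (suc k) = quotient (tail g) y n k

  pe-quotient : ∀ g u y n → pe g u (suc n) - pe g y (suc n) ≈ (u - y) * pe (quotient g y n) u n
  pe-quotient g u y zero = solve 3 (λ g u y → g :+ u :* :0 :- (g :+ y :* :0) := (u :- y) :* :0) refl (g 0) u y
  pe-quotient g u y (suc n) = trans
    (solve 5 (λ g u y a b → g :+ u :* a :- (g :+ y :* b) := u :* (a :- b) :+ (u :- y) :* b) refl (g 0) u y
      (pe (tail g) u (suc n)) (pe (tail g) y (suc n)))
    (trans (+-congʳ (*-congˡ (pe-quotient (tail g) u y n)))
      (solve 4 (λ u y b q → u :* ((u :- y) :* q) :+ (u :- y) :* b := (u :- y) :* (b :+ u :* q)) refl u y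
        (pe (tail g) y (suc n)) (pe (quotient (tail g) y n) u n)))

  -- The head of the quotient is the value at `y` of the tail of `g`, and the tail of the quotient
  -- is the quotient of the tail, so the hypotheses pass from `g` to its tail.
  coefficients-from-quotient : ∀ {g y K E} n → 0# ≤ K → ∣ y ∣ ≤ K → (∀ k → k ℕ.< n → ∣ quotient g y n k ∣ ≤ E) →
    ∣ pe g y (suc n) ∣ ≤ E → ∀ k → k ℕ.< suc n → ∣ g k ∣ ≤ E + K * E
  coefficients-from-quotient {g} {y} {K} {E} zero 0≤K yK q v zero _ = ≤-trans
    (≈⇒≤ (abs-cong (solve 2 (λ g y → g := g :+ y :* :0) refl (g 0) y)))
      (≤-trans v (≤-by (*-nonneg 0≤K (≤-trans (abs-nonneg _) v)) (solve 2 (λ a b → b := a :+ b :- a) refl E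
      (K * E))))
  coefficients-from-quotient zero _ _ _ _ (suc k) (ℕ.s≤s ())
  coefficients-from-quotient (suc n) 0≤K yK q v (suc k) (ℕ.s≤s k<n) =
    coefficients-from-quotient n 0≤K yK (λ j r → q (suc j) (ℕ.s≤s r)) (q 0 (ℕ.s≤s ℕ.z≤n)) k k<n
  coefficients-from-quotient {g} {y} (suc n) 0≤K yK q v zero _ = ≤-trans
    (≈⇒≤ (abs-cong (solve 3 (λ g y b → g := (g :+ y :* b) :- y :* b) refl (g 0) y (pe (tail g) y (suc n)))))
    (≤-trans (abs-triangle⁻ _ _) (+-mono-≤ v (abs-*-≤ yK (q 0 (ℕ.s≤s ℕ.z≤n)))))

  fromℕ-separated : ∀ {m n} → ¬ m ≡ n → 1# ≤ ∣ fromℕ m - fromℕ n ∣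
  fromℕ-separated {m} {n} m≢n = integer-abs≥1 (m , n , refl) λ e →
    let e′ = trans (solve 2 (λ m n → m := (m :- n) :+ n) refl (fromℕ m) (fromℕ n)) (trans (+-congʳ e) (+-identityˡ _)) in
    m≢n (ℕₚ.≤-antisym (fromℕ-cancel-≤ (≈⇒≤ e′)) (fromℕ-cancel-≤ (≈⇒≤ (sym e′))))

  -- Newton interpolation, one node at a time: distinct naturals are at least 1 apart, so a divided
  -- difference of values at most `η` is at most `2 η`. The constant depends only on the number of
  -- nodes and their range, not on the choice of nodes.
  interpolation : ∀ n K → ∃ λ C → 0# ≤ C × (∀ g η us → length us ≡ n → AllPairs (λ u v → ¬ u ≡ v) us → All (ℕ._≤ K)
    us →
    All (λ u → ∣ pe g (fromℕ u) n ∣ ≤ η) us → ∀ k → k ℕ.< n → ∣ g k ∣ ≤ C * η)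
  interpolation zero K = 0# , ≤-refl , λ g η us _ _ _ _ k ()
  interpolation (suc n) K = C′ , *-nonneg (+-nonneg 0≤1 0≤2C) (+-nonneg 0≤1 (fromℕ-nonneg K)) , bound
    where
    IH = interpolation n K
    C = proj₁ IH
    0≤2C : 0# ≤ (1# + 1#) * C
    0≤2C = *-nonneg (<⇒≤ 0<2) (proj₁ (proj₂ IH))
    C′ = (1# + (1# + 1#) * C) * (1# + fromℕ K)
    bound : ∀ g η us → length us ≡ suc n → AllPairs (λ u v → ¬ u ≡ v) us → All (ℕ._≤ K) us →
      All (λ u → ∣ pe g (fromℕ u) (suc n) ∣ ≤ η) us → ∀ k → k ℕ.< suc n → ∣ g k ∣ ≤ C′ * η
    bound g η (y ∷ us) len (y≢ ∷ distinct) (y≤K ∷ us≤K) (v ∷ vs) k k<n = ≤-trans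
      (coefficients-from-quotient n (fromℕ-nonneg K) (≤-trans (≈⇒≤ (abs-of-nonneg (fromℕ-nonneg y))) (fromℕ-mono-≤
        y≤K)) q≤E
        (≤-trans v (≤-by (*-nonneg 0≤2C 0≤η) (solve 2 (λ c e → c :* e := (:1 :+ c) :* e :- e) refl ((1# + 1#) * C)
          η))) k k<n)
      (≈⇒≤ (solve 3 (λ c e k → (:1 :+ c) :* e :+ k :* ((:1 :+ c) :* e) := (:1 :+ c) :* (:1 :+ k) :* e) refl
        ((1# + 1#) * C) η (fromℕ K)))
      where
      0≤η = ≤-trans (abs-nonneg _) v
      Y = fromℕ y
      quotient-value : ∀ us → All (λ u → ¬ y ≡ u) us → All (λ u → ∣ pe g (fromℕ u) (suc n) ∣ ≤ η) us →
        All (λ u → ∣ pe (quotient g Y n) (fromℕ u) n ∣ ≤ η + η) us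
      quotient-value [] _ _ = []
      quotient-value (u ∷ us) (y≢u ∷ p) (w ∷ ws) = ≤-trans
        (≤-trans (≈⇒≤ (sym (*-identityˡ _))) (*-monoʳ-≤ (abs-nonneg _) (fromℕ-separated λ e → y≢u (≡.sym e))))
        (≤-trans (≈⇒≤ (sym (abs-* _ _))) (≤-trans (≈⇒≤ (abs-cong (sym (pe-quotient g (fromℕ u) Y n))))
          (≤-trans (abs-triangle⁻ _ _) (+-mono-≤ w v)))) ∷ quotient-value us p ws
      q≤E : ∀ k → k ℕ.< n → ∣ quotient g Y n k ∣ ≤ (1# + (1# + 1#) * C) * η
      q≤E k k<n = ≤-trans (proj₂ (proj₂ IH) (quotient g Y n) (η + η) us (ℕₚ.suc-injective len) distinct us≤K
        (quotient-value us y≢ vs) k k<n)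
        (≤-by 0≤η (solve 2 (λ c e → e := (:1 :+ (:1 :+ :1) :* c) :* e :- c :* (e :+ e)) refl C η))

  IsPoly : ℕ → (Carrier → Carrier) → Set
  IsPoly n p = ∃ λ g → (∀ k → n ℕ.≤ k → g k ≈ 0#) × (∀ u → p u ≈ pe g u n)

  isPoly-cong : ∀ {n p q} → (∀ u → q u ≈ p u) → IsPoly n p → IsPoly n q
  isPoly-cong e (g , z , f) = g , z , λ u → trans (e u) (f u)

  isPoly-0 : IsPoly 0 (λ _ → 0#)
  isPoly-0 = (λ _ → 0#) , (λ _ _ → refl) , λ _ → refl

  isPoly-mono : ∀ {m n p} → m ℕ.≤ n → IsPoly m p → IsPoly n p
  isPoly-mono {m} {n} m≤n (g , z , f) = g , (λ k q → z k (ℕₚ.≤-trans m≤n q)) , λ u →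
    trans (f u) (trans (sym (pe-extend g u m (n ℕ.∸ m) λ k q _ → z k q)) (reflexive (≡.cong (pe g u) (ℕₚ.m+[n∸m]≡n
      m≤n))))

  isPoly-+ : ∀ {n p q} → IsPoly n p → IsPoly n q → IsPoly n (λ u → p u + q u)
  isPoly-+ {n} (g , z , f) (h , y , e) = (λ k → g k + h k) , (λ k r → trans (+-cong (z k r) (y k r))
    (+-identityˡ 0#)) ,
    λ u → trans (+-cong (f u) (e u)) (sym (pe-+ g h u n))

  isPoly-scale : ∀ {n p} c → IsPoly n p → IsPoly n (λ u → c * p u)
  isPoly-scale {n} c (g , z , f) = (λ k → c * g k) , (λ k r → trans (*-congˡ (z k r)) (zeroʳ c)) ,
    λ u → trans (*-congˡ (f u)) (sym (pe-scale c g u n))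

  isPoly-shift : ∀ {n p} → IsPoly n p → IsPoly (suc n) (λ u → u * p u)
  isPoly-shift {n} {p} (g , z , f) = (λ { zero → 0# ; (suc k) → g k }) , (λ { zero () ; (suc k) (ℕ.s≤s r) → z k r
    }) ,
    λ u → trans (*-congˡ (f u)) (sym (+-identityˡ _))

  isPoly-const : ∀ c → IsPoly 1 (λ _ → c)
  isPoly-const c = (λ { zero → c ; (suc k) → 0# }) , (λ { zero () ; (suc k) r → refl }) ,
    λ u → solve 2 (λ c u → c := c :+ u :* :0) refl c u

  isPoly-sub : ∀ {n p q} → IsPoly n p → IsPoly n q → IsPoly n (λ u → p u - q u)
  isPoly-sub {p = p} {q} P Q = isPoly-cong (λ u → solve 2 (λ x y → x :- y := x :+ :- :1 :* y) refl (p u) (q u))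
    (isPoly-+ P (isPoly-scale (- 1#) Q))

  isPoly-affine : ∀ a α β n → IsPoly n (λ u → pe a (α + β * u) n)
  isPoly-affine a α β zero = isPoly-0
  isPoly-affine a α β (suc n) = isPoly-cong
    (λ u → solve 5 (λ c a b u p → c :+ (a :+ b :* u) :* p := c :+ (a :* p :+ b :* (u :* p))) refl (a 0) α β u
      (pe (tail a) (α + β * u) n))
    (isPoly-+ (isPoly-mono (ℕ.s≤s ℕ.z≤n) (isPoly-const (a 0)))
      (isPoly-+ (isPoly-mono (ℕₚ.n≤1+n n) (isPoly-scale α P)) (isPoly-scale β (isPoly-shift P))))
    where P = isPoly-affine (tail a) α β n

  isPoly-* : ∀ {m n p q} → IsPoly m p → IsPoly n q → IsPoly (m ℕ.+ n) (λ u → p u * q u)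
  isPoly-* {m} {n} {p} {q} (g , _ , f) Q = isPoly-cong (λ u → *-congʳ (f u)) (go m g)
    where
    go : ∀ m g → IsPoly (m ℕ.+ n) (λ u → pe g u m * q u)
    go zero g = isPoly-cong (λ u → zeroˡ _) (isPoly-mono ℕ.z≤n isPoly-0)
    go (suc m) g = isPoly-cong (λ u → solve 4 (λ g u p q → (g :+ u :* p) :* q := g :* q :+ u :* (p :* q)) refl
      (g 0) u (pe (tail g) u m) (q u))
      (isPoly-+ (isPoly-mono (ℕₚ.m≤n+m n (suc m)) (isPoly-scale (g 0) Q)) (isPoly-shift (go m (tail g))))

  naturals : ℕ → List ℕ
  naturals zero = []
  naturals (suc n) = n ∷ naturals n

  length-naturals : ∀ n → length (naturals n) ≡ n
  length-naturals zero = ≡.refl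
  length-naturals (suc n) = ≡.cong suc (length-naturals n)

  naturals-< : ∀ n → All (ℕ._< n) (naturals n)
  naturals-< zero = []
  naturals-< (suc n) = ℕₚ.≤-refl ∷ All.map ℕₚ.m≤n⇒m≤1+n (naturals-< n)

  naturals-distinct : ∀ n → AllPairs (λ u v → ¬ u ≡ v) (naturals n)
  naturals-distinct zero = []
  naturals-distinct (suc n) = All.map (λ q e → ℕₚ.<-irrefl (≡.sym e) q) (naturals-< n) ∷ naturals-distinct n

  naturals-≤ : ∀ n → All (ℕ._≤ n) (naturals n)
  naturals-≤ n = All.map ℕₚ.<⇒≤ (naturals-< n)

  -- The coefficients are bounded by interpolation at `0, …, n - 1`. The exact growth `D ^ (n ∸ 1)`,
  -- one power below the number of coefficients, is what leaves a square in `resultant-bound`.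
  extrapolation : ∀ n → ∃ λ C → 0# ≤ C × (∀ {p η} → IsPoly n p → 0# ≤ η →
    (∀ u → u ℕ.< n → ∣ p (fromℕ u) ∣ ≤ η) → ∀ x D → 1# ≤ D → ∣ x ∣ ≤ D → ∣ p x ∣ ≤ C * η * D ^ (n ℕ.∸ 1))
  extrapolation n = fromℕ n * C , *-nonneg (fromℕ-nonneg n) 0≤C , λ {p} {η} (g , _ , f) 0≤η small x D 1≤D x≤D →
      let coeff≤ = proj₂ (proj₂ I) g η (naturals n) (length-naturals n) (naturals-distinct n) (naturals-≤ n)
                     (All.map (λ {u} q → ≤-trans (≈⇒≤ (abs-cong (sym (f (fromℕ u))))) (small u q)) (naturals-< n)) in
      ≤-trans (≈⇒≤ (abs-cong (f x))) (≤-trans (crude n 1≤D x≤D (*-nonneg 0≤C 0≤η) coeff≤)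
        (≈⇒≤ (solve 4 (λ n c e d → n :* (c :* e :* d) := n :* c :* e :* d) refl (fromℕ n) C η (D ^ (n ℕ.∸ 1)))))
    where
    I = interpolation n n
    C = proj₁ I
    0≤C = proj₁ (proj₂ I)
    crude : ∀ {g x D B} n → 1# ≤ D → ∣ x ∣ ≤ D → 0# ≤ B → (∀ k → k ℕ.< n → ∣ g k ∣ ≤ B) → ∣ pe g x n ∣ ≤ fromℕ n *
      (B * D ^ (n ℕ.∸ 1))
    crude zero _ _ _ _ = ≈⇒≤ (trans abs-0 (sym (zeroˡ _)))
    crude {g} {x} {B = B} (suc zero) 1≤D x≤D 0≤B q = ≤-trans (≈⇒≤ (abs-cong (solve 2 (λ g x → g :+ x :* :0 := g)
      refl (g 0) x)))
      (≤-trans (q 0 (ℕ.s≤s ℕ.z≤n)) (≈⇒≤ (solve 1 (λ b → b := (:1 :+ :0) :* (b :* :1)) refl B)))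
    crude {g} {x} {D} {B} (suc (suc n)) 1≤D x≤D 0≤B q = ≤-trans
      (abs-+-≤ (≤-trans (q 0 (ℕ.s≤s ℕ.z≤n)) (≤-trans (≈⇒≤ (sym (*-identityʳ B))) (*-monoˡ-≤ 0≤B (1≤^ (suc n) 1≤D))))
        (abs-*-≤ x≤D (crude {tail g} {x} {D} {B} (suc n) 1≤D x≤D 0≤B λ k r → q (suc k) (ℕ.s≤s r))))
      (≈⇒≤ (solve 4 (λ n b d e → b :* (d :* e) :+ d :* ((:1 :+ n) :* (b :* e)) := (:1 :+ (:1 :+ n)) :*
        (b :* (d :* e))) refl (fromℕ n) B D (D ^ n)))

-- Padé approximants do not depend on their centre.

module Constancy (em : ExcludedMiddle 0ℓ) (ℝ : CompleteOrderedField) where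
  open CompleteOrderedField ℝ hiding (zero)
  open RealAnalysis ℝ
  open IntegerSolver commutativeRing
  open Ordered ℝ
  open Archimedean em ℝ
  open Horner ℝ
  open Algebra.Properties.Semiring.Exp semiring using (^-congˡ)
  open Interpolation em ℝ

  -- A function with a quadratic modulus of continuity is constant: halving the step halves the bound.
  quadratic⇒constant : ∀ {φ : Carrier → Carrier} {s₁ r C} →
    (∀ s s′ → ∣ s - s₁ ∣ ≤ r → ∣ s′ - s₁ ∣ ≤ r → s ≉ s′ → ∣ φ s - φ s′ ∣ ≤ C * ∣ s - s′ ∣ ^ 2) →
    ∀ s s′ → ∣ s - s₁ ∣ ≤ r → ∣ s′ - s₁ ∣ ≤ r → s ≉ s′ → φ s ≈ φ s′
  quadratic⇒constant {φ} {s₁} {r} {C} quad s s′ sI s′I s≉s′ = close (abs≤0⇒≈0 (≤-geometric-limit (C * ∣ s - s′ ∣ ^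
    2) λ j →
      ≤-trans (halving j s s′ sI s′I s≉s′) (≈⇒≤ (trans (solve 3 (λ c h d → c :* h :* d := c :* d :* h) refl C
        (½ ^ j) (∣ s - s′ ∣ ^ 2)) (sym (+-identityˡ _))))))
    where
    close : φ s - φ s′ ≈ 0# → φ s ≈ φ s′
    close e = trans (solve 2 (λ x y → x := (x :- y) :+ y) refl (φ s) (φ s′)) (trans (+-congʳ e) (+-identityˡ _))
    half-diff : ∀ x y → ½ * (x + y) - y ≈ ½ * (x - y)
    half-diff x y = trans (+-congˡ (-‿cong (sym (½+½ y)))) (solve 3 (λ h x y → h :* (x :+ y) :- (h :* y :+ h :* y)
      := h :* (x :- y)) refl ½ x y)
    half-diff′ : ∀ x y → x - ½ * (x + y) ≈ ½ * (x - y)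
    half-diff′ x y = trans (+-congʳ (sym (½+½ x))) (solve 3 (λ h x y → h :* x :+ h :* x :- h :* (x :+ y) := h :*
      (x :- y)) refl ½ x y)
    apart : ∀ {x y z} → x ≉ y → z ≈ ½ * (x - y) → z ≉ 0#
    apart {x} {y} x≉y e z≈0 = x≉y (trans (solve 2 (λ x y → x := (x :- y) :+ y) refl x y)
      (trans (+-congʳ (zero-product (>⇒≉ 0<½) (trans (sym e) z≈0))) (+-identityˡ y)))
    abs-half : ∀ {x y} → x ≈ ½ * y → ∣ x ∣ ≈ ½ * ∣ y ∣
    abs-half {x} {y} e = trans (abs-cong e) (trans (abs-* ½ y) (*-congʳ (abs-of-nonneg (<⇒≤ 0<½))))
    halving : ∀ j s s′ → ∣ s - s₁ ∣ ≤ r → ∣ s′ - s₁ ∣ ≤ r → s ≉ s′ → ∣ φ s - φ s′ ∣ ≤ C * ½ ^ j * ∣ s - s′ ∣ ^ 2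
    halving zero s s′ sI s′I ne = ≤-trans (quad s s′ sI s′I ne) (≈⇒≤ (*-congʳ (sym (*-identityʳ C))))
    halving (suc j) s s′ sI s′I ne = ≤-trans (abs-sub-triangle (φ s) (φ m) (φ s′))
      (≤-trans (+-mono-≤ (halving j s m sI mI s≉m) (halving j m s′ mI s′I m≉s′))
        (≈⇒≤ (trans (+-cong (*-congˡ (^-congˡ 2 (abs-half (half-diff′ s s′))))
          (*-congˡ (^-congˡ 2 (abs-half (half-diff s s′)))))
          (trans (solve 4 (λ c h p d → c :* p :* (h :* d :* (h :* d :* :1)) :+ c :* p :* (h :* d :* (h :* d :* :1))
            := c :* (h :* p) :* (d :* (d :* :1)) :* (h :+ h)) refl C ½ (½ ^ j) ∣ s - s′ ∣)
            (trans (*-congˡ (trans (+-cong (sym (*-identityʳ ½)) (sym (*-identityʳ ½))) (½+½ 1#)))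
              (*-identityʳ _))))))
      where
      m = ½ * (s + s′)
      s≉m : s ≉ m
      s≉m e = apart ne (half-diff′ s s′) (trans (+-congʳ e) (-‿inverseʳ m))
      m≉s′ : m ≉ s′
      m≉s′ e = apart ne (half-diff s s′) (trans (+-congʳ e) (-‿inverseʳ s′))
      mI : ∣ m - s₁ ∣ ≤ r
      mI = ≤-trans (≈⇒≤ (trans (abs-cong (trans (+-congˡ (-‿cong (sym (½+½ s₁))))
        (solve 4 (λ h s t u → h :* (s :+ t) :- (h :* u :+ h :* u) := h :* (s :- u) :+ h :* (t :- u)) refl ½ s s′
        s₁))) refl))
        (≤-trans (abs-triangle _ _) (≤-trans (+-mono-≤ (≤-trans (≈⇒≤ (abs-half refl)) (*-monoˡ-≤ (<⇒≤ 0<½) sI))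
          (≤-trans (≈⇒≤ (abs-half refl)) (*-monoˡ-≤ (<⇒≤ 0<½) s′I)))
          (≈⇒≤ (½+½ r))))

  inverse-≤ : ∀ {c x} → 0# < c → c ≤ ∣ x ∣ → ∣ x ⁻¹ ∣ ≤ c ⁻¹
  inverse-≤ {c} {x} 0<c c≤x = *-cancelˡ-≤ 0<c (≤-trans (*-monoʳ-≤ (abs-nonneg _) c≤x)
    (≈⇒≤ (trans (sym (abs-* x (x ⁻¹))) (trans (abs-cong (⁻¹-inverseʳ x x≉0)) (trans (abs-of-nonneg 0≤1)
      (sym (*-inv 0<c)))))))
    where
    x≉0 : x ≉ 0#
    x≉0 e = ≤⇒≯ c≤x (≤-<-trans (≈⇒≤ (trans (abs-cong e) abs-0)) 0<c)

  -- `P s` and `Q s` are Padé data at the centre `x* + s`: with `n` coefficients in all, `Q F - P`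
  -- has order `n + 1` in `t`. The constants are uniform in `s`, and `small` keeps points at up to
  -- `n` times the distance of two centres within the range of `approx`.
  module _ (F : Carrier → Carrier) (F-cong : ∀ {x y} → x ≈ y → F x ≈ F y) (x* s₁ r : Carrier) (0≤r : 0# ≤ r) (nP nQ : ℕ)
    (P Q : Carrier → Sequence) {E Λ q c : Carrier} (0≤E : 0# ≤ E) (1≤Λ : 1# ≤ Λ) (0≤q : 0# ≤ q) (0<c : 0# < c)
    (1≤n : 1 ℕ.≤ nP ℕ.+ nQ)
    (small : Λ * (fromℕ (nP ℕ.+ nQ) * (r + r)) ≤ 1#)
    (approx : ∀ s → ∣ s - s₁ ∣ ≤ r → ∀ t → Λ * ∣ t ∣ ≤ 1# →
      ∣ pe (Q s) t nQ * F (x* + s + t) - pe (P s) t nP ∣ ≤ E * (Λ * ∣ t ∣) ^ suc (nP ℕ.+ nQ))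
    (upper : ∀ s → ∣ s - s₁ ∣ ≤ r → ∀ t → ∣ t ∣ ≤ 1# → ∣ pe (Q s) t nQ ∣ ≤ q)
    (lower : ∀ s → ∣ s - s₁ ∣ ≤ r → ∀ t → ∣ t ∣ ≤ r + r → c ≤ ∣ pe (Q s) t nQ ∣)
    where

    private
      n = nP ℕ.+ nQ
      N = fromℕ n
      0≤Λ = ≤-trans 0≤1 1≤Λ
      0≤2r = +-nonneg 0≤r 0≤r
      1≤N = 1≤fromℕ 1≤n
      2r≤1 : r + r ≤ 1#
      2r≤1 = ≤-trans (≤-trans (≈⇒≤ (solve 1 (λ x → x := :1 :* (:1 :* x)) refl (r + r))) (*-mono-≤ 0≤1 (*-nonneg 0≤1
        0≤2r) 1≤Λ (*-monoʳ-≤ 0≤2r 1≤N))) small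
      Qt Pt : Carrier → Carrier → Carrier
      Qt s t = pe (Q s) t nQ
      Pt s t = pe (P s) t nP
      In : Carrier → Set
      In s = ∣ s - s₁ ∣ ≤ r

      diameter : ∀ {x y} → In x → In y → ∣ x - y ∣ ≤ r + r
      diameter {x} {y} p p′ = ≤-trans (abs-sub-triangle x s₁ y) (+-mono-≤ p (≤-trans (≈⇒≤ (abs-minus-comm s₁ y))
        p′))

      Qt≉0 : ∀ {s t} → In s → ∣ t ∣ ≤ r + r → Qt s t ≉ 0#
      Qt≉0 {s} {t} p t≤ e = ≤⇒≯ (lower s p t t≤) (≤-<-trans (≈⇒≤ (trans (abs-cong e) abs-0)) 0<c)

      -- The numerator of the difference of the two Padé fractions at `x`, a polynomial in `x` of
      -- degree below `n`.
      resultant : Carrier → Carrier → Carrier → Carrier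
      resultant s s′ x = Pt s (x - s) * Qt s′ (x - s′) - Pt s′ (x - s′) * Qt s (x - s)

      C₀ = (1# + 1#) * (q * (E * (Λ * N) ^ suc n))
      0≤C₀ : 0# ≤ C₀
      0≤C₀ = *-nonneg (<⇒≤ 0<2) (*-nonneg 0≤q (*-nonneg 0≤E (^-nonneg (suc n) (*-nonneg 0≤Λ (fromℕ-nonneg n)))))

      -- Eliminating `F` writes the resultant as a combination of the two approximation errors, each
      -- of order `n + 1` in `δ` when `x` is within `n * ∣ δ ∣` of both centres.
      resultant-near : ∀ {s s′ x δ} → In s → In s′ → ∣ δ ∣ ≤ r + r → ∣ x - s ∣ ≤ N * ∣ δ ∣ → ∣ x - s′ ∣ ≤ N * ∣ δ ∣
        →
        ∣ resultant s s′ x ∣ ≤ C₀ * ∣ δ ∣ ^ suc n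
      resultant-near {s} {s′} {x} {δ} sI s′I δ≤ u v = ≤-trans
        (≈⇒≤ (abs-cong (solve 5 (λ p q p′ q′ f → p :* q′ :- p′ :* q := q :* (q′ :* f :- p′) :- q′ :* (q :* f :- p))
          refl (Pt s (x - s)) (Qt s (x - s)) (Pt s′ (x - s′)) (Qt s′ (x - s′)) (F (x* + x)))))
        (≤-trans (abs-triangle⁻ _ _) (≤-trans (+-mono-≤ (abs-*-≤ (upper s sI _ (le1 u)) (ap s′I v))
          (abs-*-≤ (upper s′ s′I _ (le1 v)) (ap sI u)))
          (≈⇒≤ (solve 4 (λ q e l d → q :* (e :* (l :* d)) :+ q :* (e :* (l :* d)) := (:1 :+ :1) :* (q :* (e :* l))
            :* d) refl q E ((Λ * N) ^ suc n) (∣ δ ∣ ^ suc n)))))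
        where
        ΛNδ≤1 : Λ * (N * ∣ δ ∣) ≤ 1#
        ΛNδ≤1 = ≤-trans (*-monoˡ-≤ 0≤Λ (*-monoˡ-≤ (fromℕ-nonneg n) δ≤)) small
        le1 : ∀ {t} → ∣ t ∣ ≤ N * ∣ δ ∣ → ∣ t ∣ ≤ 1#
        le1 {t} w = ≤-trans w (≤-trans (≤-trans (≈⇒≤ (sym (*-identityˡ _))) (*-monoʳ-≤ (*-nonneg (fromℕ-nonneg n)
          (abs-nonneg δ)) 1≤Λ)) ΛNδ≤1)
        ap : ∀ {s} → In s → ∣ x - s ∣ ≤ N * ∣ δ ∣ → ∣ Qt s (x - s) * F (x* + x) - Pt s (x - s) ∣ ≤ E *
          ((Λ * N) ^ suc n * ∣ δ ∣ ^ suc n)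
        ap {s} sI w = ≤-trans (≈⇒≤ (abs-cong
          (+-congʳ (*-congˡ (F-cong (solve 3 (λ a s x → a :+ x := a :+ s :+ (x :- s)) refl x* s x))))))
          (≤-trans (approx s sI (x - s) (≤-trans (*-monoˡ-≤ 0≤Λ w) ΛNδ≤1))
            (*-monoˡ-≤ 0≤E (≤-trans (^-mono-≤ (suc n) (*-nonneg 0≤Λ (abs-nonneg _)) (≤-trans (*-monoˡ-≤ 0≤Λ w)
              (≈⇒≤ (sym (*-assoc Λ N ∣ δ ∣)))))
              (≈⇒≤ (^-* (Λ * N) ∣ δ ∣ (suc n))))))

      X = extrapolation n
      C₁ = proj₁ X * C₀
      0≤C₁ : 0# ≤ C₁
      0≤C₁ = *-nonneg (proj₁ (proj₂ X)) 0≤C₀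

      cancel-powers : ∀ n {d} x c → 1 ℕ.≤ n → 0# < d → x * (c * d ^ suc n) * (d ⁻¹) ^ (n ℕ.∸ 1) ≈ x * c * d ^ 2
      cancel-powers (suc k) {d} x c _ 0<d = trans (solve 5 (λ x c d a b → x :* (c :* (d :* (d :* a))) :* b := x :*
        c :* (d :* (d :* :1)) :* (a :* b)) refl x c d (d ^ k) ((d ⁻¹) ^ k))
        (trans (*-congˡ (^-inv k 0<d)) (*-identityʳ _))

      -- In the coordinate `u = (x - s) / δ` the resultant is `O(d ^ (n + 1))` at the nodes
      -- `0, …, n - 1`. Extrapolating to `∣ u ∣ ≤ d ⁻¹`, which covers all `x` in the interval, costs
      -- `d ^ (- (n - 1))` and leaves `d ^ 2`.
      resultant-bound : ∀ {s s′ x} → In s → In s′ → In x → s ≉ s′ → ∣ resultant s s′ x ∣ ≤ C₁ * ∣ s - s′ ∣ ^ 2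
      resultant-bound {s} {s′} {x} sI s′I xI s≉s′ = ≤-trans (≈⇒≤ (sym (abs-cong at-x)))
        (≤-trans (proj₂ (proj₂ X) poly (*-nonneg 0≤C₀ (^-nonneg (suc n) 0≤d)) at-nodes ((x - s) * δ ⁻¹) (d ⁻¹)
          1≤d⁻¹ node≤)
          (≈⇒≤ powers))
        where
        δ = s′ - s
        d = ∣ δ ∣
        0≤d = abs-nonneg δ
        δ≉0 : δ ≉ 0#
        δ≉0 e = s≉s′ (sym (trans (solve 2 (λ s t → t := (t :- s) :+ s) refl s s′) (trans (+-congʳ e)
          (+-identityˡ s))))
        0<d : 0# < d
        0<d = abs-pos δ≉0
        d≤2r : d ≤ r + r
        d≤2r = diameter s′I sI
        d≤1 = ≤-trans d≤2r 2r≤1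
        1≤d⁻¹ : 1# ≤ d ⁻¹
        1≤d⁻¹ = *-cancelˡ-≤ 0<d (≤-trans (≈⇒≤ (*-identityʳ d)) (≤-trans d≤1 (≈⇒≤ (sym (*-inv 0<d)))))
        p : Carrier → Carrier
        p u = pe (P s) (0# + δ * u) nP * pe (Q s′) (- δ + δ * u) nQ - pe (P s′) (- δ + δ * u) nP * pe (Q s)
          (0# + δ * u) nQ
        poly : IsPoly n p
        poly = isPoly-sub (isPoly-* (isPoly-affine (P s) 0# δ nP) (isPoly-affine (Q s′) (- δ) δ nQ))
                          (isPoly-* (isPoly-affine (P s′) (- δ) δ nP) (isPoly-affine (Q s) 0# δ nQ))
        p-resultant : ∀ u → p u ≈ resultant s s′ (s + δ * u)
        p-resultant u = +-cong (*-cong (pe-cong nP (λ _ _ → refl) e₁) (pe-cong nQ (λ _ _ → refl) e₂))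
          (-‿cong (*-cong (pe-cong nP (λ _ _ → refl) e₂) (pe-cong nQ (λ _ _ → refl) e₁)))
          where
          e₁ : 0# + δ * u ≈ s + δ * u - s
          e₁ = solve 2 (λ s y → :0 :+ y := s :+ y :- s) refl s (δ * u)
          e₂ : - δ + δ * u ≈ s + δ * u - s′
          e₂ = solve 3 (λ s t y → :- (t :- s) :+ y := s :+ y :- t) refl s s′ (δ * u)
        at-x : p ((x - s) * δ ⁻¹) ≈ resultant s s′ x
        at-x = trans (p-resultant _) (+-cong (*-cong (pe-cong nP (λ _ _ → refl) (+-congʳ e))
          (pe-cong nQ (λ _ _ → refl) (+-congʳ e)))
          (-‿cong (*-cong (pe-cong nP (λ _ _ → refl) (+-congʳ e)) (pe-cong nQ (λ _ _ → refl) (+-congʳ e)))))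
          where
          e : s + δ * ((x - s) * δ ⁻¹) ≈ x
          e = trans (solve 4 (λ s x d i → s :+ d :* ((x :- s) :* i) := s :+ (x :- s) :* (d :* i)) refl s x δ (δ ⁻¹))
            (trans (+-congˡ (*-congˡ (⁻¹-inverseʳ δ δ≉0))) (solve 2 (λ s x → s :+ (x :- s) :* :1 := x) refl s x))
        node≤ : ∣ (x - s) * δ ⁻¹ ∣ ≤ d ⁻¹
        node≤ = ≤-trans (abs-*-≤ (≤-trans (diameter xI sI) 2r≤1) (inverse-≤ 0<d ≤-refl)) (≈⇒≤ (*-identityˡ _))
        at-nodes : ∀ u → u ℕ.< n → ∣ p (fromℕ u) ∣ ≤ C₀ * d ^ suc n
        at-nodes u u<n = ≤-trans (≈⇒≤ (abs-cong (p-resultant (fromℕ u)))) (resultant-near sI s′I d≤2r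
          (≤-trans (≈⇒≤ (trans (abs-cong (solve 2 (λ s y → s :+ y :- s := y) refl s (δ * fromℕ u)))
            (trans (abs-* δ (fromℕ u)) (trans (*-congˡ (abs-of-nonneg (fromℕ-nonneg u))) (*-comm _ _)))))
            (*-monoʳ-≤ 0≤d (fromℕ-mono-≤ (ℕₚ.<⇒≤ u<n))))
          (≤-trans (≈⇒≤ (trans (abs-cong (solve 3 (λ s t y → s :+ (t :- s) :* y :- t := (t :- s) :* (y :- :1)) refl
            s s′ (fromℕ u))) (trans (abs-* δ _) (*-comm _ _))))
            (*-monoʳ-≤ 0≤d (abs-least (≤-by (+-nonneg (sub-nonneg (fromℕ-mono-≤ (ℕₚ.<⇒≤ u<n))) 0≤1)
              (solve 2 (λ n u → n :- u :+ :1 := n :- (u :- :1)) refl N (fromℕ u)))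
              (≤-by (+-nonneg (sub-nonneg 1≤N) (fromℕ-nonneg u)) (solve 2 (λ n u → n :- :1 :+ u := n :- :-
                (u :- :1)) refl N (fromℕ u)))))))
        powers : proj₁ X * (C₀ * d ^ suc n) * (d ⁻¹) ^ (n ℕ.∸ 1) ≈ C₁ * ∣ s - s′ ∣ ^ 2
        powers = trans (cancel-powers n (proj₁ X) C₀ 1≤n 0<d) (*-congˡ (^-congˡ 2 (abs-minus-comm s′ s)))

      ratio : Carrier → Carrier → Carrier
      ratio x s = Pt s (x - s) * (Qt s (x - s)) ⁻¹

      ratio-quadratic : ∀ {x} → In x → ∀ s s′ → In s → In s′ → s ≉ s′ → ∣ ratio x s - ratio x s′ ∣ ≤ C₁ *
        (c ⁻¹ * c ⁻¹) * ∣ s - s′ ∣ ^ 2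
      ratio-quadratic {x} xI s s′ sI s′I s≉s′ = ≤-trans (≈⇒≤ (abs-cong cross))
        (≤-trans (abs-*-≤ (resultant-bound sI s′I xI s≉s′) (abs-*-≤ (inverse-≤ 0<c (lower s sI _ (diameter xI sI)))
          (inverse-≤ 0<c (lower s′ s′I _ (diameter xI s′I)))))
          (≈⇒≤ (solve 3 (λ a d i → a :* d :* i := a :* i :* d) refl C₁ (∣ s - s′ ∣ ^ 2) (c ⁻¹ * c ⁻¹))))
        where
        y = Qt s (x - s)
        y′ = Qt s′ (x - s′)
        cross : ratio x s - ratio x s′ ≈ resultant s s′ x * (y ⁻¹ * y′ ⁻¹)
        cross = begin
          Pt s (x - s) * y ⁻¹ - Pt s′ (x - s′) * y′ ⁻¹
            ≈⟨ +-cong (sym (*-identityʳ _)) (-‿cong (sym (*-identityʳ _))) ⟩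
          Pt s (x - s) * y ⁻¹ * 1# - Pt s′ (x - s′) * y′ ⁻¹ * 1#
            ≈⟨ +-cong (*-congˡ (⁻¹-inverseʳ y′ (Qt≉0 s′I (diameter xI s′I))))
              (-‿cong (*-congˡ (⁻¹-inverseʳ y (Qt≉0 sI (diameter xI sI))))) ⟨
          Pt s (x - s) * y ⁻¹ * (y′ * y′ ⁻¹) - Pt s′ (x - s′) * y′ ⁻¹ * (y * y ⁻¹)
            ≈⟨ (solve 6 (λ p i y j z p′ → p :* i :* (z :* j) :- p′ :* j :* (y :* i) := (p :* z :- p′ :* y) :*
              (i :* j)) refl) (Pt s (x - s)) (y ⁻¹) y (y′ ⁻¹) y′ (Pt s′ (x - s′)) ⟩
          resultant s s′ x * (y ⁻¹ * y′ ⁻¹) ∎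
          where open SetoidReasoning setoid

      at-centre : ∀ {s t} → In s → t ≈ 0# → Qt s t * F (x* + s + t) ≈ Pt s t
      at-centre {s} {t} sI t≈0 = trans (solve 2 (λ x y → x := (x :- y) :+ y) refl _ (Pt s t))
        (trans (+-congʳ (abs≤0⇒≈0 (≤-trans
        (approx s sI t (≤-trans (≈⇒≤ Λt≈0) 0≤1)) (≈⇒≤ (trans (*-congˡ (trans (*-congʳ Λt≈0) (zeroˡ _)))
          (zeroʳ E)))))) (+-identityˡ _))
        where
        Λt≈0 : Λ * ∣ t ∣ ≈ 0#
        Λt≈0 = trans (*-congˡ (trans (abs-cong t≈0) abs-0)) (zeroʳ Λ)

      centre : In s₁
      centre = ≤-trans (≈⇒≤ (trans (abs-cong (-‿inverseʳ s₁)) abs-0)) 0≤r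

    -- The fraction centred at `x = s₁ + t` itself has the exact value of `F` there, because its
    -- error vanishes at its own centre; and `ratio x` takes the same value at the centres `x` and
    -- `s₁`.
    rational-near : ∀ t → ∣ t ∣ ≤ r → pe (Q s₁) t nQ * F (x* + s₁ + t) ≈ pe (P s₁) t nP
    rational-near t t≤r with em {t ≈ 0#}
    ... | yes t≈0 = at-centre centre t≈0
    ... | no t≉0 = *-cancelˡ-≈ (Qt≉0 xI (≤-trans (≈⇒≤ (trans (abs-cong (-‿inverseʳ x)) abs-0)) 0≤2r)) (begin
        y * (y₁′ * F (x* + s₁ + t))     ≈⟨ (solve 3 (λ y z f → y :* (z :* f) := z :* (y :* f)) refl) y y₁′
          (F (x* + s₁ + t)) ⟩
        y₁′ * (y * F (x* + s₁ + t))     ≈⟨ *-cong x-s₁Q (*-congˡ (F-cong (solve 3 (λ a s t → a :+ s :+ t := a :+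
          (s :+ t) :+ ((s :+ t) :- (s :+ t))) refl x* s₁ t))) ⟩
        y₁ * (y * F (x* + x + (x - x))) ≈⟨ *-congˡ (at-centre xI (-‿inverseʳ x)) ⟩
        y₁ * Pt x (x - x)               ≈⟨ *-identityʳ _ ⟨
        y₁ * Pt x (x - x) * 1#          ≈⟨ *-congˡ (⁻¹-inverseʳ y y≉0) ⟨
        y₁ * Pt x (x - x) * (y * y ⁻¹)  ≈⟨ (solve 4 (λ a p y i → a :* p :* (y :* i) := a :* y :* (p :* i)) refl) y₁
          (Pt x (x - x)) y (y ⁻¹) ⟩
        y₁ * y * ratio x x              ≈⟨ *-congˡ same ⟩
        y₁ * y * ratio x s₁             ≈⟨ (solve 4 (λ a y p i → a :* y :* (p :* i) := y :* p :* (a :* i)) refl) y₁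
          y (Pt s₁ (x - s₁)) (y₁ ⁻¹) ⟩
        y * Pt s₁ (x - s₁) * (y₁ * y₁ ⁻¹) ≈⟨ *-congˡ (⁻¹-inverseʳ y₁ (Qt≉0 centre (diameter xI centre))) ⟩
        y * Pt s₁ (x - s₁) * 1#         ≈⟨ *-identityʳ _ ⟩
        y * Pt s₁ (x - s₁)              ≈⟨ *-congˡ (pe-cong nP (λ _ _ → refl) x-s₁≈t) ⟩
        y * Pt s₁ t                     ∎)
      where
      open SetoidReasoning setoid
      x = s₁ + t
      x-s₁≈t : x - s₁ ≈ t
      x-s₁≈t = solve 2 (λ s t → s :+ t :- s := t) refl s₁ t
      xI : In x
      xI = ≤-trans (≈⇒≤ (abs-cong x-s₁≈t)) t≤r
      y = Qt x (x - x)
      y₁ = Qt s₁ (x - s₁)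
      y₁′ = Qt s₁ t
      x-s₁Q : y₁′ ≈ y₁
      x-s₁Q = pe-cong nQ (λ _ _ → refl) (sym x-s₁≈t)
      y≉0 : y ≉ 0#
      y≉0 = Qt≉0 xI (≤-trans (≈⇒≤ (trans (abs-cong (-‿inverseʳ x)) abs-0)) 0≤2r)
      same : ratio x x ≈ ratio x s₁
      same = quadratic⇒constant {φ = ratio x} (ratio-quadratic xI) x s₁ xI centre
        λ e → t≉0 (trans (sym x-s₁≈t) (trans (+-congʳ e) (-‿inverseʳ s₁)))

-- Local alternative: rational, or nondegenerate and bi-Lipschitz.

module Local (em : ExcludedMiddle 0ℓ) (ℝ : CompleteOrderedField) where
  open CompleteOrderedField ℝ hiding (zero)
  open RealAnalysis ℝ
  open IntegerSolver commutativeRing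
  open Ordered ℝ
  open Archimedean em ℝ
  open Horner ℝ
  open Germs em ℝ
  open LinearAlgebra em ℝ
  open Constancy em ℝ

  pe-truncate : ∀ a s {m n} → m ℕ.≤ n → (∀ k → m ℕ.≤ k → k ℕ.< n → a k ≈ 0#) → pe a s n ≈ pe a s m
  pe-truncate a s {m} {n} m≤n z = trans (reflexive (≡.cong (pe a s) (≡.sym e)))
    (pe-extend a s m (n ℕ.∸ m) λ k p q → z k p (≡.subst (k ℕ.<_) e q))
    where e = ℕₚ.m+[n∸m]≡n m≤n

  truncate : ℕ → Sequence → Sequence
  truncate zero a i = 0#
  truncate (suc n) a zero = a 0
  truncate (suc n) a (suc i) = truncate n (tail a) i

  truncate-< : ∀ n a i → i ℕ.< n → truncate n a i ≡ a i
  truncate-< (suc n) a zero _ = ≡.refl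
  truncate-< (suc n) a (suc i) (ℕ.s≤s p) = truncate-< n (tail a) i p

  truncate-≥ : ∀ n a i → n ℕ.≤ i → truncate n a i ≡ 0#
  truncate-≥ zero a i _ = ≡.refl
  truncate-≥ (suc n) a (suc i) (ℕ.s≤s p) = truncate-≥ n (tail a) i p

  truncate-abs : ∀ n a {V} → 0# ≤ V → (∀ i → i ℕ.< n → ∣ a i ∣ ≤ V) → ∀ i → ∣ truncate n a i ∣ ≤ V
  truncate-abs zero a 0≤V p i = ≤-trans (≈⇒≤ abs-0) 0≤V
  truncate-abs (suc n) a 0≤V p zero = p 0 (ℕ.s≤s ℕ.z≤n)
  truncate-abs (suc n) a 0≤V p (suc i) = truncate-abs n (tail a) 0≤V (λ j q → p (suc j) (ℕ.s≤s q)) i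

  conv-dot : ∀ n k v b → n ℕ.≤ suc k → (∀ i → n ℕ.≤ i → v i ≈ 0#) → conv v b k ≈ dot (λ i → b (k ℕ.∸ i)) v n
  conv-dot zero zero v b _ z = trans (*-congʳ (z 0 ℕ.z≤n)) (zeroˡ _)
  conv-dot zero (suc k) v b _ z = trans (+-cong (trans (*-congʳ (z 0 ℕ.z≤n)) (zeroˡ _)) (conv-dot zero k (tail v) b
    ℕ.z≤n λ i _ → z (suc i) ℕ.z≤n)) (+-identityˡ 0#)
  conv-dot (suc zero) zero v b _ z = solve 2 (λ x y → x :* y := y :* x :+ :0) refl (v 0) (b 0)
  conv-dot (suc (suc n)) zero v b (ℕ.s≤s ()) z
  conv-dot (suc n) (suc k) v b (ℕ.s≤s p) z = +-cong (*-comm _ _) (conv-dot n k (tail v) b p λ i q → z (suc i)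
    (ℕ.s≤s q))

  dot-truncate : ∀ n x w → dot x (truncate n w) n ≈ dot x w n
  dot-truncate n x w = dot-cong n λ k p → *-congˡ (reflexive (truncate-< n w k p))

  isGerm-truncate : ∀ n {v : ℕ → Carrier → Carrier} → (∀ i → IsGerm (v i)) → ∀ i → IsGerm (λ s → truncate n
    (λ j → v j s) i)
  isGerm-truncate zero p i = isGerm-const 0#
  isGerm-truncate (suc n) p zero = p 0
  isGerm-truncate (suc n) p (suc i) = isGerm-truncate n (λ j → p (suc j)) i

  -- Taylor coefficients at all centres near `x*`, as germs in the displacement `s` of the centre,
  -- with `B` and `Λ` common to all centres.
  record Jets (F : Carrier → Carrier) (x* : Carrier) : Set where
    field
      c      : ℕ → Carrier → Carrier
      germ   : ∀ k → IsGerm (c k)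
      B Λ    : Carrier
      1≤Λ    : 1# ≤ Λ
      0≤B    : 0# ≤ B
      taylor : Near (λ s → Expansion (λ t → F (x* + s + t)) (λ k → c k s) B Λ)

  RationalAt : (Carrier → Carrier) → Carrier → Set
  RationalAt F y = ∃ λ Q → ∃ λ P → ∃ λ m → ∃ λ n → Q 0 ≉ 0# × Near (λ t → pe Q t (suc m) * F (y + t) ≈ pe P t n)

  scaled-inverse : ∀ {Y Z d} → 0# < Z → Y ≤ Z → 0# ≤ d → d ≤ Z ⁻¹ → Y * d ≤ 1#
  scaled-inverse 0<Z Y≤Z 0≤d p = ≤-trans (*-monoʳ-≤ 0≤d Y≤Z) (≤-trans (*-monoˡ-≤ (<⇒≤ 0<Z) p) (≈⇒≤ (*-inv 0<Z)))

  -- In `independent`, `w` is a polynomial with `m` coefficients, and the dot products are the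
  -- coefficients of index `2 m` to `3 m` of its product with the jet: they cannot all be small
  -- unless `w` is, uniformly in the centre.
  record NiceAt (F : Carrier → Carrier) (m : ℕ) (x₀ : Carrier) : Set where
    field
      ρ κ B Λ     : Carrier
      0<ρ         : 0# < ρ
      0≤κ         : 0# ≤ κ
      jet         : Carrier → Sequence
      expansion   : ∀ x → ∣ x - x₀ ∣ < ρ → Expansion (λ t → F (x + t)) (jet x) B Λ
      independent : ∀ x → ∣ x - x₀ ∣ < ρ → ∀ w η →
        (∀ k → 2 ℕ.* m ℕ.≤ k → k ℕ.≤ 2 ℕ.* m ℕ.+ m → ∣ dot (λ i → jet x (k ℕ.∸ i)) w m ∣ ≤ η) →
        ∀ i → i ℕ.< m → ∣ w i ∣ ≤ κ * η

  record BiLipschitzAt (F : Carrier → Carrier) (x₀ : Carrier) : Set where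
    field
      ρ λ₁ L    : Carrier
      0<ρ       : 0# < ρ
      0<λ₁      : 0# < λ₁
      0<L       : 0# < L
      expanding : ∀ x y → ∣ x - x₀ ∣ < ρ → ∣ y - x₀ ∣ < ρ → λ₁ * ∣ x - y ∣ ≤ ∣ F x - F y ∣
      lipschitz : ∀ x y → ∣ x - x₀ ∣ < ρ → ∣ y - x₀ ∣ < ρ → ∣ F x - F y ∣ ≤ L * ∣ x - y ∣

  module _ {F : Carrier → Carrier} (F-cong : ∀ {x y} → x ≈ y → F x ≈ F y) {x* : Carrier} (J : Jets F x*) where

    open Jets J

    RationalNear : Carrier → Set
    RationalNear ε = ∃ λ y → ∣ y - x* ∣ < ε × RationalAt F y

    private
      x*+s-x* : ∀ {s} → ∣ x* + s - x* ∣ ≈ ∣ s ∣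
      x*+s-x* {s} = abs-cong (solve 2 (λ x s → x :+ s :- x := s) refl x* s)

      module Positive {s₁ r : Carrier} (0<s₁ : 0# < s₁) (r≤ : r ≤ ½ * s₁) where
        size : ∀ {s} → ∣ s - s₁ ∣ ≤ r → ½ * s₁ ≤ ∣ s ∣
        size {s} p = ≤-trans (≤-trans (≤-by (sub-nonneg (≤-trans p r≤))
          (trans (+-congʳ (solve 1 (λ h → h := h :+ h :- h) refl (½ * s₁))) (trans (+-congʳ (+-congʳ (½+½ s₁)))
          (solve 3 (λ s h d → s :- h :- d := s :- d :- h) refl s₁ (½ * s₁) ∣ s - s₁ ∣))))
            (≤-by (sub-nonneg (-x≤∣x∣ (s - s₁))) (solve 3 (λ s t d → d :- :- (s :- t) := s :- (t :- d)) refl s s₁ ∣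
              s - s₁ ∣))) (x≤∣x∣ s)
        bound : ∀ {s ρ} → ∣ s - s₁ ∣ ≤ r → s₁ + s₁ ≤ ρ → ∣ s ∣ < ρ
        bound {s} p q = <-≤-trans (≤-<-trans (≤-trans (≈⇒≤ (abs-cong (solve 2 (λ s t → s := (s :- t) :+ t) refl s
          s₁))) (abs-triangle _ _))
          (+-mono-<-≤ (≤-<-trans (≤-trans p r≤) (half-< 0<s₁)) (≈⇒≤ (abs-of-nonneg (<⇒≤ 0<s₁))))) q

    private
     Facts : ∀ (nP nQ : ℕ) (v : ℕ → Carrier → Carrier) (V c₀ : Carrier) (k : ℕ) → Carrier → Set
     Facts nP nQ v V c₀ k s = Expansion (λ t → F (x* + s + t)) (λ k → c k s) B Λ × (∀ i → i ℕ.< suc nQ → ∣ v i s ∣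
       ≤ V) ×
       (c₀ * ∣ s ∣ ^ k ≤ ∣ v 0 s ∣) × (∀ k → nP ℕ.≤ k → k ℕ.≤ nP ℕ.+ suc nQ → conv (λ i → v i s) (λ i → c i s) k ≈
         0#)

     -- The kernel vector `v` provides the denominators `Q s`, and its product with the jet the
     -- numerators `P s`. The centre `s₁` is positive because `v 0` may vanish at 0, whereas around
     -- `s₁` it is bounded below by `c₁`.
     module Base (nP nQ : ℕ) (v : ℕ → Carrier → Carrier) (v-zero : ∀ i s → suc nQ ℕ.≤ i → v i s ≈ 0#)
       {V ρ c₀ s₁ : Carrier} {k : ℕ} (0≤V : 0# ≤ V) (0<c₀ : 0# < c₀) (0<s₁ : 0# < s₁) (2s₁≤ρ : s₁ + s₁ ≤ ρ) where

      module _ (facts : ∀ s → ∣ s ∣ < ρ → Facts nP nQ v V c₀ k s) where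
        c₁ = c₀ * (½ * s₁) ^ k
        0<c₁ = *-pos 0<c₀ (^-pos k (half-pos 0<s₁))
        n = nP ℕ.+ suc nQ
        D = suc n
        W = pe (λ _ → V) 1# nQ
        0≤W : 0# ≤ W
        0≤W = pe-nonneg nQ (λ _ → 0≤V) 0≤1
        q = pe (λ _ → V) 1# (suc nQ)
        0≤q : 0# ≤ q
        0≤q = pe-nonneg (suc nQ) (λ _ → 0≤V) 0≤1
        E = fromℕ D * (V * B)
        0≤E = *-nonneg (fromℕ-nonneg D) (*-nonneg 0≤V 0≤B)
        0≤Λ = ≤-trans 0≤1 1≤Λ
        ΛN = Λ * fromℕ n
        0≤ΛN = *-nonneg 0≤Λ (fromℕ-nonneg n)
        WC = W * (½ * c₁) ⁻¹
        0≤WC = *-nonneg 0≤W (<⇒≤ (⁻¹-pos (half-pos 0<c₁)))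
        -- The radius `r ≤ ½ * Z ⁻¹` meets three demands at once: `small`, `2 r ≤ 1`, and
        -- `W * 2 r ≤ ½ * c₁`, by which `v 0` dominates the other terms of the denominator.
        Z = 1# + (ΛN + WC)
        0<Z = +-pos 0<1 (+-nonneg 0≤ΛN 0≤WC)
        radius = common-lower-bound (half-pos 0<s₁) (half-pos (⁻¹-pos 0<Z))
        r = proj₁ radius
        0<r = proj₁ (proj₂ radius)
        r≤½s₁ = proj₁ (proj₂ (proj₂ radius))
        0≤2r = +-nonneg (<⇒≤ 0<r) (<⇒≤ 0<r)
        2r≤ : r + r ≤ Z ⁻¹
        2r≤ = ≤-trans (+-mono-≤ (proj₂ (proj₂ (proj₂ radius))) (proj₂ (proj₂ (proj₂ radius)))) (≈⇒≤ (½+½ _))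
        open Positive 0<s₁ r≤½s₁
        small : Λ * (fromℕ n * (r + r)) ≤ 1#
        small = ≤-trans (≈⇒≤ (sym (*-assoc _ _ _))) (scaled-inverse 0<Z (≤-by (+-nonneg 0≤1 0≤WC)
          (solve 2 (λ x y → :1 :+ y := :1 :+ (x :+ y) :- x) refl ΛN WC)) 0≤2r 2r≤)
        2r≤1 : r + r ≤ 1#
        2r≤1 = ≤-trans (≈⇒≤ (sym (*-identityˡ _))) (scaled-inverse 0<Z (≤-by (+-nonneg 0≤ΛN 0≤WC)
          (solve 1 (λ x → x := :1 :+ x :- :1) refl (ΛN + WC))) 0≤2r 2r≤)
        W2r≤ : W * (r + r) ≤ ½ * c₁
        W2r≤ = ≤-trans (≈⇒≤ (trans (sym (*-identityˡ _)) (trans (*-congʳ (sym (*-inv (half-pos 0<c₁))))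
          (solve 4 (λ h i w r → h :* i :* (w :* r) := h :* (w :* i :* r)) refl (½ * c₁) ((½ * c₁) ⁻¹) W (r + r)))))
          (≤-trans (*-monoˡ-≤ (<⇒≤ (half-pos 0<c₁)) (scaled-inverse 0<Z (≤-by (+-nonneg 0≤1 0≤ΛN)
            (solve 2 (λ x y → :1 :+ x := :1 :+ (x :+ y) :- y) refl ΛN WC)) 0≤2r 2r≤)) (≈⇒≤ (*-identityʳ _)))
        In : Carrier → Set
        In s = ∣ s - s₁ ∣ ≤ r
        self : In s₁
        self = ≤-trans (≈⇒≤ (trans (abs-cong (-‿inverseʳ s₁)) abs-0)) (<⇒≤ 0<r)
        at : ∀ s → In s → Facts nP nQ v V c₀ k s
        at s p = facts s (bound p 2s₁≤ρ)
        v≤V : ∀ s → In s → ∀ i → ∣ v i s ∣ ≤ V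
        v≤V s p i = [ proj₁ (proj₂ (at s p)) i ,
          (λ q → ≤-trans (≈⇒≤ (trans (abs-cong (v-zero i s q)) abs-0)) 0≤V) ]′ (ℕₚ.<-≤-connex i (suc nQ))
        v₀-lower : ∀ s → In s → c₁ ≤ ∣ v 0 s ∣
        v₀-lower s p = ≤-trans (*-monoˡ-≤ (<⇒≤ 0<c₀) (^-mono-≤ k (<⇒≤ (half-pos 0<s₁)) (size p)))
          (proj₁ (proj₂ (proj₂ (at s p))))
        upper : ∀ s → In s → ∀ t → ∣ t ∣ ≤ 1# → ∣ pe (λ i → v i s) t (suc nQ) ∣ ≤ q
        upper s p t t≤1 = pe-abs (suc nQ) (λ i _ → v≤V s p i) t≤1
        lower : ∀ s → In s → ∀ t → ∣ t ∣ ≤ r + r → ½ * c₁ ≤ ∣ pe (λ i → v i s) t (suc nQ) ∣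
        lower s p t t≤ = ≤-by (+-nonneg (sub-nonneg (v₀-lower s p)) (sub-nonneg (≤-trans v₀≤ (+-monoʳ-≤ _ tail≤))))
          (trans (+-congʳ (+-congˡ (-‿cong (sym (½+½ c₁))))) (solve 3 (λ v h y → (v :- (h :+ h)) :+ (y :+ h :- v)
            := y :- h) refl ∣ v 0 s ∣ (½ * c₁) (∣ pe (λ i → v i s) t (suc nQ) ∣)))
          where
          u = pe (λ i → v (suc i) s) t nQ
          v₀≤ : ∣ v 0 s ∣ ≤ ∣ pe (λ i → v i s) t (suc nQ) ∣ + ∣ t * u ∣
          v₀≤ = ≤-trans (≈⇒≤ (abs-cong (solve 2 (λ v x → v := (v :+ x) :- x) refl (v 0 s) (t * u)))) (abs-triangle⁻
            _ _)
          tail≤ : ∣ t * u ∣ ≤ ½ * c₁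
          tail≤ = ≤-trans (abs-*-≤ t≤ (pe-abs nQ (λ i _ → v≤V s p (suc i)) (≤-trans t≤ 2r≤1)))
            (≤-trans (≈⇒≤ (*-comm _ _)) W2r≤)
        -- By the kernel relation the coefficients of `v F` from `nP` up to `n` vanish, so
        -- truncation at `nP` is truncation at `D = n + 1`, and `product-remainder` gives the order
        -- `D`.
        approx : ∀ s → In s → ∀ t → Λ * ∣ t ∣ ≤ 1# →
          ∣ pe (λ i → v i s) t (suc nQ) * F (x* + s + t) - pe (conv (λ i → v i s) (λ i → c i s)) t nP ∣ ≤ E *
            (Λ * ∣ t ∣) ^ D
        approx s p t Λt≤1 = ≤-trans (≈⇒≤ (abs-cong (+-cong
            (*-congʳ (sym (pe-truncate (λ i → v i s) t (ℕₚ.m≤n⇒m≤1+n (ℕₚ.m≤n+m (suc nQ) nP)) λ i q _ → v-zero i s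
              q)))
            (-‿cong (sym (pe-truncate (conv (λ i → v i s) (λ i → c i s)) t (ℕₚ.m≤n⇒m≤1+n (ℕₚ.m≤m+n nP (suc nQ)))
              λ i q q′ → proj₂ (proj₂ (proj₂ (at s p))) i q (ℕₚ.≤-pred q′)))))))
          (≤-trans (product-remainder D 0≤Λ (λ i → ≤-trans (v≤V s p i) (≤-trans (≈⇒≤ (sym (*-identityʳ V)))
            (*-monoˡ-≤ 0≤V (1≤^ i 1≤Λ))))
            (Expansion.approx (proj₁ (at s p)) t Λt≤1))
            (≈⇒≤ (sym (*-assoc _ _ _))))

        result : RationalAt F (x* + s₁)
        result = (λ i → v i s₁) , conv (λ i → v i s₁) (λ i → c i s₁) , nQ , nP ,
          (λ e → ≤⇒≯ (v₀-lower s₁ self) (≤-<-trans (≈⇒≤ (trans (abs-cong e) abs-0)) 0<c₁)) ,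
          r , 0<r , λ t p → rational-near F F-cong x* s₁ r (<⇒≤ 0<r) nP (suc nQ) (λ s → conv (λ i → v i s)
            (λ i → c i s)) (λ s i → v i s)
            0≤E 1≤Λ 0≤q (half-pos 0<c₁) (ℕₚ.≤-trans (ℕ.s≤s ℕ.z≤n) (ℕₚ.m≤n+m (suc nQ) nP)) small approx upper lower
              t (<⇒≤ p)

    kernel⇒rational-base : ∀ nP nQ (v : ℕ → Carrier → Carrier) → (∀ i → IsGerm (v i)) →
      (∀ i s → suc nQ ℕ.≤ i → v i s ≈ 0#) → Nonvanishing (v 0) →
      Near (λ s → ∀ k → nP ℕ.≤ k → k ℕ.≤ nP ℕ.+ suc nQ → conv (λ i → v i s) (λ i → c i s) k ≈ 0#) →
      ∀ {ε} → 0# < ε → RationalNear ε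
    kernel⇒rational-base nP nQ v v-germ v-zero (c₀ , k , 0<c₀ , v₀≥) kernel {ε} 0<ε =
      assemble (germs-bounded (suc nQ) v-germ)
      where
      assemble : (∃ λ V → 0# ≤ V × Near (λ s → ∀ i → i ℕ.< suc nQ → ∣ v i s ∣ ≤ V)) → RationalNear ε
      assemble (V , 0≤V , bounded) = shrink (near-∧ taylor (near-∧ bounded (near-∧ v₀≥ kernel)))
        where
        shrink : Near (Facts nP nQ v V c₀ k) → RationalNear ε
        shrink (ρ , 0<ρ , facts) = centre (common-lower-bound 0<ε 0<ρ)
          where
          centre : (∃ λ μ → 0# < μ × μ ≤ ε × μ ≤ ρ) → RationalNear ε
          centre (μ , 0<μ , μ≤ε , μ≤ρ) = x* + ½ * μ ,
            ≤-<-trans (≈⇒≤ (trans x*+s-x* (abs-of-nonneg (<⇒≤ (half-pos 0<μ))))) (<-≤-trans (half-< 0<μ) μ≤ε) ,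
            Base.result nP nQ v v-zero {k = k} 0≤V 0<c₀ (half-pos 0<μ) (≤-trans (≈⇒≤ (½+½ μ)) μ≤ρ) facts

    kernel⇒rational : ∀ nQ nP (v : ℕ → Carrier → Carrier) → (∀ i → IsGerm (v i)) →
      (∀ i s → nQ ℕ.≤ i → v i s ≈ 0#) → (∃ λ i → i ℕ.< nQ × Nonvanishing (v i)) →
      Near (λ s → ∀ k → nP ℕ.≤ k → k ℕ.≤ nP ℕ.+ nQ → conv (λ i → v i s) (λ i → c i s) k ≈ 0#) →
      ∀ {ε} → 0# < ε → RationalNear ε
    kernel⇒rational zero nP v v-germ v-zero (i , () , _) kernel 0<ε
    kernel⇒rational (suc nQ) nP v v-germ v-zero (zero , _ , v₀≢0) kernel 0<ε =
      kernel⇒rational-base nP nQ v v-germ v-zero v₀≢0 kernel 0<ε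
    kernel⇒rational (suc nQ) nP v v-germ v-zero (suc i , ℕ.s≤s i<nQ , vi≢0) kernel {ε} 0<ε = step (germ-dichotomy
      (v-germ 0))
      where
      step : Vanishing (v 0) ⊎ Nonvanishing (v 0) → RationalNear ε
      step (inj₂ v₀≢0) = kernel⇒rational-base nP nQ v v-germ v-zero v₀≢0 kernel 0<ε
      step (inj₁ v₀≡0) = kernel⇒rational nQ (nP ℕ.∸ 1) (λ i → v (suc i)) (λ i → v-germ (suc i)) (λ i s p → v-zero
        (suc i) s (ℕ.s≤s p))
        (i , i<nQ , vi≢0) (near-map shift (near-∧ v₀≡0 kernel)) 0<ε
        where
        shift : ∀ s → v 0 s ≈ 0# × (∀ k → nP ℕ.≤ k → k ℕ.≤ nP ℕ.+ suc nQ → conv (λ i → v i s) (λ i → c i s) k ≈ 0#)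
          →
          ∀ k → nP ℕ.∸ 1 ℕ.≤ k → k ℕ.≤ (nP ℕ.∸ 1) ℕ.+ nQ → conv (λ i → v (suc i) s) (λ i → c i s) k ≈ 0#
        shift s (z , ker) k p q = trans (sym (trans (+-congʳ (trans (*-congʳ z) (zeroˡ _))) (+-identityˡ _)))
          (ker (suc k) (ℕₚ.≤-trans (ℕₚ.m≤n+m∸n nP 1) (ℕ.s≤s p))
            (ℕₚ.≤-trans (ℕ.s≤s (ℕₚ.≤-trans q (ℕₚ.+-monoˡ-≤ nQ (ℕₚ.m∸n≤m nP 1)))) (ℕₚ.≤-reflexive
              (≡.sym (ℕₚ.+-suc nP nQ)))))

    private
      -- Row `r` gives the coefficient of index `2 m + r` in the product of the jet with a
      -- polynomial having `m` coefficients.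
      hankel : ℕ → Matrix
      hankel m r i s = c (2 ℕ.* m ℕ.+ r ℕ.∸ i) s

      degenerate⇒rational : ∀ m → Degenerate (hankel m) (suc m) m → ∀ {ε} → 0# < ε → RationalNear ε
      degenerate⇒rational m (v , v-germ , (i , i<m , vi≢0) , ker) = kernel⇒rational m (2 ℕ.* m) v̂ (isGerm-truncate
        m v-germ)
        (λ i s p → reflexive (truncate-≥ m (λ j → v j s) i p)) (i , i<m , v̂i≢0) (near-map kernel ker)
        where
        v̂ : ℕ → Carrier → Carrier
        v̂ i s = truncate m (λ j → v j s) i
        v̂i≢0 : Nonvanishing (v̂ i)
        v̂i≢0 = let c₀ , k , 0<c₀ , p = vi≢0 in c₀ , k , 0<c₀ ,
          near-map (λ s q → ≤-trans q (≈⇒≤ (abs-cong (reflexive (≡.sym (truncate-< m (λ j → v j s) i i<m)))))) p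
        kernel : ∀ s → (∀ r → r ℕ.< suc m → dot (λ i → hankel m r i s) (λ i → v i s) m ≈ 0#) →
          ∀ k → 2 ℕ.* m ℕ.≤ k → k ℕ.≤ 2 ℕ.* m ℕ.+ m → conv (λ i → v̂ i s) (λ i → c i s) k ≈ 0#
        kernel s p k q q′ = trans (conv-dot m k (λ i → v̂ i s) (λ i → c i s)
            (ℕₚ.m≤n⇒m≤1+n (ℕₚ.≤-trans (ℕₚ.m≤m+n m _) q)) (λ i r → reflexive (truncate-≥ m (λ j → v j s) i r)))
          (trans (dot-truncate m (λ i → c (k ℕ.∸ i) s) (λ j → v j s))
            (≡.subst (λ k → dot (λ i → c (k ℕ.∸ i) s) (λ i → v i s) m ≈ 0#) (ℕₚ.m+[n∸m]≡n q)
              (p (k ℕ.∸ 2 ℕ.* m) (ℕ.s≤s (≡.subst (k ℕ.∸ 2 ℕ.* m ℕ.≤_) (ℕₚ.m+n∸m≡n (2 ℕ.* m) m) (ℕₚ.∸-monoˡ-≤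
                (2 ℕ.* m) q′))))))

      module Around {x₀ ρ : Carrier} (x₀≉x* : x₀ ≉ x*) (x₀<ρ : ∣ x₀ - x* ∣ < ρ) where
        d = ∣ x₀ - x* ∣
        0<d : 0# < d
        0<d = abs-pos λ e → x₀≉x* (trans (solve 2 (λ x y → x := (x :- y) :+ y) refl x₀ x*) (trans (+-congʳ e)
          (+-identityˡ x*)))
        radius = common-lower-bound (half-pos 0<d) (sub-pos x₀<ρ)
        σ = proj₁ radius
        0<σ = proj₁ (proj₂ radius)
        module _ {x : Carrier} (p : ∣ x - x₀ ∣ < σ) where
          inside : ∣ x - x* ∣ < ρ
          inside = ≤-<-trans (abs-sub-triangle x x₀ x*)
            (<-≤-trans (+-monoˡ-< d (<-≤-trans p (proj₂ (proj₂ (proj₂ radius)))))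
            (≈⇒≤ (solve 2 (λ r d → r :- d :+ d := r) refl ρ d)))
          away : ½ * d ≤ ∣ x - x* ∣
          away = ≤-by (+-nonneg (sub-nonneg (abs-sub-triangle x₀ x x*))
            (sub-nonneg (≤-trans (≈⇒≤ (abs-minus-comm x₀ x)) (≤-trans (<⇒≤ p) (proj₁ (proj₂ (proj₂ radius)))))))
            (trans (+-congʳ (+-congˡ (-‿cong (sym (½+½ d))))) (solve 3 (λ a b h → (b :+ a :- (h :+ h)) :+ (h :- b)
              := a :- h) refl ∣ x - x* ∣ (∣ x₀ - x ∣) (½ * d)))

    expansion-at : ∀ x {a} → Expansion (λ t → F (x* + (x - x*) + t)) a B Λ → Expansion (λ t → F (x + t)) a B Λ
    expansion-at x = expansion-cong λ t → F-cong (solve 3 (λ a x t → a :+ (x :- a) :+ t := x :+ t) refl x* x t)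

    -- A germ-valued kernel would make `F` rational nearby, so elimination ends with some `δ`. On a
    -- ball around `x₀` that stays away from `x*`, `δ` is bounded below and can be divided out; at
    -- `x*` itself it may vanish, whence `x₀ ≉ x*`.
    irrational⇒nice : ∀ m {ε} → 0# < ε → ¬ RationalNear ε → ∃ λ ρ → 0# < ρ × (∀ x₀ → x₀ ≉ x* → ∣ x₀ - x* ∣ < ρ →
      NiceAt F m x₀)
    irrational⇒nice m 0<ε ¬rat = decide (degenerate-or-not m (suc m) (hankel m) (λ r i → germ (2 ℕ.* m ℕ.+ r ℕ.∸
      i)))
      where
      decide : Degenerate (hankel m) (suc m) m ⊎ Nondegenerate (hankel m) (suc m) m →
        ∃ λ ρ → 0# < ρ × (∀ x₀ → x₀ ≉ x* → ∣ x₀ - x* ∣ < ρ → NiceAt F m x₀)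
      decide (inj₁ deg) = ⊥-elim (¬rat (degenerate⇒rational m deg 0<ε))
      decide (inj₂ (δ , C , _ , (c₀ , k , 0<c₀ , δ≥) , 0≤C , solve-system)) = proj₁ facts , proj₁ (proj₂ facts) ,
        nice
        where
        facts = near-∧ taylor (near-∧ δ≥ solve-system)
        nice : ∀ x₀ → x₀ ≉ x* → ∣ x₀ - x* ∣ < proj₁ facts → NiceAt F m x₀
        nice x₀ x₀≉x* x₀<ρ = record
          { ρ = σ ; κ = c₁ ⁻¹ * C ; B = B ; Λ = Λ ; 0<ρ = 0<σ ; 0≤κ = *-nonneg (<⇒≤ (⁻¹-pos 0<c₁)) 0≤C
          ; jet = λ x i → c i (x - x*)
          ; expansion = λ x p → expansion-at x (proj₁ (at x p))
          ; independent = λ x p w η h i i<m → *-cancelˡ-≤ 0<c₁ (≤-trans (*-monoʳ-≤ (abs-nonneg _) (δ-lower x p))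
              (≤-trans (≈⇒≤ (sym (abs-* _ _))) (≤-trans (proj₂ (proj₂ (at x p)) w η (λ r r<1+m → h (2 ℕ.* m ℕ.+ r)
                (ℕₚ.m≤m+n _ r) (ℕₚ.+-monoʳ-≤ (2 ℕ.* m) (ℕₚ.≤-pred r<1+m))) i i<m)
                (≈⇒≤ (sym (trans (solve 4 (λ d i c e → d :* (i :* c :* e) := d :* i :* (c :* e)) refl c₁ (c₁ ⁻¹) C
                  η) (trans (*-congʳ (*-inv 0<c₁)) (*-identityˡ _))))))))
          }
          where
          open Around x₀≉x* x₀<ρ
          c₁ = c₀ * (½ * d) ^ k
          0<c₁ = *-pos 0<c₀ (^-pos k (half-pos 0<d))
          at : ∀ x → ∣ x - x₀ ∣ < σ → _
          at x p = proj₂ (proj₂ facts) (x - x*) (inside p)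
          δ-lower : ∀ x → ∣ x - x₀ ∣ < σ → c₁ ≤ ∣ δ (x - x*) ∣
          δ-lower x p = ≤-trans (*-monoˡ-≤ (<⇒≤ 0<c₀) (^-mono-≤ k (<⇒≤ (half-pos 0<d)) (away p)))
            (proj₁ (proj₂ (at x p)))

    first-order : ∀ {x a} → Expansion (λ t → F (x + t)) a B Λ → ∀ t → Λ * ∣ t ∣ ≤ 1# → ∣ F (x + t) - F x - a 1 * t
      ∣ ≤ B * (Λ * ∣ t ∣) ^ 2
    first-order {x} {a} E t p = ≤-trans
      (≈⇒≤ (abs-cong (trans (+-congʳ (+-congˡ (-‿cong (trans (F-cong (sym (+-identityʳ x))) (Expansion.value-at-0
      E)))))
      (solve 4 (λ f a b t → f :- a :- b :* t := f :- (a :+ t :* (b :+ t :* :0))) refl (F (x + t)) (a 0) (a 1) t))))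
        (Expansion.approx E t p 2)

    private
      -- With vanishing first coefficients, the first-order expansion becomes a quadratic modulus of
      -- continuity, so `F` is locally constant.
      constant-near : ∀ {ρ} → 0# < ρ → (∀ s → ∣ s ∣ < ρ → Expansion (λ t → F (x* + s + t)) (λ k → c k s) B Λ × c 1
        s ≈ 0#) → RationalAt F x*
      constant-near {ρ} 0<ρ facts = constant 1# , constant (F x*) , 0 , 1 , 1≉0 , r , 0<r , λ t t<r →
          trans (solve 2 (λ f t → (:1 :+ t :* :0) :* f := f) refl (F (x* + t)) t) (trans (same t t<r)
            (solve 2 (λ f t → f := f :+ t :* :0) refl (F x*) t))
        where
        0≤Λ = ≤-trans 0≤1 1≤Λ
        0<2Λ : 0# < Λ + Λ
        0<2Λ = +-pos (<-≤-trans 0<1 1≤Λ) 0≤Λ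
        radius = common-lower-bound (half-pos 0<ρ) (⁻¹-pos 0<2Λ)
        r = proj₁ radius
        0<r = proj₁ (proj₂ radius)
        in-ρ : ∀ {s} → ∣ s - 0# ∣ ≤ r → ∣ s ∣ < ρ
        in-ρ {s} p = ≤-<-trans (≤-trans (≈⇒≤ (abs-cong (solve 1 (λ s → s := s :- :0) refl s)))
          (≤-trans p (proj₁ (proj₂ (proj₂ radius))))) (half-< 0<ρ)
        quad : ∀ s s′ → ∣ s - 0# ∣ ≤ r → ∣ s′ - 0# ∣ ≤ r → s ≉ s′ → ∣ F (x* + s) - F (x* + s′) ∣ ≤ B * Λ ^ 2 * ∣ s
          - s′ ∣ ^ 2
        quad s s′ p p′ _ = ≤-trans
          (≈⇒≤ (abs-cong (trans (+-congʳ (F-cong (solve 3 (λ x s u → x :+ s := x :+ u :+ (s :- u)) refl x* s s′)))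
            (trans (solve 3 (λ f g t → f :- g := f :- g :- :0 :* t) refl _ _ (s - s′))
              (+-congˡ (-‿cong (*-congʳ (sym (proj₂ (facts s′ (in-ρ p′))))))))))) 
          (≤-trans (first-order (proj₁ (facts s′ (in-ρ p′))) (s - s′) Λt≤1) (≈⇒≤ (trans (*-congˡ (^-* Λ _ 2))
            (sym (*-assoc _ _ _)))))
          where
          Λt≤1 : Λ * ∣ s - s′ ∣ ≤ 1#
          Λt≤1 = ≤-trans (*-monoˡ-≤ 0≤Λ (≤-trans (abs-sub-triangle s 0# s′)
            (+-mono-≤ p (≤-trans (≈⇒≤ (abs-minus-comm 0# s′)) p′))))
            (≤-trans (≈⇒≤ (solve 2 (λ l r → l :* (r :+ r) := (l :+ l) :* r) refl Λ r)) (scaled-inverse 0<2Λ ≤-refl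
              (<⇒≤ 0<r) (proj₂ (proj₂ (proj₂ radius)))))
        0In : ∣ 0# - 0# ∣ ≤ r
        0In = ≤-trans (≈⇒≤ (trans (abs-cong (-‿inverseʳ 0#)) abs-0)) (<⇒≤ 0<r)
        same : ∀ t → ∣ t ∣ < r → F (x* + t) ≈ F x*
        same t t<r = decide (em {t ≈ 0#})
          where
          decide : Dec (t ≈ 0#) → F (x* + t) ≈ F x*
          decide (yes e) = F-cong (trans (+-congˡ e) (+-identityʳ x*))
          decide (no e) = trans (quadratic⇒constant {φ = λ s → F (x* + s)} quad t 0#
            (≤-trans (≈⇒≤ (abs-cong (solve 1 (λ t → t :- :0 := t) refl t))) (<⇒≤ t<r)) 0In e)
            (F-cong (+-identityʳ x*))

      module Steep {x₀ ρ c₁ : Carrier} {a : Carrier → Sequence} (0<ρ : 0# < ρ) (0<c₁ : 0# < c₁)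
        (expand : ∀ x → ∣ x - x₀ ∣ < ρ → Expansion (λ t → F (x + t)) (a x) B Λ)
        (steep : ∀ x → ∣ x - x₀ ∣ < ρ → c₁ ≤ ∣ a x 1 ∣) where

        0≤Λ = ≤-trans 0≤1 1≤Λ
        -- `Y * ∣ t ∣ ≤ 1#` makes the second-order error at most half of the linear term, whose
        -- slope is at least `c₁`.
        Y = B * Λ ^ 2 * (½ * c₁) ⁻¹
        0≤BΛ² = *-nonneg 0≤B (^-nonneg 2 0≤Λ)
        0≤Y = *-nonneg 0≤BΛ² (<⇒≤ (⁻¹-pos (half-pos 0<c₁)))
        Z = 1# + (Λ + Y)
        0<Z = +-pos 0<1 (+-nonneg 0≤Λ 0≤Y)

        module _ {r : Carrier} (r≤ρ : r ≤ ρ) (r≤Z : r ≤ ½ * Z ⁻¹) {x y : Carrier} (xI : ∣ x - x₀ ∣ < r) (yI : ∣ y - x₀ ∣ < r) where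
          t = x - y
          t≤ : ∣ t ∣ ≤ Z ⁻¹
          t≤ = ≤-trans (abs-sub-triangle x x₀ y) (≤-trans (+-mono-≤ (≤-trans (<⇒≤ xI) r≤Z)
            (≤-trans (≈⇒≤ (abs-minus-comm x₀ y)) (≤-trans (<⇒≤ yI) r≤Z))) (≈⇒≤ (½+½ _)))
          Λt≤1 : Λ * ∣ t ∣ ≤ 1#
          Λt≤1 = scaled-inverse 0<Z (≤-by (+-nonneg 0≤1 0≤Y) (solve 2 (λ x y → :1 :+ y := :1 :+ (x :+ y) :- x) refl
            Λ Y)) (abs-nonneg t) t≤
          Yt≤1 : Y * ∣ t ∣ ≤ 1#
          Yt≤1 = scaled-inverse 0<Z (≤-by (+-nonneg 0≤1 0≤Λ) (solve 2 (λ x y → :1 :+ x := :1 :+ (x :+ y) :- y) refl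
            Λ Y)) (abs-nonneg t) t≤
          E = expand y (<-≤-trans yI r≤ρ)
          error : ∣ F x - F y - a y 1 * t ∣ ≤ ½ * c₁ * ∣ t ∣
          error = ≤-trans (≈⇒≤ (abs-cong (+-congʳ (+-congʳ (F-cong (solve 2 (λ x y → x := y :+ (x :- y)) refl x
            y))))))
            (≤-trans (first-order E t Λt≤1) (≤-trans
              (≈⇒≤ (trans (*-congˡ (^-* Λ ∣ t ∣ 2)) (trans (solve 3 (λ b l u → b :* (l :* (u :* (u :* :1))) := b :*
                l :* :1 :* u :* u) refl B (Λ ^ 2) ∣ t ∣)
                (trans (*-congʳ (*-congʳ (*-congˡ (sym (*-inv (half-pos 0<c₁))))))
                  (solve 4 (λ b h i u → b :* (h :* i) :* u :* u := h :* u :* (b :* i :* u)) refl (B * Λ ^ 2)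
                  (½ * c₁) ((½ * c₁) ⁻¹) ∣ t ∣)))))
              (≤-trans (*-monoˡ-≤ (*-nonneg (<⇒≤ (half-pos 0<c₁)) (abs-nonneg t)) Yt≤1) (≈⇒≤ (*-identityʳ _)))))
          lower : ½ * c₁ * ∣ t ∣ ≤ ∣ F x - F y ∣
          lower = ≤-by (+-nonneg (sub-nonneg linear) (sub-nonneg (*-monoʳ-≤ (abs-nonneg t) (≤-trans (≈⇒≤ (½+½ c₁))
            (steep y (<-≤-trans yI r≤ρ))))))
            (solve 4 (λ f h t a → (f :+ h :* t :- a :* t) :+ (a :* t :- (h :+ h) :* t) := f :- h :* t) refl ∣ F x -
              F y ∣ (½ * c₁) (∣ t ∣) (∣ a y 1 ∣))
            where
            linear : ∣ a y 1 ∣ * ∣ t ∣ ≤ ∣ F x - F y ∣ + ½ * c₁ * ∣ t ∣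
            linear = ≤-trans (≈⇒≤ (trans (sym (abs-* _ _)) (abs-cong (solve 2 (λ f b → b := f :- (f :- b)) refl
              (F x - F y) (a y 1 * t)))))
              (≤-trans (abs-triangle⁻ _ _) (+-monoʳ-≤ _ error))
          upper : ∣ F x - F y ∣ ≤ (B * Λ ^ 1 + ½ * c₁) * ∣ t ∣
          upper = ≤-trans (≈⇒≤ (abs-cong (solve 2 (λ f b → f := b :+ (f :- b)) refl (F x - F y) (a y 1 * t))))
            (≤-trans (abs-+-≤ (abs-*-≤ (Expansion.coeffs E 1) ≤-refl) error) (≈⇒≤ (sym (distribʳ ∣ t ∣ _ _))))

        biLipschitz : BiLipschitzAt F x₀
        biLipschitz = build (common-lower-bound 0<ρ (half-pos (⁻¹-pos 0<Z)))
          where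
          build : (∃ λ r → 0# < r × r ≤ ρ × r ≤ ½ * Z ⁻¹) → BiLipschitzAt F x₀
          build (r , 0<r , r≤ρ , r≤Z) = record
            { ρ = r ; λ₁ = ½ * c₁ ; L = B * Λ ^ 1 + ½ * c₁ ; 0<ρ = 0<r ; 0<λ₁ = half-pos 0<c₁
            ; 0<L = <-≤-trans (half-pos 0<c₁) (≤-by (*-nonneg 0≤B (^-nonneg 1 0≤Λ)) (solve 2 (λ x y → x := x :+ y
              :- y) refl (B * Λ ^ 1) (½ * c₁)))
            ; expanding = λ x y p q → lower r≤ρ r≤Z p q
            ; lipschitz = λ x y p q → upper r≤ρ r≤Z p q }

    -- If the derivative is the zero germ, `F` is constant and hence rational near `x*`. Otherwise
    -- it is bounded below around a point slightly off `x*`, where it may still vanish.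
    irrational⇒biLipschitz : ∀ {ε} → 0# < ε → ¬ RationalNear ε → ∃ λ x₀ → ∣ x₀ - x* ∣ < ε × BiLipschitzAt F x₀
    irrational⇒biLipschitz {ε} 0<ε ¬rat = [ vanishing , nonvanishing ]′ (germ-dichotomy (germ 1))
      where
      vanishing : Vanishing (c 1) → ∃ λ x₀ → ∣ x₀ - x* ∣ < ε × BiLipschitzAt F x₀
      vanishing c₁≡0 = ⊥-elim (¬rat (x* , ≤-<-trans (≈⇒≤ (trans (abs-cong (-‿inverseʳ x*)) abs-0)) 0<ε , const
        (near-∧ taylor c₁≡0)))
        where
        const : Near (λ s → Expansion (λ t → F (x* + s + t)) (λ k → c k s) B Λ × c 1 s ≈ 0#) → RationalAt F x*
        const (ρ , 0<ρ , facts) = constant-near 0<ρ facts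
      nonvanishing : Nonvanishing (c 1) → ∃ λ x₀ → ∣ x₀ - x* ∣ < ε × BiLipschitzAt F x₀
      nonvanishing (c₀ , k , 0<c₀ , c₁≥) = pick (near-∧ taylor c₁≥)
        where
        pick : Near (λ s → Expansion (λ t → F (x* + s + t)) (λ k → c k s) B Λ × c₀ * ∣ s ∣ ^ k ≤ ∣ c 1 s ∣) → ∃ λ
          x₀ → ∣ x₀ - x* ∣ < ε × BiLipschitzAt F x₀
        pick (ρ , 0<ρ , facts) = place (common-lower-bound 0<ε 0<ρ)
          where
          place : (∃ λ μ → 0# < μ × μ ≤ ε × μ ≤ ρ) → ∃ λ x₀ → ∣ x₀ - x* ∣ < ε × BiLipschitzAt F x₀
          place (μ , 0<μ , μ≤ε , μ≤ρ) = x₀ , <-≤-trans x₀<μ μ≤ε ,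
              Steep.biLipschitz {a = λ x i → c i (x - x*)} A.0<σ 0<c₁ (λ x p → expansion-at x
                (proj₁ (facts (x - x*) (A.inside p))))
                (λ x p → ≤-trans (*-monoˡ-≤ (<⇒≤ 0<c₀) (^-mono-≤ k (<⇒≤ (half-pos A.0<d)) (A.away p)))
                  (proj₂ (facts (x - x*) (A.inside p))))
            where
            x₀ = x* + ½ * μ
            e : x₀ - x* ≈ ½ * μ
            e = solve 2 (λ x s → x :+ s :- x := s) refl x* (½ * μ)
            x₀<μ : ∣ x₀ - x* ∣ < μ
            x₀<μ = ≤-<-trans (≈⇒≤ (trans (abs-cong e) (abs-of-nonneg (<⇒≤ (half-pos 0<μ))))) (half-< 0<μ)
            x₀≉x* : x₀ ≉ x*
            x₀≉x* q = >⇒≉ (half-pos 0<μ) (trans (sym e) (trans (+-congʳ q) (-‿inverseʳ x*)))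
            module A = Around x₀≉x* (<-≤-trans x₀<μ μ≤ρ)
            0<c₁ : 0# < c₀ * (½ * A.d) ^ k
            0<c₁ = *-pos 0<c₀ (^-pos k (half-pos A.0<d))

-- From analytic functions on an interval to jets.

module AnalyticFunctions (em : ExcludedMiddle 0ℓ) (ℝ : CompleteOrderedField) where
  open CompleteOrderedField ℝ hiding (zero)
  open RealAnalysis ℝ
  open IntegerSolver commutativeRing
  open Ordered ℝ
  open Archimedean em ℝ
  open Horner ℝ
  open Germs em ℝ
  open Series em ℝ
  open Local em ℝ
  open Relation.Binary.Construct.Add.Extrema.Strict _<_ using (⊥±<[_]; [_]<⊤±) renaming ([_] to [_]<)

  private
    right-of : ∀ {a x y} → a <± [ x ] → x ≤ y → a <± [ y ]
    right-of ⊥±<[ _ ] p = ⊥±<[ _ ]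
    right-of [ a<x ]< p = [ <-≤-trans a<x p ]<

    left-of : ∀ {b x y} → [ x ] <± b → y ≤ x → [ y ] <± b
    left-of [ _ ]<⊤± p = [ _ ]<⊤±
    left-of [ x<b ]< p = [ ≤-<-trans p x<b ]<

    room-left : ∀ {a x} → a <± [ x ] → ∃ λ r → 0# < r × a <± [ x - r ]
    room-left ⊥±<[ _ ] = 1# , 0<1 , ⊥±<[ _ ]
    room-left {[ a ]} {x} [ a<x ]< = ½ * (x - a) , half-pos (sub-pos a<x) , [ <-by (half-pos (sub-pos a<x))
      (trans (solve 3 (λ h x a → h :* (x :- a) := (h :* (x :- a) :+ h :* (x :- a)) :- h :* (x :- a)) refl ½ x a)
        (trans (+-congʳ (½+½ _)) (solve 3 (λ x a y → x :- a :- y := x :- y :- a) refl x a (½ * (x - a))))) ]<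

    room-right : ∀ {b x} → [ x ] <± b → ∃ λ r → 0# < r × [ x + r ] <± b
    room-right [ _ ]<⊤± = 1# , 0<1 , [ _ ]<⊤±
    room-right {[ b ]} {x} [ x<b ]< = ½ * (b - x) , half-pos (sub-pos x<b) , [ <-by (half-pos (sub-pos x<b))
      (trans (solve 3 (λ h x a → h :* (a :- x) := (h :* (a :- x) :+ h :* (a :- x)) :- h :* (a :- x)) refl ½ x b)
        (trans (+-congʳ (½+½ _)) (solve 3 (λ x a y → a :- x :- y := a :- (x :+ y)) refl x b (½ * (b - x))))) ]<

  ∈ᴵ-resp : ∀ {U x y} → x ≈ y → x ∈ᴵ U → y ∈ᴵ U
  ∈ᴵ-resp e (p , q) = right-of p (≈⇒≤ e) , left-of q (≈⇒≤ (sym e))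

  ∈ᴵ-convex : ∀ {U x y z} → x ∈ᴵ U → y ∈ᴵ U → x ≤ z → z ≤ y → z ∈ᴵ U
  ∈ᴵ-convex (p , _) (_ , q) x≤z z≤y = right-of p x≤z , left-of q z≤y

  ∈ᴵ-open : ∀ {U x} → x ∈ᴵ U → ∃ λ r → 0# < r × (∀ y → ∣ y - x ∣ < r → y ∈ᴵ U)
  ∈ᴵ-open {U} {x} (p , q) = combine (room-left p) (room-right q)
    where
    combine : (∃ λ r → 0# < r × OpenInterval.lower U <± [ x - r ]) → (∃ λ r → 0# < r × [ x + r ] <±
      OpenInterval.upper U) →
      ∃ λ r → 0# < r × (∀ y → ∣ y - x ∣ < r → y ∈ᴵ U)
    combine (r , 0<r , p′) (s , 0<s , q′) = pick (common-lower-bound 0<r 0<s)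
      where
      pick : (∃ λ t → 0# < t × t ≤ r × t ≤ s) → ∃ λ r → 0# < r × (∀ y → ∣ y - x ∣ < r → y ∈ᴵ U)
      pick (t , 0<t , t≤r , t≤s) = t , 0<t , λ y d →
        right-of p′ (≤-by (sub-nonneg (≤-trans (≤-trans (-x≤∣x∣ (y - x)) (<⇒≤ d)) t≤r)) (solve 3 (λ x y r → r :- :-
          (y :- x) := y :- (x :- r)) refl x y r)) ,
        left-of q′ (≤-by (sub-nonneg (≤-trans (≤-trans (x≤∣x∣ (y - x)) (<⇒≤ d)) t≤s))
          (solve 3 (λ x y r → r :- (y :- x) := x :+ r :- y) refl x y s))

  eventually-bounded : ∀ (b : ℕ → Carrier) N {K} → (∀ n → N ℕ.≤ n → b n ≤ K) → ∃ λ A → 0# ≤ A × (∀ n → b n ≤ A)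
  eventually-bounded b zero {K} p = ∣ K ∣ , abs-nonneg K , λ n → ≤-trans (p n ℕ.z≤n) (x≤∣x∣ K)
  eventually-bounded b (suc N) {K} p = extend (eventually-bounded (λ n → b (suc n)) N λ n q → p (suc n) (ℕ.s≤s q))
    where
    extend : (∃ λ A → 0# ≤ A × (∀ n → b (suc n) ≤ A)) → ∃ λ A → 0# ≤ A × (∀ n → b n ≤ A)
    extend (A , 0≤A , q) = A ⊔ b 0 , ≤-trans 0≤A (x≤x⊔y A (b 0)) ,
      λ { zero → y≤x⊔y A (b 0) ; (suc n) → ≤-trans (q n) (x≤x⊔y A (b 0)) }

  -- The terms `a n * h ^ n` are differences of consecutive partial sums, hence eventually at most
  -- 2; the finitely many others only enlarge `A`.
  convergent⇒bounded : ∀ {a h y} → 0# < h → ConvergesTo (pe a h) y → ∃ λ A → 0# ≤ A × Bounded a A (h ⁻¹)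
  convergent⇒bounded {a} {h} {y} 0<h conv = terms (conv 1# 0<1)
    where
    terms : (∃ λ N → ∀ n → N ℕ.≤ n → ∣ pe a h n - y ∣ < 1#) → ∃ λ A → 0# ≤ A × Bounded a A (h ⁻¹)
    terms (N , p) = scale (eventually-bounded (λ n → ∣ a n ∣ * h ^ n) N bound)
      where
      bound : ∀ n → N ℕ.≤ n → ∣ a n ∣ * h ^ n ≤ 1# + 1#
      bound n N≤n = ≤-trans (≈⇒≤ (trans (*-congˡ (sym (abs-of-nonneg (^-nonneg n (<⇒≤ 0<h)))))
        (trans (sym (abs-* _ _))
          (abs-cong (trans (solve 3 (λ u v y → v := (u :+ v :- y) :- (u :- y)) refl (pe a h n) (a n * h ^ n) y)
            (+-congʳ (+-congʳ (sym (pe-snoc a h n)))))))))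
        (≤-trans (abs-triangle⁻ _ _) (+-mono-≤ (<⇒≤ (p (suc n) (ℕₚ.m≤n⇒m≤1+n N≤n))) (<⇒≤ (p n N≤n))))
      scale : (∃ λ A → 0# ≤ A × (∀ n → ∣ a n ∣ * h ^ n ≤ A)) → ∃ λ A → 0# ≤ A × Bounded a A (h ⁻¹)
      scale (A , 0≤A , q) = A , 0≤A , λ n → ≤-trans (≈⇒≤ (sym (trans (*-assoc _ _ _) (trans (*-congˡ (^-inv n 0<h))
        (*-identityʳ _)))))
        (*-monoʳ-≤ (^-nonneg n (<⇒≤ (⁻¹-pos 0<h))) (q n))

  sum-scale : ∀ c n (u v : Fin n → Carrier) → (∀ i → u i ≈ c * v i) → sum u ≈ c * sum v
  sum-scale c zero u v e = sym (zeroʳ c)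
  sum-scale c (suc n) u v e = trans (+-cong (e Fin.zero) (sum-scale c n _ _ λ i → e (Fin.suc i)))
    (sym (distribˡ c _ _))

  powerSeries≈pe : ∀ a h n → powerSeries a h n ≈ pe a h n
  powerSeries≈pe a h zero = refl
  powerSeries≈pe a h (suc n) = +-cong (*-identityʳ (a 0)) (trans
    (sum-scale h n _ _ λ i → solve 3 (λ b h u → b :* (h :* u) := h :* (b :* u)) refl (a (suc (Fin.toℕ i))) h
      (h ^ Fin.toℕ i))
    (*-congˡ (powerSeries≈pe (tail a) h n)))

  module Extension {U : OpenInterval} (f : U ⟶ℝ) where

    private
      choose : ∀ x → Dec (x ∈ᴵ U) → Carrier
      choose x (yes p) = Func.to f (x , p)
      choose x (no _) = 0#

    -- Extended by `0#` outside `U`, so that real numbers can be plugged in without membership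
    -- proofs; near points of `U` nothing changes.
    F : Carrier → Carrier
    F x = choose x em

    F-cong : ∀ {x y} → x ≈ y → F x ≈ F y
    F-cong {x} {y} e = go em em
      where
      go : (p : Dec (x ∈ᴵ U)) (q : Dec (y ∈ᴵ U)) → choose x p ≈ choose y q
      go (yes p) (yes q) = Func.cong f e
      go (yes p) (no q) = ⊥-elim (q (∈ᴵ-resp {U} e p))
      go (no p) (yes q) = ⊥-elim (p (∈ᴵ-resp {U} (sym e) q))
      go (no p) (no q) = refl

    F-extends : ∀ x (p : x ∈ᴵ U) → F x ≈ Func.to f (x , p)
    F-extends x p = go em
      where
      go : (q : Dec (x ∈ᴵ U)) → choose x q ≈ Func.to f (x , p)
      go (yes q) = Func.cong f refl
      go (no q) = ⊥-elim (q p)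

    jets : Analytic f → ∀ {x*} → x* ∈ᴵ U → Jets F x*
    jets analytic {x*} x*∈U = from (analytic x* x*∈U) (∈ᴵ-open {U} x*∈U)
      where
      from : (Σ (ℕ → Carrier) λ a → ∃ λ r → 0# < r × (∀ x (x∈U : x ∈ᴵ U) → ∣ x - x* ∣ < r →
               ConvergesTo (powerSeries a (x - x*)) (Func.to f (x , x∈U)))) →
             (∃ λ r → 0# < r × (∀ y → ∣ y - x* ∣ < r → y ∈ᴵ U)) → Jets F x*
      from (a , r , 0<r , conv) (r′ , 0<r′ , ball) = pick (common-lower-bound 0<r 0<r′)
        where
        pick : (∃ λ μ → 0# < μ × μ ≤ r × μ ≤ r′) → Jets F x*
        pick (μ , 0<μ , μ≤r , μ≤r′) = build (convergent⇒bounded 0<h (converges (abs-h<μ)))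
          where
          h = ½ * μ
          0<h = half-pos 0<μ
          abs-h<μ : ∣ h ∣ < μ
          abs-h<μ = ≤-<-trans (≈⇒≤ (abs-of-nonneg (<⇒≤ 0<h))) (half-< 0<μ)
          abs-shift : ∀ {s} → ∣ x* + s - x* ∣ ≈ ∣ s ∣
          abs-shift {s} = abs-cong (solve 2 (λ x s → x :+ s :- x := s) refl x* s)
          converges : ∀ {s} → ∣ s ∣ < μ → ConvergesTo (pe a s) (F (x* + s))
          converges {s} p ε 0<ε = let
              in-U = ball (x* + s) (<-≤-trans (≤-<-trans (≈⇒≤ abs-shift) p) μ≤r′)
              N , q = conv (x* + s) in-U (<-≤-trans (≤-<-trans (≈⇒≤ abs-shift) p) μ≤r) ε 0<ε in
            N , λ n N≤n → ≤-<-trans (≈⇒≤ (abs-cong (+-cong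
              (trans (pe-cong n (λ _ _ → refl) (solve 2 (λ x s → s := x :+ s :- x) refl x* s))
                (sym (powerSeries≈pe a (x* + s - x*) n)))
              (-‿cong (F-extends (x* + s) in-U))))) (q n N≤n)
          build : (∃ λ A → 0# ≤ A × Bounded a A (h ⁻¹)) → Jets F x*
          build (A , 0≤A , bounded) = record
            { c = λ k → sum-of (hasse k a)
            ; germ = λ k → _ , _ , _ , hasse-expansion k 0≤A a-bound
            ; B = (1# + 1#) * A ; Λ = (1# + 1#) * ((1# + 1#) * R)
            ; 1≤Λ = Expansion.1≤R (hasse-expansion 0 0≤A a-bound)
            ; 0≤B = *-nonneg (<⇒≤ 0<2) 0≤A
            ; taylor = near-map expand (near-small ((1# + 1#) * ((1# + 1#) * R)))
            }
            where
            -- The summand `1#` secures `1# ≤ R`, which an `Expansion` demands.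
            R = 1# + h ⁻¹
            0≤h⁻¹ = <⇒≤ (⁻¹-pos 0<h)
            1≤R : 1# ≤ R
            1≤R = ≤-by 0≤h⁻¹ (solve 1 (λ x → x := :1 :+ x :- :1) refl (h ⁻¹))
            h⁻¹≤R : h ⁻¹ ≤ R
            h⁻¹≤R = ≤-by 0≤1 (solve 1 (λ x → :1 := :1 :+ x :- x) refl (h ⁻¹))
            a-bound : Bounded a A R
            a-bound = bounded-weaken 0≤A 0≤h⁻¹ ≤-refl h⁻¹≤R bounded
            open Taylor 1≤R
            value : ∀ s → R * ∣ s ∣ ≤ ½ → sum-of a s ≈ F (x* + s)
            value s p = sym (sum-of-converges (converges (≤-<-trans s≤h (half-< 0<μ))))
              where
              s≤h : ∣ s ∣ ≤ h
              s≤h = ≤-trans (≈⇒≤ (trans (sym (*-identityˡ _)) (trans (*-congʳ (sym (*-inv 0<h))) (*-assoc h (h ⁻¹)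
                ∣ s ∣))))
                (≤-trans (*-monoˡ-≤ (<⇒≤ 0<h) (≤-trans (*-monoʳ-≤ (abs-nonneg s) h⁻¹≤R) (≤-trans p (<⇒≤ ½<1))))
                  (≈⇒≤ (*-identityʳ h)))
            expand : ∀ s → (1# + 1#) * ((1# + 1#) * R) * ∣ s ∣ ≤ 1# →
              Expansion (λ t → F (x* + s + t)) (λ k → sum-of (hasse k a) s) ((1# + 1#) * A)
                ((1# + 1#) * ((1# + 1#) * R))
            expand s p = record
              { 0≤A = E.0≤A ; 1≤R = E.1≤R ; coeffs = E.coeffs
              ; approx = λ t q n → ≤-trans (≈⇒≤ (abs-cong (+-congʳ (trans (F-cong (+-assoc x* s t))
                (sym (value (s + t) (sum-small p q))))))) (E.approx t q n) }
              where module E = Expansion (taylor 0≤A a-bound p)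

-- Polynomials of the statement: evaluation, identity, division by a root.

module Polynomials (em : ExcludedMiddle 0ℓ) (ℝ : CompleteOrderedField) where
  open CompleteOrderedField ℝ hiding (zero)
  open RealAnalysis ℝ
  open IntegerSolver commutativeRing
  open Ordered ℝ
  open Horner ℝ
  open Interpolation em ℝ

  eval-+ᴾ : ∀ p q x → eval (p +ᴾ q) x ≈ eval p x + eval q x
  eval-+ᴾ [] q x = sym (+-identityˡ _)
  eval-+ᴾ (a ∷ p) [] x = sym (+-identityʳ _)
  eval-+ᴾ (a ∷ p) (b ∷ q) x = trans (+-congˡ (*-congˡ (eval-+ᴾ p q x)))
    (solve 5 (λ a b x u v → a :+ b :+ x :* (u :+ v) := a :+ x :* u :+ (b :+ x :* v)) refl a b x (eval p x)
      (eval q x))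

  eval-map : ∀ a q x → eval (map (a *_) q) x ≈ a * eval q x
  eval-map a [] x = sym (zeroʳ a)
  eval-map a (b ∷ q) x = trans (+-congˡ (*-congˡ (eval-map a q x)))
    (solve 4 (λ a b x u → a :* b :+ x :* (a :* u) := a :* (b :+ x :* u)) refl a b x (eval q x))

  eval-*ᴾ : ∀ p q x → eval (p *ᴾ q) x ≈ eval p x * eval q x
  eval-*ᴾ [] q x = sym (zeroˡ _)
  eval-*ᴾ (a ∷ p) q x = trans (eval-+ᴾ (map (a *_) q) (0# ∷ p *ᴾ q) x)
    (trans (+-cong (eval-map a q x) (+-congˡ (*-congˡ (eval-*ᴾ p q x))))
      (solve 4 (λ a x u v → a :* v :+ (:0 :+ x :* (u :* v)) := (a :+ x :* u) :* v) refl a x (eval p x) (eval q x)))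

  eval-cong : ∀ p {x y} → x ≈ y → eval p x ≈ eval p y
  eval-cong [] e = refl
  eval-cong (a ∷ p) e = +-congˡ (*-cong e (eval-cong p e))

  eval-zero : ∀ p → p ≈ᴾ [] → ∀ x → eval p x ≈ 0#
  eval-zero [] z x = refl
  eval-zero (a ∷ p) z x = trans (+-cong (z 0) (*-congˡ (eval-zero p (λ n → z (suc n)) x)))
    (solve 1 (λ x → :0 :+ x :* :0 := :0) refl x)

  eval-pe : ∀ p x n → length p ℕ.≤ n → eval p x ≈ pe (coeff p) x n
  eval-pe [] x n _ = sym (pe-zero (λ _ → 0#) x n λ _ _ → refl)
  eval-pe (a ∷ p) x (suc n) (ℕ.s≤s q) = +-congˡ (*-congˡ (eval-pe p x n q))

  -- The difference vanishes at as many integers as it has coefficients, and `interpolation` with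
  -- `η = 0#` annihilates them.
  eval-injective : ∀ p q → (∀ x → eval p x ≈ eval q x) → p ≈ᴾ q
  eval-injective p q e k = trans (solve 2 (λ x y → x := (x :- y) :+ y) refl (coeff p k) (coeff q k))
    (trans (+-congʳ (abs≤0⇒≈0 coefficient≤)) (+-identityˡ _))
    where
    -- The two lengths make the truncation exact, and `suc k` puts the index `k` in range.
    n = length p ℕ.+ (length q ℕ.+ suc k)
    difference : Sequence
    difference j = coeff p j - coeff q j
    vanishes : ∀ x → pe difference x n ≈ 0#
    vanishes x = trans (pe-sub (coeff p) (coeff q) x n) (trans (+-cong
      (sym (eval-pe p x n (ℕₚ.m≤m+n _ _)))
        (-‿cong (sym (eval-pe q x n (ℕₚ.≤-trans (ℕₚ.m≤m+n _ _) (ℕₚ.m≤n+m _ (length p)))))))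
      (trans (+-congʳ (e x)) (-‿inverseʳ _)))
    I = interpolation n n
    coefficient≤ : ∣ difference k ∣ ≤ 0#
    coefficient≤ = ≤-trans (proj₂ (proj₂ I) difference 0# (naturals n) (length-naturals n) (naturals-distinct n)
      (naturals-≤ n)
      (All.map (λ {u} _ → ≈⇒≤ (trans (abs-cong (vanishes (fromℕ u))) abs-0)) (naturals-< n)) k
      (ℕₚ.≤-trans (ℕₚ.m≤n+m (suc k) (length q)) (ℕₚ.m≤n+m _ (length p)))) (≈⇒≤ (zeroʳ _))

  recentre : Sequence → Carrier → ℕ → Polynomial
  recentre a y zero = []
  recentre a y (suc n) = (a 0 ∷ []) +ᴾ (- y ∷ 1# ∷ []) *ᴾ recentre (tail a) y n

  eval-recentre : ∀ a y n x → eval (recentre a y n) x ≈ pe a (x - y) n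
  eval-recentre a y zero x = refl
  eval-recentre a y (suc n) x = trans (eval-+ᴾ (a 0 ∷ []) ((- y ∷ 1# ∷ []) *ᴾ recentre (tail a) y n) x)
    (trans (+-congˡ (trans (eval-*ᴾ (- y ∷ 1# ∷ []) (recentre (tail a) y n) x) (*-congˡ (eval-recentre (tail a) y n
      x))))
      (solve 4 (λ a y x u → a :+ x :* :0 :+ (:- y :+ x :* (:1 :+ x :* :0)) :* u := a :+ (x :- y) :* u) refl (a 0) y
        x (pe (tail a) (x - y) n)))

  private
    divide-tail : Polynomial → Carrier → Polynomial
    divide-tail [] x = []
    divide-tail (b ∷ p) x = eval (b ∷ p) x ∷ divide-tail p x

    length-divide-tail : ∀ p x → length (divide-tail p x) ≡ length p
    length-divide-tail [] x = ≡.refl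
    length-divide-tail (b ∷ p) x = ≡.cong suc (length-divide-tail p x)

    eval-divide-tail : ∀ a p x z → eval (a ∷ p) z ≈ (z - x) * eval (divide-tail p x) z + eval (a ∷ p) x
    eval-divide-tail a [] x z = solve 3 (λ a x z → a :+ z :* :0 := (z :- x) :* :0 :+ (a :+ x :* :0)) refl a x z
    eval-divide-tail a (b ∷ p) x z = trans (+-congˡ (*-congˡ (eval-divide-tail b p x z)))
      (solve 5 (λ a x z u v → a :+ z :* ((z :- x) :* u :+ v) := (z :- x) :* (v :+ z :* u) :+ (a :+ x :* v)) refl a
        x z (eval (divide-tail p x) z) (eval (b ∷ p) x))

  divide : Polynomial → Carrier → Polynomial
  divide [] x = []
  divide (a ∷ p) x = divide-tail p x

  length-divide : ∀ p x {n} → length p ℕ.≤ suc n → length (divide p x) ℕ.≤ n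
  length-divide [] x _ = ℕ.z≤n
  length-divide (a ∷ p) x (ℕ.s≤s q) = ℕₚ.≤-trans (ℕₚ.≤-reflexive (length-divide-tail p x)) q

  eval-divide : ∀ p x → eval p x ≈ 0# → ∀ z → eval p z ≈ (z - x) * eval (divide p x) z
  eval-divide [] x _ z = sym (zeroʳ _)
  eval-divide (a ∷ p) x e z = trans (eval-divide-tail a p x z) (trans (+-congˡ e) (+-identityʳ _))

-- Continuation of a rational identity along the interval.

module Continuation (em : ExcludedMiddle 0ℓ) (ℝ : CompleteOrderedField) where
  open CompleteOrderedField ℝ hiding (zero)
  open RealAnalysis ℝ
  open IntegerSolver commutativeRing
  open Ordered ℝ
  open Horner ℝ
  open Germs em ℝ
  open Local em ℝ
  open AnalyticFunctions em ℝ
  open Polynomials em ℝ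

  Isolated : (Carrier → Carrier) → Carrier → Set
  Isolated g x = (∃ λ ρ → 0# < ρ × (∀ y → ∣ y - x ∣ < ρ → g y ≈ 0#)) ⊎ (∃ λ ρ → 0# < ρ × (∀ y → ∣ y - x ∣ < ρ → y ≉
    x → g y ≉ 0#))

  germ⇒isolated : ∀ {g x} → (∀ {y z} → y ≈ z → g y ≈ g z) → IsGerm (λ s → g (x + s)) → Isolated g x
  germ⇒isolated {g} {x} g-cong G = [ vanishing , nonvanishing ]′ (germ-dichotomy G)
    where
    back : ∀ y → g (x + (y - x)) ≈ g y
    back y = g-cong (solve 2 (λ x y → x :+ (y :- x) := y) refl x y)
    vanishing : Vanishing (λ s → g (x + s)) → Isolated g x
    vanishing (ρ , 0<ρ , z) = inj₁ (ρ , 0<ρ , λ y p → trans (sym (back y)) (z (y - x) p))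
    nonvanishing : Nonvanishing (λ s → g (x + s)) → Isolated g x
    nonvanishing (c , k , 0<c , ρ , 0<ρ , z) = inj₂ (ρ , 0<ρ , λ y p y≉x e → ≤⇒≯ (z (y - x) p)
      (≤-<-trans (≈⇒≤ (trans (abs-cong (trans (back y) e)) abs-0)) (*-pos 0<c (^-pos k (abs-pos λ d →
        y≉x (trans (solve 2 (λ x y → y := (y :- x) :+ x) refl x y) (trans (+-congʳ d) (+-identityˡ x))))))))

  -- Let `s` be the supremum of the `τ` for which `g` vanishes on `[0, τ]`. An isolated zero at `s`
  -- contradicts the zeros just below `s`, and a flat neighbourhood lets the set of zeros grow past
  -- `s` unless `s` is 1.
  unit-interval-propagation : ∀ {g} → (∀ {y z} → y ≈ z → g y ≈ g z) →
    (∀ τ → 0# ≤ τ → τ ≤ 1# → Isolated g τ) →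
    (∃ λ ρ → 0# < ρ × (∀ y → ∣ y ∣ < ρ → g y ≈ 0#)) → g 1# ≈ 0#
  unit-interval-propagation {g} g-cong iso (ρ₀ , 0<ρ₀ , zero₀) = conclude (common-lower-bound (half-pos 0<ρ₀) 0<1)
    where
    Z : Carrier → Set
    Z τ = 0# ≤ τ × τ ≤ 1# × (∀ σ → 0# ≤ σ → σ ≤ τ → g σ ≈ 0#)
    conclude : (∃ λ τ → 0# < τ × τ ≤ ½ * ρ₀ × τ ≤ 1#) → g 1# ≈ 0#
    conclude (τ₀ , 0<τ₀ , τ₀≤½ρ₀ , τ₀≤1) = at-supremum (complete Z (τ₀ , Zτ₀) (1# , λ τ z → proj₁ (proj₂ z)))
      where
      Zτ₀ : Z τ₀
      Zτ₀ = <⇒≤ 0<τ₀ , τ₀≤1 , λ σ 0≤σ σ≤τ₀ → zero₀ σ (≤-<-trans (≈⇒≤ (abs-of-nonneg 0≤σ))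
        (≤-<-trans (≤-trans σ≤τ₀ τ₀≤½ρ₀) (half-< 0<ρ₀)))
      at-supremum : (∃ λ s → (∀ τ → Z τ → τ ≤ s) × (∀ u → (∀ τ → Z τ → τ ≤ u) → s ≤ u)) → g 1# ≈ 0#
      at-supremum (s , upper , least) = [ flat , isolated ]′ (iso s 0≤s s≤1)
        where
        0<s = <-≤-trans 0<τ₀ (upper τ₀ Zτ₀)
        0≤s = <⇒≤ 0<s
        s≤1 : s ≤ 1#
        s≤1 = least 1# λ τ z → proj₁ (proj₂ z)
        below : ∀ σ → 0# ≤ σ → σ < s → g σ ≈ 0#
        below σ 0≤σ σ<s = decide (em {∃ λ τ → Z τ × σ ≤ τ})
          where
          decide : Dec (∃ λ τ → Z τ × σ ≤ τ) → g σ ≈ 0#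
          decide (yes (τ , (_ , _ , z) , σ≤τ)) = z σ 0≤σ σ≤τ
          decide (no ¬p) = ⊥-elim (≤⇒≯ (least σ λ τ z → <⇒≤ (≰⇒> λ q → ¬p (τ , z , q))) σ<s)
        isolated : (∃ λ ρ → 0# < ρ × (∀ y → ∣ y - s ∣ < ρ → y ≉ s → g y ≉ 0#)) → g 1# ≈ 0#
        isolated (ρ , 0<ρ , nz) = pick (common-lower-bound 0<ρ 0<s)
          where
          pick : (∃ λ μ → 0# < μ × μ ≤ ρ × μ ≤ s) → g 1# ≈ 0#
          pick (μ , 0<μ , μ≤ρ , μ≤s) = ⊥-elim
            (nz y (≤-<-trans (≈⇒≤ (trans (abs-cong (solve 2 (λ s m → s :- m :- s := :- m) refl s m))
            (trans (abs-neg m) (abs-of-nonneg (<⇒≤ 0<m))))) (<-≤-trans (half-< 0<μ) μ≤ρ))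
              (λ e → <-irrefl (<-≤-trans y<s (≈⇒≤ (sym e)))) (below y (sub-nonneg (≤-trans (<⇒≤ (half-< 0<μ)) μ≤s))
                y<s))
            where
            m = ½ * μ
            0<m = half-pos 0<μ
            y = s - m
            y<s : y < s
            y<s = <-by 0<m (solve 2 (λ s m → m := s :- (s :- m)) refl s m)
        flat : (∃ λ ρ → 0# < ρ × (∀ y → ∣ y - s ∣ < ρ → g y ≈ 0#)) → g 1# ≈ 0#
        flat (ρ , 0<ρ , z) = [ reached , (λ e → trans (g-cong (sym e)) at-s) ]′ s≤1
          where
          at-s : g s ≈ 0#
          at-s = z s (≤-<-trans (≈⇒≤ (trans (abs-cong (-‿inverseʳ s)) abs-0)) 0<ρ)
          reached : s < 1# → g 1# ≈ 0#
          reached s<1 = extend (common-lower-bound (half-pos 0<ρ) (sub-pos s<1))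
            where
            extend : (∃ λ μ → 0# < μ × μ ≤ ½ * ρ × μ ≤ 1# - s) → g 1# ≈ 0#
            extend (μ , 0<μ , μ≤½ρ , μ≤) = ⊥-elim (≤⇒≯ (upper (s + μ) Zs+μ)
              (<-by 0<μ (solve 2 (λ s m → m := s :+ m :- s) refl s μ)))
              where
              Zs+μ : Z (s + μ)
              Zs+μ = +-nonneg 0≤s (<⇒≤ 0<μ) , ≤-by (sub-nonneg μ≤) (solve 2 (λ s m → :1 :- s :- m := :1 :-
                (s :+ m)) refl s μ) , λ σ 0≤σ σ≤ →
                [ near σ 0≤σ σ≤ , below σ 0≤σ ]′ (split σ)
                where
                split : ∀ σ → s ≤ σ ⊎ σ < s
                split σ = [ inj₁ , (λ { (inj₁ p) → inj₂ p ; (inj₂ e) → inj₁ (≈⇒≤ (sym e)) }) ]′ (≤-total s σ)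
                near : ∀ σ → 0# ≤ σ → σ ≤ s + μ → s ≤ σ → g σ ≈ 0#
                near σ _ σ≤ s≤σ = z σ (≤-<-trans (≤-trans (≈⇒≤ (abs-of-nonneg (sub-nonneg s≤σ)))
                  (≤-by (sub-nonneg σ≤) (solve 3 (λ x s m → s :+ m :- x := m :- (x :- s)) refl σ s μ)))
                    (≤-<-trans μ≤½ρ (half-< 0<ρ)))

  isGerm-pe : ∀ a y x* n → IsGerm (λ s → pe a (x* + s - y) n)
  isGerm-pe a y x* zero = isGerm-const 0#
  isGerm-pe a y x* (suc n) = isGerm-+ (isGerm-const (a 0)) (isGerm-* (isGerm-sub (isGerm-+ (isGerm-const x*)
    isGerm-id) (isGerm-const y)) (isGerm-pe (tail a) y x* n))

  isGerm-eval : ∀ p x* → IsGerm (λ s → eval p (x* + s))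
  isGerm-eval [] x* = isGerm-const 0#
  isGerm-eval (a ∷ p) x* = isGerm-+ (isGerm-const a) (isGerm-* (isGerm-+ (isGerm-const x*) isGerm-id)
    (isGerm-eval p x*))

  module _ {U : OpenInterval} (f : U ⟶ℝ) (analytic : Analytic f) where

    open Extension f

    isGerm-F : ∀ {x*} → x* ∈ᴵ U → IsGerm (λ s → F (x* + s))
    isGerm-F {x*} x*∈U = at-0 (Jets.taylor J)
      where
      J = jets analytic x*∈U
      at-0 : Near (λ s → Expansion (λ t → F (x* + s + t)) (λ k → Jets.c J k s) (Jets.B J) (Jets.Λ J)) → IsGerm
        (λ s → F (x* + s))
      at-0 (ρ , 0<ρ , E) = _ , _ , _ , expansion-cong (λ s → F-cong (+-congʳ (+-identityʳ x*)))
        (E 0# (≤-<-trans (≈⇒≤ abs-0) 0<ρ))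

    RationalOn : Polynomial → Polynomial → Set
    RationalOn den num = ∀ x → x ∈ᴵ U → eval den x * F x ≈ eval num x

    defect : Polynomial → Polynomial → Carrier → Carrier
    defect den num x = eval den x * F x - eval num x

    defect-cong : ∀ den num {x y} → x ≈ y → defect den num x ≈ defect den num y
    defect-cong den num e = +-cong (*-cong (eval-cong den e) (F-cong e)) (-‿cong (eval-cong num e))

    defect-isolated : ∀ den num {x} → x ∈ᴵ U → Isolated (defect den num) x
    defect-isolated den num {x} x∈U = germ⇒isolated (defect-cong den num)
      (isGerm-sub (isGerm-* (isGerm-eval den x) (isGerm-F x∈U)) (isGerm-eval num x))

    no-defect : ∀ {x y} → x - y ≈ 0# → x ≈ y
    no-defect {x} {y} e = trans (solve 2 (λ x y → x := (x :- y) :+ y) refl x y) (trans (+-congʳ e) (+-identityˡ y))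

    -- The identity theorem on the segment from `y` to `x`, parametrised by the unit interval: `U`
    -- is convex, and the defect is analytic at each point of the segment.
    continuation : ∀ den num {y} → y ∈ᴵ U → (∃ λ ρ → 0# < ρ × (∀ x → ∣ x - y ∣ < ρ → defect den num x ≈ 0#)) →
      RationalOn den num
    continuation den num {y} y∈U (ρ , 0<ρ , zero-near) x x∈U = no-defect (decide (em {x - y ≈ 0#}))
      where
      d = x - y
      line : Carrier → Carrier
      line τ = y + τ * d
      line-1 : line 1# ≈ x
      line-1 = solve 2 (λ x y → y :+ :1 :* (x :- y) := x) refl x y
      line∈U : ∀ τ → 0# ≤ τ → τ ≤ 1# → line τ ∈ᴵ U
      line∈U τ 0≤τ τ≤1 = [ (λ y≤x → ∈ᴵ-convex {U} y∈U x∈U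
            (≤-by (*-nonneg 0≤τ (sub-nonneg y≤x)) (solve 3 (λ t y d → t :* d := y :+ t :* d :- y) refl τ y d))
            (≤-by (*-nonneg (sub-nonneg τ≤1) (sub-nonneg y≤x)) (solve 3 (λ t x y → (:1 :- t) :* (x :- y) := x :-
              (y :+ t :* (x :- y))) refl τ x y))) ,
          (λ x≤y → ∈ᴵ-convex {U} x∈U y∈U
            (≤-by (*-nonneg (sub-nonneg τ≤1) (sub-nonneg x≤y)) (solve 3 (λ t x y → (:1 :- t) :* (y :- x) := y :+ t
              :* (x :- y) :- x) refl τ x y))
            (≤-by (*-nonneg 0≤τ (sub-nonneg x≤y)) (solve 3 (λ t x y → t :* (y :- x) := y :- (y :+ t :* (x :- y)))
              refl τ x y))) ]′ (≤-total y x)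
      decide : Dec (d ≈ 0#) → defect den num x ≈ 0#
      decide (yes d≈0) = zero-near x (≤-<-trans (≈⇒≤ (trans (abs-cong d≈0) abs-0)) 0<ρ)
      decide (no d≉0) = trans (defect-cong den num (sym line-1)) (unit-interval-propagation {g = λ τ → defect den
        num (line τ)}
          (λ e → defect-cong den num (+-congˡ (*-congʳ e))) isolated (rescale (ρ , 0<ρ , λ x p → zero-near x p)))
        where
        0<∣d∣ = abs-pos d≉0
        difference : ∀ σ τ → ∣ line σ - line τ ∣ ≈ ∣ σ - τ ∣ * ∣ d ∣
        difference σ τ = trans (abs-cong (solve 4 (λ s t y d → y :+ s :* d :- (y :+ t :* d) := (s :- t) :* d) refl
          σ τ y d)) (abs-* _ _)
        scale : ∀ {r a} → a < r * ∣ d ∣ ⁻¹ → a * ∣ d ∣ < r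
        scale {r} {a} p = <-≤-trans (*-monoʳ-< 0<∣d∣ p)
          (≈⇒≤ (trans (solve 3 (λ r i d → r :* i :* d := r :* (d :* i)) refl r (∣ d ∣ ⁻¹) ∣ d ∣)
          (trans (*-congˡ (*-inv 0<∣d∣)) (*-identityʳ r))))
        rescale : (∃ λ r → 0# < r × (∀ x → ∣ x - y ∣ < r → defect den num x ≈ 0#)) → ∃ λ r → 0# < r ×
          (∀ σ → ∣ σ ∣ < r → defect den num (line σ) ≈ 0#)
        rescale (r , 0<r , z) = r * ∣ d ∣ ⁻¹ , *-pos 0<r (⁻¹-pos 0<∣d∣) , λ σ p → z (line σ)
          (≤-<-trans (≈⇒≤ (trans (abs-cong (solve 3 (λ s y d → y :+ s :* d :- y := s :* d) refl σ y d))
            (abs-* σ d))) (scale p))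
        isolated : ∀ τ → 0# ≤ τ → τ ≤ 1# → Isolated (λ σ → defect den num (line σ)) τ
        isolated τ 0≤τ τ≤1 = transfer (defect-isolated den num (line∈U τ 0≤τ τ≤1))
          where
          transfer : Isolated (defect den num) (line τ) → Isolated (λ σ → defect den num (line σ)) τ
          transfer (inj₁ (r , 0<r , z)) = inj₁ (r * ∣ d ∣ ⁻¹ , *-pos 0<r (⁻¹-pos 0<∣d∣) , λ σ p → z (line σ)
            (≤-<-trans (≈⇒≤ (difference σ τ)) (scale p)))
          transfer (inj₂ (r , 0<r , z)) = inj₂ (r * ∣ d ∣ ⁻¹ , *-pos 0<r (⁻¹-pos 0<∣d∣) , λ σ p σ≉τ → z (line σ)
            (≤-<-trans (≈⇒≤ (difference σ τ)) (scale p))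
            λ e → σ≉τ (no-defect (zero-product d≉0 (trans (solve 4 (λ s t y d → d :* (s :- t) := y :+ s :* d :-
              (y :+ t :* d)) refl σ τ y d) (trans (+-congʳ e) (-‿inverseʳ _))))))

    rationalAt⇒rationalOn : ∀ {y} → y ∈ᴵ U → RationalAt F y → ∃ λ den → ∃ λ num → (∃ λ z → eval den z ≉ 0#) ×
      RationalOn den num
    rationalAt⇒rationalOn {y} y∈U (Q , P , m , n , Q₀≉0 , ρ , 0<ρ , eq) = recentre Q y (suc m) , recentre P y n ,
      (y , λ e → Q₀≉0 (trans (solve 3 (λ q y u → q := q :+ (y :- y) :* u) refl (Q 0) y (pe (tail Q) (y - y) m))
        (trans (sym (eval-recentre Q y (suc m) y)) e))) ,
      continuation (recentre Q y (suc m)) (recentre P y n) y∈U (ρ , 0<ρ , λ x p → trans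
        (+-cong (*-cong (eval-recentre Q y (suc m) x) (F-cong (solve 2 (λ x y → x := y :+ (x :- y)) refl x y)))
        (-‿cong (eval-recentre P y n x)))
        (trans (+-congʳ (eq (x - y) p)) (-‿inverseʳ _)))

    -- A zero of `den` at `x` is also one of `num`, so the factor `z - x` is cancelled from both;
    -- `N` bounds the number of rounds by the length of `den`. Equality of the fractions is kept in
    -- cross-multiplied form for all `z`, as `_≃_` requires.
    reduce : ∀ N den num → length den ℕ.≤ N → (∃ λ z → eval den z ≉ 0#) → RationalOn den num → ∀ x → x ∈ᴵ U →
      ∃ λ den′ → ∃ λ num′ → (∀ z → eval num′ z * eval den z ≈ eval num z * eval den′ z) × eval den′ x ≉ 0# × eval
        den′ x * F x ≈ eval num′ x
    reduce N den num len (w , den≉0) rat x x∈U = decide (em {eval den x ≈ 0#})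
      where
      decide : Dec (eval den x ≈ 0#) → ∃ λ den′ → ∃ λ num′ → (∀ z → eval num′ z * eval den z ≈ eval num z * eval
        den′ z) × eval den′ x ≉ 0# × eval den′ x * F x ≈ eval num′ x
      decide (no ne) = den , num , (λ z → refl) , ne , rat x x∈U
      decide (yes den-x) = divided N len
        where
        num-x : eval num x ≈ 0#
        num-x = trans (sym (rat x x∈U)) (trans (*-congʳ den-x) (zeroˡ _))
        den₁ = divide den x
        num₁ = divide num x
        den-split = eval-divide den x den-x
        num-split = eval-divide num x num-x
        rat₁ : RationalOn den₁ num₁
        rat₁ z z∈U = no-defect (at (em {z ≈ x}))
          where
          off : ∀ z → z ∈ᴵ U → z ≉ x → defect den₁ num₁ z ≈ 0#
          off z z∈U z≉x = zero-product (λ e → z≉x (no-defect e)) (trans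
            (trans (solve 4 (λ d a f b → d :* (a :* f :- b) := d :* a :* f :- d :* b) refl (z - x) (eval den₁ z)
              (F z) (eval num₁ z))
              (+-cong (*-congʳ (sym (den-split z))) (-‿cong (sym (num-split z))))) (trans (+-congʳ (rat z z∈U))
                (-‿inverseʳ _)))
          -- The factor `z - x` cancels only off `x`. At `x` the defect vanishes because an isolated
          -- zero there would contradict the zeros at neighbouring points.
          at-x : defect den₁ num₁ x ≈ 0#
          at-x = go (defect-isolated den₁ num₁ x∈U) (∈ᴵ-open {U} x∈U)
            where
            go : Isolated (defect den₁ num₁) x → (∃ λ r → 0# < r × (∀ y → ∣ y - x ∣ < r → y ∈ᴵ U)) → defect den₁
              num₁ x ≈ 0#
            go (inj₁ (r , 0<r , z)) _ = z x (≤-<-trans (≈⇒≤ (trans (abs-cong (-‿inverseʳ x)) abs-0)) 0<r)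
            go (inj₂ (r , 0<r , nz)) (r′ , 0<r′ , ball) = pick (common-lower-bound 0<r 0<r′)
              where
              pick : (∃ λ μ → 0# < μ × μ ≤ r × μ ≤ r′) → defect den₁ num₁ x ≈ 0#
              pick (μ , 0<μ , μ≤r , μ≤r′) = ⊥-elim (nz y (<-≤-trans y-x<μ μ≤r) y≉x
                (off y (ball y (<-≤-trans y-x<μ μ≤r′)) y≉x))
                where
                y = x + ½ * μ
                e : y - x ≈ ½ * μ
                e = solve 2 (λ x m → x :+ m :- x := m) refl x (½ * μ)
                y-x<μ : ∣ y - x ∣ < μ
                y-x<μ = ≤-<-trans (≈⇒≤ (trans (abs-cong e) (abs-of-nonneg (<⇒≤ (half-pos 0<μ))))) (half-< 0<μ)
                y≉x : y ≉ x
                y≉x q = >⇒≉ (half-pos 0<μ) (trans (sym e) (trans (+-congʳ q) (-‿inverseʳ x)))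
          at : Dec (z ≈ x) → defect den₁ num₁ z ≈ 0#
          at (yes e) = trans (defect-cong den₁ num₁ e) at-x
          at (no ne) = off z z∈U ne
        den₁≉0 : eval den₁ w ≉ 0#
        den₁≉0 e = den≉0 (trans (den-split w) (trans (*-congˡ e) (zeroʳ _)))
        divided : ∀ N → length den ℕ.≤ N → ∃ λ den′ → ∃ λ num′ → (∀ z → eval num′ z * eval den z ≈ eval num z *
          eval den′ z) × eval den′ x ≉ 0# × eval den′ x * F x ≈ eval num′ x
        divided zero len = ⊥-elim (den≉0 (empty den len))
          where
          empty : ∀ p → length p ℕ.≤ 0 → eval p w ≈ 0#
          empty [] _ = refl
        divided (suc N) len = lift (reduce N den₁ num₁ (length-divide den x len) (w , den₁≉0) rat₁ x x∈U)
          where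
          lift : (∃ λ den′ → ∃ λ num′ → (∀ z → eval num′ z * eval den₁ z ≈ eval num₁ z * eval den′ z) × eval den′ x
            ≉ 0# × eval den′ x * F x ≈ eval num′ x) →
            ∃ λ den′ → ∃ λ num′ → (∀ z → eval num′ z * eval den z ≈ eval num z * eval den′ z) × eval den′ x ≉ 0# ×
              eval den′ x * F x ≈ eval num′ x
          lift (den′ , num′ , cross , ne , value) = den′ , num′ , (λ z → trans (*-congˡ (den-split z))
            (trans (solve 3 (λ n d e → n :* (d :* e) := d :* (n :* e)) refl (eval num′ z) (z - x) (eval den₁ z))
              (trans (*-congˡ (cross z))
              (trans (sym (*-assoc _ _ _)) (*-congʳ (sym (num-split z))))))) , ne , value

    Conclusion : Set
    Conclusion = ∃ λ R → (∀ x → x ∈ᴵ U → ¬ PoleAt R x) × (∀ x (x∈U : x ∈ᴵ U) → R ⟨ x ⟩≈ Func.to f (x , x∈U))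

    rationalOn⇒conclusion : (∃ λ den → ∃ λ num → (∃ λ z → eval den z ≉ 0#) × RationalOn den num) → Conclusion
    rationalOn⇒conclusion (den , num , (w , den≉0) , rat) = R , (λ x x∈U → no-pole (value x x∈U)) , value
      where
      R : RationalFunction
      R = record { num = num ; den = den ; den≉0 = λ z → den≉0 (eval-zero den z w) }
      no-pole : ∀ {x y} → R ⟨ x ⟩≈ y → ¬ PoleAt R x
      no-pole (S , S≃R , ne , _) pole = ne (pole S S≃R)
      value : ∀ x (x∈U : x ∈ᴵ U) → R ⟨ x ⟩≈ Func.to f (x , x∈U)
      value x x∈U = represent (reduce (length den) den num ℕₚ.≤-refl (w , den≉0) rat x x∈U)
        where
        represent : (∃ λ den′ → ∃ λ num′ → (∀ z → eval num′ z * eval den z ≈ eval num z * eval den′ z) × eval den′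
          x ≉ 0# × eval den′ x * F x ≈ eval num′ x) →
          R ⟨ x ⟩≈ Func.to f (x , x∈U)
        represent (den′ , num′ , cross , ne , v) = record { num = num′ ; den = den′ ; den≉0 = λ z → ne (eval-zero den′ z x) } ,
          eval-injective (num′ *ᴾ den) (num *ᴾ den′) (λ z → trans (eval-*ᴾ num′ den z) (trans (cross z)
            (sym (eval-*ᴾ num den′ z)))) ,
          ne , trans (sym (F-extends x x∈U)) (trans (trans (sym (*-identityʳ _))
            (trans (*-congˡ (sym (⁻¹-inverseʳ _ ne)))
            (solve 3 (λ f d i → f :* (d :* i) := d :* f :* i) refl (F x) (eval den′ x) (eval den′ x ⁻¹))))
              (*-congʳ v))

-- Digits, codes and the counting for Siegel's lemma.

module Digits where

  ^-distribʳ-* : ∀ n a b → (a ℕ.* b) ℕ.^ n ≡ a ℕ.^ n ℕ.* b ℕ.^ n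
  ^-distribʳ-* zero a b = ≡.refl
  ^-distribʳ-* (suc n) a b = ≡.trans (≡.cong (a ℕ.* b ℕ.*_) (^-distribʳ-* n a b)) (ℕₚ.[m*n]*[o*p]≡[m*o]*[n*p] a b
    (a ℕ.^ n) (b ℕ.^ n))

  odd-bound : ∀ M {Z} → 1 ℕ.≤ Z → suc (2 ℕ.* (M ℕ.* Z)) ℕ.≤ (2 ℕ.* M ℕ.+ 1) ℕ.* Z
  odd-bound M {Z} 1≤Z = ℕₚ.≤-trans (ℕₚ.+-monoˡ-≤ (2 ℕ.* (M ℕ.* Z)) 1≤Z) (ℕₚ.≤-reflexive
    (solve 2 (λ m z → z :+ con 2 :* (m :* z) := (con 2 :* m :+ con 1) :* z) ≡.refl M Z))
    where open +-*-Solver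

  -- For `m = suc k` and `D = 3 m + 1` this is `2 D + 1 ≤ 9 m`; equality at `m = 1` shows that 9 is
  -- the least exponent that works.
  exponent : ∀ k → suc (2 ℕ.* suc (2 ℕ.* suc k ℕ.+ suc k)) ℕ.≤ 9 ℕ.* suc k
  exponent k = ℕₚ.≤-trans (ℕₚ.m≤m+n _ (3 ℕ.* k)) (ℕₚ.≤-reflexive
    (solve 1 (λ k → con 1 :+ con 2 :* (con 1 :+ (con 2 :* (con 1 :+ k) :+ (con 1 :+ k))) :+ con 3 :* k := con 9 :*
      (con 1 :+ k)) ≡.refl k))
    where open +-*-Solver

  -- The one power of `X` to spare in `suc (2 * D) ≤ e` absorbs the constant `M ^ D`.
  power-count : ∀ {W M X Y D e} → W ℕ.≤ M ℕ.* X ℕ.^ 2 → M ℕ.^ D ℕ.< Y → Y ℕ.≤ X → 1 ℕ.≤ X → suc (2 ℕ.* D) ℕ.≤ e → W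
    ℕ.^ D ℕ.< X ℕ.^ e
  power-count {W} {M} {X} {Y} {D} {e} W≤ large Y≤X 1≤X exp = begin-strict
    W ℕ.^ D                       ≤⟨ ℕₚ.^-monoˡ-≤ D W≤ ⟩
    (M ℕ.* X ℕ.^ 2) ℕ.^ D         ≡⟨ ^-distribʳ-* D M (X ℕ.^ 2) ⟩
    M ℕ.^ D ℕ.* (X ℕ.^ 2) ℕ.^ D   ≡⟨ ≡.cong (M ℕ.^ D ℕ.*_) (ℕₚ.^-*-assoc X 2 D) ⟩
    M ℕ.^ D ℕ.* X ℕ.^ (2 ℕ.* D)   <⟨ ℕₚ.*-monoˡ-< (X ℕ.^ (2 ℕ.* D)) {{ℕ.>-nonZero (ℕₚ.m^n>0 X {{X≢0}} (2 ℕ.* D))}}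
      large ⟩
    Y ℕ.* X ℕ.^ (2 ℕ.* D)         ≤⟨ ℕₚ.*-monoˡ-≤ (X ℕ.^ (2 ℕ.* D)) Y≤X ⟩
    X ℕ.^ suc (2 ℕ.* D)           ≤⟨ ℕₚ.^-monoʳ-≤ X {{X≢0}} exp ⟩
    X ℕ.^ e                       ∎
    where
    open ℕₚ.≤-Reasoning
    X≢0 = ℕ.>-nonZero 1≤X

  -- Digits in base `H`: the numbers below `H ^ m` enumerate the vectors of `m` coefficients below
  -- `H`, so that the pigeonhole principle can be applied to numbers.
  digit : (H : ℕ) .{{_ : ℕ.NonZero H}} → ℕ → ℕ → ℕ
  digit H i zero = i % H
  digit H i (suc k) = digit H (i / H) k

  digit-< : ∀ H .{{_ : ℕ.NonZero H}} i k → digit H i k ℕ.< H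
  digit-< H i zero = m%n<n i H
  digit-< H i (suc k) = digit-< H (i / H) k

  digit-injective : ∀ H .{{_ : ℕ.NonZero H}} m {i j} → i ℕ.< H ℕ.^ m → j ℕ.< H ℕ.^ m →
    (∀ k → k ℕ.< m → digit H i k ≡ digit H j k) → i ≡ j
  digit-injective H zero (ℕ.s≤s ℕ.z≤n) (ℕ.s≤s ℕ.z≤n) p = ≡.refl
  digit-injective H (suc m) {i} {j} i< j< p = ≡.trans (m≡m%n+[m/n]*n i H)
    (≡.trans (≡.cong₂ (λ r d → r ℕ.+ d ℕ.* H) (p 0 (ℕ.s≤s ℕ.z≤n))
      (digit-injective H m (quotient< i<) (quotient< j<) λ k k<m → p (suc k) (ℕ.s≤s k<m)))
    (≡.sym (m≡m%n+[m/n]*n j H)))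
    where
    quotient< : ∀ {i} → i ℕ.< H ℕ.^ suc m → i / H ℕ.< H ℕ.^ m
    quotient< {i} q = m<n*o⇒m/o<n (ℕₚ.<-≤-trans q (ℕₚ.≤-reflexive (ℕₚ.*-comm H (H ℕ.^ m))))

  code : ℕ → List ℕ → ℕ
  code W [] = 0
  code W (z ∷ zs) = z ℕ.+ code W zs ℕ.* W

  code-< : ∀ W zs → All (ℕ._< W) zs → code W zs ℕ.< W ℕ.^ length zs
  code-< W [] [] = ℕ.s≤s ℕ.z≤n
  code-< W (z ∷ zs) (z<W ∷ zs<W) = ℕₚ.<-≤-trans (ℕₚ.+-monoˡ-< (code W zs ℕ.* W) z<W)
    (ℕₚ.≤-trans (ℕₚ.*-monoˡ-≤ W (code-< W zs zs<W)) (ℕₚ.≤-reflexive (ℕₚ.*-comm (W ℕ.^ length zs) W)))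

  code-head : ∀ W .{{_ : ℕ.NonZero W}} {z z′} c c′ → z ℕ.< W → z′ ℕ.< W → z ℕ.+ c ℕ.* W ≡ z′ ℕ.+ c′ ℕ.* W → z ≡ z′
    × c ≡ c′
  code-head W {z} {z′} c c′ z<W z′<W e = z≡z′ ,
    ℕₚ.*-cancelʳ-≡ c c′ W (ℕₚ.+-cancelˡ-≡ z (c ℕ.* W) (c′ ℕ.* W) (≡.trans e (≡.cong (ℕ._+ c′ ℕ.* W) (≡.sym z≡z′))))
    where
    z≡z′ : z ≡ z′
    z≡z′ = ≡.trans (≡.sym (≡.trans ([m+kn]%n≡m%n z c W) (m<n⇒m%n≡m z<W)))
      (≡.trans (≡.cong (_% W) e) (≡.trans ([m+kn]%n≡m%n z′ c′ W) (m<n⇒m%n≡m z′<W)))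

  pigeonhole : ∀ {m n} → m ℕ.< n → (f : ℕ → ℕ) → (∀ i → f i ℕ.< m) → ∃ λ i → ∃ λ j → i ℕ.< n × j ℕ.< n × ¬ i ≡ j ×
    f i ≡ f j
  pigeonhole {m} m<n f f< = convert (Finₚ.pigeonhole m<n λ i → Fin.fromℕ< (f< (Fin.toℕ i)))
    where
    convert : (∃ λ i → ∃ λ j → i Fin.< j × Fin.fromℕ< (f< (Fin.toℕ i)) ≡ Fin.fromℕ< (f< (Fin.toℕ j))) → _
    convert (i , j , i<j , e) = Fin.toℕ i , Fin.toℕ j , Finₚ.toℕ<n i , Finₚ.toℕ<n j , ℕₚ.<⇒≢ i<j ,
      ≡.trans (≡.sym (Finₚ.toℕ-fromℕ< (f< (Fin.toℕ i)))) (≡.trans (≡.cong Fin.toℕ e) (Finₚ.toℕ-fromℕ<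
        (f< (Fin.toℕ j))))

-- Windows of rational points and Siegel's lemma.

module Windows (em : ExcludedMiddle 0ℓ) (ℝ : CompleteOrderedField) where
  open CompleteOrderedField ℝ hiding (zero)
  open RealAnalysis ℝ
  open IntegerSolver commutativeRing
  open Ordered ℝ
  open Archimedean em ℝ
  open Horner ℝ
  open Algebra.Properties.Semiring.Exp semiring using (^-congˡ; ^-homo-*; ^-assocʳ)
  open Germs em ℝ
  open LinearAlgebra em ℝ
  open Interpolation em ℝ
  open Local em ℝ
  open Digits

  argmax : ∀ (g : Sequence) n → ∃ λ k → k ℕ.< suc n × (∀ i → i ℕ.< suc n → ∣ g i ∣ ≤ ∣ g k ∣)
  argmax g zero = 0 , ℕ.s≤s ℕ.z≤n , λ { zero _ → ≤-refl ; (suc i) (ℕ.s≤s ()) }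
  argmax g (suc n) = extend (argmax g n)
    where
    extend : (∃ λ k → k ℕ.< suc n × (∀ i → i ℕ.< suc n → ∣ g i ∣ ≤ ∣ g k ∣)) → ∃ λ k → k ℕ.< suc (suc n) ×
      (∀ i → i ℕ.< suc (suc n) → ∣ g i ∣ ≤ ∣ g k ∣)
    extend (k , k< , p) = [ (λ q → k , ℕₚ.m≤n⇒m≤1+n k< , λ i i< → [ p i , (λ { ≡.refl → q }) ]′ (ℕₚ.m<1+n⇒m<n∨m≡n
      i<)) ,
      (λ q → suc n , ℕₚ.≤-refl , λ i i< → [ (λ r → ≤-trans (p i r) q) , (λ { ≡.refl → ≤-refl }) ]′
        (ℕₚ.m<1+n⇒m<n∨m≡n i<)) ]′
      (≤-total ∣ g (suc n) ∣ ∣ g k ∣)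

  record RationalApproximation (l u : ℕ) (y : Carrier) : Set where
    field
      numerator   : Carrier
      denominator : ℕ
      integral    : IsInteger numerator
      lower       : l ℕ.≤ denominator
      upper       : denominator ℕ.< u
      close       : ∣ y - numerator * fromℕ denominator ⁻¹ ∣ ≤ (fromℕ denominator ⁻¹) ^ 40

  open RationalApproximation

  shifted-cancel : ∀ {x y} n k → x * y ≈ 1# → x ^ n * y ^ (n ℕ.+ k) ≈ y ^ k
  shifted-cancel {x} {y} n k e = trans (*-congˡ (^-homo-* y n k)) (trans (sym (*-assoc _ _ _))
    (trans (*-congʳ (trans (sym (^-* x y n)) (trans (^-congˡ n e) (1^ n)))) (*-identityˡ _)))

  -- The points x + u / Y ^ 10 form a window of width O(Y ^ -10) at x; the fractions in play have
  -- denominators between X and X ^ 2, where X = Y ^ m.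
  module Window {F : Carrier → Carrier} (m′ : ℕ) {x : Carrier} {c : Sequence} {B Λ κ : Carrier}
    (E : Expansion (λ t → F (x + t)) c B Λ) (0≤κ : 0# ≤ κ)
    (independent : ∀ w η → (∀ k → 2 ℕ.* suc m′ ℕ.≤ k → k ℕ.≤ 2 ℕ.* suc m′ ℕ.+ suc m′ → ∣ dot (λ i → c (k ℕ.∸ i)) w
      (suc m′) ∣ ≤ η) →
      ∀ i → i ℕ.< suc m′ → ∣ w i ∣ ≤ κ * η)
    (K Y : ℕ) (1≤Y : 1 ℕ.≤ Y) (ΛK≤Y : Λ * fromℕ K ≤ fromℕ Y)
    where

    m n D : ℕ
    m = suc m′
    n = 2 ℕ.* m
    D = suc (n ℕ.+ m)

    k̂ y ε q h Xr Xi : Carrier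
    k̂ = fromℕ K
    y = fromℕ Y
    ε = y ⁻¹
    q = y ^ 10
    h = ε ^ 10
    Xr = y ^ m
    Xi = ε ^ m

    X H : ℕ
    X = Y ℕ.^ m
    H = X ℕ.^ 9

    private
      0<y = fromℕ-pos′ 1≤Y
      1≤y = 1≤fromℕ 1≤Y
      yε = *-inv 0<y
      0<ε = ⁻¹-pos 0<y
      0≤ε = <⇒≤ 0<ε
      ε≤1 : ε ≤ 1#
      ε≤1 = *-cancelˡ-≤ 0<y (≤-trans (≈⇒≤ yε) (≤-trans 1≤y (≈⇒≤ (sym (*-identityʳ y)))))
      0≤h = ^-nonneg 10 0≤ε
      h≤1 = ^-≤1 10 0≤ε ε≤1
      h≤ε : h ≤ ε
      h≤ε = ≤-trans (*-monoˡ-≤ 0≤ε (^-≤1 9 0≤ε ε≤1)) (≈⇒≤ (*-identityʳ ε))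
      1≤q = 1≤^ 10 1≤y
      0≤q = ≤-trans 0≤1 1≤q
      qh : q * h ≈ 1#
      qh = ^-inv 10 0<y
      0≤Xr = ^-nonneg m (<⇒≤ 0<y)
      1≤Xr = 1≤^ m 1≤y
      0≤Xi = ^-nonneg m 0≤ε
      Xi≤1 = ^-≤1 m 0≤ε ε≤1
      Xi≤ε : Xi ≤ ε
      Xi≤ε = ≤-trans (*-monoˡ-≤ 0≤ε (^-≤1 m′ 0≤ε ε≤1)) (≈⇒≤ (*-identityʳ ε))
      XrXi : Xr * Xi ≈ 1#
      XrXi = ^-inv m 0<y
      X≈ : fromℕ X ≈ Xr
      X≈ = fromℕ-^ Y m
      1≤X : 1 ℕ.≤ X
      1≤X = ℕₚ.m^n>0 Y {{ℕ.>-nonZero 1≤Y}} m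
      Ĥ = Xr ^ 9
      H≈ : fromℕ H ≈ Ĥ
      H≈ = trans (fromℕ-^ X 9) (^-congˡ 9 X≈)
      0≤Ĥ = ^-nonneg 9 0≤Xr
      open Expansion E renaming (0≤A to 0≤B; 1≤R to 1≤Λ; 0≤R to 0≤Λ)
      0≤k̂ = fromℕ-nonneg K
      ΛK = Λ * k̂
      0≤ΛK = *-nonneg 0≤Λ 0≤k̂
      hm : h ^ m ≈ Xi ^ 10
      hm = trans (^-assocʳ ε 10 m) (trans (reflexive (≡.cong (ε ^_) (ℕₚ.*-comm 10 m))) (sym (^-assocʳ ε m 10)))
      qm : q ^ m ≈ Xr ^ 10
      qm = trans (^-assocʳ y 10 m) (trans (reflexive (≡.cong (y ^_) (ℕₚ.*-comm 10 m))) (sym (^-assocʳ y m 10)))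

    at : ℕ → Carrier
    at u = F (x + h * fromℕ u)

    Approximable : ℕ → Set
    Approximable u = RationalApproximation X (X ℕ.^ 2) (at u)

    -- `Ca` and `Cd` bound Taylor errors of order `n` and `D`; `Cb` and `Cc` bound, at the nodes,
    -- polynomials with `n` and `D` coefficients of size 1. None depends on `Y`, so `Y` can be
    -- chosen large against them.
    Ca Cb Cc Cd : Carrier
    Ca = fromℕ n * (B * ΛK ^ n)
    Cb = pe (λ _ → 1#) k̂ n
    Cc = pe (λ _ → 1#) k̂ D
    Cd = fromℕ D * (B * ΛK ^ D)

    private
      0≤Cc : 0# ≤ Cc
      0≤Cc = pe-nonneg D (λ _ → 0≤1) 0≤k̂
      0≤Cd : 0# ≤ Cd
      0≤Cd = *-nonneg (fromℕ-nonneg D) (*-nonneg 0≤B (^-nonneg D 0≤ΛK))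

      module _ {u : ℕ} (u≤K : u ℕ.≤ K) where
        û = fromℕ u
        abs-û : ∣ û ∣ ≤ k̂
        abs-û = ≤-trans (≈⇒≤ (abs-of-nonneg (fromℕ-nonneg u))) (fromℕ-mono-≤ u≤K)
        abs-hû : ∣ h * û ∣ ≤ h * k̂
        abs-hû = abs-*-≤ (≈⇒≤ (abs-of-nonneg 0≤h)) abs-û
        Λhû : Λ * ∣ h * û ∣ ≤ ΛK * h
        Λhû = ≤-trans (*-monoˡ-≤ 0≤Λ abs-hû) (≈⇒≤ (solve 3 (λ l h k → l :* (h :* k) := l :* k :* h) refl Λ h k̂))
        Λhû≤1 : Λ * ∣ h * û ∣ ≤ 1#
        Λhû≤1 = ≤-trans Λhû (≤-trans (*-mono-≤ 0≤ΛK 0≤h ΛK≤Y h≤ε) (≈⇒≤ yε))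
        pe-û : ∀ a j → pe (λ k → a k * q ^ k) (h * û) j ≈ pe a û j
        pe-û a j = trans (pe-substitute a q (h * û) j) (pe-cong j (λ _ _ → refl) (trans (sym (*-assoc q h û))
          (trans (*-congʳ qh) (*-identityˡ û))))
        taylor-product : ∀ {v ω} j → 0# ≤ ω → (∀ k → ∣ v k ∣ ≤ ω) →
          ∣ pe v (h * û) j * at u - pe (conv v c) (h * û) j ∣ ≤ fromℕ j * (B * ΛK ^ j) * (ω * h ^ j)
        taylor-product {v} {ω} j 0≤ω v≤ = ≤-trans
          (product-remainder j 0≤Λ (λ k → ≤-trans (v≤ k) (≤-trans (≈⇒≤ (sym (*-identityʳ ω))) (*-monoˡ-≤ 0≤ω
            (1≤^ k 1≤Λ)))) (approx (h * û) Λhû≤1))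
          (≤-trans (*-monoˡ-≤ (fromℕ-nonneg j) (*-monoˡ-≤ (*-nonneg 0≤ω 0≤B)
            (≤-trans (^-mono-≤ j (*-nonneg 0≤Λ (abs-nonneg _)) Λhû) (≈⇒≤ (^-* ΛK h j)))))
            (≈⇒≤ (solve 5 (λ n o b l h → n :* (o :* b :* (l :* h)) := n :* (b :* l) :* (o :* h)) refl (fromℕ j) ω B
              (ΛK ^ j) (h ^ j))))
        pe-bound : ∀ {a A} j → j ℕ.≤ D → 0# ≤ A → (∀ k → ∣ a k ∣ ≤ A) → ∣ pe a û j ∣ ≤ A * Cc
        pe-bound {a} {A} j j≤D 0≤A a≤ = ≤-trans (pe-abs j (λ k _ → ≤-trans (a≤ k) (≈⇒≤ (sym (*-identityʳ A))))
          abs-û)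
          (≤-trans (≈⇒≤ (pe-scale A (λ _ → 1#) k̂ j)) (*-monoˡ-≤ 0≤A (grow j≤D)))
          where
          grow : ∀ {i j} → i ℕ.≤ j → pe (λ _ → 1#) k̂ i ≤ pe (λ _ → 1#) k̂ j
          grow {j = j} ℕ.z≤n = pe-nonneg j (λ _ → 0≤1) 0≤k̂
          grow (ℕ.s≤s p) = +-monoʳ-≤ 1# (*-monoˡ-≤ 0≤k̂ (grow p))

      fraction-error : ∀ {u} (ap : Approximable u) → ∣ at u - numerator ap * fromℕ (denominator ap) ⁻¹ ∣ ≤ Xi ^ 40
      fraction-error ap = ≤-trans (close ap) (^-mono-≤ 40 (<⇒≤ (⁻¹-pos 0<b)) b⁻¹≤)
        where
        0<b = fromℕ-pos′ (ℕₚ.≤-trans 1≤X (lower ap))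
        b⁻¹≤ : fromℕ (denominator ap) ⁻¹ ≤ Xi
        b⁻¹≤ = ≤-trans (⁻¹-anti-≤ (fromℕ-pos′ 1≤X) (fromℕ-mono-≤ (lower ap)))
          (≈⇒≤ (sym (⁻¹-unique (fromℕ-pos′ 1≤X) (trans (*-congʳ X≈) XrXi))))

      instance
        H-nonZero : ℕ.NonZero H
        H-nonZero = ℕ.>-nonZero (ℕₚ.m^n>0 X {{ℕ.>-nonZero 1≤X}} 9)

    -- Q ranges over integer polynomials with coefficients below H; P is the integer part of the
    -- Taylor polynomial of Q f.
    Q v γ P : ℕ → Sequence
    Q i = truncate m (λ k → fromℕ (digit H i k))
    -- In the variable `t = h * u` the polynomial `Q` has coefficients `v`; `γ` are the Taylor
    -- coefficients of `Q F` brought back to the variable `u`.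
    v i k = Q i k * q ^ k
    γ i k = conv (v i) c k * h ^ k
    P i k = proj₁ (floor (γ i k))

    private
      Q-integer : ∀ i k → IsInteger (Q i k)
      Q-integer i k = [ (λ k<m → ≡.subst IsInteger (≡.sym (truncate-< m _ k k<m)) (isInteger-fromℕ (digit H i k))) ,
        (λ m≤k → ≡.subst IsInteger (≡.sym (truncate-≥ m (λ k → fromℕ (digit H i k)) k m≤k)) (isInteger-fromℕ 0)) ]′
          (ℕₚ.<-≤-connex k m)

      Q-bound : ∀ i k → ∣ Q i k ∣ ≤ Ĥ
      Q-bound i = truncate-abs m _ 0≤Ĥ λ k _ → ≤-trans (≈⇒≤ (abs-of-nonneg (fromℕ-nonneg (digit H i k))))
        (≤-trans (fromℕ-mono-≤ (ℕₚ.<⇒≤ (digit-< H i k))) (≈⇒≤ H≈))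

      Q-beyond : ∀ i k → m ℕ.≤ k → Q i k ≈ 0#
      Q-beyond i k m≤k = reflexive (truncate-≥ m _ k m≤k)

      P-integer : ∀ i k → IsInteger (P i k)
      P-integer i k = proj₁ (proj₂ (floor (γ i k)))

      P-near : ∀ i k → ∣ γ i k - P i k ∣ ≤ 1#
      P-near i k = abs-least (<⇒≤ (<-by (sub-pos (proj₂ (proj₂ (proj₂ (floor (γ i k))))))
        (solve 2 (λ p g → p :+ :1 :- g := :1 :- (g :- p)) refl (P i k) (γ i k))))
        (≤-by (+-nonneg (sub-nonneg (proj₁ (proj₂ (proj₂ (floor (γ i k)))))) 0≤1) (solve 2 (λ p g → g :- p :+ :1 :=
          :1 :- :- (g :- p)) refl (P i k) (γ i k)))

      v-bound : ∀ i k → ∣ v i k ∣ ≤ Ĥ * q ^ m′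
      v-bound i k = [ (λ k<m → abs-*-≤ (Q-bound i k) (≤-trans (≈⇒≤ (abs-of-nonneg (^-nonneg k 0≤q))) (^-monoʳ-≤ 1≤q
        (ℕₚ.≤-pred k<m)))) ,
        (λ m≤k → ≤-trans (≈⇒≤ (trans (abs-cong (trans (*-congʳ (Q-beyond i k m≤k)) (zeroˡ _))) abs-0))
          (*-nonneg 0≤Ĥ (^-nonneg m′ 0≤q))) ]′ (ℕₚ.<-≤-connex k m)

      -- The left side is `h * X⁹ * h ^ m`, and `h ^ m = X⁻¹⁰`: the spacing exponent 10 only has to
      -- exceed the 9 of the coefficient bound.
      siegel-size : Ĥ * q ^ m′ * h ^ n ≤ 1#
      siegel-size = ≤-trans (≈⇒≤ (begin
          Ĥ * q ^ m′ * h ^ n                     ≡⟨ ≡.cong (λ j → Ĥ * q ^ m′ * h ^ j) n≡ ⟩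
          Ĥ * q ^ m′ * h ^ (m′ ℕ.+ suc m)        ≈⟨ *-assoc _ _ _ ⟩
          Ĥ * (q ^ m′ * h ^ (m′ ℕ.+ suc m))      ≈⟨ *-congˡ (shifted-cancel m′ (suc m) qh) ⟩
          Ĥ * (h * h ^ m)                        ≈⟨ *-congˡ (*-congˡ hm) ⟩
          Ĥ * (h * Xi ^ 10)                      ≈⟨ (solve 3 (λ a h b → a :* (h :* b) := h :* (a :* b)) refl) Ĥ h
            (Xi ^ 10) ⟩
          h * (Ĥ * Xi ^ 10)                      ≈⟨ *-congˡ (shifted-cancel 9 1 XrXi) ⟩
          h * Xi ^ 1                             ∎))
        (≤-trans (*-mono-≤ 0≤h (^-nonneg 1 0≤Xi) h≤1 (^-≤1 1 0≤Xi Xi≤1)) (≈⇒≤ (*-identityʳ 1#)))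
        where
        open SetoidReasoning setoid
        n≡ : n ≡ m′ ℕ.+ suc m
        n≡ = ≡.trans (≡.cong (λ j → suc (m′ ℕ.+ suc j)) (ℕₚ.+-identityʳ m′)) (≡.sym (ℕₚ.+-suc m′ m))

      n≤D : n ℕ.≤ D
      n≤D = ℕₚ.m≤n⇒m≤1+n (ℕₚ.m≤m+n n m)
      m≤n : m ℕ.≤ n
      m≤n = ℕₚ.m≤m+n m _

      -- `Ca` is the error of the Taylor polynomial of `Q F`, and `Cb` the effect of rounding its
      -- coefficients down to integers.
      linear-form : ∀ i {u} → u ℕ.≤ K → ∣ pe (Q i) (fromℕ u) n * at u - pe (P i) (fromℕ u) n ∣ ≤ Ca + Cb
      linear-form i {u} u≤K = ≤-trans (≈⇒≤ (abs-cong (solve 3 (λ f g p → f :- p := (f :- g) :+ (g :- p)) refl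
        (pe (Q i) û′ n * at u) (pe (γ i) û′ n) (pe (P i) û′ n))))
        (abs-+-≤ (≤-trans (≈⇒≤ (abs-cong (+-cong (*-congʳ (sym (pe-û u≤K (Q i) n)))
          (-‿cong (pe-substitute (conv (v i) c) h û′ n)))))
            (≤-trans (taylor-product u≤K n (*-nonneg 0≤Ĥ (^-nonneg m′ 0≤q)) (v-bound i))
              (≤-trans (*-monoˡ-≤ (*-nonneg (fromℕ-nonneg n) (*-nonneg 0≤B (^-nonneg n 0≤ΛK))) siegel-size)
                (≈⇒≤ (*-identityʳ _)))))
          (≤-trans (≈⇒≤ (abs-cong (sym (pe-sub (γ i) (P i) û′ n)))) (pe-abs n (λ k _ → P-near i k) (abs-û u≤K))))
        where û′ = fromℕ u

      small-fraction : ∀ {a} → ∣ a ∣ ≤ Ĥ * Cc → ∀ {e} → ∣ e ∣ ≤ Xi ^ 40 → ∣ a * e ∣ ≤ Cc * Xi ^ 31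
      small-fraction p r = ≤-trans (abs-*-≤ p r) (≈⇒≤ (trans (solve 3 (λ h c x → h :* c :* x := c :* (h :* x)) refl
        Ĥ Cc (Xi ^ 40)) (*-congˡ (shifted-cancel 9 31 XrXi))))

    form : ℕ → ℕ → Carrier → ℕ → Carrier
    form i u a b = pe (Q i) (fromℕ u) n * a - pe (P i) (fromℕ u) n * fromℕ b

    module Siegel (M₀ : ℕ) (M₀≥ : Ca + Cb + Cc ≤ fromℕ M₀) (large : (2 ℕ.* M₀ ℕ.+ 1) ℕ.^ D ℕ.< Y) where

      M W : ℕ
      M = M₀ ℕ.* X ℕ.^ 2
      W = suc (2 ℕ.* M)

      private
        pe-integer : ∀ {g} u j → (∀ k → IsInteger (g k)) → IsInteger (pe g (fromℕ u) j)
        pe-integer u zero p = isInteger-fromℕ 0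
        pe-integer u (suc j) p = isInteger-+ (p 0) (isInteger-* (isInteger-fromℕ u) (pe-integer u j λ k → p
          (suc k)))

        -- The form is `b` times the difference of two bounded terms, the linear form and `Q` times
        -- the error of the fraction; the class bounds `b` by `X²`.
        form-bound : ∀ i u a b → u ℕ.≤ K → X ℕ.≤ b → b ℕ.< X ℕ.^ 2 → ∣ at u - a * fromℕ b ⁻¹ ∣ ≤ Xi ^ 40 → ∣ form i
          u a b ∣ ≤ fromℕ M
        form-bound i u a b u≤K X≤b b<X² err = ≤-trans (≈⇒≤ (trans (abs-cong split) (abs-* _ _)))
          (≤-trans (*-mono-≤ (abs-nonneg _) (abs-nonneg _) bracket b≤) (≈⇒≤ (trans (*-congˡ (sym (fromℕ-^ X 2)))
            (sym (fromℕ-* M₀ (X ℕ.^ 2))))))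
          where
          Qu = pe (Q i) (fromℕ u) n
          Pu = pe (P i) (fromℕ u) n
          b̂ = fromℕ b
          0<b : 0# < b̂
          0<b = fromℕ-pos′ (ℕₚ.≤-trans 1≤X X≤b)
          split : form i u a b ≈ ((Qu * at u - Pu) - Qu * (at u - a * b̂ ⁻¹)) * b̂
          split = sym (trans (solve 6 (λ s f p a b i → ((s :* f :- p) :- s :* (f :- a :* i)) :* b := s :* a :*
            (b :* i) :- p :* b) refl Qu (at u) Pu a b̂ (b̂ ⁻¹))
            (+-congʳ (trans (*-congˡ (*-inv 0<b)) (*-identityʳ _))))
          bracket : ∣ (Qu * at u - Pu) - Qu * (at u - a * b̂ ⁻¹) ∣ ≤ fromℕ M₀
          bracket = ≤-trans (abs-triangle⁻ _ _) (≤-trans (+-mono-≤ (linear-form i u≤K)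
            (≤-trans (small-fraction {Qu} (pe-bound u≤K {Q i} n n≤D 0≤Ĥ (Q-bound i)) {at u - a * b̂ ⁻¹} err)
              (≤-trans (*-monoˡ-≤ 0≤Cc (^-≤1 31 0≤Xi Xi≤1)) (≈⇒≤ (*-identityʳ Cc))))) M₀≥)
          b≤ : ∣ b̂ ∣ ≤ fromℕ X ^ 2
          b≤ = ≤-trans (≈⇒≤ (abs-of-nonneg (fromℕ-nonneg b))) (≤-trans (fromℕ-mono-≤ (ℕₚ.<⇒≤ b<X²))
            (≈⇒≤ (fromℕ-^ X 2)))

        +-cancelʳ : ∀ z x y → x + z ≈ y + z → x ≈ y
        +-cancelʳ z x y e = trans (solve 2 (λ x z → x := x :+ z :- z) refl x z) (trans (+-congʳ e)
          (solve 2 (λ y z → y :+ z :- z := y) refl y z))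

        -- The forms are integers of absolute value at most `M`; adding `M` turns them into naturals
        -- below `W`, the digits of a code.
        Residue : ℕ → ℕ → Carrier → ℕ → Set
        Residue i u a b = ∃ λ z → form i u a b + fromℕ M ≈ fromℕ z × z ℕ.< W

        residue-of : ∀ i u a b → IsInteger a → ∣ form i u a b ∣ ≤ fromℕ M → Residue i u a b
        residue-of i u a b a-int bound = finish (nonneg-integer
            (isInteger-+ (isInteger-sub (isInteger-* (pe-integer u n (Q-integer i)) a-int)
              (isInteger-* (pe-integer u n (P-integer i)) (isInteger-fromℕ b))) (isInteger-fromℕ M))
            (≤-by (sub-nonneg (≤-trans (-x≤∣x∣ _) bound)) (solve 2 (λ f m → m :- :- f := f :+ m :- :0) refl
              (form i u a b) (fromℕ M))))
          where
          finish : (∃ λ z → form i u a b + fromℕ M ≈ fromℕ z) → Residue i u a b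
          finish (z , e) = z , e , ℕ.s≤s (fromℕ-cancel-≤ {z} {2 ℕ.* M} (≤-trans (≈⇒≤ (sym e))
            (≤-trans (+-monoˡ-≤ (fromℕ M) (≤-trans (x≤∣x∣ _) bound))
              (≈⇒≤ (sym (trans (fromℕ-* 2 M) (solve 1 (λ m → (:1 :+ (:1 :+ :0)) :* m := m :+ m) refl
              (fromℕ M))))))))

        residue : ∀ i {u} → u ℕ.≤ K → (ap : Approximable u) → Residue i u (numerator ap) (denominator ap)
        residue i {u} u≤K ap = residue-of i u (numerator ap) (denominator ap) (integral ap)
          (form-bound i u (numerator ap) (denominator ap) u≤K (lower ap) (upper ap) (fraction-error {u} ap))

        residues : ℕ → ∀ us → All (ℕ._≤ K) us → All Approximable us → List ℕ
        residues i [] [] [] = []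
        residues i (u ∷ us) (u≤K ∷ us≤K) (ap ∷ aps) = proj₁ (residue i u≤K ap) ∷ residues i us us≤K aps

        residues-< : ∀ i us us≤K aps → All (ℕ._< W) (residues i us us≤K aps)
        residues-< i [] [] [] = []
        residues-< i (u ∷ us) (u≤K ∷ us≤K) (ap ∷ aps) = proj₂ (proj₂ (residue i u≤K ap)) ∷ residues-< i us us≤K aps

        length-residues : ∀ i us us≤K aps → length (residues i us us≤K aps) ≡ length us
        length-residues i [] [] [] = ≡.refl
        length-residues i (u ∷ us) (u≤K ∷ us≤K) (ap ∷ aps) = ≡.cong suc (length-residues i us us≤K aps)

      Relation : (i j : ℕ) → ∀ {u} → Approximable u → Set
      Relation i j {u} ap = form i u (numerator ap) (denominator ap) ≈ form j u (numerator ap) (denominator ap)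

      private
        agree : ∀ i j us us≤K aps → code W (residues i us us≤K aps) ≡ code W (residues j us us≤K aps) →
          All (λ u → Σ (Approximable u) (Relation i j {u})) us
        agree i j [] [] [] e = []
        agree i j (u ∷ us) (u≤K ∷ us≤K) (ap ∷ aps) e = (ap , same) ∷ agree i j us us≤K aps (proj₂ heads)
          where
          heads = code-head W (code W (residues i us us≤K aps)) (code W (residues j us us≤K aps))
            (proj₂ (proj₂ (residue i u≤K ap))) (proj₂ (proj₂ (residue j u≤K ap))) e
          same : Relation i j {u} ap
          same = +-cancelʳ (fromℕ M) (form i u (numerator ap) (denominator ap)) (form j u (numerator ap)
            (denominator ap)) (trans (proj₁ (proj₂ (residue i u≤K ap)))
            (trans (reflexive (≡.cong fromℕ (proj₁ heads))) (sym (proj₁ (proj₂ (residue j u≤K ap))))))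

        count : W ℕ.^ D ℕ.< H ℕ.^ m
        count = ℕₚ.<-≤-trans (power-count {W} {2 ℕ.* M₀ ℕ.+ 1} {X} {Y} {D} {9 ℕ.* m} W≤ large Y≤X 1≤X
          (exponent m′)) (ℕₚ.≤-reflexive (≡.sym (ℕₚ.^-*-assoc X 9 m)))
          where
          Y≤X : Y ℕ.≤ X
          Y≤X = ℕₚ.≤-trans (ℕₚ.≤-reflexive (≡.sym (ℕₚ.*-identityʳ Y))) (ℕₚ.*-monoʳ-≤ Y
            (ℕₚ.m^n>0 Y {{ℕ.>-nonZero 1≤Y}} m′))
          W≤ : W ℕ.≤ (2 ℕ.* M₀ ℕ.+ 1) ℕ.* X ℕ.^ 2
          W≤ = odd-bound M₀ (ℕₚ.m^n>0 X {{ℕ.>-nonZero 1≤X}} 2)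

      -- Siegel's lemma by pigeonhole: there are more indices below `H ^ m` than lists of `D`
      -- residues. The polynomials of the relation are the differences of those of index `i` and
      -- `j`.
      integer-relation : ∀ us → length us ≡ D → All (ℕ._≤ K) us → All Approximable us →
        ∃ λ i → ∃ λ j → i ℕ.< H ℕ.^ m × j ℕ.< H ℕ.^ m × ¬ i ≡ j × All (λ u → Σ (Approximable u) (Relation i j {u}))
          us
      integer-relation us len us≤K aps = conclude (pigeonhole count (λ i → code W (residues i us us≤K aps)) λ i →
          ≡.subst (λ d → code W (residues i us us≤K aps) ℕ.< W ℕ.^ d) (≡.trans (length-residues i us us≤K aps) len)
            (code-< W _ (residues-< i us us≤K aps)))
        where
        conclude : (∃ λ i → ∃ λ j → i ℕ.< H ℕ.^ m × j ℕ.< H ℕ.^ m × ¬ i ≡ j × code W (residues i us us≤K aps) ≡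
          code W (residues j us us≤K aps)) → _
        conclude (i , j , i< , j< , i≢j , e) = i , j , i< , j< , i≢j , agree i j us us≤K aps e

    module Contradiction {C : Carrier} (0≤C : 0# ≤ C)
      (interpolate : ∀ g η us → length us ≡ D → AllPairs (λ u v → ¬ u ≡ v) us → All (ℕ._≤ K) us →
        All (λ u → ∣ pe g (fromℕ u) D ∣ ≤ η) us → ∀ k → k ℕ.< D → ∣ g k ∣ ≤ C * η)
      (large : κ * (C * (Cc + Cc + Cd)) < y) (i j : ℕ) (i< : i ℕ.< H ℕ.^ m) (j< : j ℕ.< H ℕ.^ m) (i≢j : ¬ i ≡ j) where

      private
        w p p̂ v′ : Sequence
        w k = Q i k - Q j k
        p k = P i k - P j k
        p̂ = truncate n p
        v′ k = w k * q ^ k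

        peak = argmax v′ m′
        k* = proj₁ peak
        ω = ∣ v′ k* ∣
        0≤ω = abs-nonneg (v′ k*)

        w-beyond : ∀ k → m ℕ.≤ k → w k ≈ 0#
        w-beyond k r = trans (+-cong (Q-beyond i k r) (-‿cong (Q-beyond j k r))) (-‿inverseʳ 0#)

        v′≤ω : ∀ k → ∣ v′ k ∣ ≤ ω
        v′≤ω k = [ proj₂ (proj₂ peak) k , (λ r → ≤-trans
          (≈⇒≤ (trans (abs-cong (trans (*-congʳ (w-beyond k r)) (zeroˡ _))) abs-0)) 0≤ω) ]′ (ℕₚ.<-≤-connex k m)

        -- If every scaled coefficient were below 1, the integers `w k` would all vanish, and the
        -- indices `i` and `j` would share all their digits.
        1≤ω : 1# ≤ ω
        1≤ω = ≮⇒≥ λ ω<1 → i≢j (digit-injective H m i< j< λ k k<m → same-digit k k<m ω<1)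
          where
          same-digit : ∀ k → k ℕ.< m → ω < 1# → digit H i k ≡ digit H j k
          same-digit k k<m ω<1 = ℕₚ.≤-antisym (fromℕ-cancel-≤ {digit H i k} {digit H j k} (≈⇒≤ e)) (fromℕ-cancel-≤
            {digit H j k} {digit H i k} (≈⇒≤ (sym e)))
            where
            w≈0 : w k ≈ 0#
            w≈0 = integer-small⇒0 (isInteger-sub (Q-integer i k) (Q-integer j k)) (≤-<-trans
              (≤-trans (≈⇒≤ (sym (*-identityʳ _))) (≤-trans (*-monoˡ-≤ (abs-nonneg _) (1≤^ k 1≤q))
                (≈⇒≤ (sym (trans (abs-* (w k) (q ^ k)) (*-congˡ (abs-of-nonneg (^-nonneg k 0≤q))))))))
                  (≤-<-trans (v′≤ω k) ω<1))
            e : fromℕ (digit H i k) ≈ fromℕ (digit H j k)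
            e = trans (sym (reflexive (truncate-< m (λ k → fromℕ (digit H i k)) k k<m))) (trans
              (trans (solve 2 (λ x y → x := (x :- y) :+ y) refl (Q i k) (Q j k)) (trans (+-congʳ w≈0)
                (+-identityˡ _)))
              (reflexive (truncate-< m (λ k → fromℕ (digit H j k)) k k<m)))

        -- The Taylor coefficients of `w F - p` in the variable `t = h * u`. Truncating `p` at `n`
        -- ensures that from index `n` on they are those of `w F` alone.
        g : Sequence
        g k = conv v′ c k - p̂ k * q ^ k

        η : Carrier
        η = Cd * (ω * h ^ D) + (Cc * Xi ^ 31 + Cc * Xi ^ 31)

      -- The relation says `w a = p b` at `u`, so `w F - p` equals `w (F - a/b)` there; what remains
      -- is the Taylor error and the error of the fraction.
      small-value : ∀ {u} → u ℕ.≤ K → (ap : Approximable u) →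
        form i u (numerator ap) (denominator ap) ≈ form j u (numerator ap) (denominator ap) →
        ∣ pe (λ k → g k * h ^ k) (fromℕ u) D ∣ ≤ η
      small-value {u} u≤K ap relation = ≤-trans (≈⇒≤ (abs-cong split))
        (≤-trans (abs-triangle _ _) (+-mono-≤ (≤-trans (≈⇒≤ (abs-neg _)) (taylor-product u≤K {v′} {ω} D 0≤ω v′≤ω))
          fraction))
        where
        û′ = fromℕ u
        a = numerator ap
        b̂ = fromℕ (denominator ap)
        0<b : 0# < b̂
        0<b = fromℕ-pos′ (ℕₚ.≤-trans 1≤X (lower ap))
        V = pe v′ (h * û′) D
        T = pe (conv v′ c) (h * û′) D
        Qi = pe (Q i) û′ n
        Qj = pe (Q j) û′ n
        Pi = pe (P i) û′ n
        Pj = pe (P j) û′ n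
        e = at u - a * b̂ ⁻¹
        V≈ : V ≈ Qi - Qj
        V≈ = trans (pe-û u≤K w D) (trans (pe-truncate w û′ {n} {D} n≤D λ k r _ → w-beyond k (ℕₚ.≤-trans m≤n r))
          (pe-sub (Q i) (Q j) û′ n))
        G≈ : pe (λ k → g k * h ^ k) û′ D ≈ T - (Pi - Pj)
        G≈ = trans (pe-substitute g h û′ D) (trans (pe-sub (conv v′ c) (λ k → p̂ k * q ^ k) (h * û′) D)
          (+-congˡ (-‿cong
          (trans (pe-û u≤K p̂ D) (trans (pe-truncate p̂ û′ {n} {D} n≤D λ k r _ → reflexive (truncate-≥ n p k r))
            (trans (pe-cong n (λ k r → reflexive (truncate-< n p k r)) refl) (pe-sub (P i) (P j) û′ n)))))))
        cross : Pi - Pj ≈ (Qi - Qj) * (a * b̂ ⁻¹)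
        cross = sym (trans (solve 7 (λ r s p t a b k → (r :- s) :* (a :* k) := ((r :* a :- p :* b) :-
          (s :* a :- t :* b)) :* k :+ (p :- t) :* (b :* k)) refl Qi Qj Pi Pj a b̂ (b̂ ⁻¹))
          (trans (+-cong (trans (*-congʳ (trans (+-congʳ relation) (-‿inverseʳ _))) (zeroˡ _))
            (trans (*-congˡ (*-inv 0<b)) (*-identityʳ _))) (+-identityˡ _)))
        split : pe (λ k → g k * h ^ k) û′ D ≈ - (V * at u - T) + (Qi * e - Qj * e)
        split = trans G≈ (trans (+-congˡ (-‿cong cross)) (trans
          (solve 5 (λ t r s f x → t :- (r :- s) :* x := :- ((r :- s) :* f :- t) :+ (r :* (f :- x) :- s :*
            (f :- x))) refl T Qi Qj (at u) (a * b̂ ⁻¹))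
          (+-congʳ (-‿cong (+-congʳ (*-congʳ (sym V≈)))))))
        fraction : ∣ Qi * e - Qj * e ∣ ≤ Cc * Xi ^ 31 + Cc * Xi ^ 31
        fraction = ≤-trans (abs-triangle⁻ _ _) (+-mono-≤
          (small-fraction {Qi} (pe-bound u≤K {Q i} n n≤D 0≤Ĥ (Q-bound i)) {e} (fraction-error {u} ap))
          (small-fraction {Qj} (pe-bound u≤K {Q j} n n≤D 0≤Ĥ (Q-bound j)) {e} (fraction-error {u} ap)))

      private
        CC = Cc + Cc + Cd

        -- Passing back from values at the nodes to coefficients in `t` costs `q ^ (3 m) = X³⁰`. One
        -- factor is left over in both terms: `h` from `h ^ D` with `D = 3 m + 1`, and `X⁻¹` from
        -- `X⁻³¹`.
        scaled-η : η * q ^ (n ℕ.+ m) ≤ CC * (ω * ε)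
        scaled-η = ≤-trans (≈⇒≤ (begin-equality
            (Cd * (ω * h ^ D) + (Cc * Xi ^ 31 + Cc * Xi ^ 31)) * q ^ (n ℕ.+ m)
              ≈⟨ (solve 7 (λ d o h k c x r → (d :* (o :* (h :* k)) :+ (c :* x :+ c :* x)) :* r := d :* (o :* h) :*
                (r :* k) :+ (c :+ c) :* (r :* x)) refl) Cd ω h (h ^ (n ℕ.+ m)) Cc (Xi ^ 31) (q ^ (n ℕ.+ m)) ⟩
            Cd * (ω * h) * (q ^ (n ℕ.+ m) * h ^ (n ℕ.+ m)) + (Cc + Cc) * (q ^ (n ℕ.+ m) * Xi ^ 31)
              ≈⟨ +-cong (trans (*-congˡ (trans (sym (^-* q h (n ℕ.+ m))) (trans (^-congˡ (n ℕ.+ m) qh)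
                (1^ (n ℕ.+ m))))) (*-identityʳ _))
                        (*-congˡ (trans (*-congʳ q³ᵐ) (shifted-cancel 30 1 XrXi))) ⟩
            Cd * (ω * h) + (Cc + Cc) * Xi ^ 1 ∎))
          (≤-trans (+-mono-≤ (*-monoˡ-≤ 0≤Cd (*-monoˡ-≤ 0≤ω h≤ε))
              (*-monoˡ-≤ (+-nonneg 0≤Cc 0≤Cc) (≤-trans (≈⇒≤ (*-identityʳ Xi)) (≤-trans Xi≤ε
                (≤-trans (≈⇒≤ (sym (*-identityˡ ε))) (*-monoʳ-≤ 0≤ε 1≤ω))))))
            (≈⇒≤ (solve 3 (λ d c x → d :* x :+ c :* x := (c :+ d) :* x) refl Cd (Cc + Cc) (ω * ε))))
          where
          open ≤-Reasoning
          q³ᵐ : q ^ (n ℕ.+ m) ≈ Xr ^ 30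
          q³ᵐ = begin-equality
            q ^ (n ℕ.+ m)                         ≈⟨ ^-homo-* q n m ⟩
            q ^ n * q ^ m                         ≈⟨ *-congʳ (^-homo-* q m (m ℕ.+ 0)) ⟩
            q ^ m * q ^ (m ℕ.+ 0) * q ^ m         ≈⟨ *-congʳ
              (*-congˡ (reflexive (≡.cong (q ^_) (ℕₚ.+-identityʳ m)))) ⟩
            q ^ m * q ^ m * q ^ m                 ≈⟨ *-cong (*-cong qm qm) qm ⟩
            Xr ^ 10 * Xr ^ 10 * Xr ^ 10           ≈⟨ *-congʳ (^-homo-* Xr 10 10) ⟨
            Xr ^ 20 * Xr ^ 10                     ≈⟨ ^-homo-* Xr 20 10 ⟨
            Xr ^ 30                               ∎

      -- Interpolation at `3 m + 1` nodes bounds the coefficients of `g` up to index `3 m`. Those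
      -- from `2 m` on are the dot products of `independent`, which yields `ω ≤ const * ε * ω` with
      -- a factor below 1.
      no-relation : ∀ us → length us ≡ D → AllPairs (λ u v → ¬ u ≡ v) us → All (ℕ._≤ K) us →
        All (λ u → Σ (Approximable u) λ ap → form i u (numerator ap) (denominator ap) ≈ form j u (numerator ap)
          (denominator ap)) us → ⊥
      no-relation us len distinct us≤K relations = ≤⇒≯ ω≤ ω<
        where
        values : ∀ us → All (ℕ._≤ K) us →
          All (λ u → Σ (Approximable u) λ ap → form i u (numerator ap) (denominator ap) ≈ form j u (numerator ap)
            (denominator ap)) us →
          All (λ u → ∣ pe (λ k → g k * h ^ k) (fromℕ u) D ∣ ≤ η) us
        values [] [] [] = []
        values (u ∷ us) (u≤K ∷ us≤K) ((ap , r) ∷ rs) = small-value {u} u≤K ap r ∷ values us us≤K rs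
        g≤ : ∀ k → k ℕ.< D → ∣ g k * h ^ k ∣ ≤ C * η
        g≤ = interpolate (λ k → g k * h ^ k) η us len distinct us≤K (values us us≤K relations)
        0≤η : 0# ≤ η
        0≤η = +-nonneg (*-nonneg 0≤Cd (*-nonneg 0≤ω (^-nonneg D 0≤h))) (+-nonneg 0≤CX 0≤CX)
          where 0≤CX = *-nonneg 0≤Cc (^-nonneg 31 0≤Xi)
        dots : ∀ k → n ℕ.≤ k → k ℕ.≤ n ℕ.+ m → ∣ dot (λ i → c (k ℕ.∸ i)) v′ m ∣ ≤ C * (CC * (ω * ε))
        dots k n≤k k≤n+m = ≤-trans (≈⇒≤ (abs-cong (trans (sym (conv-dot m k v′ c (ℕₚ.m≤n⇒m≤1+n (ℕₚ.≤-trans m≤n n≤k))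
            (λ i r → trans (*-congʳ (w-beyond i r)) (zeroˡ _)))) unscale)))
          (≤-trans (abs-*-≤ (g≤ k (ℕ.s≤s k≤n+m)) (≤-trans (≈⇒≤ (abs-of-nonneg (^-nonneg k 0≤q))) (^-monoʳ-≤ 1≤q
            k≤n+m)))
            (≤-trans (≈⇒≤ (*-assoc _ _ _)) (*-monoˡ-≤ 0≤C scaled-η)))
          where
          unscale : conv v′ c k ≈ g k * h ^ k * q ^ k
          unscale = sym (trans (solve 3 (λ g h q → g :* h :* q := g :* (q :* h)) refl (g k) (h ^ k) (q ^ k))
            (trans (*-congˡ (trans (sym (^-* q h k)) (trans (^-congˡ k qh) (1^ k))))
            (trans (*-identityʳ _) (trans (+-congˡ (-‿cong (trans (*-congʳ (reflexive (truncate-≥ n p k n≤k)))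
              (zeroˡ _)))) (solve 1 (λ x → x :- :0 := x) refl (conv v′ c k))))))
        ω≤ : ω ≤ κ * (C * (CC * (ω * ε)))
        ω≤ = independent v′ _ dots k* (proj₁ (proj₂ peak))
        ω< : κ * (C * (CC * (ω * ε))) < ω
        ω< = ≤-<-trans (≈⇒≤ (solve 5 (λ k c d o e → k :* (c :* (d :* (o :* e))) := k :* (c :* d) :* (o :* e)) refl
          κ C CC ω ε))
          (<-≤-trans (*-monoʳ-< (*-pos (<-≤-trans 0<1 1≤ω) 0<ε) large)
            (≈⇒≤ (trans (solve 3 (λ y o e → y :* (o :* e) := y :* e :* o) refl y ω ε) (trans (*-congʳ yε)
            (*-identityˡ ω)))))

  sparse-windows : ∀ {F x₀} m′ (N : NiceAt F (suc m′) x₀) K → ∃ λ Y₀ → ∀ Y → Y₀ ℕ.≤ Y → ∀ x → ∣ x - x₀ ∣ < NiceAt.ρ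
    N →
    ∀ us → length us ≡ suc (2 ℕ.* suc m′ ℕ.+ suc m′) → AllPairs (λ u v → ¬ u ≡ v) us → All (ℕ._≤ K) us →
    ¬ All (λ u → RationalApproximation (Y ℕ.^ suc m′) ((Y ℕ.^ suc m′) ℕ.^ 2) (F (x + (fromℕ Y ⁻¹) ^ 10 * fromℕ u)))
      us
  sparse-windows {F} {x₀} m′ N K = choose (archimedean (Λ * k̂)) (archimedean (Ca + Cb + Cc)) (interpolation D K)
    where
    open NiceAt N
    n = 2 ℕ.* suc m′
    D = suc (n ℕ.+ suc m′)
    k̂ = fromℕ K
    Ca = fromℕ n * (B * (Λ * k̂) ^ n)
    Cb = pe (λ _ → 1#) k̂ n
    Cc = pe (λ _ → 1#) k̂ D
    Cd = fromℕ D * (B * (Λ * k̂) ^ D)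
    choose : (∃ λ L → Λ * k̂ < fromℕ L) → (∃ λ M₀ → Ca + Cb + Cc < fromℕ M₀) →
      (∃ λ C → 0# ≤ C × (∀ g η us → length us ≡ D → AllPairs (λ u v → ¬ u ≡ v) us → All (ℕ._≤ K) us →
        All (λ u → ∣ pe g (fromℕ u) D ∣ ≤ η) us → ∀ k → k ℕ.< D → ∣ g k ∣ ≤ C * η)) → _
    choose (L , L<) (M₀ , M₀<) (C , 0≤C , interpolate) = large (archimedean (κ * (C * (Cc + Cc + Cd))))
      where
      M₁ = (2 ℕ.* M₀ ℕ.+ 1) ℕ.^ D
      large : (∃ λ R → κ * (C * (Cc + Cc + Cd)) < fromℕ R) → _
      -- `L` keeps the window within the range of the expansion, `M₁` serves the pigeonhole count,
      -- and `R` the final contradiction.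
      large (R , R<) = suc (L ℕ.+ (M₁ ℕ.+ R)) , λ Y Y₀≤Y x xI us len distinct us≤K aps →
        let L≤Y = ℕₚ.≤-trans (ℕₚ.m≤n⇒m≤1+n (ℕₚ.m≤m+n L (M₁ ℕ.+ R))) Y₀≤Y
            M₁<Y = ℕₚ.≤-trans (ℕ.s≤s (ℕₚ.≤-trans (ℕₚ.m≤m+n M₁ R) (ℕₚ.m≤n+m _ L))) Y₀≤Y
            R≤Y = ℕₚ.≤-trans (ℕₚ.m≤n⇒m≤1+n (ℕₚ.≤-trans (ℕₚ.m≤n+m R M₁) (ℕₚ.m≤n+m _ L))) Y₀≤Y in
        contradict Y (ℕₚ.≤-trans (ℕ.s≤s ℕ.z≤n) Y₀≤Y) (≤-trans (<⇒≤ L<) (fromℕ-mono-≤ L≤Y)) M₁<Y (<-≤-trans R<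
          (fromℕ-mono-≤ R≤Y)) x xI us len distinct us≤K aps
        where
        contradict : ∀ Y (1≤Y : 1 ℕ.≤ Y) (ΛK≤Y : Λ * k̂ ≤ fromℕ Y) → M₁ ℕ.< Y → κ * (C * (Cc + Cc + Cd)) < fromℕ Y
          → ∀ x → ∣ x - x₀ ∣ < ρ →
          ∀ us → length us ≡ D → AllPairs (λ u v → ¬ u ≡ v) us → All (ℕ._≤ K) us →
          ¬ All (λ u → RationalApproximation (Y ℕ.^ suc m′) ((Y ℕ.^ suc m′) ℕ.^ 2) (F (x + (fromℕ Y ⁻¹) ^ 10 *
            fromℕ u))) us
        contradict Y 1≤Y ΛK≤Y M₁<Y R<Y x xI us len distinct us≤K aps = finish (W.Siegel.integer-relation M₀
          (<⇒≤ M₀<) M₁<Y us len us≤K aps)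
          where
          module W = Window {F} m′ {x} {jet x} {B} {Λ} {κ} (expansion x xI) 0≤κ (independent x xI) K Y 1≤Y ΛK≤Y
          finish : (∃ λ i → ∃ λ j → i ℕ.< W.H ℕ.^ suc m′ × j ℕ.< W.H ℕ.^ suc m′ × ¬ i ≡ j ×
            All (λ u → Σ (W.Approximable u) (W.Siegel.Relation M₀ (<⇒≤ M₀<) M₁<Y i j {u})) us) → ⊥
          finish (i , j , i< , j< , i≢j , rel) = W.Contradiction.no-relation 0≤C interpolate R<Y i j i< j< i≢j us
            len distinct us≤K rel

-- Interval states that avoid fractions.

module Removal (em : ExcludedMiddle 0ℓ) (ℝ : CompleteOrderedField) where
  open CompleteOrderedField ℝ hiding (zero)
  open RealAnalysis ℝ
  open IntegerSolver commutativeRing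
  open Ordered ℝ
  open Archimedean em ℝ
  open Algebra.Properties.Semiring.Exp semiring using (^-congˡ)
  open Local em ℝ

  Within : Carrier → Carrier → Carrier → Set
  Within α r x = α ≤ x × x ≤ α + r

  Avoids : (Carrier → Carrier) → Carrier → Carrier → ℕ → Set
  Avoids F x a b = (fromℕ b ⁻¹) ^ 41 ≤ ∣ F x - a * fromℕ b ⁻¹ ∣

  -- Multiplied by `b * b′`, the difference of the fractions becomes an integer of absolute value
  -- below 1.
  equal-fractions : ∀ {a a′ V C} b b′ → IsInteger a → IsInteger a′ → 1 ℕ.≤ b → 1 ℕ.≤ b′ → b ℕ.< V → b′ ℕ.< V →
    0# ≤ C → C * fromℕ V ^ 2 ≤ 1# → ∣ a * fromℕ b ⁻¹ - a′ * fromℕ b′ ⁻¹ ∣ < C → a * fromℕ b ⁻¹ ≈ a′ * fromℕ b′ ⁻¹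
  equal-fractions {a} {a′} {V} {C} b b′ a-int a′-int 1≤b 1≤b′ b<V b′<V 0≤C CV²≤1 close = begin
      a * b̂ ⁻¹                          ≈⟨ *-identityʳ _ ⟨
      a * b̂ ⁻¹ * 1#                     ≈⟨ *-congˡ (*-inv 0<b′) ⟨
      a * b̂ ⁻¹ * (b̂′ * b̂′ ⁻¹)           ≈⟨ (solve 4 (λ a i c j → a :* i :* (c :* j) := a :* c :* (i :* j)) refl)
        a (b̂ ⁻¹) b̂′ (b̂′ ⁻¹) ⟩
      a * b̂′ * (b̂ ⁻¹ * b̂′ ⁻¹)           ≈⟨ *-congʳ cross ⟩
      a′ * b̂ * (b̂ ⁻¹ * b̂′ ⁻¹)           ≈⟨ (solve 4 (λ a b i j → a :* b :* (i :* j) := a :* j :* (b :* i)) refl)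
        a′ b̂ (b̂ ⁻¹) (b̂′ ⁻¹) ⟩
      a′ * b̂′ ⁻¹ * (b̂ * b̂ ⁻¹)           ≈⟨ *-congˡ (*-inv 0<b) ⟩
      a′ * b̂′ ⁻¹ * 1#                   ≈⟨ *-identityʳ _ ⟩
      a′ * b̂′ ⁻¹                        ∎
    where
    open SetoidReasoning setoid
    b̂ = fromℕ b
    b̂′ = fromℕ b′
    V̂ = fromℕ V
    0<b = fromℕ-pos′ 1≤b
    0<b′ = fromℕ-pos′ 1≤b′
    clear : (a * b̂ ⁻¹ - a′ * b̂′ ⁻¹) * (b̂ * b̂′) ≈ a * b̂′ - a′ * b̂
    clear = trans (solve 6 (λ a a′ b c i j → (a :* i :- a′ :* j) :* (b :* c) := a :* c :* (b :* i) :- a′ :* b :*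
      (c :* j)) refl a a′ b̂ b̂′ (b̂ ⁻¹) (b̂′ ⁻¹))
      (+-cong (trans (*-congˡ (*-inv 0<b)) (*-identityʳ _)) (-‿cong (trans (*-congˡ (*-inv 0<b′)) (*-identityʳ _))))
    small : ∣ a * b̂′ - a′ * b̂ ∣ < 1#
    small = ≤-<-trans (≈⇒≤ (trans (abs-cong (sym clear)) (trans (abs-* _ _)
      (*-congˡ (abs-of-nonneg (*-nonneg (<⇒≤ 0<b) (<⇒≤ 0<b′)))))))
      (<-≤-trans (*-monoʳ-< (*-pos 0<b 0<b′) close) (≤-trans (*-monoˡ-≤ 0≤C (*-mono-≤ (<⇒≤ 0<b) (<⇒≤ 0<b′)
        (fromℕ-mono-≤ (ℕₚ.<⇒≤ b<V))
        (≤-trans (fromℕ-mono-≤ (ℕₚ.<⇒≤ b′<V)) (≈⇒≤ (sym (*-identityʳ V̂)))))) CV²≤1))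
    cross : a * b̂′ ≈ a′ * b̂
    cross = trans (solve 2 (λ x y → x := (x :- y) :+ y) refl (a * b̂′) (a′ * b̂)) (trans (+-congʳ (integer-small⇒0
      (isInteger-sub (isInteger-* a-int (isInteger-fromℕ b′)) (isInteger-* a′-int (isInteger-fromℕ b))) small))
        (+-identityˡ _))

  module _ {F : Carrier → Carrier} {xc : Carrier} (bl : BiLipschitzAt F xc) where

    open BiLipschitzAt bl

    -- `c′` is `λ₁ / 8`: two points whose values are within `c′ * r` of the same fraction are then
    -- within `r / 4` of each other. Fractions met by two points of an interval of length `r` differ
    -- by less than `L * r + 2 * c′ * r`, hence by less than `Γ * r`, and `ℓ = Γ ⁻¹` normalises
    -- widths against this.
    Γ ℓ c′ : Carrier
    Γ = 1# + (L + λ₁)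
    ℓ = Γ ⁻¹
    c′ = ½ * (½ * (½ * λ₁))

    0<Γ : 0# < Γ
    0<Γ = +-pos 0<1 (+-nonneg (<⇒≤ 0<L) (<⇒≤ 0<λ₁))

    0<ℓ : 0# < ℓ
    0<ℓ = ⁻¹-pos 0<Γ

    ℓ≤1 : ℓ ≤ 1#
    ℓ≤1 = *-cancelˡ-≤ 0<Γ (≤-trans (≈⇒≤ (*-inv 0<Γ)) (≤-by (+-nonneg (<⇒≤ 0<L) (<⇒≤ 0<λ₁))
      (solve 1 (λ x → x := (:1 :+ x) :* :1 :- :1) refl (L + λ₁))))

    0<c′ : 0# < c′
    0<c′ = half-pos (half-pos (half-pos 0<λ₁))

    eight-c′ : (1# + 1#) * ((1# + 1#) * ((1# + 1#) * c′)) ≈ λ₁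
    eight-c′ = trans (solve 2 (λ h l → (:1 :+ :1) :* ((:1 :+ :1) :* ((:1 :+ :1) :* (h :* (h :* (h :* l))))) :=
      ((:1 :+ :1) :* h) :* (((:1 :+ :1) :* h) :* (((:1 :+ :1) :* h) :* l))) refl ½ λ₁)
      (trans (*-cong (*-inv 0<2) (trans (*-cong (*-inv 0<2) (trans (*-congʳ (*-inv 0<2)) (*-identityˡ _)))
        (*-identityˡ _))) (*-identityˡ _))

    quarter : Carrier → Carrier
    quarter r = ½ * (½ * r)

    four-quarters : ∀ r → quarter r + quarter r + (quarter r + quarter r) ≈ r
    four-quarters r = trans (+-cong (½+½ _) (½+½ _)) (½+½ r)

    -- By `fine` all fractions that disturb the interval coincide, so all bad points lie within a
    -- quarter of its length of any one of them. The condition `(fromℕ b ⁻¹) ^ 41 ≤ c′ * r`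
    -- restricts to fractions whose forbidden zone is small compared with the interval.
    remove : ∀ α r V → 0# < r → (∀ x → Within α r x → ∣ x - xc ∣ < ρ) → Γ * r * fromℕ V ^ 2 ≤ 1# →
      ∃ λ α′ → α ≤ α′ × α′ + quarter r ≤ α + r × (∀ x → Within α′ (quarter r) x →
        ∀ a b → IsInteger a → 1 ℕ.≤ b → b ℕ.< V → (fromℕ b ⁻¹) ^ 41 ≤ c′ * r → Avoids F x a b)
    remove α r V 0<r inside fine = decide (em {∃ λ x → Within α r x × Bad x})
      where
      Bad : Carrier → Set
      Bad x = ∃ λ a → ∃ λ b → IsInteger a × 1 ℕ.≤ b × b ℕ.< V × (fromℕ b ⁻¹) ^ 41 ≤ c′ * r × ∣ F x - a * fromℕ b ⁻¹
        ∣ < (fromℕ b ⁻¹) ^ 41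
      Result : Set
      Result = ∃ λ α′ → α ≤ α′ × α′ + quarter r ≤ α + r × (∀ x → Within α′ (quarter r) x →
        ∀ a b → IsInteger a → 1 ℕ.≤ b → b ℕ.< V → (fromℕ b ⁻¹) ^ 41 ≤ c′ * r → Avoids F x a b)
      s = quarter r
      0<s : 0# < s
      0<s = half-pos (half-pos 0<r)
      3s≤ : α + (s + s + s) + s ≤ α + r
      3s≤ = ≈⇒≤ (trans (solve 2 (λ a s → a :+ (s :+ s :+ s) :+ s := a :+ (s :+ s :+ (s :+ s))) refl α s)
        (+-congˡ (four-quarters r)))
      s≤r : α + s ≤ α + r
      s≤r = ≤-trans (≤-by (+-nonneg (+-nonneg (<⇒≤ 0<s) (<⇒≤ 0<s)) (<⇒≤ 0<s)) (solve 2 (λ a s → s :+ s :+ s := a :+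
        (s :+ s :+ s) :+ s :- (a :+ s)) refl α s)) 3s≤
      avoid : ∀ {x} → ¬ Bad x → ∀ a b → IsInteger a → 1 ℕ.≤ b → b ℕ.< V → (fromℕ b ⁻¹) ^ 41 ≤ c′ * r → Avoids F x a
        b
      avoid ¬bad a b a-int 1≤b b<V small = ≮⇒≥ λ close → ¬bad (a , b , a-int , 1≤b , b<V , small , close)
      decide : Dec (∃ λ x → Within α r x × Bad x) → Result
      decide (no none) = α , ≤-refl , s≤r , λ x (p , q) → avoid λ bad → none (x , (p , ≤-trans q s≤r) , bad)
      decide (yes (x₁ , x₁∈ , a₁ , b₁ , a₁-int , 1≤b₁ , b₁<V , small₁ , close₁)) = side (≤-total x₁ (α + (s + s)))
        where
        e₁ = c′ * r
        0≤e₁ = *-nonneg (<⇒≤ 0<c′) (<⇒≤ 0<r)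
        bad-close : ∀ x → Within α r x → Bad x → ∣ x - x₁ ∣ < s
        bad-close x x∈ (a , b , a-int , 1≤b , b<V , small , close) = *-cancelˡ-< (<⇒≤ 0<λ₁)
          (≤-<-trans (expanding x x₁ (inside x x∈) (inside x₁ x₁∈))
          (<-≤-trans F-close (≈⇒≤ (trans (solve 2 (λ c r → c :* r :+ c :* r := (:1 :+ :1) :* c :* r) refl c′ r)
            eight))))
          where
          f = a * fromℕ b ⁻¹
          f₁ = a₁ * fromℕ b₁ ⁻¹
          eight : (1# + 1#) * c′ * r ≈ λ₁ * s
          eight = sym (trans (*-congʳ (sym eight-c′)) (trans (solve 3 (λ c h r → (:1 :+ :1) :* ((:1 :+ :1) :*
            ((:1 :+ :1) :* c)) :* (h :* (h :* r)) := (:1 :+ :1) :* c :* r :* (((:1 :+ :1) :* h) :* ((:1 :+ :1) :*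
            h))) refl c′ ½ r)
            (trans (*-congˡ (trans (*-cong (*-inv 0<2) (*-inv 0<2)) (*-identityʳ 1#))) (*-identityʳ _))))
          near : ∣ F x - f ∣ < e₁
          near = <-≤-trans close small
          near₁ : ∣ F x₁ - f₁ ∣ < e₁
          near₁ = <-≤-trans close₁ small₁
          fractions : ∣ f - f₁ ∣ < Γ * r
          fractions = ≤-<-trans (≤-trans (≈⇒≤ (abs-cong (solve 4 (λ u v f g → f :- g := (u :- v) :+
            ((v :- g) :- (u :- f))) refl (F x) (F x₁) f f₁)))
              (≤-trans (abs-triangle _ _) (+-monoʳ-≤ _ (abs-triangle⁻ _ _))))
            (<-≤-trans (+-mono-≤-< (≤-trans (lipschitz x x₁ (inside x x∈) (inside x₁ x₁∈)) (*-monoˡ-≤ (<⇒≤ 0<L)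
              diameter)) (+-mono-<-≤ near₁ (<⇒≤ near)))
              (≤-by (+-nonneg (*-nonneg 0≤1 (<⇒≤ 0<r)) (+-nonneg (*-nonneg 0≤e₆ (<⇒≤ 0<r)) ≤-refl))
                (trans (solve 3 (λ l c r → :1 :* r :+ ((c :+ c :+ (c :+ c) :+ (c :+ c)) :* r :+ :0) :=
                  (:1 :+ (l :+ (:1 :+ :1) :* ((:1 :+ :1) :* ((:1 :+ :1) :* c)))) :* r :-
                  (l :* r :+ (c :* r :+ c :* r))) refl L c′ r)
                  (+-congʳ (*-congʳ (+-congˡ (+-congˡ eight-c′)))))))
            where
            0≤2c′ = +-nonneg (<⇒≤ 0<c′) (<⇒≤ 0<c′)
            0≤e₆ = +-nonneg (+-nonneg 0≤2c′ 0≤2c′) 0≤2c′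
            diameter : ∣ x - x₁ ∣ ≤ r
            diameter = abs-least (≤-by (+-nonneg (sub-nonneg (proj₂ x∈)) (sub-nonneg (proj₁ x₁∈)))
              (solve 4 (λ x y a r → (a :+ r :- x) :+ (y :- a) := r :- (x :- y)) refl x x₁ α r))
              (≤-by (+-nonneg (sub-nonneg (proj₂ x₁∈)) (sub-nonneg (proj₁ x∈))) (solve 4 (λ x y a r → (a :+ r :- y)
                :+ (x :- a) := r :- :- (x :- y)) refl x x₁ α r))
          f≈f₁ : f ≈ f₁
          f≈f₁ = equal-fractions {a} {a₁} {V} {Γ * r} b b₁ a-int a₁-int 1≤b 1≤b₁ b<V b₁<V (*-nonneg (<⇒≤ 0<Γ)
            (<⇒≤ 0<r)) fine fractions
          F-close : ∣ F x - F x₁ ∣ < e₁ + e₁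
          F-close = ≤-<-trans (≤-trans (≈⇒≤ (abs-cong (trans (solve 3 (λ u v f → u :- v := (u :- f) :- (v :- f))
            refl (F x) (F x₁) f) (+-congˡ (-‿cong (+-congˡ (-‿cong f≈f₁))))))) (abs-triangle⁻ _ _))
            (+-mono-<-≤ near (<⇒≤ near₁))
        -- The quarter kept is the last one if `x₁` lies in the left half and the first one
        -- otherwise; either way it is at distance at least `s` from `x₁`.
        side : x₁ ≤ α + (s + s) ⊎ α + (s + s) ≤ x₁ → Result
        side (inj₁ left) = α + (s + s + s) , ≤-by (+-nonneg (+-nonneg (<⇒≤ 0<s) (<⇒≤ 0<s)) (<⇒≤ 0<s))
          (solve 2 (λ a s → s :+ s :+ s := a :+ (s :+ s :+ s) :- a) refl α s) , 3s≤ ,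
          λ x (p , q) → avoid λ bad → ≤⇒≯ (≤-trans (≤-by (+-nonneg (sub-nonneg left) (sub-nonneg p))
            (solve 4 (λ x y a s → (a :+ (s :+ s) :- y) :+ (x :- (a :+ (s :+ s :+ s))) := (x :- y) :- s) refl x x₁ α
            s)) (x≤∣x∣ _))
            (bad-close x (≤-trans (≤-by (+-nonneg (+-nonneg (<⇒≤ 0<s) (<⇒≤ 0<s)) (<⇒≤ 0<s))
              (solve 2 (λ a s → s :+ s :+ s := a :+ (s :+ s :+ s) :- a) refl α s)) p , ≤-trans q 3s≤) bad)
        side (inj₂ right) = α , ≤-refl , s≤r ,
          λ x (p , q) → avoid λ bad → ≤⇒≯ (≤-trans (≤-by (+-nonneg (sub-nonneg right) (sub-nonneg q))
            (solve 4 (λ x y a s → (y :- (a :+ (s :+ s))) :+ (a :+ s :- x) := :- (x :- y) :- s) refl x x₁ α s))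
            (-x≤∣x∣ _))
            (bad-close x (p , ≤-trans q s≤r) bad)

    -- Distinct fractions with denominators below X ^ 2 are at least X ^ -4 apart, so an interval of length
    -- ℓ X ^ -4 is affected by at most one of them when X is replaced by X ^ 2.
    module States (B₀ : ℕ) (9≤B₀ : 9 ℕ.≤ B₀) (B₀-large : 1# ≤ fromℕ B₀ * (c′ * ℓ)) where

      record State : Set where
        field
          X      : ℕ
          α      : Carrier
          B₀≤X   : B₀ ℕ.≤ X

        ξ : Carrier
        ξ = fromℕ X ⁻¹

        width : Carrier
        width = ℓ * ξ ^ 4

        field
          inside : ∀ x → Within α width x → ∣ x - xc ∣ < ρ
          free   : ∀ x → Within α width x → ∀ a b → IsInteger a → B₀ ℕ.≤ b → b ℕ.< X → Avoids F x a b

        9≤X : 9 ℕ.≤ X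
        9≤X = ℕₚ.≤-trans 9≤B₀ B₀≤X

        1≤X : 1 ℕ.≤ X
        1≤X = ℕₚ.≤-trans (ℕ.s≤s ℕ.z≤n) 9≤X

        0<X̂ : 0# < fromℕ X
        0<X̂ = fromℕ-pos′ 1≤X

        0<ξ : 0# < ξ
        0<ξ = ⁻¹-pos 0<X̂

        9ξ≤1 : fromℕ 9 * ξ ≤ 1#
        9ξ≤1 = ≤-trans (*-monoʳ-≤ (<⇒≤ 0<ξ) (fromℕ-mono-≤ 9≤X)) (≈⇒≤ (*-inv 0<X̂))

        ξ≤½ : ξ ≤ ½
        ξ≤½ = *-cancelˡ-≤ 0<2 (≤-trans (*-monoʳ-≤ (<⇒≤ 0<ξ) (≤-trans (≈⇒≤ (solve 1 (λ x → x :+ x := x :+ (x :+ :0))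
          refl 1#)) (fromℕ-mono-≤ {2} {9} (ℕ.s≤s (ℕ.s≤s ℕ.z≤n))))) (≤-trans 9ξ≤1 (≈⇒≤ (sym (*-inv 0<2)))))

        ξ≤1 : ξ ≤ 1#
        ξ≤1 = ≤-trans ξ≤½ (<⇒≤ ½<1)

        0<width : 0# < width
        0<width = *-pos 0<ℓ (^-pos 4 0<ξ)

        Contains : Carrier → Set
        Contains = Within α width

      open State

      infix 4 _⊑_
      _⊑_ : State → State → Set
      S ⊑ T = α T ≤ α S × α S + width S ≤ α T + width T

      ⊑-refl : ∀ {S} → S ⊑ S
      ⊑-refl = ≤-refl , ≤-refl

      ⊑-trans : ∀ {S T R} → S ⊑ T → T ⊑ R → S ⊑ R
      ⊑-trans (p , q) (p′ , q′) = ≤-trans p′ p , ≤-trans q q′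

      private
        square-inverse : ∀ S → fromℕ (X S ℕ.^ 2) ⁻¹ ≈ ξ S ^ 2
        square-inverse S = sym (⁻¹-unique (fromℕ-pos′ (ℕₚ.m^n>0 (X S) {{ℕ.>-nonZero (1≤X S)}} 2))
          (trans (*-congʳ (fromℕ-^ (X S) 2)) (^-inv 2 (0<X̂ S))))

        refine-at : ∀ S β → α S ≤ β → β + ℓ * (ξ S ^ 2) ^ 4 ≤ α S + width S →
          (∀ x → Within β (ℓ * (ξ S ^ 2) ^ 4) x → ∀ a b → IsInteger a → B₀ ℕ.≤ b → b ℕ.< X S ℕ.^ 2 → Avoids F x a
            b) → State
        refine-at S β p q avoid = record
          { X = X S ℕ.^ 2 ; α = β
          ; B₀≤X = ℕₚ.≤-trans (B₀≤X S) (ℕₚ.≤-trans (ℕₚ.≤-reflexive (≡.sym (ℕₚ.*-identityʳ (X S)))) (ℕₚ.*-monoʳ-≤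
            (X S) (ℕₚ.≤-trans (1≤X S) (ℕₚ.≤-reflexive (≡.sym (ℕₚ.*-identityʳ (X S)))))))
          ; inside = λ x (u , v) → inside S x (≤-trans p u , ≤-trans (≤-trans v same-width) q)
          ; free = λ x (u , v) → avoid x (u , ≤-trans v same-width)
          }
          where
          same-width : β + ℓ * (fromℕ (X S ℕ.^ 2) ⁻¹) ^ 4 ≤ β + ℓ * (ξ S ^ 2) ^ 4
          same-width = ≈⇒≤ (+-congˡ (*-congˡ (^-congˡ 4 (square-inverse S))))

      Refinement : State → Carrier → Set
      Refinement S z = ∃ λ T → T ⊑ S × X T ≡ X S ℕ.^ 2 × ¬ Contains T z

      -- The quarter left by `remove` has room for two disjoint intervals of the new width, and one
      -- of them misses `z`. Missing a prescribed point is what later separates a limit from the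
      -- centre of a jet.
      refine : ∀ S z → Refinement S z
      refine S z = from (remove (α S) (width S) (X S ℕ.^ 2) (0<width S) (inside S) fine)
        where
        x̂ = fromℕ (X S)
        fine : Γ * width S * fromℕ (X S ℕ.^ 2) ^ 2 ≤ 1#
        fine = ≈⇒≤ (trans (*-congˡ (^-congˡ 2 (fromℕ-^ (X S) 2)))
          (trans (solve 4 (λ g l t x → g :* (l :* (t :* (t :* (t :* (t :* :1))))) :* (x :* (x :* :1) :*
            (x :* (x :* :1) :* :1)) := g :* l :* ((x :* t) :* ((x :* t) :* ((x :* t) :* (x :* t))))) refl Γ ℓ (ξ S)
            x̂)
            (trans (*-cong (*-inv 0<Γ) (trans (*-cong xξ (trans (*-cong xξ (*-cong xξ xξ)) (*-cong refl refl)))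
              (solve 1 (λ x → :1 :* (:1 :* (:1 :* :1)) := :1) refl x̂))) (*-identityʳ 1#))))
          where xξ = *-inv (0<X̂ S)
        s = quarter (width S)
        w = ℓ * (ξ S ^ 2) ^ 4
        0<w : 0# < w
        0<w = *-pos 0<ℓ (^-pos 4 (^-pos 2 (0<ξ S)))
        threshold : ∀ b → X S ℕ.≤ b → (fromℕ b ⁻¹) ^ 41 ≤ c′ * width S
        threshold b X≤b = ≤-trans (^-mono-≤ 41 (<⇒≤ (⁻¹-pos (fromℕ-pos′ (ℕₚ.≤-trans (1≤X S) X≤b))))
          (⁻¹-anti-≤ (0<X̂ S) (fromℕ-mono-≤ X≤b)))
          (≤-trans (^-antiʳ-≤ (<⇒≤ (0<ξ S)) (ξ≤1 S) (ℕₚ.m≤m+n 5 36))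
            (≤-trans (*-monoʳ-≤ (^-nonneg 4 (<⇒≤ (0<ξ S))) ξ≤c′ℓ) (≈⇒≤ (*-assoc c′ ℓ (ξ S ^ 4)))))
          where
          ξ≤c′ℓ : ξ S ≤ c′ * ℓ
          ξ≤c′ℓ = *-cancelˡ-≤ (0<X̂ S) (≤-trans (≈⇒≤ (*-inv (0<X̂ S))) (≤-trans B₀-large
            (*-monoʳ-≤ (*-nonneg (<⇒≤ 0<c′) (<⇒≤ 0<ℓ)) (fromℕ-mono-≤ (B₀≤X S)))))
        2w<s : w + w < s
        2w<s = *-cancelˡ-< 0≤4 (<-≤-trans (≤-<-trans (≈⇒≤ (solve 2 (λ l t → (:1 :+ :1 :+ :1 :+ :1) :*
          (l :* (t :* (t :* :1) :* (t :* (t :* :1) :* (t :* (t :* :1) :* (t :* (t :* :1) :* :1)))) :+ l :*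
          (t :* (t :* :1) :* (t :* (t :* :1) :* (t :* (t :* :1) :* (t :* (t :* :1) :* :1))))) := l :*
          (t :* (t :* (t :* (t :* :1)))) :* ((:1 :+ :1) :* t :* ((:1 :+ :1) :* t :* ((:1 :+ :1) :* t :* t)))) refl
          ℓ (ξ S)))
            (<-≤-trans (*-monoˡ-< (0<width S) tiny) (≈⇒≤ (*-identityʳ _))))
            (≈⇒≤ (sym (trans (solve 1 (λ s → (:1 :+ :1 :+ :1 :+ :1) :* s := s :+ s :+ (s :+ s)) refl s)
              (four-quarters (width S))))))
          where
          0≤4 = +-nonneg (+-nonneg (<⇒≤ 0<2) 0≤1) 0≤1
          2ξ≤1 : (1# + 1#) * ξ S ≤ 1#
          2ξ≤1 = ≤-trans (*-monoˡ-≤ (<⇒≤ 0<2) (ξ≤½ S)) (≈⇒≤ (*-inv 0<2))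
          0≤2ξ = *-nonneg (<⇒≤ 0<2) (<⇒≤ (0<ξ S))
          tiny : (1# + 1#) * ξ S * ((1# + 1#) * ξ S * ((1# + 1#) * ξ S * ξ S)) < 1#
          tiny = ≤-<-trans (*-mono-≤ 0≤2ξ (*-nonneg 0≤2ξ (*-nonneg 0≤2ξ (<⇒≤ (0<ξ S)))) 2ξ≤1 (*-mono-≤ 0≤2ξ
            (*-nonneg 0≤2ξ (<⇒≤ (0<ξ S))) 2ξ≤1 (*-mono-≤ 0≤2ξ (<⇒≤ (0<ξ S)) 2ξ≤1 (ξ≤½ S))))
            (≤-<-trans (≈⇒≤ (solve 1 (λ h → :1 :* (:1 :* (:1 :* h)) := h) refl ½)) ½<1)
        from : (∃ λ β → α S ≤ β × β + s ≤ α S + width S × (∀ x → Within β s x →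
          ∀ a b → IsInteger a → 1 ℕ.≤ b → b ℕ.< X S ℕ.^ 2 → (fromℕ b ⁻¹) ^ 41 ≤ c′ * width S → Avoids F x a b)) →
            Refinement S z
        from (β , α≤β , β+s≤ , removed) = choose (em {z ≤ β + w})
          where
          place : ∀ γ → β ≤ γ → γ + w ≤ β + s → ¬ Within γ w z → Refinement S z
          place γ β≤γ γ+w≤ z∉ = refine-at S γ (≤-trans α≤β β≤γ) (≤-trans γ+w≤ β+s≤) avoid ,
              (≤-trans α≤β β≤γ , ≤-trans (≈⇒≤ (+-congˡ (*-congˡ (^-congˡ 4 (square-inverse S))))) (≤-trans γ+w≤
                β+s≤)) , ≡.refl ,
              λ (u , v) → z∉ (u , ≤-trans v (≈⇒≤ (+-congˡ (*-congˡ (^-congˡ 4 (square-inverse S))))))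
            where
            avoid : ∀ x → Within γ w x → ∀ a b → IsInteger a → B₀ ℕ.≤ b → b ℕ.< X S ℕ.^ 2 → Avoids F x a b
            avoid x (u , v) a b a-int B₀≤b b< = [ (λ b<X → free S x (≤-trans α≤β (≤-trans β≤γ u) , ≤-trans v
              (≤-trans γ+w≤ β+s≤)) a b a-int B₀≤b b<X) ,
              (λ X≤b → removed x (≤-trans β≤γ u , ≤-trans v γ+w≤) a b a-int (ℕₚ.≤-trans (ℕₚ.≤-trans (ℕ.s≤s ℕ.z≤n)
                9≤B₀) B₀≤b) b< (threshold b X≤b)) ]′ (ℕₚ.<-≤-connex b (X S))
          choose : Dec (z ≤ β + w) → Refinement S z
          choose (no z≰) = place β ≤-refl (+-monoʳ-≤ β (≤-trans (≤-by (<⇒≤ 0<w) (solve 1 (λ w → w := w :+ w :- w)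
            refl w)) (<⇒≤ 2w<s))) λ (_ , v) → z≰ v
          choose (yes z≤) = place (β + (s - w)) (≤-trans (≤-by (<⇒≤ 0<w) (solve 2 (λ b w → w := b :+ w :- b) refl β
            w)) (≤-by (sub-nonneg (<⇒≤ 2w<s)) (solve 3 (λ b s w → s :- (w :+ w) := b :+ (s :- w) :- (b :+ w)) refl
            β s w))) (≈⇒≤ (solve 3 (λ b s w → b :+ (s :- w) :+ w := b :+ s) refl β s w))
            λ (u , _) → ≤⇒≯ (≤-trans u z≤) (<-by (sub-pos 2w<s) (solve 3 (λ b s w → s :- (w :+ w) := b :+ (s :- w)
              :- (b :+ w)) refl β s w))

      width-≤ : ∀ S → width S ≤ ξ S
      width-≤ S = ≤-trans (*-mono-≤ (<⇒≤ 0<ℓ) (^-nonneg 4 (<⇒≤ (0<ξ S))) ℓ≤1 (^-antiʳ-≤ (<⇒≤ (0<ξ S)) (ξ≤1 S)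
        (ℕₚ.m≤m+n 1 3))) (≈⇒≤ (solve 1 (λ x → :1 :* (x :* :1) := x) refl (ξ S)))

      narrow : ∀ r → 0# < r → ∃ λ n → ∀ S → n ℕ.≤ X S → width S < r
      narrow r 0<r = from (archimedean (r ⁻¹))
        where
        from : (∃ λ n → r ⁻¹ < fromℕ n) → ∃ λ n → ∀ S → n ℕ.≤ X S → width S < r
        from (n , p) = n , λ S n≤X → ≤-<-trans (width-≤ S) (*-cancelˡ-< (<⇒≤ (⁻¹-pos 0<r)) (<-≤-trans
          (*-monoʳ-< (0<ξ S) (<-≤-trans p (fromℕ-mono-≤ n≤X))) (≈⇒≤ (trans (*-inv (0<X̂ S))
            (sym (⁻¹-inverseˡ r (>⇒≉ 0<r)))))))

      limit-of : (S : ℕ → State) → (∀ n → S (suc n) ⊑ S n) → ∃ λ x → ∀ n → Contains (S n) x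
      limit-of S step = nested-intervals (λ n → α (S n)) (λ n → α (S n) + width (S n)) λ m n →
          let k = m ℕ.⊔ n in ≤-trans (proj₁ (descend (ℕₚ.m≤m⊔n m n))) (≤-trans (≤-by (<⇒≤ (0<width (S k))) (solve 2 (λ a w → w := a :+ w :- a) refl (α (S k)) (width (S k)))) (proj₂ (descend (ℕₚ.m≤n⊔m m n))))
        where
        descend : ∀ {m n} → m ℕ.≤ n → S n ⊑ S m
        descend {n = zero} ℕ.z≤n = ⊑-refl {S 0}
        descend {m} {suc n} m≤ = [ (λ q → ⊑-trans {S (suc n)} {S n} {S m} (step n) (descend (ℕₚ.≤-pred q))) ,
          (λ { ≡.refl → ⊑-refl {S (suc n)} }) ]′ (ℕₚ.m≤n⇒m<n∨m≡n m≤)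

      module Ladder (refine : ∀ S z → Refinement S z) where

        ladder : State → Carrier → ℕ → State
        ladder S z zero = S
        ladder S z (suc n) = proj₁ (refine (ladder S z n) z)

        ladder-⊑ : ∀ S z {m n} → m ℕ.≤ n → ladder S z n ⊑ ladder S z m
        ladder-⊑ S z {n = zero} ℕ.z≤n = ⊑-refl {S}
        ladder-⊑ S z {m} {suc n} m≤1+n = [ (λ m<1+n → ⊑-trans {ladder S z (suc n)} {ladder S z n} {ladder S z m}
          (proj₁ (proj₂ (refine (ladder S z n) z))) (ladder-⊑ S z (ℕₚ.≤-pred m<1+n))) ,
          (λ { ≡.refl → ⊑-refl {ladder S z (suc n)} }) ]′ (ℕₚ.m≤n⇒m<n∨m≡n m≤1+n)

        ladder-X : ∀ S z n → n ℕ.≤ X (ladder S z n)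
        ladder-X S z zero = ℕ.z≤n
        ladder-X S z (suc n) = ℕₚ.≤-trans (ℕ.s≤s (ladder-X S z n)) (ℕₚ.≤-trans (grow (X T) (9≤X T)) (ℕₚ.≤-reflexive
          (≡.sym (proj₁ (proj₂ (proj₂ (refine T z)))))))
          where
          T = ladder S z n
          grow : ∀ x → 9 ℕ.≤ x → suc x ℕ.≤ x ℕ.^ 2
          grow x 9≤x = ℕₚ.≤-trans (ℕₚ.≤-trans (ℕₚ.+-monoˡ-≤ x (ℕₚ.≤-trans (ℕ.s≤s ℕ.z≤n) 9≤x)) (ℕₚ.≤-reflexive
            (≡.cong (x ℕ.+_) (≡.sym (ℕₚ.+-identityʳ x)))))
            (ℕₚ.≤-trans (ℕₚ.*-monoˡ-≤ x (ℕₚ.≤-trans (ℕ.s≤s (ℕ.s≤s ℕ.z≤n)) 9≤x)) (ℕₚ.≤-reflexive (≡.cong (x ℕ.*_)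
              (≡.sym (ℕₚ.*-identityʳ x)))))

        -- The limit already differs from `z` because it lies in the first refined state. Thresholds
        -- on width and `X` depend on the limit, hence the late states `T` around it are supplied
        -- for any thresholds given afterwards.
        ladder-limit : ∀ S z → ∃ λ x → Contains S x × x ≉ z × (∀ r → 0# < r → ∀ Y → ∃ λ T → T ⊑ S × Contains T x ×
          width T < r × Y ℕ.≤ X T)
        ladder-limit S z = from (limit-of (ladder S z) λ n → proj₁ (proj₂ (refine (ladder S z n) z)))
          where
          from : (∃ λ x → ∀ n → Contains (ladder S z n) x) → ∃ λ x → Contains S x × x ≉ z × (∀ r → 0# < r → ∀ Y → ∃
            λ T → T ⊑ S × Contains T x × width T < r × Y ℕ.≤ X T)
          from (x , x∈) = x , x∈ 0 , (λ e → proj₂ (proj₂ (proj₂ (refine S z))) (≤-trans (proj₁ (x∈ 1)) (≈⇒≤ e) ,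
            ≤-trans (≈⇒≤ (sym e)) (proj₂ (x∈ 1)))) ,
            λ r 0<r Y → deep Y (narrow r 0<r)
            where
            deep : ∀ {r} Y → (∃ λ n → ∀ S → n ℕ.≤ X S → width S < r) → ∃ λ T → T ⊑ S × Contains T x × width T < r ×
              Y ℕ.≤ X T
            deep Y (n , p) = T , ladder-⊑ S z {n = n ℕ.+ Y} ℕ.z≤n , x∈ (n ℕ.+ Y) , p T (ℕₚ.≤-trans (ℕₚ.m≤m+n n Y)
              (ladder-X S z (n ℕ.+ Y))) , ℕₚ.≤-trans (ℕₚ.m≤n+m Y n) (ladder-X S z (n ℕ.+ Y))
              where T = ladder S z (n ℕ.+ Y)

-- Classes of denominators.

module Classes where

  data Interleaved : List ℕ → List ℕ → List ℕ → Set where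
    []    : Interleaved [] [] []
    left  : ∀ {x xs ys zs} → Interleaved xs ys zs → Interleaved (x ∷ xs) ys (x ∷ zs)
    right : ∀ {x xs ys zs} → Interleaved xs ys zs → Interleaved xs (x ∷ ys) (x ∷ zs)

  all-split : ∀ {P : ℕ → Set} {xs ys zs} → Interleaved xs ys zs → All P zs → All P xs × All P ys
  all-split [] [] = [] , []
  all-split (left i) (p ∷ ps) = let a , b = all-split i ps in p ∷ a , b
  all-split (right i) (p ∷ ps) = let a , b = all-split i ps in a , p ∷ b

  distinct-split : ∀ {xs ys zs} → Interleaved xs ys zs → AllPairs (λ u v → ¬ u ≡ v) zs →
    AllPairs (λ u v → ¬ u ≡ v) xs × AllPairs (λ u v → ¬ u ≡ v) ys
  distinct-split [] [] = [] , []
  distinct-split (left i) (p ∷ ps) = let a , b = distinct-split i ps in proj₁ (all-split i p) ∷ a , b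
  distinct-split (right i) (p ∷ ps) = let a , b = distinct-split i ps in a , proj₂ (all-split i p) ∷ b

  length-split : ∀ {xs ys zs} → Interleaved xs ys zs → length zs ≡ length xs ℕ.+ length ys
  length-split [] = ≡.refl
  length-split (left i) = ≡.cong suc (length-split i)
  length-split {xs} {ys = _ ∷ ys} (right i) = ≡.trans (≡.cong suc (length-split i)) (≡.sym (ℕₚ.+-suc (length xs)
    (length ys)))

  separate : ∀ {P : ℕ → ℕ → Set} {L} us → All (λ u → ∃ λ l → l ℕ.< suc L × P l u) us →
    ∃ λ vs → ∃ λ ws → Interleaved vs ws us × All (P L) vs × All (λ u → ∃ λ l → l ℕ.< L × P l u) ws
  separate [] [] = [] , [] , [] , [] , []
  separate {P} {L} (u ∷ us) ((l , l<1+L , p) ∷ ps) = let vs , ws , i , a , b = separate us ps in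
    [ (λ l<L → vs , u ∷ ws , right i , a , (l , l<L , p) ∷ b) , (λ { ≡.refl → u ∷ vs , ws , left i , p ∷ a , b })
      ]′ (ℕₚ.m<1+n⇒m<n∨m≡n l<1+L)

  total : (ℕ → ℕ) → ℕ → ℕ
  total D zero = 0
  total D (suc L) = D L ℕ.+ total D L

  -- Pigeonhole with a separate quota `D l` for each class: if the last class misses its quota, the
  -- remaining elements still exceed the total of the other quotas.
  pick-class : ∀ {P : ℕ → ℕ → Set} (D : ℕ → ℕ) {K} L us → All (λ u → ∃ λ l → l ℕ.< L × P l u) us →
    AllPairs (λ u v → ¬ u ≡ v) us → All (ℕ._≤ K) us → total D L ℕ.< length us →
    ∃ λ l → l ℕ.< L × (∃ λ vs → length vs ≡ D l × AllPairs (λ u v → ¬ u ≡ v) vs × All (ℕ._≤ K) vs × All (P l) vs)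
  pick-class D zero [] _ _ _ ()
  pick-class D zero (u ∷ us) ((l , () , _) ∷ _) _ _ _
  pick-class {P} D {K} (suc L) us classes distinct us≤K enough = decide (separate us classes)
    where
    Result : Set
    Result = ∃ λ l → l ℕ.< suc L × (∃ λ vs → length vs ≡ D l × AllPairs (λ u v → ¬ u ≡ v) vs × All (ℕ._≤ K) vs ×
      All (P l) vs)
    decide : (∃ λ vs → ∃ λ ws → Interleaved vs ws us × All (P L) vs × All (λ u → ∃ λ l → l ℕ.< L × P l u) ws) →
      Result
    decide (vs , ws , i , a , b) = [ few , many ]′ (ℕₚ.<-≤-connex (length vs) (D L))
      where
      many : D L ℕ.≤ length vs → Result
      many D≤ = L , ℕₚ.≤-refl , take (D L) vs , ≡.trans (Listₚ.length-take (D L) vs) (ℕₚ.m≤n⇒m⊓n≡m D≤) ,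
        AllPairsₚ.take⁺ (D L) (proj₁ (distinct-split i distinct)) , Allₚ.take⁺ (D L) (proj₁ (all-split i us≤K)) ,
          Allₚ.take⁺ (D L) a
      few : length vs ℕ.< D L → Result
      few <D = lift (pick-class D L ws b (proj₂ (distinct-split i distinct)) (proj₂ (all-split i us≤K)) rest)
        where
        rest : total D L ℕ.< length ws
        rest = ℕₚ.+-cancelˡ-< (length vs) _ _ (ℕₚ.<-≤-trans (ℕₚ.+-monoˡ-< (total D L) <D)
          (ℕₚ.≤-trans (ℕₚ.<⇒≤ enough) (ℕₚ.≤-reflexive (length-split i))))
        lift : (∃ λ l → l ℕ.< L × (∃ λ vs → length vs ≡ D l × AllPairs (λ u v → ¬ u ≡ v) vs × All (ℕ._≤ K) vs × All
          (P l) vs)) → Result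
        lift (l , l<L , r) = l , ℕₚ.m≤n⇒m≤1+n l<L , r

  -- Dyadic in the exponent: the ranges `[X, X²)` with `X = Y ^ (2 ^ l)` tile `[Y, Y ^ (2 ^ L))`,
  -- and class `l` corresponds to `m = 2 ^ l`.
  dyadic-class : ∀ Y L b → Y ℕ.≤ b → b ℕ.< Y ℕ.^ (2 ℕ.^ L) → ∃ λ l → l ℕ.< L × Y ℕ.^ (2 ℕ.^ l) ℕ.≤ b × b ℕ.<
    (Y ℕ.^ (2 ℕ.^ l)) ℕ.^ 2
  dyadic-class Y zero b Y≤b b< = ⊥-elim (ℕₚ.<-irrefl ≡.refl (ℕₚ.<-≤-trans b< (ℕₚ.≤-trans (ℕₚ.≤-reflexive
    (ℕₚ.*-identityʳ Y)) Y≤b)))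
  dyadic-class Y (suc L) b Y≤b b< = [ (λ lower → let l , l<L , p = dyadic-class Y L b Y≤b lower in l , ℕₚ.m≤n⇒m≤1+n l<L , p) ,
    (λ upper → L , ℕₚ.≤-refl , upper , ℕₚ.<-≤-trans b< (ℕₚ.≤-reflexive
      (≡.trans (≡.cong (Y ℕ.^_) (ℕₚ.*-comm 2 (2 ℕ.^ L))) (≡.sym (ℕₚ.^-*-assoc Y (2 ℕ.^ L) 2))))) ]′
    (ℕₚ.<-≤-connex b (Y ℕ.^ (2 ℕ.^ L)))

  -- The reason for taking `k + 2` classes: an interval of width `O(Z⁻⁴)` with
  -- `Z = X ^ (2 ^ (k + 2))` is shorter than `q ^ (- k)` for `q = X ^ 10`, with one power of `X` to
  -- spare for a factor 8.
  linear≤exponential : ∀ k → suc (10 ℕ.* k) ℕ.≤ 2 ℕ.^ (k ℕ.+ 2) ℕ.* 4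
  linear≤exponential zero = ℕ.s≤s ℕ.z≤n
  linear≤exponential (suc k) = ℕₚ.≤-trans (ℕₚ.≤-reflexive (≡.cong suc (ℕₚ.*-suc 10 k)))
    (ℕₚ.≤-trans (ℕₚ.≤-reflexive (≡.sym (ℕₚ.+-suc 10 (10 ℕ.* k))))
    (ℕₚ.≤-trans (ℕₚ.+-mono-≤ (sixteen k) (linear≤exponential k)) (ℕₚ.≤-reflexive (double (2 ℕ.^ (k ℕ.+ 2))))))
    where
    sixteen : ∀ k → 10 ℕ.≤ 2 ℕ.^ (k ℕ.+ 2) ℕ.* 4
    sixteen k = ℕₚ.≤-trans (ℕₚ.m≤m+n 10 6) (ℕₚ.*-monoˡ-≤ 4 (ℕₚ.^-monoʳ-≤ 2 (ℕₚ.m≤n+m 2 k)))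
    double : ∀ e → e ℕ.* 4 ℕ.+ e ℕ.* 4 ≡ 2 ℕ.* e ℕ.* 4
    double e = ≡.trans (≡.sym (ℕₚ.*-distribʳ-+ 4 e e)) (≡.cong (λ z → (e ℕ.+ z) ℕ.* 4) (≡.sym (ℕₚ.+-identityʳ e)))

  ten<exponential : ∀ k → 11 ℕ.≤ 2 ℕ.^ (k ℕ.+ 2) ℕ.* 4
  ten<exponential k = ℕₚ.≤-trans (ℕₚ.m≤m+n 11 5) (ℕₚ.*-monoˡ-≤ 4 (ℕₚ.^-monoʳ-≤ 2 (ℕₚ.m≤n+m 2 k)))

-- One step of the construction of the Liouville number.

module Steps (em : ExcludedMiddle 0ℓ) (ℝ : CompleteOrderedField) where
  open CompleteOrderedField ℝ hiding (zero)
  open RealAnalysis ℝ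
  open IntegerSolver commutativeRing
  open Ordered ℝ
  open Archimedean em ℝ
  open Algebra.Properties.Semiring.Exp semiring using (^-congˡ; ^-assocʳ)
  open Interpolation em ℝ
  open Local em ℝ
  open Windows em ℝ
  open Removal em ℝ
  open Classes

  SparseAt : (Carrier → Carrier) → ℕ → ℕ → ℕ → Carrier → Set
  SparseAt F m K Y x = ∀ us → length us ≡ suc (2 ℕ.* m ℕ.+ m) → AllPairs (λ u v → ¬ u ≡ v) us → All (ℕ._≤ K) us →
    ¬ All (λ u → RationalApproximation (Y ℕ.^ m) ((Y ℕ.^ m) ℕ.^ 2) (F (x + (fromℕ Y ⁻¹) ^ 10 * fromℕ u))) us

  sparse : ∀ {F x₀} m → 1 ℕ.≤ m → NiceAt F m x₀ → ∀ K → ∃ λ Y₀ → ∃ λ ρ → 0# < ρ × (∀ Y → Y₀ ℕ.≤ Y → ∀ x → ∣ x - x₀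
    ∣ < ρ → SparseAt F m K Y x)
  sparse (suc m′) _ N K = from (sparse-windows m′ N K)
    where
    from : _ → _
    from (Y₀ , p) = Y₀ , NiceAt.ρ N , NiceAt.0<ρ N , p

  -- The number `3 m + 1` of nodes for `m = 2 ^ l`: a class with that many points of a window
  -- contradicts `SparseAt`.
  class-size : ℕ → ℕ
  class-size l = suc (2 ℕ.* 2 ℕ.^ l ℕ.+ 2 ℕ.^ l)

  module _ {F : Carrier → Carrier} {xc : Carrier} (bl : BiLipschitzAt F xc)
    (B₀ : ℕ) (9≤B₀ : 9 ℕ.≤ B₀) (B₀-large : 1# ≤ fromℕ B₀ * (c′ bl * ℓ bl))
    (B₀-margin : 1# + (1# + 1#) * (BiLipschitzAt.L bl * c′ bl ⁻¹) ≤ fromℕ B₀) where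

    open BiLipschitzAt bl using (ρ; L; 0<L; lipschitz)
    open States bl B₀ 9≤B₀ B₀-large
    open State

    Step : State → ℕ → Set
    Step S k = ∃ λ T → T ⊑ S × X S ℕ.< X T × (∃ λ p → ∃ λ q → 2 ℕ.≤ q × IsInteger p ×
      (∀ x → Contains T x → 0# < ∣ x - p * fromℕ q ⁻¹ ∣ × ∣ x - p * fromℕ q ⁻¹ ∣ < (fromℕ q ^ k) ⁻¹))

    -- Jumps from `X` to `Z` at a rational point `y` of denominator `X ^ 10` whose value stays away
    -- from all fractions with denominators in `[X, Z)`. The new interval lies in
    -- `[y + r, y + 2 r]`, so that `y` approximates all its points without being one of them.
    module Zoom (T : State) (k : ℕ) (y p : Carrier) (p-int : IsInteger p) (y≈ : y ≈ p * ξ T ^ 10) (α≤y : α T ≤ y)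
      (y+h≤ : y + ξ T ^ 10 ≤ α T + width T)
      (good : ∀ a b → IsInteger a → X T ℕ.≤ b → b ℕ.< X T ℕ.^ (2 ℕ.^ (k ℕ.+ 2)) → ¬ ∣ F y - a * fromℕ b ⁻¹ ∣ ≤ (fromℕ b ⁻¹) ^ 40) where

      e Z : ℕ
      e = 2 ℕ.^ (k ℕ.+ 2)
      Z = X T ℕ.^ e

      private
        ε h ζ w r : Carrier
        ε = ξ T
        h = ε ^ 10
        ζ = fromℕ Z ⁻¹
        w = ℓ bl * ζ ^ 4
        -- Four times the new width `w`, so that the quarter kept by `remove` has exactly the width
        -- of the next state.
        r = (1# + 1#) * ((1# + 1#) * w)
        0<ε = 0<ξ T
        0≤ε = <⇒≤ 0<ε
        4≤e : 4 ℕ.≤ e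
        4≤e = ℕₚ.^-monoʳ-≤ 2 (ℕₚ.m≤n+m 2 k)
        1≤Z : 1 ℕ.≤ Z
        1≤Z = ℕₚ.m^n>0 (X T) {{ℕ.>-nonZero (1≤X T)}} e
        0<Ẑ = fromℕ-pos′ 1≤Z
        0<ζ = ⁻¹-pos 0<Ẑ
        X<Z : X T ℕ.< Z
        X<Z = ℕₚ.<-≤-trans (ℕₚ.≤-trans (ℕₚ.≤-reflexive (≡.cong suc (≡.sym (ℕₚ.*-identityʳ (X T)))))
            (ℕₚ.^-monoʳ-< (X T) (ℕₚ.≤-trans (ℕ.s≤s (ℕ.s≤s ℕ.z≤n)) (9≤X T)) {1} {2} (ℕ.s≤s (ℕ.s≤s ℕ.z≤n))))
          (ℕₚ.^-monoʳ-≤ (X T) {{ℕ.>-nonZero (1≤X T)}} (ℕₚ.≤-trans (ℕ.s≤s (ℕ.s≤s ℕ.z≤n)) 4≤e))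
        ζ≈ : ζ ≈ ε ^ e
        ζ≈ = sym (⁻¹-unique 0<Ẑ (trans (*-congʳ (fromℕ-^ (X T) e)) (^-inv e (0<X̂ T))))
        ζ≤½ : ζ ≤ ½
        ζ≤½ = ≤-trans (⁻¹-anti-≤ (0<X̂ T) (fromℕ-mono-≤ (ℕₚ.<⇒≤ X<Z))) (ξ≤½ T)
        0<w : 0# < w
        0<w = *-pos (0<ℓ bl) (^-pos 4 0<ζ)
        0<r : 0# < r
        0<r = *-pos 0<2 (*-pos 0<2 0<w)
        quarter-r : quarter bl r ≈ w
        quarter-r = trans (solve 2 (λ h w → h :* (h :* ((:1 :+ :1) :* ((:1 :+ :1) :* w))) := (:1 :+ :1) :* h :*
          ((:1 :+ :1) :* h :* w)) refl ½ w)
          (trans (*-cong (*-inv 0<2) (trans (*-congʳ (*-inv 0<2)) (*-identityˡ w))) (*-identityˡ w))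
        8ε<1 : (1# + 1#) * ((1# + 1#) * ((1# + 1#) * ε)) < 1#
        8ε<1 = <-≤-trans (<-by 0<ε (solve 1
          (λ t → t := (:1 :+ (:1 :+ (:1 :+ (:1 :+ (:1 :+ (:1 :+ (:1 :+ (:1 :+ (:1 :+ :0))))))))) :* t :- (:1 :+ :1)
          :* ((:1 :+ :1) :* ((:1 :+ :1) :* t))) refl ε)) (9ξ≤1 T)
        2r< : ∀ j → suc j ℕ.≤ e ℕ.* 4 → r + r < ε ^ j
        2r< j j< = ≤-<-trans (≤-trans (≈⇒≤ (solve 2 (λ l z → (:1 :+ :1) :* ((:1 :+ :1) :* (l :* z)) :+ (:1 :+ :1)
          :* ((:1 :+ :1) :* (l :* z)) := (:1 :+ :1) :* ((:1 :+ :1) :* ((:1 :+ :1) :* :1)) :* (l :* z)) refl (ℓ bl)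
          (ζ ^ 4)))
            (*-monoˡ-≤ (*-nonneg (<⇒≤ 0<2) (*-nonneg (<⇒≤ 0<2) (*-nonneg (<⇒≤ 0<2) 0≤1)))
              (≤-trans (*-monoʳ-≤ (^-nonneg 4 (<⇒≤ 0<ζ)) (ℓ≤1 bl))
              (≤-trans (≈⇒≤ (trans (*-identityˡ _) (trans (^-congˡ 4 ζ≈) (^-assocʳ ε e 4)))) (^-antiʳ-≤ 0≤ε (ξ≤1 T)
              j<)))))
          (≤-<-trans (≈⇒≤ (solve 2 (λ t u → (:1 :+ :1) :* ((:1 :+ :1) :* ((:1 :+ :1) :* :1)) :* (t :* u) :=
            (:1 :+ :1) :* ((:1 :+ :1) :* ((:1 :+ :1) :* t)) :* u) refl ε (ε ^ j)))
            (<-≤-trans (*-monoʳ-< (^-pos j 0<ε) 8ε<1) (≈⇒≤ (*-identityˡ _))))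
        2r≤h : r + r ≤ h
        2r≤h = <⇒≤ (2r< 10 (ten<exponential k))
        fine : Γ bl * r * fromℕ Z ^ 2 ≤ 1#
        fine = ≤-trans (≈⇒≤ (trans (solve 4 (λ g l t z → g :* ((:1 :+ :1) :* ((:1 :+ :1) :*
          (l :* (t :* (t :* (t :* (t :* :1))))))) :* (z :* (z :* :1)) := g :* l :* (z :* t :* (z :* t)) :*
          ((:1 :+ :1) :* t :* ((:1 :+ :1) :* t))) refl (Γ bl) (ℓ bl) ζ (fromℕ Z))
            (trans (*-congʳ (trans (*-cong (*-inv (0<Γ bl)) (trans (*-cong (*-inv 0<Ẑ) (*-inv 0<Ẑ))
              (*-identityʳ 1#))) (*-identityʳ 1#))) (*-identityˡ _))))
          (≤-trans (*-mono-≤ 0≤2ζ 0≤2ζ 2ζ≤1 2ζ≤1) (≈⇒≤ (*-identityʳ 1#)))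
          where
          0≤2ζ = *-nonneg (<⇒≤ 0<2) (<⇒≤ 0<ζ)
          2ζ≤1 : (1# + 1#) * ζ ≤ 1#
          2ζ≤1 = ≤-trans (*-monoˡ-≤ (<⇒≤ 0<2) ζ≤½) (≈⇒≤ (*-inv 0<2))
        y∈ : Contains T y
        y∈ = α≤y , ≤-trans (≤-by (^-nonneg 10 0≤ε) (solve 2 (λ y h → h := y :+ h :- y) refl y h)) y+h≤
        ball : ∀ x → Within (y + r) r x → Contains T x
        ball x (u , v) = ≤-trans α≤y (≤-trans (≤-by (<⇒≤ 0<r) (solve 2 (λ y r → r := y :+ r :- y) refl y r)) u) ,
          ≤-trans v (≤-trans (≤-trans (≈⇒≤ (+-assoc y r r)) (+-monoʳ-≤ y 2r≤h)) y+h≤)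
        2Lc : Carrier
        2Lc = (1# + 1#) * (L * c′ bl ⁻¹)
        -- Here `b` is so small that `F` varies over the short interval by at most a constant times
        -- `b⁻⁴¹`. At `y` the distance exceeds `b⁻⁴⁰ = b * b⁻⁴¹`, and `b ≥ B₀` covers both that
        -- variation and the required `b⁻⁴¹`.
        from-good : ∀ x → Within (y + r) r x → ∀ a b → IsInteger a → X T ℕ.≤ b → b ℕ.< Z → c′ bl * r ≤ (fromℕ b ⁻¹)
          ^ 41 → Avoids F x a b
        from-good x x∈ a b a-int X≤b b<Z c′r≤ = ≤-by (+-nonneg (+-nonneg (sub-nonneg (<⇒≤ far))
          (sub-nonneg (≤-trans triangle (+-monoʳ-≤ _ move))))
            (*-nonneg 0≤β (sub-nonneg (≤-trans B₀-margin (fromℕ-mono-≤ (ℕₚ.≤-trans (B₀≤X T) X≤b))))))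
          (trans (+-cong (+-congʳ (+-congˡ (-‿cong β40))) refl) (solve 5 (λ b m t s g → (s :- b :* t) :+
            (g :+ m :* t :- s) :+ t :* (b :- (:1 :+ m)) := g :- t) refl b̂ 2Lc β (∣ F y - f ∣) (∣ F x - f ∣)))
          where
          b̂ = fromℕ b
          f = a * b̂ ⁻¹
          β = (b̂ ⁻¹) ^ 41
          0<b = fromℕ-pos′ (ℕₚ.≤-trans (1≤X T) X≤b)
          0≤β = ^-nonneg 41 (<⇒≤ (⁻¹-pos 0<b))
          β40 : (b̂ ⁻¹) ^ 40 ≈ b̂ * β
          β40 = sym (trans (sym (*-assoc b̂ (b̂ ⁻¹) ((b̂ ⁻¹) ^ 40))) (trans (*-congʳ (*-inv 0<b)) (*-identityˡ _)))
          far : (b̂ ⁻¹) ^ 40 < ∣ F y - f ∣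
          far = ≰⇒> (good a b a-int X≤b b<Z)
          triangle : ∣ F y - f ∣ ≤ ∣ F x - f ∣ + ∣ F x - F y ∣
          triangle = ≤-trans (≈⇒≤ (abs-cong (solve 3 (λ x y f → y :- f := (x :- f) :- (x :- y)) refl (F x) (F y)
            f))) (abs-triangle⁻ _ _)
          x-y≤ : ∣ x - y ∣ ≤ r + r
          x-y≤ = ≤-trans (≈⇒≤ (abs-of-nonneg (≤-trans (<⇒≤ 0<r) (≤-by (sub-nonneg (proj₁ x∈))
            (solve 3 (λ x y r → x :- (y :+ r) := x :- y :- r) refl x y r)))))
            (≤-by (sub-nonneg (proj₂ x∈)) (solve 3 (λ x y r → y :+ r :+ r :- x := r :+ r :- (x :- y)) refl x y r))
          r≤ : r ≤ c′ bl ⁻¹ * β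
          r≤ = ≤-trans (≈⇒≤ (sym (trans (sym (*-assoc _ _ _))
            (trans (*-congʳ (trans (*-comm _ _) (*-inv (0<c′ bl)))) (*-identityˡ r)))))
            (*-monoˡ-≤ (<⇒≤ (⁻¹-pos (0<c′ bl))) c′r≤)
          move : ∣ F x - F y ∣ ≤ 2Lc * β
          move = ≤-trans (lipschitz x y (inside T x (ball x x∈)) (inside T y y∈)) (≤-trans (*-monoˡ-≤ (<⇒≤ 0<L)
            (≤-trans x-y≤ (+-mono-≤ r≤ r≤)))
            (≈⇒≤ (solve 3 (λ l c b → l :* (c :* b :+ c :* b) := (:1 :+ :1) :* (l :* c) :* b) refl L (c′ bl ⁻¹) β)))

      step : Step T k
      step = from (remove bl (y + r) r Z 0<r (λ x x∈ → inside T x (ball x x∈)) fine)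
        where
        from : (∃ λ α′ → y + r ≤ α′ × α′ + quarter bl r ≤ y + r + r × (∀ x → Within α′ (quarter bl r) x →
          ∀ a b → IsInteger a → 1 ℕ.≤ b → b ℕ.< Z → (fromℕ b ⁻¹) ^ 41 ≤ c′ bl * r → Avoids F x a b)) → Step T k
        from (α′ , lo , hi , removed) = T′ , (≤-trans α≤y (≤-trans (≤-by (<⇒≤ 0<r) (solve 2 (λ y r → r := y :+ r :-
          y) refl y r)) lo) , proj₂ (ball _ (≤-trans lo (≤-by (<⇒≤ 0<w) (solve 2 (λ a w → w := a :+ w :- a) refl α′
          w)) , hi′))) , X<Z ,
            p , X T ℕ.^ 10 , 2≤q , p-int , close
          where
          hi′ : α′ + w ≤ y + r + r
          hi′ = ≤-trans (+-monoʳ-≤ α′ (≈⇒≤ (sym quarter-r))) hi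
          in-ball : ∀ {x} → Within α′ w x → Within (y + r) r x
          in-ball (u , v) = ≤-trans lo u , ≤-trans v hi′
          T′ : State
          T′ = record
            { X = Z ; α = α′ ; B₀≤X = ℕₚ.≤-trans (B₀≤X T) (ℕₚ.<⇒≤ X<Z)
            ; inside = λ x x∈ → inside T x (ball x (in-ball x∈))
            ; free = λ x x∈ a b a-int B₀≤b b<Z →
                -- Three ranges of `b`: below `X T` the old state applies, where `b⁻⁴¹ ≤ c′ * r` the
                -- fraction has been removed, and in between the value at `y` is good.
                [ (λ b<X → free T x (ball x (in-ball x∈)) a b a-int B₀≤b b<X) ,
                  (λ X≤b → [ removed x (proj₁ x∈ , ≤-trans (proj₂ x∈) (+-monoʳ-≤ α′ (≈⇒≤ (sym quarter-r)))) a b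
                    a-int (ℕₚ.≤-trans (1≤X T) X≤b) b<Z ,
                             from-good x (in-ball x∈) a b a-int X≤b b<Z ]′ (≤-total ((fromℕ b ⁻¹) ^ 41)
                               (c′ bl * r))) ]′ (ℕₚ.<-≤-connex b (X T)) }
          2≤q : 2 ℕ.≤ X T ℕ.^ 10
          2≤q = ℕₚ.≤-trans (ℕₚ.≤-trans (ℕ.s≤s (ℕ.s≤s ℕ.z≤n)) (9≤X T)) (ℕₚ.≤-trans (ℕₚ.≤-reflexive
            (≡.sym (ℕₚ.*-identityʳ (X T)))) (ℕₚ.^-monoʳ-≤ (X T) {{ℕ.>-nonZero (1≤X T)}} {1} {10} (ℕ.s≤s ℕ.z≤n)))
          q̂ = fromℕ (X T ℕ.^ 10)
          0<q = fromℕ-pos′ (ℕₚ.≤-trans (ℕ.s≤s ℕ.z≤n) 2≤q)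
          h≈ : h ≈ q̂ ⁻¹
          h≈ = ⁻¹-unique 0<q (trans (*-congʳ (fromℕ-^ (X T) 10)) (^-inv 10 (0<X̂ T)))
          hk : ε ^ (10 ℕ.* k) ≈ (q̂ ^ k) ⁻¹
          hk = trans (sym (^-assocʳ ε 10 k)) (⁻¹-unique (^-pos k 0<q) (trans (*-congˡ (^-congˡ k h≈))
            (^-inv k 0<q)))
          distance : ∀ x → x - y ≈ x - p * q̂ ⁻¹
          distance x = +-congˡ (-‿cong (trans y≈ (*-congˡ h≈)))
          close : ∀ x → Contains T′ x → 0# < ∣ x - p * q̂ ⁻¹ ∣ × ∣ x - p * q̂ ⁻¹ ∣ < (q̂ ^ k) ⁻¹
          close x x∈ = <-≤-trans (<-≤-trans 0<r r≤x-y) (≤-trans (x≤∣x∣ _) (≈⇒≤ (abs-cong (distance x)))) ,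
            ≤-<-trans (≈⇒≤ (trans (abs-cong (sym (distance x))) (abs-of-nonneg (≤-trans (<⇒≤ 0<r) r≤x-y))))
              (≤-<-trans (≤-by (sub-nonneg (proj₂ (in-ball x∈))) (solve 3 (λ x y r → y :+ r :+ r :- x := r :+ r :-
                (x :- y)) refl x y r))
                (<-≤-trans (2r< (10 ℕ.* k) (linear≤exponential k)) (≈⇒≤ hk)))
            where
            r≤x-y : r ≤ x - y
            r≤x-y = ≤-by (sub-nonneg (proj₁ (in-ball x∈))) (solve 3 (λ x y r → x :- (y :+ r) := x :- y :- r) refl x
              y r)

    module Search (refine : ∀ S z → Refinement S z)
      (nice : ∀ x* → ∣ x* - xc ∣ < ρ → ∀ m → ∃ λ σ → 0# < σ × (∀ x₀ → x₀ ≉ x* → ∣ x₀ - x* ∣ < σ → NiceAt F m x₀)) where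

      open Ladder refine

      distance-≤ : ∀ S {x y} → Contains S x → Contains S y → ∣ x - y ∣ ≤ width S
      distance-≤ S {x} {y} (p , q) (p′ , q′) = abs-least
        (≤-by (+-nonneg (sub-nonneg q) (sub-nonneg p′)) (solve 4 (λ x y a w → (a :+ w :- x) :+ (y :- a) := w :-
          (x :- y)) refl x y (α S) (width S)))
        (≤-by (+-nonneg (sub-nonneg q′) (sub-nonneg p)) (solve 4 (λ x y a w → (a :+ w :- y) :+ (x :- a) := w :- :-
          (x :- y)) refl x y (α S) (width S)))

      all-nice : ∀ n x* → ∣ x* - xc ∣ < ρ → ∃ λ σ → 0# < σ × (∀ x₀ → x₀ ≉ x* → ∣ x₀ - x* ∣ < σ → ∀ l → l ℕ.< n →
        NiceAt F (2 ℕ.^ l) x₀)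
      all-nice zero x* p = 1# , 0<1 , λ x₀ _ _ l ()
      all-nice (suc n) x* p = combine (nice x* p (2 ℕ.^ n)) (all-nice n x* p)
        where
        combine : (∃ λ σ → 0# < σ × (∀ x₀ → x₀ ≉ x* → ∣ x₀ - x* ∣ < σ → NiceAt F (2 ℕ.^ n) x₀)) →
          (∃ λ σ → 0# < σ × (∀ x₀ → x₀ ≉ x* → ∣ x₀ - x* ∣ < σ → ∀ l → l ℕ.< n → NiceAt F (2 ℕ.^ l) x₀)) →
          ∃ λ σ → 0# < σ × (∀ x₀ → x₀ ≉ x* → ∣ x₀ - x* ∣ < σ → ∀ l → l ℕ.< suc n → NiceAt F (2 ℕ.^ l) x₀)
        combine (σ , 0<σ , f) (τ , 0<τ , g) = let υ , 0<υ , υ≤σ , υ≤τ = common-lower-bound 0<σ 0<τ in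
          υ , 0<υ , λ x₀ ne d l l<1+n → [ g x₀ ne (<-≤-trans d υ≤τ) l , (λ { ≡.refl → f x₀ ne (<-≤-trans d υ≤σ) })
            ]′ (ℕₚ.m<1+n⇒m<n∨m≡n l<1+n)

      all-sparse : ∀ n K {x₀} → (∀ l → l ℕ.< n → NiceAt F (2 ℕ.^ l) x₀) →
        ∃ λ Y₀ → ∃ λ σ → 0# < σ × (∀ Y → Y₀ ℕ.≤ Y → ∀ x → ∣ x - x₀ ∣ < σ → ∀ l → l ℕ.< n → SparseAt F (2 ℕ.^ l) K Y
          x)
      all-sparse zero K N = 0 , 1# , 0<1 , λ Y _ x _ l ()
      all-sparse (suc n) K {x₀} N = combine (sparse (2 ℕ.^ n) (ℕₚ.m^n>0 2 n) (N n ℕₚ.≤-refl) K) (all-sparse n K λ l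
        l<n → N l (ℕₚ.m≤n⇒m≤1+n l<n))
        where
        combine : (∃ λ Y₀ → ∃ λ σ → 0# < σ × (∀ Y → Y₀ ℕ.≤ Y → ∀ x → ∣ x - x₀ ∣ < σ → SparseAt F (2 ℕ.^ n) K Y x)) →
          (∃ λ Y₀ → ∃ λ σ → 0# < σ × (∀ Y → Y₀ ℕ.≤ Y → ∀ x → ∣ x - x₀ ∣ < σ → ∀ l → l ℕ.< n → SparseAt F (2 ℕ.^ l)
            K Y x)) →
          ∃ λ Y₀ → ∃ λ σ → 0# < σ × (∀ Y → Y₀ ℕ.≤ Y → ∀ x → ∣ x - x₀ ∣ < σ → ∀ l → l ℕ.< suc n → SparseAt F
            (2 ℕ.^ l) K Y x)
        combine (Y₀ , σ , 0<σ , f) (Y₁ , τ , 0<τ , g) = let υ , 0<υ , υ≤σ , υ≤τ = common-lower-bound 0<σ 0<τ in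
          Y₀ ℕ.+ Y₁ , υ , 0<υ , λ Y Y≥ x d l l<1+n →
            [ g Y (ℕₚ.≤-trans (ℕₚ.m≤n+m Y₁ Y₀) Y≥) x (<-≤-trans d υ≤τ) l ,
              (λ { ≡.refl → f Y (ℕₚ.≤-trans (ℕₚ.m≤m+n Y₀ Y₁) Y≥) x (<-≤-trans d υ≤σ) }) ]′ (ℕₚ.m<1+n⇒m<n∨m≡n l<1+n)

      -- With `total class-size n + 1` points, all of them approximable, some class of denominators
      -- would fill its quota, against sparsity.
      good-point : ∀ n {Y x} → (∀ l → l ℕ.< n → SparseAt F (2 ℕ.^ l) (total class-size n) Y x) →
        ∃ λ u → u ℕ.≤ total class-size n × ¬ RationalApproximation Y (Y ℕ.^ (2 ℕ.^ n)) (F (x + (fromℕ Y ⁻¹) ^ 10 *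
          fromℕ u))
      good-point n {Y} {x} sp = decide (em {∃ λ u → u ℕ.≤ K × ¬ Approx u})
        where
        K = total class-size n
        Approx : ℕ → Set
        Approx u = RationalApproximation Y (Y ℕ.^ (2 ℕ.^ n)) (F (x + (fromℕ Y ⁻¹) ^ 10 * fromℕ u))
        ApproxIn : ℕ → ℕ → Set
        ApproxIn l u = RationalApproximation (Y ℕ.^ (2 ℕ.^ l)) ((Y ℕ.^ (2 ℕ.^ l)) ℕ.^ 2)
          (F (x + (fromℕ Y ⁻¹) ^ 10 * fromℕ u))
        classify : ∀ u → Approx u → ∃ λ l → l ℕ.< n × ApproxIn l u
        classify u ap = let open RationalApproximation ap
                            l , l<n , lo , hi = dyadic-class Y n denominator lower upper in
          l , l<n , record { numerator = numerator ; denominator = denominator ; integral = integral ; lower = lo ; upper = hi ; close = close }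
        decide : Dec (∃ λ u → u ℕ.≤ K × ¬ Approx u) → ∃ λ u → u ℕ.≤ K × ¬ Approx u
        decide (yes found) = found
        decide (no none) = ⊥-elim (contradiction (pick-class {P = ApproxIn} class-size n (naturals (suc K))
            (All.map (λ {u} u<1+K → classify u (approx u (ℕₚ.≤-pred u<1+K))) (naturals-< (suc K)))
            (naturals-distinct (suc K)) (All.map ℕₚ.≤-pred (naturals-< (suc K))) (ℕₚ.≤-reflexive
              (≡.sym (length-naturals (suc K))))))
          where
          approx : ∀ u → u ℕ.≤ K → Approx u
          approx u u≤K = from (em {Approx u})
            where
            from : Dec (Approx u) → Approx u
            from (yes ap) = ap
            from (no ¬ap) = ⊥-elim (none (u , u≤K , ¬ap))
          contradiction : (∃ λ l → l ℕ.< n × (∃ λ vs → length vs ≡ class-size l × AllPairs (λ u v → ¬ u ≡ v) vs ×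
            All (ℕ._≤ K) vs × All (ApproxIn l) vs)) → ⊥
          contradiction (l , l<n , vs , len , distinct , vs≤K , aps) = sp l l<n vs len distinct vs≤K aps

      grid-point : ∀ q h x → q * h ≈ 1# → 0# < h → ∃ λ p → IsInteger p × x ≤ p * h × p * h ≤ x + h
      grid-point q h x qh 0<h = from (floor (q * x))
        where
        from : (∃ λ p → IsInteger p × p ≤ q * x × q * x < p + 1#) → ∃ λ p → IsInteger p × x ≤ p * h × p * h ≤ x + h
        from (p , p-int , lo , hi) = p + 1# , isInteger-+ p-int (isInteger-cong fromℕ-1 (isInteger-fromℕ 1)) ,
          ≤-trans (≈⇒≤ (sym unscale)) (*-monoʳ-≤ (<⇒≤ 0<h) (<⇒≤ hi)) ,
          ≤-trans (≈⇒≤ (solve 2 (λ p h → (p :+ :1) :* h := p :* h :+ h) refl p h))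
            (+-monoˡ-≤ h (≤-trans (*-monoʳ-≤ (<⇒≤ 0<h) lo) (≈⇒≤ unscale)))
          where
          unscale : q * x * h ≈ x
          unscale = trans (solve 3 (λ q x h → q :* x :* h := q :* h :* x) refl q x h) (trans (*-congʳ qh)
            (*-identityˡ x))

      -- The order of choices matters. Niceness holds only off a centre `x*` and at a distance that
      -- depends on it, so a second limit `x₀ ≉ x*` is built close to `x*`; the thresholds of
      -- sparsity depend on `x₀` in turn, so the window is placed in a still later state around
      -- `x₀`.
      take-step : ∀ S k → Step S k
      -- The first limit only has to lie in `S`; the point `0#` to be missed is arbitrary.
      take-step S k = first (ladder-limit S 0#)
        where
        n K : ℕ
        n = k ℕ.+ 2
        K = total class-size n
        lift : ∀ {T} → T ⊑ S → X S ℕ.≤ X T → Step T k → Step S k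
        lift {T} T⊑S X≤ (T′ , T′⊑T , X< , rest) = T′ , ⊑-trans {T′} {T} {S} T′⊑T T⊑S , ℕₚ.≤-<-trans X≤ X< , rest
        Deep : State → Carrier → Set
        Deep S x = ∀ r → 0# < r → ∀ Y → ∃ λ T → T ⊑ S × Contains T x × width T < r × Y ℕ.≤ X T
        window : ∀ T → (fromℕ (K ℕ.+ 2) ≤ fromℕ (X T) * ℓ bl) → (∀ x → Contains T x → ∀ l → l ℕ.< n → SparseAt F
          (2 ℕ.^ l) K (X T) x) → Step T k
        window T wide sp = at-grid (grid-point (fromℕ (X T) ^ 10) h (α T) (^-inv 10 (0<X̂ T)) (^-pos 10 (0<ξ T)))
          where
          h = ξ T ^ 10
          0≤h = ^-nonneg 10 (<⇒≤ (0<ξ T))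
          -- Besides the `K` spacings of the window, one `h` is lost in rounding to the grid and one
          -- is room for the zoom at the last point.
          Kh≤ : fromℕ (K ℕ.+ 2) * h ≤ width T
          Kh≤ = ≤-trans (*-monoˡ-≤ (fromℕ-nonneg (K ℕ.+ 2)) (^-antiʳ-≤ (<⇒≤ (0<ξ T)) (ξ≤1 T) (ℕₚ.m≤m+n 5 5)))
            (≤-trans (*-monoʳ-≤ (^-nonneg 5 (<⇒≤ (0<ξ T))) wide)
            (≈⇒≤ (trans (solve 4 (λ x l t u → x :* l :* (t :* u) := x :* t :* (l :* u)) refl (fromℕ (X T)) (ℓ bl)
              (ξ T) (ξ T ^ 4)) (trans (*-congʳ (*-inv (0<X̂ T))) (*-identityˡ _)))))
          at-grid : (∃ λ p → IsInteger p × α T ≤ p * h × p * h ≤ α T + h) → Step T k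
          at-grid (p , p-int , lo , hi) = use (good-point n (sp x x∈))
            where
            x = p * h
            room : ∀ u → u ℕ.≤ K → x + h * fromℕ u + h ≤ α T + width T
            room u u≤K = ≤-trans (+-mono-≤ (+-mono-≤ hi (*-monoˡ-≤ 0≤h (fromℕ-mono-≤ u≤K))) ≤-refl)
              (≤-trans (≈⇒≤ (trans (solve 3 (λ a h k → a :+ h :+ h :* k :+ h := a :+ (k :+ (:1 :+ (:1 :+ :0))) :*
                h) refl (α T) h (fromℕ K)) (+-congˡ (*-congʳ (sym (fromℕ-+ K 2)))))) (+-monoʳ-≤ (α T) Kh≤))
            x∈ : Contains T x
            x∈ = lo , ≤-trans (≤-by (+-nonneg (*-nonneg 0≤h (fromℕ-nonneg 0)) 0≤h) (solve 2 (λ x h → h :* :0 :+ h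
              := x :+ h :* :0 :+ h :- x) refl x h)) (room 0 ℕ.z≤n)
            use : (∃ λ u → u ℕ.≤ K × ¬ RationalApproximation (X T) (X T ℕ.^ (2 ℕ.^ n)) (F (x + h * fromℕ u))) →
              Step T k
            use (u , u≤K , ¬ap) = Zoom.step T k (x + h * fromℕ u) (p + fromℕ u) (isInteger-+ p-int (isInteger-fromℕ
              u))
              (solve 3 (λ p h u → p :* h :+ h :* u := (p :+ u) :* h) refl p h (fromℕ u))
              (≤-trans lo (≤-by (*-nonneg 0≤h (fromℕ-nonneg u)) (solve 2 (λ x y → y := x :+ y :- x) refl x
                (h * fromℕ u)))) (room u u≤K)
              λ a b a-int lower upper close → ¬ap record { numerator = a ; denominator = b ; integral = a-int ; lower = lower ; upper = upper ; close = close }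
        first : (∃ λ x* → Contains S x* × x* ≉ 0# × Deep S x*) → Step S k
        first (x* , x*∈S , _ , deep) = approach (all-nice n x* (inside S x* x*∈S))
          where
          approach : (∃ λ σ → 0# < σ × (∀ x₀ → x₀ ≉ x* → ∣ x₀ - x* ∣ < σ → ∀ l → l ℕ.< n → NiceAt F (2 ℕ.^ l) x₀))
            → Step S k
          approach (σ , 0<σ , nice-near) = second (deep σ 0<σ (X S))
            where
            second : (∃ λ T → T ⊑ S × Contains T x* × width T < σ × X S ℕ.≤ X T) → Step S k
            second (T , T⊑S , x*∈T , T<σ , XS≤) = third (ladder-limit T x*)
              where
              third : (∃ λ x₀ → Contains T x₀ × x₀ ≉ x* × Deep T x₀) → Step S k
              third (x₀ , x₀∈T , x₀≉x* , deep₀) = fourth (all-sparse n K (nice-near x₀ x₀≉x*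
                (≤-<-trans (distance-≤ T x₀∈T x*∈T) T<σ)))
                where
                fourth : (∃ λ Y₀ → ∃ λ τ → 0# < τ × (∀ Y → Y₀ ℕ.≤ Y → ∀ x → ∣ x - x₀ ∣ < τ → ∀ l → l ℕ.< n →
                  SparseAt F (2 ℕ.^ l) K Y x)) → Step S k
                fourth (Y₀ , τ , 0<τ , sp) = fifth (archimedean (fromℕ (K ℕ.+ 2) * Γ bl))
                  where
                  fifth : (∃ λ R → fromℕ (K ℕ.+ 2) * Γ bl < fromℕ R) → Step S k
                  fifth (R , R>) = sixth (deep₀ τ 0<τ (X S ℕ.+ (Y₀ ℕ.+ R)))
                    where
                    sixth : (∃ λ V → V ⊑ T × Contains V x₀ × width V < τ × X S ℕ.+ (Y₀ ℕ.+ R) ℕ.≤ X V) → Step S k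
                    sixth (V , V⊑T , x₀∈V , V<τ , large) = lift {V} (⊑-trans {V} {T} {S} V⊑T T⊑S)
                      (ℕₚ.≤-trans (ℕₚ.m≤m+n (X S) _) large)
                      (window V wide λ x x∈ → sp (X V) (ℕₚ.≤-trans (ℕₚ.≤-trans (ℕₚ.m≤m+n Y₀ R) (ℕₚ.m≤n+m _ (X S)))
                        large) x (≤-<-trans (distance-≤ V x∈ x₀∈V) V<τ))
                      where
                      wide : fromℕ (K ℕ.+ 2) ≤ fromℕ (X V) * ℓ bl
                      wide = ≤-trans (≈⇒≤ (sym (trans (*-assoc _ _ _) (trans (*-congˡ (*-inv (0<Γ bl)))
                        (*-identityʳ _)))))
                        (*-monoʳ-≤ (<⇒≤ (0<ℓ bl)) (≤-trans (<⇒≤ R>) (fromℕ-mono-≤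
                          (ℕₚ.≤-trans (ℕₚ.≤-trans (ℕₚ.m≤n+m R Y₀) (ℕₚ.m≤n+m _ (X S))) large))))

-- Criteria for being, and for not being, Liouville.

module LiouvilleNumbers (em : ExcludedMiddle 0ℓ) (ℝ : CompleteOrderedField) where
  open CompleteOrderedField ℝ hiding (zero)
  open RealAnalysis ℝ
  open IntegerSolver commutativeRing
  open Ordered ℝ
  open Archimedean em ℝ
  open Algebra.Properties.Ring ring using (-‿involutive)

  separation : ∀ ξ (xs : List (ℤ × ℕ)) → ∃ λ δ → 0# < δ ×
    (∀ p q → (p , q) ∈ xs → 0# < ∣ ξ - fromℤ p * fromℕ q ⁻¹ ∣ → δ ≤ ∣ ξ - fromℤ p * fromℕ q ⁻¹ ∣)
  separation ξ [] = 1# , 0<1 , λ p q ()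
  separation ξ ((p , q) ∷ xs) = extend (separation ξ xs) (em {0# < ∣ ξ - fromℤ p * fromℕ q ⁻¹ ∣})
    where
    Separated : List (ℤ × ℕ) → Carrier → Set
    Separated xs δ = ∀ p q → (p , q) ∈ xs → 0# < ∣ ξ - fromℤ p * fromℕ q ⁻¹ ∣ → δ ≤ ∣ ξ - fromℤ p * fromℕ q ⁻¹ ∣
    extend : (∃ λ δ → 0# < δ × Separated xs δ) → Dec (0# < ∣ ξ - fromℤ p * fromℕ q ⁻¹ ∣) → ∃ λ δ → 0# < δ ×
      Separated ((p , q) ∷ xs) δ
    extend (δ , 0<δ , s) (no ¬pos) = δ , 0<δ , λ { _ _ (here ≡.refl) pos → ⊥-elim (¬pos pos) ; p q (there i) pos →
      s p q i pos }
    extend (δ , 0<δ , s) (yes 0<d) = combine (common-lower-bound 0<δ 0<d)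
      where
      combine : (∃ λ z → 0# < z × z ≤ δ × z ≤ ∣ ξ - fromℤ p * fromℕ q ⁻¹ ∣) → ∃ λ δ → 0# < δ × Separated
        ((p , q) ∷ xs) δ
      combine (z , 0<z , z≤δ , z≤d) = z , 0<z , λ { _ _ (here ≡.refl) pos → z≤d ; p q (there i) pos → ≤-trans z≤δ
        (s p q i pos) }

  -- One fraction per exponent suffices: since `q ≥ 2`, exponent `N + j` brings the distance below
  -- `½ ^ j`, closer than any fraction of a given finite list that differs from `ξ`.
  well-approximable⇒liouville : ∀ {ξ} → (∀ k → ∃ λ p → ∃ λ q → 2 ℕ.≤ q × 0# < ∣ ξ - fromℤ p * fromℕ q ⁻¹ ∣ × ∣ ξ -
    fromℤ p * fromℕ q ⁻¹ ∣ < (fromℕ q ^ k) ⁻¹) →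
    Liouville ξ
  well-approximable⇒liouville {ξ} approximations N _ (xs , covers) = refute (separation ξ xs)
    where
    refute : (∃ λ δ → 0# < δ × (∀ p q → (p , q) ∈ xs → 0# < ∣ ξ - fromℤ p * fromℕ q ⁻¹ ∣ → δ ≤ ∣ ξ - fromℤ p *
      fromℕ q ⁻¹ ∣)) → ⊥
    refute (δ , 0<δ , s) = at (geometric-small 1# 0<δ)
      where
      at : (∃ λ j → 1# * ½ ^ j < δ) → ⊥
      at (j , p) = with-approximation (approximations (N ℕ.+ j))
        where
        with-approximation : (∃ λ p → ∃ λ q → 2 ℕ.≤ q × 0# < ∣ ξ - fromℤ p * fromℕ q ⁻¹ ∣ × ∣ ξ - fromℤ p * fromℕ q
          ⁻¹ ∣ < (fromℕ q ^ (N ℕ.+ j)) ⁻¹) → ⊥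
        with-approximation (z , q , 2≤q , 0<d , d<) = ≤⇒≯ (s z q (covers (2≤q , 0<d , <-≤-trans d< weaken)) 0<d)
            (<-≤-trans d< (≤-trans shrink (<⇒≤ p)))
          where
          1≤q = 1≤fromℕ (ℕₚ.≤-trans (ℕ.s≤s ℕ.z≤n) 2≤q)
          0<q = <-≤-trans 0<1 1≤q
          weaken : (fromℕ q ^ (N ℕ.+ j)) ⁻¹ ≤ (fromℕ q ^ N) ⁻¹
          weaken = ⁻¹-anti-≤ (^-pos N 0<q) (^-monoʳ-≤ 1≤q (ℕₚ.m≤m+n N j))
          2≤q̂ : 1# + 1# ≤ fromℕ q
          2≤q̂ = ≤-trans (≈⇒≤ (solve 1 (λ x → x :+ x := x :+ (x :+ :0)) refl 1#)) (fromℕ-mono-≤ 2≤q)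
          shrink : (fromℕ q ^ (N ℕ.+ j)) ⁻¹ ≤ 1# * ½ ^ j
          shrink = ≤-trans (⁻¹-anti-≤ (^-pos j 0<2) (≤-trans (^-mono-≤ j (<⇒≤ 0<2) 2≤q̂) (^-monoʳ-≤ 1≤q
            (ℕₚ.m≤n+m j N))))
            (≈⇒≤ (trans (sym (⁻¹-unique (^-pos j 0<2) (^-inv j 0<2))) (sym (*-identityˡ _))))

  private
    integers-below : ℕ → List ℤ
    integers-below n = map (λ k → + k) (upTo n) ++ map (λ k → -[1+ k ]) (upTo n)

    below : ∀ n z → ∣ fromℤ z ∣ < fromℕ n → z ∈ integers-below n
    below n (+ k) p = ∈-++⁺ˡ (∈-map⁺ (λ k → + k) (∈-upTo⁺ (fromℕ-cancel-< {k} {n} (≤-<-trans (x≤∣x∣ _) p))))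
    below n -[1+ k ] p = ∈-++⁺ʳ _ (∈-map⁺ (λ k → -[1+ k ]) (∈-upTo⁺ (ℕₚ.≤-trans (ℕₚ.n≤1+n (suc k)) (fromℕ-cancel-<
      {suc k} {n}
      (≤-<-trans (≤-trans (≈⇒≤ (sym (-‿involutive (fromℕ (suc k))))) (-x≤∣x∣ _)) p)))))

  -- The exponent 41 already fails: its approximations have `q < B₀`, and then `p` is bounded as
  -- well because `p/q` is within 1 of `y`, which leaves finitely many pairs.
  badly-approximable⇒¬liouville : ∀ {y} B₀ → (∀ a b → IsInteger a → 1 ℕ.≤ b → B₀ ℕ.≤ b → (fromℕ b ⁻¹) ^ 41 ≤ ∣ y -
    a * fromℕ b ⁻¹ ∣) → ¬ Liouville y
  badly-approximable⇒¬liouville {y} B₀ bad liouville = finite (archimedean (fromℕ B₀ * (∣ y ∣ + 1#)))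
    where
    finite : (∃ λ n → fromℕ B₀ * (∣ y ∣ + 1#) < fromℕ n) → ⊥
    finite (n , n>) = liouville 41 (ℕ.s≤s ℕ.z≤n) (cartesianProduct (integers-below n) (upTo B₀) , covers)
      where
      covers : ∀ {pq} → Approximates y 41 pq → pq ∈ cartesianProduct (integers-below n) (upTo B₀)
      covers {z , q} (2≤q , 0<d , d<) = ∈-cartesianProduct⁺ (below n z z<) (∈-upTo⁺ q<B₀)
        where
        1≤q = ℕₚ.≤-trans (ℕ.s≤s ℕ.z≤n) 2≤q
        0<q = fromℕ-pos′ 1≤q
        q̂ = fromℕ q
        d = ∣ y - fromℤ z * q̂ ⁻¹ ∣
        inverse : (q̂ ^ 41) ⁻¹ ≈ (q̂ ⁻¹) ^ 41
        inverse = sym (⁻¹-unique (^-pos 41 0<q) (^-inv 41 0<q))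
        q<B₀ : q ℕ.< B₀
        q<B₀ = ℕₚ.≰⇒> λ B₀≤q → ≤⇒≯ (bad (fromℤ z) q (isInteger-fromℤ z) 1≤q B₀≤q) (<-≤-trans d< (≈⇒≤ inverse))
        d≤1 : d ≤ 1#
        d≤1 = ≤-trans (<⇒≤ d<) (≤-trans (≈⇒≤ inverse) (^-≤1 41 (<⇒≤ (⁻¹-pos 0<q))
          (*-cancelˡ-≤ 0<q (≤-trans (≈⇒≤ (*-inv 0<q)) (≤-trans (1≤fromℕ 1≤q) (≈⇒≤ (sym (*-identityʳ q̂))))))))
        z< : ∣ fromℤ z ∣ < fromℕ n
        z< = ≤-<-trans (≤-trans (≈⇒≤ (trans (abs-cong clear) (abs-* _ _))) (*-mono-≤ (abs-nonneg _) (abs-nonneg _)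
            (≤-trans (≈⇒≤ (abs-of-nonneg (fromℕ-nonneg q))) (fromℕ-mono-≤ (ℕₚ.<⇒≤ q<B₀)))
              (≤-trans (abs-triangle⁻ _ _) (+-monoʳ-≤ _ d≤1)))) n>
          where
          clear : fromℤ z ≈ q̂ * (y - (y - fromℤ z * q̂ ⁻¹))
          clear = sym (trans (solve 4 (λ q y z i → q :* (y :- (y :- z :* i)) := z :* (q :* i)) refl q̂ y (fromℤ z)
            (q̂ ⁻¹)) (trans (*-congˡ (*-inv 0<q)) (*-identityʳ _)))

-- The exceptional Liouville number and the conclusion.

module MainTheorem (em : ExcludedMiddle 0ℓ) (ℝ : CompleteOrderedField) where
  open CompleteOrderedField ℝ hiding (zero)
  open RealAnalysis ℝ
  open IntegerSolver commutativeRing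
  open Ordered ℝ
  open Archimedean em ℝ
  open Local em ℝ
  open AnalyticFunctions em ℝ
  open Continuation em ℝ
  open Removal em ℝ
  open Steps em ℝ
  open LiouvilleNumbers em ℝ

  module _ {F : Carrier → Carrier} {xc : Carrier} (bl : BiLipschitzAt F xc)
    (B₀ : ℕ) (9≤B₀ : 9 ℕ.≤ B₀) (B₀-large : 1# ≤ fromℕ B₀ * (c′ bl * ℓ bl))
    (B₀-margin : 1# + (1# + 1#) * (BiLipschitzAt.L bl * c′ bl ⁻¹) ≤ fromℕ B₀) where

    open States bl B₀ 9≤B₀ B₀-large
    open State

    module Chain (step : ∀ S k → Step bl B₀ 9≤B₀ B₀-large B₀-margin S k) (S₀ : State) where

      chain : ℕ → State
      chain zero = S₀
      chain (suc n) = proj₁ (step (chain n) n)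

      chain-X : ∀ n → n ℕ.≤ X (chain n)
      chain-X zero = ℕ.z≤n
      chain-X (suc n) = ℕₚ.≤-<-trans (chain-X n) (proj₁ (proj₂ (proj₂ (step (chain n) n))))

      special-liouville : ∃ λ ξ → Contains S₀ ξ × Liouville ξ ×
        (∀ a b → IsInteger a → 1 ℕ.≤ b → B₀ ℕ.≤ b → (fromℕ b ⁻¹) ^ 41 ≤ ∣ F ξ - a * fromℕ b ⁻¹ ∣)
      special-liouville = from (limit-of chain λ n → proj₁ (proj₂ (step (chain n) n)))
        where
        from : (∃ λ x → ∀ n → Contains (chain n) x) → ∃ λ ξ → Contains S₀ ξ × Liouville ξ ×
          (∀ a b → IsInteger a → 1 ℕ.≤ b → B₀ ℕ.≤ b → (fromℕ b ⁻¹) ^ 41 ≤ ∣ F ξ - a * fromℕ b ⁻¹ ∣)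
        from (x , x∈) = x , x∈ 0 , well-approximable⇒liouville (λ k → approximation k
          (proj₂ (proj₂ (proj₂ (step (chain k) k))))) ,
          -- State `b + 1` of the chain has `X` above `b`, so it controls this denominator.
          λ a b a-int _ B₀≤b → free (chain (suc b)) x (x∈ (suc b)) a b a-int B₀≤b (chain-X (suc b))
          where
          approximation : ∀ k → (∃ λ p → ∃ λ q → 2 ℕ.≤ q × IsInteger p × (∀ y → Contains (chain (suc k)) y →
              0# < ∣ y - p * fromℕ q ⁻¹ ∣ × ∣ y - p * fromℕ q ⁻¹ ∣ < (fromℕ q ^ k) ⁻¹)) →
            ∃ λ p → ∃ λ q → 2 ℕ.≤ q × 0# < ∣ x - fromℤ p * fromℕ q ⁻¹ ∣ × ∣ x - fromℤ p * fromℕ q ⁻¹ ∣ <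
              (fromℕ q ^ k) ⁻¹
          approximation k (p , q , 2≤q , p-int , near) = integral (integer-fromℤ p-int)
            where
            integral : (∃ λ z → p ≈ fromℤ z) → ∃ λ p → ∃ λ q → 2 ℕ.≤ q × 0# < ∣ x - fromℤ p * fromℕ q ⁻¹ ∣ × ∣ x -
              fromℤ p * fromℕ q ⁻¹ ∣ < (fromℕ q ^ k) ⁻¹
            integral (z , p≈z) = z , q , 2≤q , <-≤-trans (proj₁ (near x (x∈ (suc k)))) (≈⇒≤ e) , ≤-<-trans
              (≈⇒≤ (sym e)) (proj₂ (near x (x∈ (suc k))))
              where
              e : ∣ x - p * fromℕ q ⁻¹ ∣ ≈ ∣ x - fromℤ z * fromℕ q ⁻¹ ∣
              e = abs-cong (+-congˡ (-‿cong (*-congʳ p≈z)))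

    initial : 1# ≤ fromℕ B₀ * BiLipschitzAt.ρ bl → State
    initial B₀ρ = record
      { X = B₀ ; α = xc ; B₀≤X = ℕₚ.≤-refl
      ; inside = λ x (p , q) → ≤-<-trans (≤-trans (≈⇒≤ (abs-of-nonneg (sub-nonneg p))) (≤-by (sub-nonneg q)
        (solve 3 (λ x a w → a :+ w :- x := w :- (x :- a)) refl x xc w))) w<ρ
      -- With `X = B₀` the range `B₀ ≤ b < X` is empty, so the first state has no fraction to avoid.
      ; free = λ x _ a b _ B₀≤b b<B₀ → ⊥-elim (ℕₚ.<-irrefl ≡.refl (ℕₚ.<-≤-trans b<B₀ B₀≤b)) }
      where
      1≤B₀ = ℕₚ.≤-trans (ℕ.s≤s ℕ.z≤n) 9≤B₀
      0<B̂ = fromℕ-pos′ 1≤B₀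
      ε = fromℕ B₀ ⁻¹
      0<ε = ⁻¹-pos 0<B̂
      w = ℓ bl * ε ^ 4
      9ε≤1 : fromℕ 9 * ε ≤ 1#
      9ε≤1 = ≤-trans (*-monoʳ-≤ (<⇒≤ 0<ε) (fromℕ-mono-≤ 9≤B₀)) (≈⇒≤ (*-inv 0<B̂))
      ε<1 : ε < 1#
      ε<1 = <-≤-trans (<-by (*-pos (fromℕ-pos 7) 0<ε) (solve 2 (λ e x → x :* e := (:1 :+ x) :* e :- e) refl ε
        (fromℕ 8))) 9ε≤1
      ε≤ρ : ε ≤ BiLipschitzAt.ρ bl
      ε≤ρ = *-cancelˡ-≤ 0<B̂ (≤-trans (≈⇒≤ (*-inv 0<B̂)) B₀ρ)
      w<ρ : w < BiLipschitzAt.ρ bl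
      w<ρ = <-≤-trans (≤-<-trans (*-mono-≤ (<⇒≤ (0<ℓ bl)) (^-nonneg 4 (<⇒≤ 0<ε)) (ℓ≤1 bl) (^-antiʳ-≤ (<⇒≤ 0<ε)
        (<⇒≤ ε<1) (ℕₚ.m≤m+n 2 2)))
        (≤-<-trans (≈⇒≤ (solve 1 (λ e → :1 :* (e :* (e :* :1)) := e :* e) refl ε)) (<-≤-trans (*-monoˡ-< 0<ε ε<1)
          (≈⇒≤ (*-identityʳ ε))))) ε≤ρ

  shrink : ∀ {F xc r} → 0# < r → BiLipschitzAt F xc → Σ (BiLipschitzAt F xc) λ bl → BiLipschitzAt.ρ bl ≤ r
  shrink {F} {xc} {r} 0<r bl = build (common-lower-bound 0<ρ 0<r)
    where
    open BiLipschitzAt bl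
    build : (∃ λ σ → 0# < σ × σ ≤ ρ × σ ≤ r) → Σ (BiLipschitzAt F xc) λ bl → BiLipschitzAt.ρ bl ≤ r
    build (σ , 0<σ , σ≤ρ , σ≤r) = record { ρ = σ ; λ₁ = λ₁ ; L = L ; 0<ρ = 0<σ ; 0<λ₁ = 0<λ₁ ; 0<L = 0<L
      ; expanding = λ x y p q → expanding x y (<-≤-trans p σ≤ρ) (<-≤-trans q σ≤ρ)
      ; lipschitz = λ x y p q → lipschitz x y (<-≤-trans p σ≤ρ) (<-≤-trans q σ≤ρ) } , σ≤r

  -- Stated for every `y ≈ F ξ` because `F` agrees with `f` on `U` only up to `_≈_`.
  exceptional-value : ∀ {F xc} (bl : BiLipschitzAt F xc) →
    (∀ x* → ∣ x* - xc ∣ < BiLipschitzAt.ρ bl → ∀ m → ∃ λ σ → 0# < σ × (∀ x₀ → x₀ ≉ x* → ∣ x₀ - x* ∣ < σ → NiceAt F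
      m x₀)) →
    ∃ λ ξ → ∣ ξ - xc ∣ < BiLipschitzAt.ρ bl × Liouville ξ × (∀ y → y ≈ F ξ → ¬ Liouville y)
  exceptional-value {F} {xc} bl nice = choose (archimedean ((c′ bl * ℓ bl) ⁻¹)) (archimedean (1# + (1# + 1#) *
    (BiLipschitzAt.L bl * c′ bl ⁻¹))) (archimedean (BiLipschitzAt.ρ bl ⁻¹))
    where
    Result : Set
    Result = ∃ λ ξ → ∣ ξ - xc ∣ < BiLipschitzAt.ρ bl × Liouville ξ × (∀ y → y ≈ F ξ → ¬ Liouville y)
    invert : ∀ {x} n → 0# < x → x ⁻¹ < fromℕ n → 1# ≤ fromℕ n * x
    invert {x} n 0<x p = ≤-trans (≈⇒≤ (sym (trans (*-comm _ _) (*-inv 0<x)))) (*-monoʳ-≤ (<⇒≤ 0<x) (<⇒≤ p))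
    choose : (∃ λ n → (c′ bl * ℓ bl) ⁻¹ < fromℕ n) → (∃ λ n → 1# + (1# + 1#) * (BiLipschitzAt.L bl * c′ bl ⁻¹) <
      fromℕ n) →
      (∃ λ n → BiLipschitzAt.ρ bl ⁻¹ < fromℕ n) → Result
    -- The 9 yields `8 * ξ < 1` in a step; `n₁` serves the removal threshold, `n₂` the margin for
    -- the variation of `F`, and `n₃` puts the first interval inside the bi-Lipschitz ball.
    choose (n₁ , p₁) (n₂ , p₂) (n₃ , p₃) = combine (9 ℕ.+ (n₁ ℕ.+ (n₂ ℕ.+ n₃))) (ℕₚ.m≤m+n 9 _)
        (ℕₚ.≤-trans (ℕₚ.m≤m+n n₁ _) (ℕₚ.m≤n+m _ 9))
        (ℕₚ.≤-trans (ℕₚ.≤-trans (ℕₚ.m≤m+n n₂ n₃) (ℕₚ.m≤n+m _ n₁)) (ℕₚ.m≤n+m _ 9))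
        (ℕₚ.≤-trans (ℕₚ.≤-trans (ℕₚ.m≤n+m n₃ n₂) (ℕₚ.m≤n+m _ n₁)) (ℕₚ.m≤n+m _ 9))
      where
      construct : ∀ B₀ → 9 ℕ.≤ B₀ → 1# ≤ fromℕ B₀ * (c′ bl * ℓ bl) → 1# + (1# + 1#) * (BiLipschitzAt.L bl * c′ bl
        ⁻¹) ≤ fromℕ B₀ →
        1# ≤ fromℕ B₀ * BiLipschitzAt.ρ bl → Result
      construct B₀ 9≤B₀ large margin B₀ρ = finish (Chain.special-liouville bl B₀ 9≤B₀ large margin
          (Search.take-step bl B₀ 9≤B₀ large margin (States.refine bl B₀ 9≤B₀ large) nice) S₀)
        where
        S₀ = initial bl B₀ 9≤B₀ large margin B₀ρ
        open States bl B₀ 9≤B₀ large using (module State)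
        finish : (∃ λ ξ → State.Contains S₀ ξ × Liouville ξ ×
          (∀ a b → IsInteger a → 1 ℕ.≤ b → B₀ ℕ.≤ b → (fromℕ b ⁻¹) ^ 41 ≤ ∣ F ξ - a * fromℕ b ⁻¹ ∣)) → Result
        finish (ξ , ξ∈ , liouville , bad) = ξ , State.inside S₀ ξ ξ∈ , liouville , λ y y≈ →
          badly-approximable⇒¬liouville B₀
          λ a b a-int 1≤b B₀≤b → ≤-trans (bad a b a-int 1≤b B₀≤b) (≈⇒≤ (abs-cong (+-congʳ (sym y≈))))
      combine : ∀ B₀ → 9 ℕ.≤ B₀ → n₁ ℕ.≤ B₀ → n₂ ℕ.≤ B₀ → n₃ ℕ.≤ B₀ → Result
      combine B₀ 9≤B₀ q₁ q₂ q₃ = construct B₀ 9≤B₀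
        (invert B₀ (*-pos (0<c′ bl) (0<ℓ bl)) (<-≤-trans p₁ (fromℕ-mono-≤ q₁)))
        (≤-trans (<⇒≤ p₂) (fromℕ-mono-≤ q₂))
        (invert B₀ (BiLipschitzAt.0<ρ bl) (<-≤-trans p₃ (fromℕ-mono-≤ q₃)))

  module _ {U : OpenInterval} (f : U ⟶ℝ) (analytic : Analytic f)
    (preserves : ∀ x (x∈U : x ∈ᴵ U) → Liouville x → Liouville (Func.to f (x , x∈U))) where

    open Extension f

    rational-somewhere : ∀ {x*} → x* ∈ᴵ U → ¬ (∃ λ y → y ∈ᴵ U × RationalAt F y) → ⊥
    rational-somewhere {x*} x*∈U irrational = start (∈ᴵ-open {U} x*∈U)
      where
      not-near : ∀ {x} (x∈U : x ∈ᴵ U) {r} → (∀ y → ∣ y - x ∣ < r → y ∈ᴵ U) → ¬ RationalNear F-cong (jets analytic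
        x∈U) r
      not-near x∈U ball (y , d , rat) = irrational (y , ball y d , rat)
      start : (∃ λ r → 0# < r × (∀ y → ∣ y - x* ∣ < r → y ∈ᴵ U)) → ⊥
      start (r , 0<r , ball) = region (irrational⇒biLipschitz F-cong (jets analytic x*∈U) 0<r (not-near x*∈U ball))
        where
        region : (∃ λ xc → ∣ xc - x* ∣ < r × BiLipschitzAt F xc) → ⊥
        region (xc , d , bl) = local (∈ᴵ-open {U} (ball xc d))
          where
          local : (∃ λ s → 0# < s × (∀ y → ∣ y - xc ∣ < s → y ∈ᴵ U)) → ⊥
          -- The bi-Lipschitz ball is shrunk into `U`, so that `f` has jets at every point where
          -- niceness is asked for.
          local (s , 0<s , ball′) = shrunk (shrink 0<s bl)
            where
            shrunk : (Σ (BiLipschitzAt F xc) λ bl → BiLipschitzAt.ρ bl ≤ s) → ⊥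
            shrunk (bl , ρ≤s) = contradiction (exceptional-value bl nice)
              where
              in-U : ∀ x → ∣ x - xc ∣ < BiLipschitzAt.ρ bl → x ∈ᴵ U
              in-U x p = ball′ x (<-≤-trans p ρ≤s)
              nice : ∀ x → ∣ x - xc ∣ < BiLipschitzAt.ρ bl → ∀ m → ∃ λ σ → 0# < σ × (∀ x₀ → x₀ ≉ x → ∣ x₀ - x ∣ < σ
                → NiceAt F m x₀)
              nice x p m = at (∈ᴵ-open {U} (in-U x p))
                where
                at : (∃ λ t → 0# < t × (∀ y → ∣ y - x ∣ < t → y ∈ᴵ U)) → ∃ λ σ → 0# < σ × (∀ x₀ → x₀ ≉ x → ∣ x₀ - x
                  ∣ < σ → NiceAt F m x₀)
                at (t , 0<t , ball″) = irrational⇒nice F-cong (jets analytic (in-U x p)) m 0<t (not-near (in-U x p)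
                  ball″)
              contradiction : (∃ λ ξ → ∣ ξ - xc ∣ < BiLipschitzAt.ρ bl × Liouville ξ × (∀ y → y ≈ F ξ → ¬ Liouville
                y)) → ⊥
              contradiction (ξ , p , liouville , not) = not (Func.to f (ξ , in-U ξ p))
                (sym (F-extends ξ (in-U ξ p))) (preserves ξ (in-U ξ p) liouville)

    conclusion : Conclusion f analytic
    conclusion = inhabited (em {∃ λ x → x ∈ᴵ U})
      where
      inhabited : Dec (∃ λ x → x ∈ᴵ U) → Conclusion f analytic
      -- An empty interval imposes nothing on the fraction; `0/1` is taken.
      inhabited (no empty) = record { num = [] ; den = 1# ∷ [] ; den≉0 = λ z → 1≉0 (z 0) } ,
        (λ x x∈U → ⊥-elim (empty (x , x∈U))) , λ x x∈U → ⊥-elim (empty (x , x∈U))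
      inhabited (yes (x , x∈U)) = rational (em {∃ λ y → y ∈ᴵ U × RationalAt F y})
        where
        rational : Dec (∃ λ y → y ∈ᴵ U × RationalAt F y) → Conclusion f analytic
        rational (yes (y , y∈U , rat)) = rationalOn⇒conclusion f analytic (rationalAt⇒rationalOn f analytic y∈U rat)
        rational (no ¬rat) = ⊥-elim (rational-somewhere x∈U ¬rat)

corollary1p3 : ExcludedMiddle 0ℓ →
    (ℝ : CompleteOrderedField) →
    let open CompleteOrderedField ℝ
        open RealAnalysis ℝ in
    (U : OpenInterval) (f : U ⟶ℝ) → Analytic f →
    (∀ x (x∈U : x ∈ᴵ U) → Liouville x → Liouville (Func.to f (x , x∈U))) →
    ∃ λ R →
      (∀ x → x ∈ᴵ U → ¬ PoleAt R x) ×
      (∀ x (x∈U : x ∈ᴵ U) → R ⟨ x ⟩≈ Func.to f (x , x∈U))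
corollary1p3 em ℝ U f analytic preserves = MainTheorem.conclusion em ℝ f analytic preserves
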